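{- Let $n,k,t$ be positive integers with $k\ge t+3$ and $n\ge \binom{t+3}{2}(k-t+1)^4$. Let $\mathcal F\subseteq\binom{[n]}{k}$ be a $t$-intersecting family with $\tau_t(\mathcal F)\ge t+2$. Then $$|\mathcal F|\le \max\{f_1(n,k,t),f_2(n,k,t),f_3(n,k,t)\},$$ where $$f_1(n,k,t)=\binom{n-t}{k-t}-3\binom{n-k-1}{k-t}+\binom{n-k-2}{k-t}+\binom{n-2k+t-1}{k-t}+3,$$ $$f_2(n,k,t)=\binom{n-t-2}{k-t-2}+(t+2)\left(\binom{n-t-2}{k-t-1}-\binom{n-k-2}{k-t-1}\right)+\binom{t+2}{2},$$ $$f_3(n,k,t)=\binom{t+4}{2}\binom{n-t-4}{k-t-2}+(t+4)\binom{n-t-4}{k-t-3}+\binom{n-t-4}{k-t-4}.$$ Moreover, if equality holds, then $\mathcal F$ is a Type I, Type II or Type III family (as defined in the context).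
   Context: $[n]=\{1,\dots,n\}$ and $\binom{X}{k}$ is the set of $k$-subsets of $X$. A family $\mathcal F$ of sets is $t$-intersecting if $|F\cap F'|\ge t$ for all $F,F'\in\mathcal F$. A $t$-cover of $\mathcal F$ is a set $S\subseteq[n]$ with $|S\cap F|\ge t$ for every $F\in\mathcal F$; the $t$-covering number $\tau_t(\mathcal F)$ is the minimum size of a $t$-cover of $\mathcal F$. Type I family: choose $T,A\in\binom{[n]}{t}$ and $B,C\in\binom{[n]}{k-t}$ with $|T\cap A|=t-1$, $T\cap(B\cup C)=\emptyset$, and $A,B,C$ pairwise disjoint; choose $u\in C$; put $G_1=A\cup B$, $G_2=A\cup C$, $G_3=(T\cap A)\cup B\cup\{u\}$. The family is $\{F\in\binom{[n]}{k}: F\cap(A\cup T)=T,\ F\cap B\ne\emptyset,\ F\cap C\neq\emptyset\}\cup\{F\in\binom{[n]}{k}: A\cup T\subseteq F,\ F\cap(B\cup\{u\})\neq\emptyset\}\cup\{G_1,G_2,G_3\}$; its size is $f_1(n,k,t)$ (for $n>2k$, $k\ge t+3$). Type II family: choose $M\in\binom{[n]}{k+2}$ and $W\in\binom{M}{t+2}$; the family is $\{F\in\binom{[n]}{k}: W\subseteq F\}\cup\{F\in\binom{[n]}{k}: |F\cap W|=t+1,\ F\cap(M\setminus W)\neq\emptyset\}\cup\{F\in\binom{M}{k}: |F\cap W|=t\}$; its size is $f_2(n,k,t)$. Type III family: choose $Z\in\binom{[n]}{t+4}$; the family is $\{F\in\binom{[n]}{k}: |F\cap Z|\ge t+2\}$;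 its size is $f_3(n,k,t)$. -}

module Defs where

open import Data.Nat.Base as ℕ using (ℕ; zero; suc; _∸_)
open import Data.Nat.Properties using (_≤?_)
open import Data.Nat.Combinatorics using (_C_)
open import Data.Integer.Base using (ℤ; +_; _+_; _-_; _*_)
open import Data.Fin.Base using (Fin)
open import Data.Fin.Subset using (Subset; inside; outside; _∈_; _⊆_; _∩_; _∪_; _─_; ⁅_⁆; ∣_∣; Nonempty; Empty)
open import Data.Vec.Base using ([]; _∷_)
open import Data.List.Base using (List; []; _∷_; _++_; map; filter)
open import Data.List.Extrema.Nat using (min)
open import Data.List.Relation.Unary.All using (All; all?)
import Data.List.Membership.Propositional as List
open import Data.Product.Base using (_×_)
open import Data.Sum.Base using (_⊎_)
open import Level using (0ℓ)
open import Relation.Binary.PropositionalEquality.Core using (_≡_)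
open import Relation.Nullary.Decidable.Core using (Dec)
open import Relation.Unary using (Pred; _≐_)

-- The ground set [n] is Fin n.  A family is a list of subsets; it stands for
-- the set of its members, and its size is its length once it is Unique.
Family : ℕ → Set
Family n = List (Subset n)

Members : ∀ {n} → Family n → Pred (Subset n) 0ℓ
Members 𝓕 F = F List.∈ 𝓕

Uniform : ∀ {n} → ℕ → Family n → Set
Uniform k = All (λ F → ∣ F ∣ ≡ k)

Intersecting : ∀ {n} → ℕ → Family n → Set
Intersecting t 𝓕 = ∀ {F F′} → F List.∈ 𝓕 → F′ List.∈ 𝓕 → t ℕ.≤ ∣ F ∩ F′ ∣

Cover : ∀ {n} → ℕ → Family n → Pred (Subset n) 0ℓ
Cover t 𝓕 S = All (λ F → t ℕ.≤ ∣ S ∩ F ∣) 𝓕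

cover? : ∀ {n} t (𝓕 : Family n) S → Dec (Cover t 𝓕 S)
cover? t 𝓕 S = all? (λ F → t ≤? ∣ S ∩ F ∣) 𝓕

subsets : ∀ n → List (Subset n)
subsets zero    = [] ∷ []
subsets (suc n) = map (outside ∷_) (subsets n) ++ map (inside ∷_) (subsets n)

-- The first argument of min is an upper bound on the result.  It does not
-- affect the minimum when a t-cover exists, since every subset of [n] has size
-- at most n.  A t-cover (namely [n]) exists for k-uniform families with t ≤ k.
τ : ∀ {n} → ℕ → Family n → ℕ
τ {n} t 𝓕 = min n (map ∣_∣ (filter (cover? t 𝓕) (subsets n)))

-- The truncated differences k ∸ t and t ∸ 1 are the true ones when 1 ≤ t ≤ k.
record TypeI {n} (k t : ℕ) (𝓕 : Family n) : Set where
  field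
    T A B C  : Subset n
    u        : Fin n
    ∣T∣≡t    : ∣ T ∣ ≡ t
    ∣A∣≡t    : ∣ A ∣ ≡ t
    ∣B∣≡k-t  : ∣ B ∣ ≡ k ∸ t
    ∣C∣≡k-t  : ∣ C ∣ ≡ k ∸ t
    ∣T∩A∣    : ∣ T ∩ A ∣ ≡ t ∸ 1
    T∩[B∪C]  : Empty (T ∩ (B ∪ C))
    A∩B      : Empty (A ∩ B)
    A∩C      : Empty (A ∩ C)
    B∩C      : Empty (B ∩ C)
    u∈C      : u ∈ C
    members  : Members 𝓕 ≐ λ F →
        (∣ F ∣ ≡ k × F ∩ (A ∪ T) ≡ T × Nonempty (F ∩ B) × Nonempty (F ∩ C))
      ⊎ (∣ F ∣ ≡ k × (A ∪ T) ⊆ F × Nonempty (F ∩ (B ∪ ⁅ u ⁆)))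
      ⊎ (F ≡ A ∪ B ⊎ F ≡ A ∪ C ⊎ F ≡ (T ∩ A) ∪ B ∪ ⁅ u ⁆)

record TypeII {n} (k t : ℕ) (𝓕 : Family n) : Set where
  field
    M W      : Subset n
    ∣M∣≡k+2  : ∣ M ∣ ≡ k ℕ.+ 2
    W⊆M      : W ⊆ M
    ∣W∣≡t+2  : ∣ W ∣ ≡ t ℕ.+ 2
    members  : Members 𝓕 ≐ λ F →
        (∣ F ∣ ≡ k × W ⊆ F)
      ⊎ (∣ F ∣ ≡ k × ∣ F ∩ W ∣ ≡ t ℕ.+ 1 × Nonempty (F ∩ (M ─ W)))
      ⊎ (∣ F ∣ ≡ k × F ⊆ M × ∣ F ∩ W ∣ ≡ t)

record TypeIII {n} (k t : ℕ) (𝓕 : Family n) : Set where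
  field
    Z        : Subset n
    ∣Z∣≡t+4  : ∣ Z ∣ ≡ t ℕ.+ 4
    members  : Members 𝓕 ≐ λ F → ∣ F ∣ ≡ k × t ℕ.+ 2 ℕ.≤ ∣ F ∩ Z ∣

-- Integer arguments, so that binom m (-1) = 0; this occurs in f₃ when
-- k = t + 3, where truncated subtraction would wrongly give binom m 0 = 1.
binom : ℤ → ℤ → ℤ
binom (+ m) (+ r) = + (m C r)
binom _     _     = + 0

f₁ f₂ f₃ : (n k t : ℤ) → ℤ
f₁ n k t =
    binom (n - t) (k - t)
  - + 3 * binom (n - k - + 1) (k - t)
  + binom (n - k - + 2) (k - t)
  + binom (n - + 2 * k + t - + 1) (k - t)
  + + 3
f₂ n k t =
    binom (n - t - + 2) (k - t - + 2)
  + (t + + 2) * (binom (n - t - + 2) (k - t - + 1) - binom (n - k - + 2) (k - t - + 1))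
  + binom (t + + 2) (+ 2)
f₃ n k t =
    binom (t + + 4) (+ 2) * binom (n - t - + 4) (k - t - + 2)
  + (t + + 4) * binom (n - t - + 4) (k - t - + 3)
  + binom (n - t - + 4) (k - t - + 4)

{-# OPTIONS --safe #-}
-- Enlarge 𝓕 to a maximal t-intersecting family 𝔽 of k-sets, write ℓ = k - t, and let 𝒮 be
-- the set of its t-covers of size t + 2.  If X is not a t-cover, some F in 𝔽 meets X in fewer
-- than t points, so a member of 𝔽 containing X hits a fixed set of ℓ + 1 points outside X.
-- Branching three times from the t-subsets of a member of 𝒮 gives
--   |𝔽| ≤ |𝒮| C(n-t-2, ℓ-2) + C(t+2, 2) (ℓ+1)³ C(n-t-3, ℓ-3).
-- Families of the three types have N₁ = ℓ² + ℓ + 1, N₂ = (t+2)ℓ + 1 and N₃ = C(t+4, 2) covers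
-- of size t + 2, and n is so large that |𝒮| < Nᵢ forces |𝔽| < fᵢ.  So only the combinatorics
-- of 𝒮 matters; by maximality of 𝔽, it is t-intersecting.  If its members share t points,
-- they are the edges of a graph for which all F in 𝔽 not through these points are vertex
-- covers; it has at most N₁ edges, with equality for Type I.  If some W in 𝒮 meets all others
-- in t + 1 points, then |𝒮| ≤ N₂, with equality for Type II.  Otherwise |𝒮| is less than
-- one of the Nᵢ unless 𝒮 consists of all (t+2)-subsets of a (t+4)-set, which gives Type III;
-- this is shown by considering how 𝒮 meets a (t+1)-set lying in as many members as possible.
module Submission where

-- The bound is a maximum, so being below any one fᵢ suffices and the fᵢ are never compared with
-- each other. Up to a relative error of order 1/n, fᵢ is Nᵢ C(n-t-2, ℓ-2); one missing cover
-- therefore outweighs all error terms, and this is what the size of n pays for. N₁ counts T with a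
-- point of B and a point of C, and A ∪ T with a point of B ∪ {u}; N₂ counts W and its exchanges of
-- one point for a point of M ─ W; N₃ counts the (t+2)-subsets of Z. A structural outcome says that
-- 𝔽 lies in a family Fam of one of the types. As |Fam| ≤ fᵢ, a subfamily 𝓕 that attains the bound
-- is all of Fam, so the bound and the equality case are settled together. If no cover has size t +
-- 2, branching from a smallest cover ends below f₃. The obstacle is small parameters: for t = 1 and
-- ℓ = 3 the Nᵢ are 13, 10 and 10, and an estimate of |𝒮| that is one too large can fail. This
-- explains the long case analysis of 𝒮. Its steps are linear inequalities between cardinalities,
-- proved by certificates that are checked point by point.

open import Defs
open import Data.Bool.Base using (Bool; true; false; _∧_; _∨_; not; if_then_else_) renaming (T to Truth)
open import Data.Bool.Properties using (T-∧) renaming (_≟_ to _≟ᵇ_)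
open import Data.Fin.Base using (Fin; zero; suc)
open import Data.Fin.Subset using (Subset; inside; outside; _∩_; _∪_; _─_; ∁; ⊥; ⊤; ∣_∣; ⁅_⁆; _⊆_; Nonempty; Empty) renaming (_∈_ to _∈ˢ_)
open import Data.Fin.Subset.Properties using (∣⊥∣≡0; ∣⊤∣≡n; p∪∁p≡⊤; drop-∷-⊆; x∈⁅x⁆)
import Data.Empty
import Data.List.Base as List
open import Data.List using (List; []; _∷_; map; length; filter; _++_)
open import Data.List.Extrema.Nat using (min≤v⁺)
open import Data.List.Membership.Propositional using (_∈_; find; lose)
open import Data.List.Membership.Propositional.Properties using (∈-++⁺ˡ; ∈-++⁺ʳ; ∈-map⁺; ∈-map⁻; ∈-filter⁺; ∈-filter⁻)
open import Data.List.Properties using (length-map; length-++; filter-++; filter-accept; filter-reject; filter-none)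
open import Data.List.Relation.Unary.All as All using (All; []; _∷_)
open import Data.List.Relation.Unary.All.Properties using (¬All⇒Any¬)
open import Data.List.Relation.Unary.AllPairs using ([]; _∷_)
open import Data.List.Relation.Unary.Any as Any using (Any; here; there; any?)
open import Data.List.Relation.Unary.Unique.Propositional using (Unique)
import Data.List.Relation.Unary.Unique.Propositional.Properties as Unique
open import Data.Nat.Base hiding (_⊔_; _⊓_)
open import Data.Nat.Combinatorics using (_C_; nC1≡n; nCn≡1; nCk≡nC[n∸k]; nCk+nC[k+1]≡[n+1]C[k+1])
open import Data.Nat.Properties
import Data.Nat.Tactic.RingSolver as Ring
open import Algebra.Properties.CommutativeSemigroup +-commutativeSemigroup using (interchange)
open import Data.Product using (∃; _×_; _,_; proj₁; proj₂)
open import Data.Sum using (_⊎_; inj₁; inj₂; [_,_]′)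
open import Data.Vec.Base as Vec using (Vec; []; _∷_; here; there)
open import Data.Vec.Properties using (≡-dec)
open import Function.Base using (_∘_; id)
open import Function.Bundles using (Equivalence)
open import Relation.Binary.Definitions using (DecidableEquality)
open import Relation.Binary.PropositionalEquality hiding ([_])
open import Relation.Nullary using (¬_; Dec; yes; no; contradiction; ¬?; _×-dec_; _⊎-dec_)
open import Relation.Nullary.Decidable using (map′; decidable-stable)
open import Relation.Unary using (Decidable)

-- Linear arithmetic of the cardinalities of subsets

infixr 9 _⋒_
infixr 8 _⋓_
infixl 8 _∖_

data Expr : Set where
  set         : ℕ → Expr
  _⋒_ _⋓_ _∖_ : Expr → Expr → Expr
  cmpl        : Expr → Expr

private
  variable
    n : ℕ

getˢ : List (Subset n) → ℕ → Subset n
getˢ []      _       = ⊥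
getˢ (A ∷ _) zero    = A
getˢ (_ ∷ ρ) (suc i) = getˢ ρ i

getᵇ : List Bool → ℕ → Bool
getᵇ []      _       = false
getᵇ (b ∷ _) zero    = b
getᵇ (_ ∷ β) (suc i) = getᵇ β i

⟦_⟧ : Expr → List (Subset n) → Subset n
⟦ set i  ⟧ ρ = getˢ ρ i
⟦ e ⋒ f  ⟧ ρ = ⟦ e ⟧ ρ ∩ ⟦ f ⟧ ρ
⟦ e ⋓ f  ⟧ ρ = ⟦ e ⟧ ρ ∪ ⟦ f ⟧ ρ
⟦ e ∖ f  ⟧ ρ = ⟦ e ⟧ ρ ─ ⟦ f ⟧ ρ
⟦ cmpl e ⟧ ρ = ∁ (⟦ e ⟧ ρ)

bit : Expr → List Bool → Bool
bit (set i)  β = getᵇ β i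
bit (e ⋒ f)  β = bit e β ∧ bit f β
bit (e ⋓ f)  β = bit e β ∨ bit f β
-- Decided by `f` first, matching how `_─_` computes.
bit (e ∖ f)  β = if bit f β then false else bit e β
bit (cmpl e) β = not (bit e β)

getˢ-column : (ρ : List (Subset (suc n))) → ∀ i →
              getˢ ρ i ≡ getᵇ (map Vec.head ρ) i ∷ getˢ (map Vec.tail ρ) i
getˢ-column []            i       = refl
getˢ-column ((_ ∷ _) ∷ _) zero    = refl
getˢ-column (_ ∷ ρ)       (suc i) = getˢ-column ρ i

⟦⟧-column : ∀ e (ρ : List (Subset (suc n))) →
            ⟦ e ⟧ ρ ≡ bit e (map Vec.head ρ) ∷ ⟦ e ⟧ (map Vec.tail ρ)
⟦⟧-column (set i)  ρ = getˢ-column ρ i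
⟦⟧-column (e ⋒ f)  ρ = cong₂ _∩_ (⟦⟧-column e ρ) (⟦⟧-column f ρ)
⟦⟧-column (e ⋓ f)  ρ = cong₂ _∪_ (⟦⟧-column e ρ) (⟦⟧-column f ρ)
⟦⟧-column (e ∖ f)  ρ rewrite ⟦⟧-column e ρ | ⟦⟧-column f ρ
  with bit f (map Vec.head ρ)
... | true  = refl
... | false = refl
⟦⟧-column (cmpl e) ρ = cong ∁ (⟦⟧-column e ρ)

infix  7 ∥_
infixl 6 _⊕_
infixr 7 _⊛_
infix  4 _≼_ _≅_ _≅˘_ _⋐_
infixr 3 _⟪_∵_⟫_

data Lin : Set where
  ∥_      : Expr → Lin
  var lit : ℕ → Lin
  _⊕_     : Lin → Lin → Lin
  _⊛_     : ℕ → Lin → Lin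

-- An equation can be used from left to right (≅) or from right to left (≅˘).
data Constraint : Set where
  _≼_ _≅_ _≅˘_ : Lin → Lin → Constraint
  _⋐_          : Expr → Expr → Constraint

lhs rhs : Constraint → Lin
lhs (l ≼ r)  = l
lhs (l ≅ r)  = l
lhs (l ≅˘ r) = r
lhs (e ⋐ f)  = ∥ e ∖ f
rhs (l ≼ r)  = r
rhs (l ≅ r)  = r
rhs (l ≅˘ r) = l
rhs (e ⋐ f)  = lit 0

getⁿ : List ℕ → ℕ → ℕ
getⁿ []      _       = 0
getⁿ (x ∷ _) zero    = x
getⁿ (_ ∷ α) (suc i) = getⁿ α i

value : List (Subset n) → List ℕ → Lin → ℕ
value ρ α (∥ e)   = ∣ ⟦ e ⟧ ρ ∣
value ρ α (var i) = getⁿ α i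
value ρ α (lit c) = c
value ρ α (l ⊕ m) = value ρ α l + value ρ α m
value ρ α (c ⊛ l) = c * value ρ α l

Holds : List (Subset n) → List ℕ → Constraint → Set
Holds ρ α (l ≼ r)  = value ρ α l ≤ value ρ α r
Holds ρ α (l ≅ r)  = value ρ α l ≡ value ρ α r
Holds ρ α (l ≅˘ r) = value ρ α l ≡ value ρ α r
Holds ρ α (e ⋐ f)  = ∣ ⟦ e ⟧ ρ ─ ⟦ f ⟧ ρ ∣ ≤ 0

holds⇒≤ : ∀ (ρ : List (Subset n)) α c → Holds ρ α c → value ρ α (lhs c) ≤ value ρ α (rhs c)
holds⇒≤ ρ α (l ≼ r)  h = h
holds⇒≤ ρ α (l ≅ r)  h = ≤-reflexive h
holds⇒≤ ρ α (l ≅˘ r) h = ≤-reflexive (sym h)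
holds⇒≤ ρ α (e ⋐ f)  h = h

data Facts (ρ : List (Subset n)) (α : List ℕ) : Set where
  []      : Facts ρ α
  _⟪_∵_⟫_ : ℕ → (c : Constraint) → Holds ρ α c → Facts ρ α → Facts ρ α

indicator : Bool → ℕ
indicator b = if b then 1 else 0

weight : Lin → List Bool → ℕ
weight (∥ e)   β = indicator (bit e β)
weight (l ⊕ m) β = weight l β + weight m β
weight (c ⊛ l) β = c * weight l β
weight _       β = 0

δ : ℕ → ℕ → ℕ
δ i j = indicator (i ≡ᵇ j)

coeff : Lin → ℕ → ℕ
coeff (var i) j = δ i j
coeff (l ⊕ m) j = coeff l j + coeff m j
coeff (c ⊛ l) j = c * coeff l j
coeff _       j = 0

const : Lin → ℕ
const (lit c) = c
const (l ⊕ m) = const l + const m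
const (c ⊛ l) = c * const l
const _       = 0

-- The sets in `ρ` are the rows of a 0-1 matrix whose columns are the points of the ground set; `w`
-- weighs a column.
Σcolumns : ∀ n → (List Bool → ℕ) → List (Subset n) → ℕ
Σcolumns zero    w ρ = 0
Σcolumns (suc n) w ρ = w (map Vec.head ρ) + Σcolumns n w (map Vec.tail ρ)

dot : List ℕ → (ℕ → ℕ) → ℕ
dot []      c = 0
dot (x ∷ α) c = c 0 * x + dot α (λ i → c (suc i))

Σcolumns-+ : ∀ n u v (ρ : List (Subset n)) →
             Σcolumns n (λ β → u β + v β) ρ ≡ Σcolumns n u ρ + Σcolumns n v ρ
Σcolumns-+ zero    u v ρ = refl
Σcolumns-+ (suc n) u v ρ = trans (cong (u _ + v _ +_) (Σcolumns-+ n u v _))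
  (interchange (u _) (v _) _ _)

Σcolumns-* : ∀ n c u (ρ : List (Subset n)) → Σcolumns n (λ β → c * u β) ρ ≡ c * Σcolumns n u ρ
Σcolumns-* zero    c u ρ = sym (*-zeroʳ c)
Σcolumns-* (suc n) c u ρ = trans (cong (c * u _ +_) (Σcolumns-* n c u _))
  (sym (*-distribˡ-+ c (u _) _))

Σcolumns-0 : ∀ n (ρ : List (Subset n)) → Σcolumns n (λ _ → 0) ρ ≡ 0
Σcolumns-0 zero    ρ = refl
Σcolumns-0 (suc n) ρ = Σcolumns-0 n _

dot-+ : ∀ α u v → dot α (λ i → u i + v i) ≡ dot α u + dot α v
dot-+ []      u v = refl
dot-+ (x ∷ α) u v = trans (cong₂ _+_ (*-distribʳ-+ x (u 0) (v 0)) (dot-+ α _ _))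
                          (interchange (u 0 * x) (v 0 * x) _ _)

dot-* : ∀ α c u → dot α (λ i → c * u i) ≡ c * dot α u
dot-* []      c u = sym (*-zeroʳ c)
dot-* (x ∷ α) c u = trans (cong₂ _+_ (*-assoc c (u 0) x) (dot-* α c _))
  (sym (*-distribˡ-+ c (u 0 * x) _))

dot-0 : ∀ α → dot α (λ _ → 0) ≡ 0
dot-0 []      = refl
dot-0 (x ∷ α) = dot-0 α

dot-δ : ∀ α i → dot α (δ i) ≡ getⁿ α i
dot-δ []      i       = refl
dot-δ (x ∷ α) zero    = trans (cong₂ _+_ (+-identityʳ x) (dot-0 α)) (+-identityʳ x)
dot-δ (x ∷ α) (suc i) = dot-δ α i

cardinality-column : ∀ b (A : Subset n) → ∣ b ∷ A ∣ ≡ indicator b + ∣ A ∣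
cardinality-column true  A = refl
cardinality-column false A = refl

Σcolumns-card : ∀ n e (ρ : List (Subset n)) → Σcolumns n (λ β → indicator (bit e β)) ρ ≡ ∣ ⟦ e ⟧ ρ ∣
Σcolumns-card zero    e ρ with ⟦ e ⟧ ρ
... | [] = refl
Σcolumns-card (suc n) e ρ = trans (cong (indicator (bit e (map Vec.head ρ)) +_)
  (Σcolumns-card n e _))
  (trans (sym (cardinality-column (bit e (map Vec.head ρ)) (⟦ e ⟧ (map Vec.tail ρ))))
    (cong ∣_∣ (sym (⟦⟧-column e ρ))))

module _ {n} (ρ : List (Subset n)) (α : List ℕ) where

  -- A cardinality is a sum over the points, and a point contributes according to its membership
  -- pattern alone. This separates an expression into three parts that can be compared
  -- independently.
  decompose : ∀ l → value ρ α l ≡ Σcolumns n (weight l) ρ + dot α (coeff l) + const l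
  decompose (∥ e) = sym (trans (+-identityʳ _) (trans (cong₂ _+_ (Σcolumns-card n e ρ) (dot-0 α))
    (+-identityʳ _)))
  decompose (var i) = sym (trans (+-identityʳ _) (trans (cong (_+ dot α (δ i)) (Σcolumns-0 n ρ))
    (dot-δ α i)))
  decompose (lit c) = sym (cong (_+ c) (cong₂ _+_ (Σcolumns-0 n ρ) (dot-0 α)))
  decompose (l ⊕ m) = begin
    value ρ α l + value ρ α m
      ≡⟨ cong₂ _+_ (decompose l) (decompose m) ⟩
    (a + b + c) + (a′ + b′ + c′)
      ≡⟨ interchange (a + b) c (a′ + b′) c′ ⟩
    (a + b + (a′ + b′)) + (c + c′)
      ≡⟨ cong (_+ (c + c′)) (interchange a b a′ b′) ⟩
    (a + a′ + (b + b′)) + (c + c′)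
      ≡⟨ cong (_+ (c + c′)) (cong₂ _+_ (sym (Σcolumns-+ n (weight l) (weight m) ρ))
        (sym (dot-+ α (coeff l) (coeff m)))) ⟩
    Σcolumns n (weight (l ⊕ m)) ρ + dot α (coeff (l ⊕ m)) + const (l ⊕ m) ∎
    where
    open ≡-Reasoning
    a  = Σcolumns n (weight l) ρ ; b  = dot α (coeff l) ; c  = const l
    a′ = Σcolumns n (weight m) ρ ; b′ = dot α (coeff m) ; c′ = const m
  decompose (c ⊛ l) = trans (cong (c *_) (decompose l))
    (trans (*-distribˡ-+ c (Σcolumns n (weight l) ρ + dot α (coeff l)) (const l))
      (cong (_+ c * const l) (trans (*-distribˡ-+ c (Σcolumns n (weight l) ρ) (dot α (coeff l)))
        (cong₂ _+_ (sym (Σcolumns-* n c (weight l) ρ)) (sym (dot-* α c (coeff l)))))))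

allBits : ℕ → (List Bool → Bool) → Bool
allBits zero    P = P []
allBits (suc m) P = allBits m (λ β → P (true ∷ β)) ∧ allBits m (λ β → P (false ∷ β))

allBelow : ℕ → (ℕ → Bool) → Bool
allBelow zero    P = true
allBelow (suc m) P = P 0 ∧ allBelow m (λ i → P (suc i))

private
  T-split : ∀ {a b} → Truth (a ∧ b) → Truth a × Truth b
  T-split = Equivalence.to T-∧

allBits-sound : ∀ m P → Truth (allBits m P) → ∀ β → length β ≡ m → Truth (P β)
allBits-sound zero    P h []          refl = h
allBits-sound (suc m) P h (true ∷ β)  refl = allBits-sound m _ (proj₁ (T-split h)) β refl
allBits-sound (suc m) P h (false ∷ β) refl = allBits-sound m _
  (proj₂ (T-split {allBits m (λ β → P (true ∷ β))} h)) β refl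

Σcolumns-mono : ∀ n m u v → Truth (allBits m (λ β → u β ≤ᵇ v β)) → (ρ : List (Subset n)) →
  length ρ ≡ m →
                Σcolumns n u ρ ≤ Σcolumns n v ρ
Σcolumns-mono zero    m u v h ρ eq = z≤n
Σcolumns-mono (suc n) m u v h ρ eq = +-mono-≤
  (≤ᵇ⇒≤ _ _ (allBits-sound m _ h (map Vec.head ρ) (trans (length-map Vec.head ρ) eq)))
  (Σcolumns-mono n m u v h (map Vec.tail ρ) (trans (length-map Vec.tail ρ) eq))

dot-mono : ∀ α u v → Truth (allBelow (length α) (λ i → u i ≤ᵇ v i)) → dot α u ≤ dot α v
dot-mono []      u v h = z≤n
dot-mono (x ∷ α) u v h =
  +-mono-≤ (*-monoˡ-≤ x (≤ᵇ⇒≤ (u 0) (v 0) (proj₁ (T-split h))))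
    (dot-mono α _ _ (proj₂ (T-split {u 0 ≤ᵇ v 0} h)))

-- All `2 ^ m` membership patterns are tried, whether they occur or not, and the variables, which
-- stand for arbitrary natural numbers, are compared coefficientwise. This is a sufficient condition
-- that evaluation decides.
dominated : ℕ → ℕ → Lin → Lin → Bool
dominated m a l r = allBits m (λ β → weight l β ≤ᵇ weight r β)
                  ∧ allBelow a (λ i → coeff l i ≤ᵇ coeff r i)
                  ∧ (const l ≤ᵇ const r)

dominated-sound : (ρ : List (Subset n)) (α : List ℕ) → ∀ l r →
                  Truth (dominated (length ρ) (length α) l r) → value ρ α l ≤ value ρ α r
dominated-sound {n} ρ α l r h =
  subst₂ _≤_ (sym (decompose ρ α l)) (sym (decompose ρ α r))
    (+-mono-≤ (+-mono-≤ (Σcolumns-mono n (length ρ) _ _ (proj₁ h₁) ρ refl)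
      (dot-mono α _ _ (proj₁ h₂)))
              (≤ᵇ⇒≤ _ _ (proj₂ h₂)))
  where
  h₁ = T-split {allBits (length ρ) (λ β → weight l β ≤ᵇ weight r β)} h
  h₂ = T-split {allBelow (length α) (λ i → coeff l i ≤ᵇ coeff r i)} (proj₂ h₁)

lefts rights : {ρ : List (Subset n)} {α : List ℕ} → Facts ρ α → Lin
lefts  []               = lit 0
lefts  (k ⟪ c ∵ _ ⟫ fs) = k ⊛ lhs c ⊕ lefts fs
rights []               = lit 0
rights (k ⟪ c ∵ _ ⟫ fs) = k ⊛ rhs c ⊕ rights fs

lefts≤rights : (ρ : List (Subset n)) (α : List ℕ) (fs : Facts ρ α) →
  value ρ α (lefts fs) ≤ value ρ α (rights fs)
lefts≤rights ρ α []               = z≤n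
lefts≤rights ρ α (k ⟪ c ∵ p ⟫ fs) = +-mono-≤ (*-monoʳ-≤ k (holds⇒≤ ρ α c p)) (lefts≤rights ρ α fs)

certified : {ρ : List (Subset n)} {α : List ℕ} → ℕ → Lin → Lin → Facts ρ α → Set
certified {ρ = ρ} {α} s l r fs = Truth (dominated (length ρ) (length α) (suc s ⊛ l ⊕ rights fs)
  (suc s ⊛ r ⊕ lefts fs))

-- A Farkas certificate: suc s times the goal plus the stated multiples of the
-- facts with their sides exchanged holds for every pattern of membership of a
-- single point in the sets ρ and coefficientwise in the numbers α.
abstract
  linear : (ρ : List (Subset n)) (α : List ℕ) (s : ℕ) (goal : Constraint) (fs : Facts ρ α) →
           {certified s (lhs goal) (rhs goal) fs} → value ρ α (lhs goal) ≤ value ρ α (rhs goal)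
  linear ρ α s goal fs {h} = *-cancelˡ-≤ (suc s) (+-cancelʳ-≤ _ _ _
    (≤-trans (dominated-sound ρ α (suc s ⊛ lhs goal ⊕ rights fs) (suc s ⊛ rhs goal ⊕ lefts fs) h)
             (+-monoʳ-≤ (suc s * value ρ α (rhs goal)) (lefts≤rights ρ α fs))))

  equation : (ρ : List (Subset n)) (α : List ℕ) (l r : Lin) (s : ℕ) (fs : Facts ρ α) (s′ : ℕ)
    (fs′ : Facts ρ α) →
             {certified s l r fs} → {certified s′ r l fs′} → value ρ α l ≡ value ρ α r
  equation ρ α l r s fs s′ fs′ {h} {h′} = ≤-antisym (linear ρ α s (l ≼ r) fs {h})
    (linear ρ α s′ (r ≼ l) fs′ {h′})

infixr 3 _∵_∙_
pattern _∵_∙_ c p fs = 1 ⟪ c ∵ p ⟫ fs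
pattern s0 = set 0
pattern s1 = set 1
pattern s2 = set 2
pattern s3 = set 3
pattern s4 = set 4
pattern s5 = set 5
pattern s6 = set 6
pattern s7 = set 7
pattern s8 = set 8
pattern x0 = var 0
pattern x1 = var 1
pattern x2 = var 2
pattern x3 = var 3
pattern x4 = var 4
pattern x5 = var 5
pattern x6 = var 6
pattern x7 = var 7
pattern x8 = var 8
pattern x9 = var 9
pattern x10 = var 10
pattern x11 = var 11
pattern x12 = var 12
pattern x13 = var 13
pattern x14 = var 14
pattern x15 = var 15

-- Contradictory facts are refuted by certifying `lit 1 ≼ lit 0` from them.
impossible : ∀ {a} {A : Set a} → 1 ≤ 0 → A
impossible ()

-- Counting subsets

private
  variable
    I : Set

-- Inclusion as a statement about cardinalities, so that `linear' applies to it.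
infix 4 _⊑_ _⊑?_
_⊑_ : Subset n → Subset n → Set
A ⊑ B = ∣ A ─ B ∣ ≤ 0

_⊑?_ : ∀ (A B : Subset n) → Dec (A ⊑ B)
A ⊑? B = ∣ A ─ B ∣ ≤? 0

⊑-refl : (A : Subset n) → A ⊑ A
⊑-refl A = linear (A ∷ []) [] 0 (s0 ⋐ s0) []

⊑-antisym : {A B : Subset n} → A ⊑ B → B ⊑ A → A ≡ B
⊑-antisym {A = []}        {[]}        h g = refl
⊑-antisym {A = true ∷ A}  {true ∷ B}  h g = cong (true ∷_) (⊑-antisym h g)
⊑-antisym {A = true ∷ A}  {false ∷ B} () g
⊑-antisym {A = false ∷ A} {true ∷ B}  h ()
⊑-antisym {A = false ∷ A} {false ∷ B} h g = cong (false ∷_) (⊑-antisym h g)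

⊥-⊑ : (A : Subset n) → ⊥ ⊑ A
⊥-⊑ []          = z≤n
⊥-⊑ (true ∷ A)  = ⊥-⊑ A
⊥-⊑ (false ∷ A) = ⊥-⊑ A

between : (A B : Subset n) → ∀ s → A ⊑ B → ∣ A ∣ ≤ s → s ≤ ∣ B ∣ →
          ∃ λ C → ∣ C ∣ ≡ s × A ⊑ C × C ⊑ B
between []          []          s       h a b = [] , sym (n≤0⇒n≡0 b) , z≤n , z≤n
between (true ∷ A)  (false ∷ B) s       () a b
between (true ∷ A)  (true ∷ B)  zero    h () b
between (true ∷ A)  (true ∷ B)  (suc s) h (s≤s a) (s≤s b) with between A B s h a b
... | C , e , i , j = true ∷ C , cong suc e , i , j
between (false ∷ A) (false ∷ B) s       h a b with between A B s h a b
... | C , e , i , j = false ∷ C , e , i , j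
-- The point is skipped while the rest of `B` still has `s` points; otherwise `s` is the size of
-- `true ∷ B`, and all of it is taken.
between (false ∷ A) (true ∷ B)  s       h a b with s ≤? ∣ B ∣
... | yes c with between A B s h a c
...   | C , e , i , j = false ∷ C , e , i , j
between (false ∷ A) (true ∷ B)  s       h a b | no c =
  true ∷ B , ≤-antisym (≰⇒> c) b , h , ⊑-refl B

-- With `s = 1` this encodes the points of `B` as one-element sets, which keeps them within reach of
-- `linear`.
Sub : ℕ → Subset n → Subset n → Set
Sub s B D = ∣ D ∣ ≡ s × D ⊑ B

Sub? : ∀ s (B : Subset n) → Decidable (Sub s B)
Sub? s B D = ∣ D ∣ ≟ s ×-dec D ⊑? B

choose : (B : Subset n) → ∀ s → s ≤ ∣ B ∣ → ∃ (Sub s B)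
choose {n} B s h with between ⊥ B s (⊥-⊑ B) (subst (_≤ s) (sym (∣⊥∣≡0 n)) z≤n) h
... | C , e , _ , j = C , e , j

cnt : {P : I → Set} → Decidable P → List I → ℕ
cnt P? xs = length (filter P? xs)

module _ {I : Set} {P : I → Set} (P? : Decidable P) where

  cnt-accept : ∀ {x xs} → P x → cnt P? (x ∷ xs) ≡ suc (cnt P? xs)
  cnt-accept p = cong length (filter-accept P? p)

  cnt-reject : ∀ {x xs} → ¬ P x → cnt P? (x ∷ xs) ≡ cnt P? xs
  cnt-reject p = cong length (filter-reject P? p)

  cnt-++ : ∀ xs ys → cnt P? (xs ++ ys) ≡ cnt P? xs + cnt P? ys
  cnt-++ xs ys = trans (cong length (filter-++ P? xs ys)) (length-++ (filter P? xs))

  cnt-witness : ∀ xs → 1 ≤ cnt P? xs → ∃ P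
  cnt-witness (x ∷ xs) h with P? x
  ... | yes p = x , p
  ... | no  _ = cnt-witness xs h

  cnt-none : ∀ xs → (∀ x → ¬ P x) → cnt P? xs ≡ 0
  cnt-none xs h = cong length (filter-none P? (All.universal h xs))

  cnt-≤1 : ∀ {xs} → Unique xs → (∀ x y → P x → P y → x ≡ y) → cnt P? xs ≤ 1
  cnt-≤1 {[]}     u h = z≤n
  cnt-≤1 {x ∷ xs} (x∉ ∷ u) h with P? x
  ... | no  _ = cnt-≤1 u h
  ... | yes p = s≤s (≤-reflexive (cong length (filter-none P?
    (All.map (λ x≢y q → x≢y (h _ _ p q)) x∉))))

cnt-map : ∀ {J : Set} {P : J → Set} (P? : Decidable P) (f : I → J) xs →
          cnt P? (map f xs) ≡ cnt (P? ∘ f) xs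
cnt-map P? f [] = refl
cnt-map P? f (x ∷ xs) with P? (f x)
... | yes p = cong suc (cnt-map P? f xs)
... | no  _ = cnt-map P? f xs

module _ {I : Set} {P Q : I → Set} (P? : Decidable P) (Q? : Decidable Q) where

  cnt-mono : ∀ xs → (∀ x → P x → Q x) → cnt P? xs ≤ cnt Q? xs
  cnt-mono [] h = z≤n
  cnt-mono (x ∷ xs) h with P? x | Q? x
  ... | yes p | yes q = s≤s (cnt-mono xs h)
  ... | yes p | no ¬q = contradiction (h x p) ¬q
  ... | no  _ | yes q = m≤n⇒m≤1+n (cnt-mono xs h)
  ... | no  _ | no  _ = cnt-mono xs h

  cnt-strict : ∀ {xs x} → (∀ x → P x → Q x) → x ∈ xs → Q x → ¬ P x → cnt P? xs < cnt Q? xs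
  cnt-strict {x ∷ xs} h (here refl) q ¬p =
    subst₂ _<_ (sym (cnt-reject P? ¬p)) (sym (cnt-accept Q? q)) (s≤s (cnt-mono xs h))
  cnt-strict {y ∷ xs} h (there i) q ¬p with P? y | Q? y
  ... | yes p | yes _ = s≤s (cnt-strict h i q ¬p)
  ... | yes p | no ¬q = contradiction (h y p) ¬q
  ... | no  _ | yes _ = m≤n⇒m≤1+n (cnt-strict h i q ¬p)
  ... | no  _ | no  _ = cnt-strict h i q ¬p

  cnt-split : ∀ xs → cnt P? xs ≡ cnt (λ x → P? x ×-dec Q? x) xs + cnt (λ x → P? x ×-dec ¬? (Q? x))
    xs
  cnt-split [] = refl
  cnt-split (x ∷ xs) with P? x | Q? x
  ... | yes p | yes q = cong suc (cnt-split xs)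
  ... | yes p | no ¬q = trans (cong suc (cnt-split xs)) (sym (+-suc _ _))
  ... | no  _ | yes q = cnt-split xs
  ... | no  _ | no  _ = cnt-split xs

cnt-cong : {P Q : I → Set} (P? : Decidable P) (Q? : Decidable Q) → ∀ xs →
           (∀ x → P x → Q x) → (∀ x → Q x → P x) → cnt P? xs ≡ cnt Q? xs
cnt-cong P? Q? xs f g = ≤-antisym (cnt-mono P? Q? xs f) (cnt-mono Q? P? xs g)

cnt-∪ : {P Q R : I → Set} (P? : Decidable P) (Q? : Decidable Q) (R? : Decidable R) → ∀ xs →
        (∀ x → P x → Q x ⊎ R x) → cnt P? xs ≤ cnt Q? xs + cnt R? xs
cnt-∪ P? Q? R? xs h = ≤-trans (≤-reflexive (cnt-split P? Q? xs))
  (+-mono-≤ (cnt-mono _ Q? xs (λ x → proj₂))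
            (cnt-mono _ R? xs (λ x (p , ¬q) → [ (λ q → contradiction q ¬q) , id ]′ (h x p))))

module _ {I J : Set} {Q : J → I → Set} (Q? : ∀ j → Decidable (Q j)) (xs : List I) (c : ℕ) where

  cnt-Any : ∀ js → (∀ {j} → j ∈ js → cnt (Q? j) xs ≤ c) →
            cnt (λ x → any? (λ j → Q? j x) js) xs ≤ length js * c
  cnt-Any [] h = ≤-reflexive (cnt-none _ xs (λ _ ()))
  cnt-Any (j ∷ js) h = ≤-trans (cnt-∪ _ (Q? j) (λ x → any? (λ j → Q? j x) js) xs (λ x → Any.toSum))
    (+-mono-≤ (h (here refl)) (cnt-Any js (h ∘ there)))

  cnt-Any-strict : ∀ js → (∀ {j} → j ∈ js → cnt (Q? j) xs ≤ c) → ∀ {i} → i ∈ js →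
    cnt (Q? i) xs < c →
                   cnt (λ x → any? (λ j → Q? j x) js) xs < length js * c
  cnt-Any-strict (j ∷ js) h (here refl) l = ≤-trans (s≤s
    (cnt-∪ _ (Q? j) (λ x → any? (λ j → Q? j x) js) xs (λ x → Any.toSum)))
    (+-mono-≤ l (cnt-Any js (h ∘ there)))
  cnt-Any-strict (j ∷ js) h (there i) l = ≤-trans (s≤s
    (cnt-∪ _ (Q? j) (λ x → any? (λ j → Q? j x) js) xs (λ x → Any.toSum)))
    (≤-trans (≤-reflexive (sym (+-suc _ _))) (+-mono-≤ (h (here refl))
      (cnt-Any-strict js (h ∘ there) i l)))

∈-subsets : (A : Subset n) → A ∈ subsets n
∈-subsets []                  = here refl
∈-subsets {suc n} (false ∷ A) = ∈-++⁺ˡ (∈-map⁺ (outside ∷_) (∈-subsets A))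
∈-subsets {suc n} (true ∷ A)  = ∈-++⁺ʳ (map (outside ∷_) (subsets n))
  (∈-map⁺ (inside ∷_) (∈-subsets A))

subsets-unique : ∀ n → Unique (subsets n)
subsets-unique zero    = [] ∷ []
subsets-unique (suc n) = Unique.++⁺ (Unique.map⁺ (λ { refl → refl }) (subsets-unique n))
  (Unique.map⁺ (λ { refl → refl }) (subsets-unique n)) disjoint
  where
  disjoint : ∀ {A} → A ∈ map (outside ∷_) (subsets n) × A ∈ map (inside ∷_) (subsets n) → _
  disjoint (a , b) with ∈-map⁻ (outside ∷_) a | ∈-map⁻ (inside ∷_) b
  ... | _ , _ , refl | _ , _ , ()

infix 9 #_
#_ : {P : Subset n → Set} → Decidable P → ℕ
#_ {n} P? = cnt P? (subsets n)

∃? : {P : Subset n → Set} → Decidable P → Dec (∃ P)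
∃? {n} P? = map′ (λ a → let (x , _ , p) = find a in x , p) (λ (x , p) → lose (∈-subsets x) p)
  (any? P? (subsets n))

counterexample : {P Q : Subset n → Set} → Decidable P → Decidable Q → ¬ (∀ S → P S → Q S) → ∃ λ S →
  P S × ¬ Q S
counterexample P? Q? h with ∃? (λ S → P? S ×-dec ¬? (Q? S))
... | yes w  = w
... | no  ¬w = contradiction (λ S p → decidable-stable (Q? S) (λ ¬q → ¬w (S , p , ¬q))) h

∀? : {P Q : Subset n → Set} → Decidable P → Decidable Q → (∀ S → P S → Q S) ⊎ ∃ λ S → P S × ¬ Q S
∀? P? Q? with ∃? (λ S → P? S ×-dec ¬? (Q? S))
... | yes w  = inj₂ w
... | no  ¬w = inj₁ (λ S p → decidable-stable (Q? S) (λ ¬q → ¬w (S , p , ¬q)))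

module _ {n} {P Q : Subset n → Set} (P? : Decidable P) (Q? : Decidable Q) where

  #-mono : (∀ S → P S → Q S) → # P? ≤ # Q?
  #-mono = cnt-mono P? Q? (subsets n)

  #-strict : (∀ S → P S → Q S) → ∀ S → Q S → ¬ P S → # P? < # Q?
  #-strict h S = cnt-strict P? Q? h (∈-subsets S)

  #-split : # P? ≡ # (λ S → P? S ×-dec Q? S) + # (λ S → P? S ×-dec ¬? (Q? S))
  #-split = cnt-split P? Q? (subsets n)

#-∪ : {P Q R : Subset n → Set} (P? : Decidable P) (Q? : Decidable Q) (R? : Decidable R) →
      (∀ S → P S → Q S ⊎ R S) → # P? ≤ # Q? + # R?
#-∪ {n} P? Q? R? = cnt-∪ P? Q? R? (subsets n)

module _ {n} {P : Subset n → Set} (P? : Decidable P) where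

  #-witness : 1 ≤ # P? → ∃ P
  #-witness = cnt-witness P? (subsets n)

  #-none : (∀ S → ¬ P S) → # P? ≡ 0
  #-none = cnt-none P? (subsets n)

  #≤1 : (∀ S S′ → P S → P S′ → S ≡ S′) → # P? ≤ 1
  #≤1 = cnt-≤1 P? (subsets-unique n)

module _ {n} {P I : Subset n → Set} {Q : Subset n → Subset n → Set}
         (P? : Decidable P) (I? : Decidable I) (Q? : ∀ R → Decidable (Q R)) (c : ℕ)
         (cover : ∀ S → P S → ∃ λ R → I R × Q R S) where

  private
    Rs = filter I? (subsets n)

    cover′ : ∀ S → P S → Any (λ R → Q R S) Rs
    cover′ S p with cover S p
    ... | R , i , q = lose (∈-filter⁺ I? (∈-subsets R) i) q

    index : ∀ {R} → R ∈ Rs → I R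
    index = proj₂ ∘ ∈-filter⁻ I? {xs = subsets n}

  #-union : (∀ R → I R → # (Q? R) ≤ c) → # P? ≤ # I? * c
  #-union h = ≤-trans (#-mono P? (λ S → any? (λ R → Q? R S) Rs) cover′)
                      (cnt-Any Q? (subsets n) c Rs (λ i → h _ (index i)))

  -- A single class with fewer than `c` members makes the union bound strict. The equality cases
  -- rest on this: when `𝒮` is as large as possible, every class is full, so every set that could be
  -- a cover is one.
  #-union-strict : (∀ R → I R → # (Q? R) ≤ c) → ∀ R → I R → # (Q? R) < c → # P? < # I? * c
  #-union-strict h R i l = ≤-<-trans (#-mono P? (λ S → any? (λ R → Q? R S) Rs) cover′)
    (cnt-Any-strict Q? (subsets n) c Rs (λ i → h _ (index i)) (∈-filter⁺ I? (∈-subsets R) i) l)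

Interval : ℕ → Subset n → Subset n → Subset n → Set
Interval k Y Z F = ∣ F ∣ ≡ k × Y ⊑ F × F ⊑ Z

Interval? : ∀ k (Y Z : Subset n) → Decidable (Interval k Y Z)
Interval? k Y Z F = ∣ F ∣ ≟ k ×-dec (Y ⊑? F ×-dec F ⊑? Z)

#-interval : (Y Z : Subset n) → ∀ j k → Y ⊑ Z → k ≡ ∣ Y ∣ + j → # (Interval? k Y Z) ≡ ∣ Z ─ Y ∣ C j
#-interval []      []      zero    .0       h refl = refl
#-interval []      []      (suc j) .(suc j) h refl = refl
#-interval {suc n} (y ∷ Y) (z ∷ Z) j k h refl =
  trans (cnt-++ P? (map (outside ∷_) (subsets n)) (map (inside ∷_) (subsets n)))
    (trans (cong₂ _+_ (cnt-map P? (outside ∷_) (subsets n)) (cnt-map P? (inside ∷_) (subsets n)))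
           (step y z j h))
  where
  P? = Interval? k (y ∷ Y) (z ∷ Z)
  step : ∀ y z j → (y ∷ Y) ⊑ (z ∷ Z) → let Q? = Interval? (∣ y ∷ Y ∣ + j) (y ∷ Y) (z ∷ Z) in
         # (Q? ∘ (outside ∷_)) + # (Q? ∘ (inside ∷_)) ≡ ∣ (z ∷ Z) ─ (y ∷ Y) ∣ C j
  step true false j ()
  step true true j h = trans (cong₂ _+_ (#-none (Interval? (∣ true ∷ Y ∣ + j) (true ∷ Y) (true ∷ Z)
    ∘ (outside ∷_)) (λ { S (_ , () , _) }))
    (cnt-cong _ (Interval? (∣ Y ∣ + j) Y Z) (subsets n) (λ S (a , b) → suc-injective a , b)
      (λ S (a , b) → cong suc a , b)))
    (#-interval Y Z j _ h refl)
  step false false j h = trans (cong₂ _+_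
    (cnt-cong _ (Interval? (∣ Y ∣ + j) Y Z) (subsets n) (λ S → id) (λ S → id))
      (#-none (Interval? (∣ false ∷ Y ∣ + j) (false ∷ Y) (false ∷ Z) ∘ (inside ∷_))
        (λ { S (_ , _ , ()) })))
    (trans (+-identityʳ _) (#-interval Y Z j _ h refl))
  -- A set of size `∣ Y ∣` above `Y` is `Y` itself and cannot contain the new point. For `suc j`
  -- both choices contribute, and Pascal's rule adds them.
  step false true zero h = trans (cong₂ _+_
    (trans (cnt-cong _ (Interval? (∣ Y ∣ + 0) Y Z) (subsets n) (λ S → id) (λ S → id))
      (#-interval Y Z 0 _ h refl))
    (#-none (Interval? (∣ false ∷ Y ∣ + 0) (false ∷ Y) (true ∷ Z) ∘ (inside ∷_))
      (λ S (a , b , _) → (impossible (linear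
        (S ∷ Y ∷ []) [] 0 (lit 1 ≼ lit 0) (lit 1 ⊕ ∥ s0 ≅ ∥ s1 ⊕ lit 0 ∵ a ∙ s1 ⋐ s0 ∵ b ∙ []))))))
    refl
  step false true (suc j) h = trans (cong₂ _+_
    (trans (cnt-cong _ (Interval? (∣ Y ∣ + suc j) Y Z) (subsets n) (λ S → id) (λ S → id))
      (#-interval Y Z (suc j) _ h refl))
    (trans (cnt-cong _ (Interval? (∣ Y ∣ + j) Y Z) (subsets n)
             (λ S (a , b) → suc-injective (trans a (+-suc _ _)) , b)
               (λ S (a , b) → trans (cong suc a) (sym (+-suc _ _)) , b))
           (#-interval Y Z j _ h refl)))
    (trans (+-comm _ (∣ Z ─ Y ∣ C j)) (nCk+nC[k+1]≡[n+1]C[k+1] ∣ Z ─ Y ∣ j))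

#-Sub : (B : Subset n) → ∀ s → # (Sub? s B) ≡ ∣ B ∣ C s
#-Sub {n} B s = trans
  (cnt-cong (Sub? s B) (Interval? s ⊥ B) (subsets n) (λ S (a , b) → a , ⊥-⊑ S , b)
    (λ S (a , _ , b) → a , b))
  (trans (#-interval ⊥ B s s (⊥-⊑ B) (cong (_+ s) (sym (∣⊥∣≡0 n))))
    (cong (_C s) (≤-antisym (linear (B ∷ (⊥) ∷ []) [] 0 (∥ s0 ∖ s1 ≼ ∥ s0) []) (linear
        (B ∷ (⊥) ∷ []) [] 0 (∥ s0 ≼ ∥ s0 ∖ s1) (∥ s1 ≅ lit 0 ∵ ∣⊥∣≡0 n ∙ [])))))

#-points : (B : Subset n) → # (Sub? 1 B) ≡ ∣ B ∣
#-points B = trans (#-Sub B 1) (nC1≡n ∣ B ∣)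

-- Intersecting families of (t+2)-sets

_≟ˢ_ : ∀ {n} → DecidableEquality (Subset n)
_≟ˢ_ = ≡-dec _≟ᵇ_

whole : ∀ {n} (A : Subset n) → ∣ A ∪ ∁ A ∣ ≡ n
whole {n} A = trans (cong ∣_∣ (p∪∁p≡⊤ A)) (∣⊤∣≡n n)

module _ {n} {P : Subset n → Set} (P? : Decidable P) where

  others? : ∀ A → Decidable (λ S → P S × ¬ S ≡ A)
  others? A S = P? S ×-dec ¬? (S ≟ˢ A)

  #-others : ∀ A → # P? ≤ suc (# (others? A))
  #-others A = ≤-trans (≤-reflexive (#-split P? (_≟ˢ A)))
    (+-monoˡ-≤ _ (#≤1 (λ S → P? S ×-dec (S ≟ˢ A)) (λ S S′ (_ , e) (_ , e′) → trans e (sym e′))))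

  others-< : ∀ A → P A → # (others? A) < # P?
  others-< A p = #-strict (others? A) P? (λ S → proj₁) A p (λ (_ , ne) → ne refl)

  two : 2 ≤ # P? → ∃ λ A → ∃ λ B → P A × P B × ¬ A ≡ B
  two h = let A , pA      = #-witness P? (≤-trans (s≤s z≤n) h)
              B , pB , ne = #-witness (others? A) (s≤s⁻¹ (≤-trans h (#-others A)))
          in A , B , pA , pB , ne ∘ sym

-- `F` has more than `j` points outside `X`. A set with at least `t` points in `F` misses at most
-- `j` points of `F`, so it hits `B`; hence the factor `1 + j` in each branching.
branch-set : ∀ {n} (F X : Subset n) t j → ∣ F ∣ ≡ t + j → ∣ F ∩ X ∣ < t →
             ∃ λ B → Sub (1 + j) F B × ∣ B ∩ X ∣ ≤ 0
branch-set F X t j e h with choose (F ─ X) (1 + j) (linear (F ∷ X ∷ []) (j ∷ t ∷ []) 0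
    (lit 1 ⊕ x0 ≼ ∥ s0 ∖ s1) (∥ s0 ≅˘ x1 ⊕ x0 ∵ e ∙ lit 1 ⊕ ∥ s0 ⋒ s1 ≼ x1 ∵ h ∙ []))
... | B , b , i = B , (b , (linear (B ∷ F ∷ X ∷ []) [] 0 (s0 ⋐ s1) (s0 ⋐ (s1 ∖ s2) ∵ i ∙ []))) ,
  (linear
    (B ∷ X ∷ F ∷ []) [] 0 (∥ s0 ⋒ s1 ≼ lit 0) (s0 ⋐ (s2 ∖ s1) ∵ i ∙ []))

hit-point : ∀ {n} (S B : Subset n) → 1 ≤ ∣ S ∩ B ∣ → ∃ λ b → Sub 1 B b × b ⊑ S
hit-point S B h with choose (S ∩ B) 1 h
... | b , e , i = b , (e , (linear (b ∷ B ∷ S ∷ []) [] 0 (s0 ⋐ s1) (s0 ⋐ (s2 ⋒ s1) ∵ i ∙ []))) ,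
  (linear
    (b ∷ S ∷ B ∷ []) [] 0 (s0 ⋐ s1) (s0 ⋐ (s1 ⋒ s2) ∵ i ∙ []))

∪-⊑ : ∀ {n} (A B S : Subset n) → A ⊑ S → B ⊑ S → (A ∪ B) ⊑ S
∪-⊑ A B S i j = linear (A ∷ B ∷ S ∷ []) [] 0 ((s0 ⋓ s1) ⋐ s2) (s0 ⋐ s2 ∵ i ∙ s1 ⋐ s2 ∵ j ∙ [])

point : ∀ {n} (x S : Subset n) → ∣ x ∣ ≡ 1 → (x ⊑ S) ⊎ (∣ x ∩ S ∣ ≤ 0)
point x S e with x ⊑? S
... | yes i = inj₁ i
... | no ¬i = inj₂ (linear (x ∷ S ∷ []) [] 0 (∥ s0 ⋒ s1 ≼ lit 0) (∥ s0 ≅ lit 1 ∵ e ∙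
    lit 1 ≼ ∥ s0 ∖ s1 ∵ ≰⇒> ¬i ∙ []))

module _ {n} {𝒢 : Subset n → Set} (𝒢? : Decidable 𝒢) where

  above? : ∀ X → Decidable (λ S → 𝒢 S × X ⊑ S)
  above? X S = 𝒢? S ×-dec X ⊑? S

  deg : Subset n → ℕ
  deg X = # (above? X)

  deg-top : ∀ s → (∀ S → 𝒢 S → ∣ S ∣ ≡ s) → ∀ X → ∣ X ∣ ≡ s → deg X ≤ 1
  deg-top s size X e = #≤1 (above? X) (λ S S′ (g , i) (g′ , i′) →
    trans (sym (same S g i)) (same S′ g′ i′))
    where
    same : ∀ S → 𝒢 S → X ⊑ S → X ≡ S
    same S g i = ⊑-antisym i (linear (S ∷ X ∷ []) (s ∷ []) 0 (s0 ⋐ s1) (s1 ⋐ s0 ∵ i ∙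
        ∥ s0 ≅ x0 ∵ size S g ∙ ∥ s1 ≅˘ x0 ∵ e ∙ []))

  deg-hit : ∀ X B c → (∀ S → 𝒢 S → X ⊑ S → 1 ≤ ∣ S ∩ B ∣) →
            (∀ b → Sub 1 B b → deg (X ∪ b) ≤ c) → deg X ≤ ∣ B ∣ * c
  deg-hit X B c h d = ≤-trans
    (#-union (above? X) (Sub? 1 B) (λ b → above? (X ∪ b)) c
      (λ S (g , i) → let b , s , j = hit-point S B (h S g i) in b , s , g , ∪-⊑ X b S i j) d)
    (≤-reflexive (cong (_* c) (#-points B)))

  deg-branch : ∀ F X t j c → (∀ S → 𝒢 S → t ≤ ∣ S ∩ F ∣) → ∣ F ∣ ≡ t + j → ∣ F ∩ X ∣ < t →
               (∀ Y → ∣ Y ∣ ≡ ∣ X ∣ + 1 → deg Y ≤ c) → deg X ≤ (1 + j) * c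
  deg-branch F X t j c h e l d with branch-set F X t j e l
  ... | B , (b , i) , o = ≤-trans
    (deg-hit X B c
      (λ S g _ → (linear (S ∷ B ∷ F ∷ []) (t ∷ j ∷ []) 0 (lit 1 ≼ ∥ s0 ⋒ s1)
          (x0 ≼ ∥ s0 ⋒ s2 ∵ h S g ∙ ∥ s2 ≅ x0 ⊕ x1 ∵ e ∙ ∥ s1 ≅˘ lit 1 ⊕ x1 ∵ b ∙ s1 ⋐ s2 ∵ i ∙
            [])))
      (λ p (p1 , pB) → d (X ∪ p) (equation (X ∷ p ∷ B ∷ []) [] (∥ s0 ⋓ s1) (∥ s0 ⊕ lit 1) 0
          (∥ s1 ≅ lit 1 ∵ p1 ∙ []) 0 (∥ s1 ≅˘ lit 1 ∵ p1 ∙ s1 ⋐ s2 ∵ pB ∙ ∥ s2 ⋒ s0 ≼ lit 0 ∵ o ∙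
          []))))
    (≤-reflexive (cong (_* c) b))

-- In a t-intersecting family 𝒮 of (t+2)-sets and for a (t+1)-set X, the members
-- meeting X in t points are X without a point x (the label) plus an edge outside X.
-- Edges with different labels intersect.
module Labels {n} (t : ℕ) {𝒮 : Subset n → Set} (𝒮? : Decidable 𝒮)
              (size : ∀ S → 𝒮 S → ∣ S ∣ ≡ t + 2)
              (meet : ∀ S S′ → 𝒮 S → 𝒮 S′ → t ≤ ∣ S ∩ S′ ∣) where

  deg≤1 : ∀ X → ∣ X ∣ ≡ t + 2 → deg 𝒮? X ≤ 1
  deg≤1 = λ X → deg-top 𝒮? (t + 2) size X

  module _ (X : Subset n) (∣X∣ : ∣ X ∣ ≡ t + 1) where

    Mid : Subset n → Set
    Mid S = 𝒮 S × ∣ S ∩ X ∣ ≡ t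

    Mid? : Decidable Mid
    Mid? S = 𝒮? S ×-dec ∣ S ∩ X ∣ ≟ t

    Label : Subset n → Subset n → Set
    Label x S = Mid S × ∣ x ∩ S ∣ ≤ 0

    Label? : ∀ x → Decidable (Label x)
    Label? x S = Mid? S ×-dec ∣ x ∩ S ∣ ≤? 0

    Other : Subset n → Subset n → Set
    Other x S = Mid S × x ⊑ S

    Other? : ∀ x → Decidable (Other x)
    Other? x S = Mid? S ×-dec x ⊑? S

    Mid≤ : ∀ c → (∀ x → Sub 1 X x → # (Label? x) ≤ c) → # Mid? ≤ c * (t + 1)
    Mid≤ c h = ≤-trans
      (#-union Mid? (Sub? 1 X) Label? c
        (λ S (s , m) → X ─ S ,
          ( (equation (X ∷ S ∷ []) (t ∷ []) (∥ s0 ∖ s1) (lit 1) 0 (∥ s1 ⋒ s0 ≅˘ x0 ∵ m ∙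
              ∥ s0 ≅ x0 ⊕ lit 1 ∵ ∣X∣ ∙ []) 0 (∥ s1 ⋒ s0 ≅ x0 ∵ m ∙ ∥ s0 ≅˘ x0 ⊕ lit 1 ∵ ∣X∣ ∙ []))
                , (linear
              (X ∷ S ∷ []) [] 0 ((s0 ∖ s1) ⋐ s0) []))
          , (s , m) , (linear (X ∷ S ∷ []) [] 0 (∥ (s0 ∖ s1) ⋒ s1 ≼ lit 0) [])) h)
      (≤-reflexive (trans (cong (_* c) (trans (#-points X) ∣X∣)) (*-comm (t + 1) c)))

    module _ (x : Subset n) (∣x∣ : ∣ x ∣ ≡ 1) (x⊑X : x ⊑ X) where

      Mid≤Label+ : ∀ c → (∀ y → Sub 1 (X ─ x) y → # (λ S → Other? x S ×-dec (∣ y ∩ S ∣ ≤? 0)) ≤ c) →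
                   # Mid? ≤ # (Label? x) + c * t
      Mid≤Label+ c h = ≤-trans
        (#-∪ Mid? (Label? x) (Other? x) (λ S m → [ (λ i → inj₂ (m , i)) , (λ d → inj₁ (m , d)) ]′
          (point x S ∣x∣)))
        (+-monoʳ-≤ (# (Label? x)) (≤-trans
          (#-union (Other? x) (Sub? 1 (X ─ x)) (λ y S → Other? x S ×-dec (∣ y ∩ S ∣ ≤? 0)) c
            (λ S ((s , m) , i) → X ─ S ,
              ( (equation (X ∷ S ∷ []) (t ∷ []) (∥ s0 ∖ s1) (lit 1) 0 (∥ s1 ⋒ s0 ≅˘ x0 ∵ m ∙
                  ∥ s0 ≅ x0 ⊕ lit 1 ∵ ∣X∣ ∙ []) 0 (∥ s1 ⋒ s0 ≅ x0 ∵ m ∙ ∥ s0 ≅˘ x0 ⊕ lit 1 ∵ ∣X∣ ∙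
                  []))
              , (linear (X ∷ S ∷ x ∷ []) [] 0 ((s0 ∖ s1) ⋐ (s0 ∖ s2)) (s2 ⋐ s1 ∵ i ∙ [])))
              , ((s , m) , i) , (linear (X ∷ S ∷ []) [] 0 (∥ (s0 ∖ s1) ⋒ s1 ≼ lit 0) [])) h)
          (≤-reflexive (trans (cong (_* c) (trans (#-points (X ─ x))
            (equation (X ∷ x ∷ []) (t ∷ []) (∥ s0 ∖ s1) (x0) 0 (∥ s0 ≅ x0 ⊕ lit 1 ∵ ∣X∣ ∙
                ∥ s1 ≅˘ lit 1 ∵ ∣x∣ ∙ s1 ⋐ s0 ∵ x⊑X ∙ []) 0 (∥ s0 ≅˘ x0 ⊕ lit 1 ∵ ∣X∣ ∙
                ∥ s1 ≅ lit 1 ∵ ∣x∣ ∙ [])))) (*-comm t c)))))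

      -- The two members miss different points of `X`, so they share only `t - 1` points there and
      -- need another one outside.
      label-hits : ∀ {S S′} → Label x S → Other x S′ → 1 ≤ ∣ S ∩ (S′ ─ X) ∣
      label-hits {S} {S′} ((s , m) , d) ((s′ , m′) , i) =
        (linear (S ∷ S′ ∷ X ∷ x ∷ []) (t ∷ []) 0 (lit 1 ≼ ∥ s0 ⋒ (s1 ∖ s2))
            (x0 ≼ ∥ s0 ⋒ s1 ∵ meet S S′ s s′ ∙ ∥ s1 ⋒ s2 ≅ x0 ∵ m′ ∙ ∥ s3 ⋒ s0 ≼ lit 0 ∵ d ∙
            s3 ⋐ s1 ∵ i ∙ ∥ s3 ≅˘ lit 1 ∵ ∣x∣ ∙ s3 ⋐ s2 ∵ x⊑X ∙ []))

      label-⊒ : ∀ {S} → Label x S → (X ─ x) ⊑ S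
      label-⊒ {S} ((s , m) , d) = linear (X ∷ x ∷ S ∷ []) (t ∷ []) 0 ((s0 ∖ s1) ⋐ s2)
          (∥ s2 ⋒ s0 ≅˘ x0 ∵ m ∙ ∥ s1 ⋒ s2 ≼ lit 0 ∵ d ∙ s1 ⋐ s0 ∵ x⊑X ∙ ∥ s1 ≅˘ lit 1 ∵ ∣x∣ ∙
          ∥ s0 ≅ x0 ⊕ lit 1 ∵ ∣X∣ ∙ [])

      edge : ∀ {S} → Mid S → ∣ S ─ X ∣ ≡ 2
      edge {S} (s , m) = equation (S ∷ X ∷ []) (t ∷ []) (∥ s0 ∖ s1) (lit 2) 0 (∥ s0 ⋒ s1 ≅˘ x0 ∵ m ∙
          ∥ s0 ≅ x0 ⊕ lit 2 ∵ size S s ∙ []) 0 (∥ s0 ⋒ s1 ≅ x0 ∵ m ∙ ∥ s0 ≅˘ x0 ⊕ lit 2 ∵ size S s ∙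
          [])

      -- The edges of a label hit an edge S′ ─ X of another label.
      Label≤ : ∀ c S′ → Other x S′ → (∀ p → Sub 1 (S′ ─ X) p →
        # (λ S → Label? x S ×-dec p ⊑? S) ≤ c) →
               # (Label? x) ≤ 2 * c
      Label≤ c S′ o h = ≤-trans
        (#-union (Label? x) (Sub? 1 (S′ ─ X)) (λ p S → Label? x S ×-dec p ⊑? S) c
          (λ S l → let p , s , j = hit-point S (S′ ─ X) (label-hits l o) in p , s , l , j) h)
        (≤-reflexive (cong (_* c) (trans (#-points (S′ ─ X)) (edge (proj₁ o)))))

      module _ (p : Subset n) (∣p∣ : ∣ p ∣ ≡ 1) (p-X : ∣ p ∩ X ∣ ≤ 0) where

        ∣X─x∪p∣ : ∣ (X ─ x) ∪ p ∣ ≡ t + 1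
        ∣X─x∪p∣ = equation (X ∷ x ∷ p ∷ []) (t ∷ []) (∥ (s0 ∖ s1) ⋓ s2) (x0 ⊕ lit 1) 0
            (∥ s2 ≅ lit 1 ∵ ∣p∣ ∙ s1 ⋐ s0 ∵ x⊑X ∙ ∥ s1 ≅˘ lit 1 ∵ ∣x∣ ∙ ∥ s0 ≅ x0 ⊕ lit 1 ∵ ∣X∣ ∙
            []) 0 (∥ s2 ≅˘ lit 1 ∵ ∣p∣ ∙ ∥ s2 ⋒ s0 ≼ lit 0 ∵ p-X ∙ ∥ s1 ≅ lit 1 ∵ ∣x∣ ∙
            ∥ s0 ≅˘ x0 ⊕ lit 1 ∵ ∣X∣ ∙ [])

        Label∋≤ : # (λ S → Label? x S ×-dec p ⊑? S) ≤ deg 𝒮? ((X ─ x) ∪ p)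
        Label∋≤ = #-mono (λ S → Label? x S ×-dec p ⊑? S) (above? 𝒮? ((X ─ x) ∪ p))
          (λ S (l , i) → proj₁ (proj₁ l) , ∪-⊑ (X ─ x) p S (label-⊒ l) i)

        Label∋≤1 : ∀ q → ∣ q ∣ ≡ 1 → ∣ q ∩ X ∣ ≤ 0 → ∣ q ∩ p ∣ ≤ 0 →
                   # (λ S → (Label? x S ×-dec p ⊑? S) ×-dec q ⊑? S) ≤ 1
        Label∋≤1 q ∣q∣ q-X q-p = ≤-trans
          (#-mono (λ S → (Label? x S ×-dec p ⊑? S) ×-dec q ⊑? S) (above? 𝒮? (((X ─ x) ∪ p) ∪ q))
            (λ S ((l , i) , j) → proj₁ (proj₁ l) , ∪-⊑ ((X ─ x) ∪ p) q S
              (∪-⊑ (X ─ x) p S (label-⊒ l) i) j))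
          (deg≤1 (((X ─ x) ∪ p) ∪ q)
            (equation (X ∷ x ∷ p ∷ q ∷ []) (t ∷ []) (∥ ((s0 ∖ s1) ⋓ s2) ⋓ s3) (x0 ⊕ lit 2) 0
                (∥ (s0 ∖ s1) ⋓ s2 ≅ x0 ⊕ lit 1 ∵ ∣X─x∪p∣ ∙ ∥ s3 ≅ lit 1 ∵ ∣q∣ ∙ []) 0
                (∥ (s0 ∖ s1) ⋓ s2 ≅˘ x0 ⊕ lit 1 ∵ ∣X─x∪p∣ ∙ ∥ s3 ≅˘ lit 1 ∵ ∣q∣ ∙
                ∥ s3 ⋒ s0 ≼ lit 0 ∵ q-X ∙ ∥ s3 ⋒ s2 ≼ lit 0 ∵ q-p ∙ [])))

-- The interesting case is that label `x` has at least four edges. An edge with another label hits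
-- all of them, which makes such edges few or ties them to one point. They may all coincide, or two
-- of them may be adjacent or disjoint; these are the cases behind `alternatives`.
module LargeLabel {n} (t : ℕ) {𝒮 : Subset n → Set} (𝒮? : Decidable 𝒮)
                  (size : ∀ S → 𝒮 S → ∣ S ∣ ≡ t + 2)
                  (meet : ∀ S S′ → 𝒮 S → 𝒮 S′ → t ≤ ∣ S ∩ S′ ∣)
                  (X : Subset n) (∣X∣ : ∣ X ∣ ≡ t + 1)
                  (Δ : ℕ) (deg≤Δ : ∀ Y → ∣ Y ∣ ≡ t + 1 → deg 𝒮? Y ≤ Δ)
                  (x : Subset n) (∣x∣ : ∣ x ∣ ≡ 1) (x⊑X : x ⊑ X) where

  private module L = Labels t 𝒮? size meet
  open L using (deg≤1)
  private
    Mid = L.Mid X ∣X∣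
    Mid? = L.Mid? X ∣X∣
    Label = L.Label X ∣X∣
    Label? = L.Label? X ∣X∣
    Other = L.Other X ∣X∣ x
    Other? = L.Other? X ∣X∣ x
    edge = L.edge X ∣X∣ x ∣x∣ x⊑X

  Label∋? : ∀ y p → Decidable (λ S → Label y S × p ⊑ S)
  Label∋? y p S = Label? y S ×-dec p ⊑? S

  OtherAvoiding? : ∀ y → Decidable (λ S → Other S × ∣ y ∩ S ∣ ≤ 0)
  OtherAvoiding? y S = Other? S ×-dec (∣ y ∩ S ∣ ≤? 0)

  -- If all edges with other labels coincide, each label `y` other than `x` has at most one member,
  -- namely `X ─ y` with that edge.
  one-edge : ∀ S′ → Other S′ → (∀ S → Other S → (S ─ X) ⊑ S′) → # Mid? ≤ # (Label? x) + t
  one-edge S′ ((s′ , m′) , _) h = ≤-trans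
    (L.Mid≤Label+ X ∣X∣ x ∣x∣ x⊑X 1 (λ y (∣y∣ , i) → #≤1 (OtherAvoiding? y)
      (λ S S₂ (o , d) (o₂ , d₂) → ⊑-antisym (same y ∣y∣ i S S₂ o d o₂ d₂)
        (same y ∣y∣ i S₂ S o₂ d₂ o d))))
    (≤-reflexive (cong (# (Label? x) +_) (*-identityˡ t)))
    where
    same : ∀ y → ∣ y ∣ ≡ 1 → y ⊑ (X ─ x) → ∀ S S₂ → Other S → ∣ y ∩ S ∣ ≤ 0 → Other S₂ →
      ∣ y ∩ S₂ ∣ ≤ 0 → S ⊑ S₂
    same y ∣y∣ i S S₂ ((s , m) , o) d ((s₂ , m₂) , o₂) d₂ = linear (S ∷ S₂ ∷ y ∷ X ∷ x ∷ S′ ∷ [])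
        (t ∷ []) 0 (s0 ⋐ s1) (∥ s2 ≅˘ lit 1 ∵ ∣y∣ ∙ s2 ⋐ (s3 ∖ s4) ∵ i ∙
        ∥ s1 ≅˘ x0 ⊕ lit 2 ∵ size S₂ s₂ ∙ ∥ s5 ≅ x0 ⊕ lit 2 ∵ size S′ s′ ∙ ∥ s5 ⋒ s3 ≅˘ x0 ∵ m′ ∙
        ∥ s2 ⋒ s0 ≼ lit 0 ∵ d ∙ ∥ s2 ⋒ s1 ≼ lit 0 ∵ d₂ ∙ (s0 ∖ s3) ⋐ s5 ∵ h S ((s , m) , o) ∙
        (s1 ∖ s3) ⋐ s5 ∵ h S₂ ((s₂ , m₂) , o₂) ∙ ∥ s3 ≅ x0 ⊕ lit 1 ∵ ∣X∣ ∙ [])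

  -- The exceptional outcome: the edges of all labels share a point. By itself it bounds nothing;
  -- each use of `alternatives` disposes of it in its own way.
  Star : Set
  Star = ∃ λ p → ∣ p ∣ ≡ 1 × ∣ p ∩ X ∣ ≤ 0 × (∀ S → Mid S → p ⊑ S)

  module TwoEdges (large : 4 ≤ # (Label? x)) (S′ S″ : Subset n) (o′ : Other S′) (o″ : Other S″)
                  (S″⋢S′ : 1 ≤ ∣ (S″ ─ X) ─ S′ ∣) where

    e′ : ∣ S′ ─ X ∣ ≡ 2
    e′ = edge (proj₁ o′)

    e″ : ∣ S″ ─ X ∣ ≡ 2
    e″ = edge (proj₁ o″)

    module Adjacent (adj : 1 ≤ ∣ (S′ ∩ S″) ─ X ∣) where

      P r s : Subset n
      P = (S′ ∩ S″) ─ X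
      r = (S′ ─ X) ─ S″
      s = (S″ ─ X) ─ S′

      ∣P∣ : ∣ P ∣ ≡ 1
      ∣P∣ = equation (S′ ∷ S″ ∷ X ∷ []) [] (∥ (s0 ⋒ s1) ∖ s2) (lit 1) 0
          (lit 1 ≼ ∥ (s1 ∖ s2) ∖ s0 ∵ S″⋢S′ ∙ ∥ s1 ∖ s2 ≅ lit 2 ∵ e″ ∙ []) 0
          (lit 1 ≼ ∥ (s0 ⋒ s1) ∖ s2 ∵ adj ∙ [])

      ∣r∣ : ∣ r ∣ ≡ 1
      ∣r∣ = equation (S′ ∷ X ∷ S″ ∷ []) [] (∥ (s0 ∖ s1) ∖ s2) (lit 1) 0
          (∥ (s0 ⋒ s2) ∖ s1 ≅˘ lit 1 ∵ ∣P∣ ∙ ∥ s0 ∖ s1 ≅ lit 2 ∵ e′ ∙ []) 0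
          (∥ (s0 ⋒ s2) ∖ s1 ≅ lit 1 ∵ ∣P∣ ∙ ∥ s0 ∖ s1 ≅˘ lit 2 ∵ e′ ∙ [])

      ∣s∣ : ∣ s ∣ ≡ 1
      ∣s∣ = equation (S″ ∷ X ∷ S′ ∷ []) [] (∥ (s0 ∖ s1) ∖ s2) (lit 1) 0
          (∥ (s2 ⋒ s0) ∖ s1 ≅˘ lit 1 ∵ ∣P∣ ∙ ∥ s0 ∖ s1 ≅ lit 2 ∵ e″ ∙ []) 0
          (∥ (s2 ⋒ s0) ∖ s1 ≅ lit 1 ∵ ∣P∣ ∙ ∥ s0 ∖ s1 ≅˘ lit 2 ∵ e″ ∙ [])

      P-X : ∣ P ∩ X ∣ ≤ 0
      P-X = linear (S′ ∷ S″ ∷ X ∷ []) [] 0 (∥ ((s0 ⋒ s1) ∖ s2) ⋒ s2 ≼ lit 0) []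
      r-X : ∣ r ∩ X ∣ ≤ 0
      r-X = linear (S′ ∷ X ∷ S″ ∷ []) [] 0 (∥ ((s0 ∖ s1) ∖ s2) ⋒ s1 ≼ lit 0) []
      s-X : ∣ s ∩ X ∣ ≤ 0
      s-X = linear (S″ ∷ X ∷ S′ ∷ []) [] 0 (∥ ((s0 ∖ s1) ∖ s2) ⋒ s1 ≼ lit 0) []

      -- `P ∪ r` and `P ∪ s` are edges with labels other than `x`, so an edge of label `x` that
      -- avoids `P` can only be `r ∪ s`.
      avoids-P : ∀ S → Label x S → ∣ P ∩ S ∣ ≤ 0 → r ⊑ S × s ⊑ S
      avoids-P S l d =
        (linear (S′ ∷ X ∷ S″ ∷ S ∷ []) [] 0 (((s0 ∖ s1) ∖ s2) ⋐ s3)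
            (lit 1 ≼ ∥ s3 ⋒ (s0 ∖ s1) ∵ L.label-hits X ∣X∣ x ∣x∣ x⊑X l o′ ∙
            ∥ ((s0 ⋒ s2) ∖ s1) ⋒ s3 ≼ lit 0 ∵ d ∙ ∥ (s0 ∖ s1) ∖ s2 ≅ lit 1 ∵ ∣r∣ ∙ [])) ,
        (linear (S″ ∷ X ∷ S′ ∷ S ∷ []) [] 0 (((s0 ∖ s1) ∖ s2) ⋐ s3)
            (lit 1 ≼ ∥ s3 ⋒ (s0 ∖ s1) ∵ L.label-hits X ∣X∣ x ∣x∣ x⊑X l o″ ∙
            ∥ ((s2 ⋒ s0) ∖ s1) ⋒ s3 ≼ lit 0 ∵ d ∙ ∥ (s0 ∖ s1) ∖ s2 ≅ lit 1 ∵ ∣s∣ ∙ []))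

      Label≤+1 : # (Label? x) ≤ # (Label∋? x P) + 1
      Label≤+1 = ≤-trans
        (#-∪ (Label? x) (Label∋? x P) (λ S → Label∋? x r S ×-dec s ⊑? S)
          (λ S l → [ (λ i → inj₁ (l , i)) , (λ d → let i , j = avoids-P S l d in inj₂ ((l , i) , j))
            ]′ (point P S ∣P∣)))
        (+-monoʳ-≤ (# (Label∋? x P)) (L.Label∋≤1 X ∣X∣ x ∣x∣ x⊑X r ∣r∣ r-X s ∣s∣ s-X
          (linear (S″ ∷ X ∷ S′ ∷ []) [] 0 (∥ ((s0 ∖ s1) ∖ s2) ⋒ ((s2 ∖ s1) ∖ s0) ≼ lit 0) [])))

      Label≤Δ+1 : # (Label? x) ≤ Δ + 1
      Label≤Δ+1 = ≤-trans Label≤+1 (+-monoˡ-≤ 1 (≤-trans (L.Label∋≤ X ∣X∣ x ∣x∣ x⊑X P ∣P∣ P-X)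
        (deg≤Δ ((X ─ x) ∪ P) (L.∣X─x∪p∣ X ∣X∣ x ∣x∣ x⊑X P ∣P∣ P-X))))

      Label∋P≤2 : ∀ S → Other S → ∣ P ∩ S ∣ ≤ 0 → # (Label∋? x P) ≤ 2
      Label∋P≤2 S o d = ≤-trans
        (#-union (Label∋? x P) (Sub? 1 (S ─ X)) (λ q S₁ → Label∋? x P S₁ ×-dec q ⊑? S₁) 1
          (λ S₁ (l , i) → let q , b , j = hit-point S₁ (S ─ X) (L.label-hits X ∣X∣ x ∣x∣ x⊑X l o) in
                                q , b , (l , i) , j)
          (λ q (∣q∣ , i) → L.Label∋≤1 X ∣X∣ x ∣x∣ x⊑X P ∣P∣ P-X q ∣q∣
            (linear (q ∷ X ∷ S ∷ []) [] 0 (∥ s0 ⋒ s1 ≼ lit 0) (s0 ⋐ (s2 ∖ s1) ∵ i ∙ []))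
            (subst (_≤ 0) refl (linear (q ∷ P ∷ S ∷ X ∷ []) [] 0 (∥ s0 ⋒ s1 ≼ lit 0)
                (s0 ⋐ (s2 ∖ s3) ∵ i ∙ ∥ s1 ⋒ s2 ≼ lit 0 ∵ d ∙ [])))))
        (≤-reflexive (trans (*-identityʳ _) (trans (#-points (S ─ X)) (edge (proj₁ o)))))

      -- If an edge with another label avoided `P`, the edges of label `x` at `P` would have to end
      -- in one of its two points. Together with `r ∪ s` this leaves at most three.
      Other∋P : ∀ S → Other S → P ⊑ S
      Other∋P S o with point P S ∣P∣
      ... | inj₁ i = i
      ... | inj₂ d = contradiction (≤-trans large (≤-trans Label≤+1
        (+-monoˡ-≤ 1 (Label∋P≤2 S o d)))) 1+n≰n

      conclusion : Star ⊎ # Mid? ≤ Δ + 1 + 2 * t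
      conclusion with ∃? (λ S → Label? x S ×-dec (∣ P ∩ S ∣ ≤? 0))
      ... | no ¬w = inj₁ (P , ∣P∣ , P-X , star)
        where
        star : ∀ S → Mid S → P ⊑ S
        star S m with point x S ∣x∣ | point P S ∣P∣
        ... | _      | inj₁ i = i
        ... | inj₁ j | inj₂ d = Other∋P S (m , j)
        ... | inj₂ c | inj₂ d = contradiction (S , (m , c) , d) ¬w
      -- The edge of `S₀` avoids `P`. Edges with other labels contain `P` and hit this edge, so
      -- there are at most two for each label.
      ... | yes (S₀ , l₀ , d₀) = inj₂ (≤-trans
        (L.Mid≤Label+ X ∣X∣ x ∣x∣ x⊑X 2 few) (+-monoˡ-≤ (2 * t) Label≤Δ+1))
        where
        few : ∀ y → Sub 1 (X ─ x) y → # (OtherAvoiding? y) ≤ 2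
        few y (∣y∣ , i) = ≤-trans
          (#-union (OtherAvoiding? y) (Sub? 1 (S₀ ─ X)) (λ q S → Label∋? y P S ×-dec q ⊑? S) 1
            (λ S (o , d) →
              let q , b , j = hit-point S (S₀ ─ X) (linear (S ∷ S₀ ∷ X ∷ []) [] 0
                    (lit 1 ≼ ∥ s0 ⋒ (s1 ∖ s2))
                    (lit 1 ≼ ∥ s1 ⋒ (s0 ∖ s2) ∵ L.label-hits X ∣X∣ x ∣x∣ x⊑X l₀ o ∙ []))
              in q , b , (((proj₁ o) , d) , Other∋P S o) , j)
            (λ q (∣q∣ , k) → L.Label∋≤1 X ∣X∣ y ∣y∣ (linear (y ∷ X ∷ x ∷ []) [] 0 (s0 ⋐ s1)
                (s0 ⋐ (s1 ∖ s2) ∵ i ∙ [])) P ∣P∣ P-X q ∣q∣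
              (linear (q ∷ X ∷ S₀ ∷ []) [] 0 (∥ s0 ⋒ s1 ≼ lit 0) (s0 ⋐ (s2 ∖ s1) ∵ k ∙ [])) (linear
                  (q ∷ P ∷ S₀ ∷ X ∷ []) [] 0 (∥ s0 ⋒ s1 ≼ lit 0) (s0 ⋐ (s2 ∖ s3) ∵ k ∙
                  ∥ s1 ⋒ s2 ≼ lit 0 ∵ d₀ ∙ []))))
          (≤-reflexive (trans (*-identityʳ _) (trans (#-points (S₀ ─ X)) (edge (proj₁ l₀)))))

    module Disjoint (dis : ∣ (S′ ∩ S″) ─ X ∣ ≤ 0) where

      pair? : ∀ a b → Decidable (λ S → (Label x S × a ⊑ S) × b ⊑ S)
      pair? a b S = Label∋? x a S ×-dec b ⊑? S

      cover₁ : ∀ S → Label x S → ∃ λ a → Sub 1 (S′ ─ X) a × Label x S × a ⊑ S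
      cover₁ S l = let a , b , j = hit-point S (S′ ─ X) (L.label-hits X ∣X∣ x ∣x∣ x⊑X l o′) in a , b
        , l , j

      cover₂ : ∀ a S → Label x S × a ⊑ S → ∃ λ b → Sub 1 (S″ ─ X) b × (Label x S × a ⊑ S) × b ⊑ S
      cover₂ a S l = let b , c , j = hit-point S (S″ ─ X)
                           (L.label-hits X ∣X∣ x ∣x∣ x⊑X (proj₁ l) o″) in b , c , l , j

      pair≤1 : ∀ a → Sub 1 (S′ ─ X) a → ∀ b → Sub 1 (S″ ─ X) b → # (pair? a b) ≤ 1
      pair≤1 a (∣a∣ , i) b (∣b∣ , j) = L.Label∋≤1 X ∣X∣ x ∣x∣ x⊑X a ∣a∣ (linear (a ∷ X ∷ S′ ∷ []) []
          0 (∥ s0 ⋒ s1 ≼ lit 0) (s0 ⋐ (s2 ∖ s1) ∵ i ∙ [])) b ∣b∣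
        (linear (b ∷ X ∷ S″ ∷ []) [] 0 (∥ s0 ⋒ s1 ≼ lit 0) (s0 ⋐ (s2 ∖ s1) ∵ j ∙ []))
        (linear (b ∷ a ∷ S′ ∷ X ∷ S″ ∷ []) [] 0 (∥ s0 ⋒ s1 ≼ lit 0) (s1 ⋐ (s2 ∖ s3) ∵ i ∙
            s0 ⋐ (s4 ∖ s3) ∵ j ∙ ∥ (s2 ⋒ s4) ∖ s3 ≼ lit 0 ∵ dis ∙ []))

      ∣e′∣ : # (Sub? 1 (S′ ─ X)) ≡ 2
      ∣e′∣ = trans (#-points (S′ ─ X)) e′
      ∣e″∣ : # (Sub? 1 (S″ ─ X)) ≡ 2
      ∣e″∣ = trans (#-points (S″ ─ X)) e″

      star≤2 : ∀ a → Sub 1 (S′ ─ X) a → # (Label∋? x a) ≤ 2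
      star≤2 a i = ≤-trans (#-union (Label∋? x a) (Sub? 1 (S″ ─ X)) (pair? a) 1 (cover₂ a)
        (pair≤1 a i))
        (≤-reflexive (trans (*-identityʳ _) ∣e″∣))

      Label≤4 : # (Label? x) ≤ 4
      Label≤4 = ≤-trans (#-union (Label? x) (Sub? 1 (S′ ─ X)) (Label∋? x) 2 cover₁ star≤2)
        (≤-reflexive (cong (_* 2) ∣e′∣))

      -- Edges of label `x` lie in the four-cycle between two disjoint edges; there are at least
      -- four of them, so they fill it.
      complete : ∀ a → Sub 1 (S′ ─ X) a → ∀ b → Sub 1 (S″ ─ X) b → ∃ λ S →
        (Label x S × a ⊑ S) × b ⊑ S
      complete a i b j with ∃? (pair? a b)
      ... | yes w = w
      ... | no ¬w = contradiction (≤-trans (s≤s large) (≤-trans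
        (#-union-strict (Label? x) (Sub? 1 (S′ ─ X)) (Label∋? x) 2 cover₁ star≤2 a i
          (≤-trans (#-union-strict (Label∋? x a) (Sub? 1 (S″ ─ X)) (pair? a) 1 (cover₂ a)
            (pair≤1 a i) b j
            (s≤s (≤-reflexive (#-none (pair? a b) (λ S p → ¬w (S , p))))))
            (≤-reflexive (trans (*-identityʳ _) ∣e″∣))))
        (≤-reflexive (cong (_* 2) ∣e′∣)))) 1+n≰n

      -- A pair of points that hits all four sides of the four-cycle is one of its two diagonals.
      contains : ∀ S → Other S → (S′ ─ X) ⊑ S ⊎ (S″ ─ X) ⊑ S
      contains S o with (S′ ─ X) ⊑? S | (S″ ─ X) ⊑? S
      ... | yes i | _     = inj₁ i
      ... | no _  | yes j = inj₂ j
      ... | no i  | no j  =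
        let a , ∣a∣ , k = choose ((S′ ─ X) ─ S) 1 (≰⇒> i)
            b , ∣b∣ , h = choose ((S″ ─ X) ─ S) 1 (≰⇒> j)
            a⊑ = linear (a ∷ S′ ∷ X ∷ S ∷ []) [] 0 (s0 ⋐ (s1 ∖ s2)) (s0 ⋐ ((s1 ∖ s2) ∖ s3) ∵ k ∙ [])
            b⊑ = linear (b ∷ S″ ∷ X ∷ S ∷ []) [] 0 (s0 ⋐ (s1 ∖ s2)) (s0 ⋐ ((s1 ∖ s2) ∖ s3) ∵ h ∙ [])
            S₁ , (l , p) , q = complete a (∣a∣ , a⊑) b (∣b∣ , b⊑)
        in (impossible (linear (S₁ ∷ S ∷ X ∷ a ∷ b ∷ S′ ∷ S″ ∷ []) [] 0 (lit 1 ≼ lit 0)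
            (lit 1 ≼ ∥ s0 ⋒ (s1 ∖ s2) ∵ L.label-hits X ∣X∣ x ∣x∣ x⊑X l o ∙
            ∥ s0 ∖ s2 ≅ lit 2 ∵ edge (proj₁ l) ∙ s3 ⋐ s0 ∵ p ∙ s4 ⋐ s0 ∵ q ∙ ∥ s3 ≅˘ lit 1 ∵ ∣a∣ ∙
            ∥ s4 ≅˘ lit 1 ∵ ∣b∣ ∙ s3 ⋐ ((s5 ∖ s2) ∖ s1) ∵ k ∙ s4 ⋐ ((s6 ∖ s2) ∖ s1) ∵ h ∙
            ∥ (s5 ⋒ s6) ∖ s2 ≼ lit 0 ∵ dis ∙ [])))

      unique? : ∀ S₀ y → Decidable (λ S → Label y S × (S₀ ─ X) ⊑ S)
      unique? S₀ y = Label∋? y (S₀ ─ X)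

      unique : ∀ S₀ y → ∣ S₀ ─ X ∣ ≡ 2 → ∣ y ∣ ≡ 1 → y ⊑ X → # (unique? S₀ y) ≤ 1
      unique S₀ y e ∣y∣ i = ≤-trans
        (#-mono (unique? S₀ y) (above? 𝒮? ((X ─ y) ∪ (S₀ ─ X)))
          (λ S (l , j) → proj₁ (proj₁ l) , ∪-⊑ (X ─ y) (S₀ ─ X) S (L.label-⊒ X ∣X∣ y ∣y∣ i l) j))
        (deg≤1 ((X ─ y) ∪ (S₀ ─ X)) (equation (X ∷ y ∷ S₀ ∷ []) (t ∷ []) (∥ (s0 ∖ s1) ⋓ (s2 ∖ s0))
            (x0 ⊕ lit 2) 0 (∥ s2 ∖ s0 ≅ lit 2 ∵ e ∙ ∥ s1 ≅˘ lit 1 ∵ ∣y∣ ∙ s1 ⋐ s0 ∵ i ∙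
            ∥ s0 ≅ x0 ⊕ lit 1 ∵ ∣X∣ ∙ []) 0 (∥ s2 ∖ s0 ≅˘ lit 2 ∵ e ∙ ∥ s1 ≅ lit 1 ∵ ∣y∣ ∙
            ∥ s0 ≅˘ x0 ⊕ lit 1 ∵ ∣X∣ ∙ [])))

      conclusion : # Mid? ≤ 4 + 2 * t
      conclusion = ≤-trans (L.Mid≤Label+ X ∣X∣ x ∣x∣ x⊑X 2 few) (+-monoˡ-≤ (2 * t) Label≤4)
        where
        few : ∀ y → Sub 1 (X ─ x) y → # (OtherAvoiding? y) ≤ 2
        few y (∣y∣ , i) = let j = (linear (y ∷ X ∷ x ∷ []) [] 0 (s0 ⋐ s1) (s0 ⋐ (s1 ∖ s2) ∵ i ∙ []))
                                in ≤-trans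
          (#-∪ (OtherAvoiding? y) (unique? S′ y) (unique? S″ y)
            (λ S (o , d) → [ (λ k → inj₁ ((proj₁ o , d) , k)) , (λ k → inj₂ ((proj₁ o , d) , k)) ]′
              (contains S o)))
          (+-mono-≤ (unique S′ y e′ ∣y∣ j) (unique S″ y e″ ∣y∣ j))

  alternatives : 4 ≤ # (Label? x) → ∀ S′ → Other S′ →
    Star ⊎ # Mid? ≤ # (Label? x) + t ⊎ # Mid? ≤ Δ + 1 + 2 * t ⊎ # Mid? ≤ 4 + 2 * t
  alternatives large S′ o′ with ∀? Other? (λ S → (S ─ X) ⊑? S′)
  ... | inj₁ h = inj₂ (inj₁ (one-edge S′ o′ h))
  ... | inj₂ (S″ , o″ , ne) with 1 ≤? ∣ (S′ ∩ S″) ─ X ∣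
  ...   | yes adj = [ inj₁ , (λ h → inj₂ (inj₂ (inj₁ h))) ]′
                      (TwoEdges.Adjacent.conclusion large S′ S″ o′ o″ (≰⇒> ne) adj)
  ...   | no ¬adj = inj₂ (inj₂ (inj₂ (TwoEdges.Disjoint.conclusion large S′ S″ o′ o″ (≰⇒> ne)
    (s≤s⁻¹ (≰⇒> ¬adj)))))

-- Comparison of the numbers of covers

C2-suc : ∀ m → suc m C 2 ≡ m + m C 2
C2-suc m = trans (sym (nCk+nC[k+1]≡[n+1]C[k+1] m 1)) (cong (_+ m C 2) (nC1≡n m))

-- The right side mirrors a count around a `(t+1)`-set: at most `3 * t + 6` members that miss at
-- most one of its points, and one member for each pair of points that is missed.
C2-+3 : ∀ t → (t + 4) C 2 ≡ 3 * t + 6 + (t + 1) C 2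
C2-+3 t = begin
  (t + 4) C 2
    ≡⟨ step 2 ⟩
  3 + t + (t + 3) C 2
    ≡⟨ cong (3 + t +_) (step 1) ⟩
  3 + t + (2 + t + (t + 2) C 2)
    ≡⟨ cong (λ c → 3 + t + (2 + t + c)) (step 0) ⟩
  3 + t + (2 + t + (1 + t + (t + 1) C 2))
    ≡⟨ (equation {n = 0} [] (t ∷ ((t + 1) C 2) ∷ []) (lit 3 ⊕ x0 ⊕ (lit 2 ⊕ x0 ⊕ (lit 1 ⊕ x0 ⊕ x1)))
        (3 ⊛ x0 ⊕ lit 6 ⊕ x1) 0 [] 0 []) ⟩
  3 * t + 6 + (t + 1) C 2 ∎
  where
  open ≡-Reasoning
  step : ∀ a → (t + (2 + a)) C 2 ≡ 1 + a + t + (t + (1 + a)) C 2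
  step a = begin
    (t + (2 + a)) C 2                ≡⟨ cong (_C 2) (+-suc t (1 + a)) ⟩
    suc (t + (1 + a)) C 2            ≡⟨ C2-suc (t + (1 + a)) ⟩
    t + (1 + a) + (t + (1 + a)) C 2  ≡⟨ cong (_+ (t + (1 + a)) C 2) (+-comm t (1 + a)) ⟩
    1 + a + t + (t + (1 + a)) C 2    ∎

-- The difference of the two sides is (m - a)(m - a + 1)/2, half a product of consecutive integers.
tangent : ∀ a m → a * m ≤ (m + 1) C 2 + a C 2
tangent zero    m       = z≤n
tangent (suc a) zero    = ≤-trans (≤-reflexive (*-zeroʳ a)) z≤n
tangent (suc a) (suc m) = begin
  suc m + a * suc m                       ≡⟨ cong (suc m +_) (*-suc a m) ⟩
  suc m + (a + a * m)                     ≤⟨ +-monoʳ-≤ (suc m) (+-monoʳ-≤ a (tangent a m)) ⟩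
  suc m + (a + ((m + 1) C 2 + a C 2))
    ≡⟨ (equation {n = 0} [] (m ∷ a ∷ ((m + 1) C 2) ∷ (a C 2) ∷ []) (lit 1 ⊕ x0 ⊕ (x1 ⊕ (x2 ⊕ x3)))
        (x0 ⊕ lit 1 ⊕ x2 ⊕ (x1 ⊕ x3)) 0 [] 0 []) ⟩
  m + 1 + (m + 1) C 2 + (a + a C 2)       ≡⟨ cong₂ _+_ (sym (C2-suc (m + 1))) (sym (C2-suc a)) ⟩
  suc (m + 1) C 2 + suc a C 2             ∎
  where open ≤-Reasoning

-- This is (x - a)(y - b) ≥ 0, expanded.
cross : ∀ {a b x y} → a ≤ x → b ≤ y → a * y + b * x ≤ x * y + a * b
cross {a} {b} {x} {y} a≤x b≤y with ≤⇒≤′ a≤x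
... | ≤′-refl = ≤-reflexive (cong (a * y +_) (*-comm b a))
... | ≤′-step {x′} h rewrite *-suc b x′ =
  (linear {n = 0} [] ((a * y) ∷ b ∷ (b * x′) ∷ y ∷ (x′ * y) ∷ (a * b) ∷ []) 0
      (x0 ⊕ (x1 ⊕ x2) ≼ x3 ⊕ x4 ⊕ x5) (x0 ⊕ x2 ≼ x4 ⊕ x5 ∵ cross {a} {b} {x′} {y} (≤′⇒≤ h) b≤y ∙
      x1 ≼ x3 ∵ b≤y ∙ []))

module Thresholds (t ℓ : ℕ) (1≤t : 1 ≤ t) (3≤ℓ : 3 ≤ ℓ) where

  -- The numbers of (t+2)-covers of families of Type I, II and III with k = t + ℓ.
  N₁ N₂ N₃ : ℕ
  N₁ = ℓ * ℓ + ℓ + 1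
  N₂ = (t + 2) * ℓ + 1
  N₃ = (t + 4) C 2

  -- Falling short of any one threshold is enough, because the bound is a maximum. Which one is
  -- available depends on how `t` compares with `ℓ`.
  data Small (s : ℕ) : Set where
    below₁ : s < N₁ → Small s
    below₂ : s < N₂ → Small s
    below₃ : s < N₃ → Small s

  private
    ℓ² : 3 * ℓ ≤ ℓ * ℓ
    ℓ² = *-monoˡ-≤ ℓ 3≤ℓ

    N₂-expand : (t + 2) * ℓ ≡ t * ℓ + 2 * ℓ
    N₂-expand = *-distribʳ-+ ℓ t 2

    C₂ : 2 * t ≤ (t + 1) C 2 + 1
    C₂ = tangent 2 t

  -- The least value of `N₁`, at `ℓ = 3`, is 13.
  small₀ : ∀ {s} → s ≤ 12 → Small s
  small₀ {s} h = below₁ (linear {n = 0} [] (s ∷ (ℓ * ℓ) ∷ ℓ ∷ []) 0 (lit 1 ⊕ x0 ≼ x1 ⊕ x2 ⊕ lit 1)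
      (x0 ≼ lit 12 ∵ h ∙ 3 ⊛ x2 ≼ x1 ∵ ℓ² ∙ 4 ⟪ lit 3 ≼ x2 ∵ 3≤ℓ ⟫ []))

  small-N₃ : ∀ {s} → s < 3 * t + 6 + (t + 1) C 2 → Small s
  small-N₃ {s} h = below₃ (≤-trans h (≤-reflexive (sym (C2-+3 t))))

  small₁ : ∀ {s} → s ≤ 3 * ℓ + 3 → Small s
  small₁ {s} h = below₁ (linear {n = 0} [] (s ∷ (ℓ * ℓ) ∷ ℓ ∷ []) 0 (lit 1 ⊕ x0 ≼ x1 ⊕ x2 ⊕ lit 1)
      (x0 ≼ 3 ⊛ x2 ⊕ lit 3 ∵ h ∙ 3 ⊛ x2 ≼ x1 ∵ ℓ² ∙ lit 3 ≼ x2 ∵ 3≤ℓ ∙ []))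

  -- `N₂` is large enough if `4 ≤ ℓ`, and `N₃` if `ℓ = 3` and `2 ≤ t`; only `t = 1`, `ℓ = 3` is left
  -- to `N₁`. The next lemmas trade the thresholds in the same spirit.
  small₂ : ∀ {s} → s ≤ ℓ + 3 * t + 4 → Small s
  small₂ {s} h with 4 ≤? ℓ | 2 ≤? t
  ... | yes 4≤ℓ | _ = below₂ (linear {n = 0} [] (s ∷ ((t + 2) * ℓ) ∷ ℓ ∷ t ∷ (t * ℓ) ∷ []) 3
      (lit 1 ⊕ x0 ≼ x1 ⊕ lit 1) (4 ⟪ x0 ≼ x2 ⊕ 3 ⊛ x3 ⊕ lit 4 ∵ h ⟫
      4 ⟪ x1 ≅˘ x4 ⊕ 2 ⊛ x2 ∵ N₂-expand ⟫ 3 ⟪ 1 ⊛ x2 ⊕ 4 ⊛ x3 ≼ x4 ⊕ lit 4 ∵ cross 1≤t 4≤ℓ ⟫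
      7 ⟪ lit 4 ≼ x2 ∵ 4≤ℓ ⟫ []))
  ... | no ℓ<4 | yes 2≤t = small-N₃ (linear {n = 0} [] (s ∷ t ∷ ((t + 1) C 2) ∷ ℓ ∷ []) 2
      (lit 1 ⊕ x0 ≼ 3 ⊛ x1 ⊕ lit 6 ⊕ x2) (3 ⟪ x0 ≼ x3 ⊕ 3 ⊛ x1 ⊕ lit 4 ∵ h ⟫
      3 ⟪ lit 1 ⊕ x3 ≼ lit 4 ∵ ≰⇒> ℓ<4 ⟫ 2 ⟪ 2 ⊛ x1 ≼ x2 ⊕ lit 1 ∵ C₂ ⟫ 4 ⟪ lit 2 ≼ x1 ∵ 2≤t ⟫ []))
  ... | no ℓ<4 | no t<2 = small₀ (linear {n = 0} [] (s ∷ ℓ ∷ t ∷ []) 0 (x0 ≼ lit 12)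
      (x0 ≼ x1 ⊕ 3 ⊛ x2 ⊕ lit 4 ∵ h ∙ lit 1 ⊕ x1 ≼ lit 4 ∵ ≰⇒> ℓ<4 ∙
      3 ⟪ lit 1 ⊕ x2 ≼ lit 2 ∵ ≰⇒> t<2 ⟫ []))

  small₃ : ∀ {s} → s ≤ 3 * ℓ + 2 + t → Small s
  small₃ {s} h with 2 ≤? t | 3 ≤? t | 4 ≤? ℓ
  ... | no t<2 | _ | _ = small₁ (linear {n = 0} [] (s ∷ ℓ ∷ t ∷ []) 0 (x0 ≼ 3 ⊛ x1 ⊕ lit 3)
      (x0 ≼ 3 ⊛ x1 ⊕ lit 2 ⊕ x2 ∵ h ∙ lit 1 ⊕ x2 ≼ lit 2 ∵ ≰⇒> t<2 ∙ []))
  ... | yes _ | yes 3≤t | _ = below₂ (linear {n = 0} [] (s ∷ ((t + 2) * ℓ) ∷ ℓ ∷ t ∷ (t * ℓ) ∷ []) 8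
      (lit 1 ⊕ x0 ≼ x1 ⊕ lit 1) (9 ⟪ x0 ≼ 3 ⊛ x2 ⊕ lit 2 ⊕ x3 ∵ h ⟫
      9 ⟪ x1 ≅˘ x4 ⊕ 2 ⊛ x2 ∵ N₂-expand ⟫ 8 ⟪ 3 ⊛ x2 ⊕ 3 ⊛ x3 ≼ x4 ⊕ lit 9 ∵ cross 3≤t 3≤ℓ ⟫
      15 ⟪ lit 3 ≼ x3 ∵ 3≤t ⟫ 15 ⟪ lit 3 ≼ x2 ∵ 3≤ℓ ⟫ []))
  ... | yes _ | no t<3 | yes 4≤ℓ = below₁ (linear {n = 0} [] (s ∷ (ℓ * ℓ) ∷ ℓ ∷ t ∷ []) 3
      (lit 1 ⊕ x0 ≼ x1 ⊕ x2 ⊕ lit 1) (4 ⟪ x0 ≼ 3 ⊛ x2 ⊕ lit 2 ⊕ x3 ∵ h ⟫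
      4 ⟪ lit 1 ⊕ x3 ≼ lit 3 ∵ ≰⇒> t<3 ⟫ 3 ⟪ 4 ⊛ x2 ≼ x1 ∵ *-monoˡ-≤ ℓ 4≤ℓ ⟫ 4 ⟪ lit 4 ≼ x2 ∵ 4≤ℓ ⟫
      []))
  ... | yes 2≤t | no _ | no ℓ<4 = small-N₃ (linear {n = 0} [] (s ∷ t ∷ ((t + 1) C 2) ∷ ℓ ∷ []) 2
      (lit 1 ⊕ x0 ≼ 3 ⊛ x1 ⊕ lit 6 ⊕ x2) (3 ⟪ x0 ≼ 3 ⊛ x3 ⊕ lit 2 ⊕ x1 ∵ h ⟫
      9 ⟪ lit 1 ⊕ x3 ≼ lit 4 ∵ ≰⇒> ℓ<4 ⟫ 2 ⟪ 2 ⊛ x1 ≼ x2 ⊕ lit 1 ∵ C₂ ⟫ 10 ⟪ lit 2 ≼ x1 ∵ 2≤t ⟫ []))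

  small₄ : ∀ {s} → s ≤ 2 * ℓ + 3 + 2 * t → Small s
  small₄ {s} h with 3 ≤? t | 4 ≤? ℓ | 2 ≤? t
  ... | yes 3≤t | _ | _ = below₂ (linear {n = 0} [] (s ∷ ((t + 2) * ℓ) ∷ ℓ ∷ t ∷ (t * ℓ) ∷ []) 0
      (lit 1 ⊕ x0 ≼ x1 ⊕ lit 1) (x0 ≼ 2 ⊛ x2 ⊕ lit 3 ⊕ 2 ⊛ x3 ∵ h ∙ x1 ≅˘ x4 ⊕ 2 ⊛ x2 ∵ N₂-expand ∙
      3 ⊛ x2 ⊕ 3 ⊛ x3 ≼ x4 ⊕ lit 9 ∵ cross 3≤t 3≤ℓ ∙ lit 3 ≼ x3 ∵ 3≤t ∙ 3 ⟪ lit 3 ≼ x2 ∵ 3≤ℓ ⟫ []))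
  ... | no t<3 | yes 4≤ℓ | _ = below₁ (linear {n = 0} [] (s ∷ (ℓ * ℓ) ∷ ℓ ∷ t ∷ []) 15
      (lit 1 ⊕ x0 ≼ x1 ⊕ x2 ⊕ lit 1) (16 ⟪ x0 ≼ 2 ⊛ x2 ⊕ lit 3 ⊕ 2 ⊛ x3 ∵ h ⟫
      32 ⟪ lit 1 ⊕ x3 ≼ lit 3 ∵ ≰⇒> t<3 ⟫ 11 ⟪ 4 ⊛ x2 ≼ x1 ∵ *-monoˡ-≤ ℓ 4≤ℓ ⟫
      28 ⟪ lit 4 ≼ x2 ∵ 4≤ℓ ⟫ []))
  ... | no _ | no ℓ<4 | yes 2≤t = small-N₃ (linear {n = 0} [] (s ∷ t ∷ ((t + 1) C 2) ∷ ℓ ∷ []) 2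
      (lit 1 ⊕ x0 ≼ 3 ⊛ x1 ⊕ lit 6 ⊕ x2) (3 ⟪ x0 ≼ 2 ⊛ x3 ⊕ lit 3 ⊕ 2 ⊛ x1 ∵ h ⟫
      6 ⟪ lit 1 ⊕ x3 ≼ lit 4 ∵ ≰⇒> ℓ<4 ⟫ 2 ⟪ 2 ⊛ x1 ≼ x2 ⊕ lit 1 ∵ C₂ ⟫ 7 ⟪ lit 2 ≼ x1 ∵ 2≤t ⟫ []))
  ... | no _ | no ℓ<4 | no t<2 = small₀ (linear {n = 0} [] (s ∷ ℓ ∷ t ∷ []) 0 (x0 ≼ lit 12)
      (x0 ≼ 2 ⊛ x1 ⊕ lit 3 ⊕ 2 ⊛ x2 ∵ h ∙ 2 ⟪ lit 1 ⊕ x1 ≼ lit 4 ∵ ≰⇒> ℓ<4 ⟫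
      2 ⟪ lit 1 ⊕ x2 ≼ lit 2 ∵ ≰⇒> t<2 ⟫ []))

  small₅ : ∀ {s} → s ≤ 4 * t + 6 → Small s
  small₅ {s} h with 2 ≤? t
  ... | yes 2≤t = small-N₃ (linear {n = 0} [] (s ∷ t ∷ ((t + 1) C 2) ∷ []) 0
      (lit 1 ⊕ x0 ≼ 3 ⊛ x1 ⊕ lit 6 ⊕ x2) (x0 ≼ 4 ⊛ x1 ⊕ lit 6 ∵ h ∙ 2 ⊛ x1 ≼ x2 ⊕ lit 1 ∵ C₂ ∙
      lit 2 ≼ x1 ∵ 2≤t ∙ []))
  ... | no t<2  = small₀ (linear {n = 0} [] (s ∷ t ∷ []) 0 (x0 ≼ lit 12) (x0 ≼ 4 ⊛ x1 ⊕ lit 6 ∵ h ∙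
      4 ⟪ lit 1 ⊕ x1 ≼ lit 2 ∵ ≰⇒> t<2 ⟫ []))

  -- For t ≤ 2 a Type II family is never the largest.
  small-N₂ : ∀ {s} → t ≤ 2 → s ≤ N₂ → Small s
  small-N₂ {s} t≤2 h with 2 ≤? t | 4 ≤? ℓ
  ... | yes 2≤t | yes 4≤ℓ = below₁ (linear {n = 0} [] (s ∷ (ℓ * ℓ) ∷ ℓ ∷ ((t + 2) * ℓ) ∷ []) 15
      (lit 1 ⊕ x0 ≼ x1 ⊕ x2 ⊕ lit 1) (16 ⟪ x0 ≼ x3 ⊕ lit 1 ∵ h ⟫
      16 ⟪ x3 ≼ 4 ⊛ x2 ∵ *-monoˡ-≤ ℓ (+-monoˡ-≤ 2 t≤2) ⟫ 13 ⟪ 4 ⊛ x2 ≼ x1 ∵ *-monoˡ-≤ ℓ 4≤ℓ ⟫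
      4 ⟪ lit 4 ≼ x2 ∵ 4≤ℓ ⟫ []))
  ... | yes 2≤t | no ℓ<4 = small-N₃ (linear {n = 0} []
      (s ∷ t ∷ ((t + 1) C 2) ∷ ((t + 2) * ℓ) ∷ ℓ ∷ []) 2 (lit 1 ⊕ x0 ≼ 3 ⊛ x1 ⊕ lit 6 ⊕ x2)
      (3 ⟪ x0 ≼ x3 ⊕ lit 1 ∵ h ⟫ 3 ⟪ x3 ≼ 4 ⊛ x4 ∵ *-monoˡ-≤ ℓ (+-monoˡ-≤ 2 t≤2) ⟫
      12 ⟪ lit 1 ⊕ x4 ≼ lit 4 ∵ ≰⇒> ℓ<4 ⟫ 2 ⟪ 2 ⊛ x1 ≼ x2 ⊕ lit 1 ∵ C₂ ⟫ 13 ⟪ lit 2 ≼ x1 ∵ 2≤t ⟫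
      []))
  ... | no t<2 | _ = small₁ (linear {n = 0} [] (s ∷ ℓ ∷ ((t + 2) * ℓ) ∷ []) 0 (x0 ≼ 3 ⊛ x1 ⊕ lit 3)
      (x0 ≼ x2 ⊕ lit 1 ∵ h ∙ x2 ≼ 3 ⊛ x1 ∵ *-monoˡ-≤ ℓ (+-monoˡ-≤ 2 (s≤s⁻¹ (≰⇒> t<2))) ∙ []))

-- Covers of a maximal family

module Setting {n} (t ℓ : ℕ) (1≤t : 1 ≤ t) (3≤ℓ : 3 ≤ ℓ) (room : (t + 2) + (t + ℓ) ≤ n)
               {𝔽 : Subset n → Set} (𝔽? : Decidable 𝔽)
               (size𝔽 : ∀ F → 𝔽 F → ∣ F ∣ ≡ t + ℓ)
               (meet𝔽 : ∀ F G → 𝔽 F → 𝔽 G → t ≤ ∣ F ∩ G ∣)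
               (maximal : ∀ X → ∣ X ∣ ≡ t + ℓ → (∀ F → 𝔽 F → t ≤ ∣ X ∩ F ∣) → 𝔽 X) where

  open Thresholds t ℓ 1≤t 3≤ℓ public

  Covers : Subset n → Set
  Covers X = ∀ F → 𝔽 F → t ≤ ∣ F ∩ X ∣

  covers? : ∀ X → Covers X ⊎ ∃ λ F → 𝔽 F × ∣ F ∩ X ∣ < t
  covers? X with ∀? 𝔽? (λ F → t ≤? ∣ F ∩ X ∣)
  ... | inj₁ c           = inj₁ c
  ... | inj₂ (F , f , h) = inj₂ (F , f , ≰⇒> h)

  Covers? : Decidable Covers
  Covers? X with covers? X
  ... | inj₁ c           = yes c
  ... | inj₂ (F , f , h) = no λ c → <⇒≱ h (c F f)

  𝒮 : Subset n → Set
  𝒮 S = ∣ S ∣ ≡ t + 2 × Covers S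

  𝒮? : Decidable 𝒮
  𝒮? S = ∣ S ∣ ≟ t + 2 ×-dec Covers? S

  size : ∀ S → 𝒮 S → ∣ S ∣ ≡ t + 2
  size S = proj₁

  -- S extends to a k-set G with G ∩ S′ = S ∩ S′; it belongs to 𝔽 by maximality.
  meet : ∀ S S′ → 𝒮 S → 𝒮 S′ → t ≤ ∣ S ∩ S′ ∣
  meet S S′ (∣S∣ , c) (∣S′∣ , c′) with between S (S ∪ ∁ S′) (t + ℓ) (linear (S ∷ S′ ∷ []) [] 0
      (s0 ⋐ (s0 ⋓ (cmpl s1))) [])
      (linear (S ∷ []) (t ∷ ℓ ∷ []) 2 (∥ s0 ≼ x0 ⊕ x1) (3 ⟪ ∥ s0 ≅ x0 ⊕ lit 2 ∵ ∣S∣ ⟫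
          2 ⟪ lit 3 ≼ x1 ∵ 3≤ℓ ⟫ []))
      (linear (S ∷ S′ ∷ []) (t ∷ ℓ ∷ n ∷ []) 0 (x0 ⊕ x1 ≼ ∥ s0 ⋓ (cmpl s1))
          (∥ s1 ⋓ (cmpl s1) ≅˘ x2 ∵ whole S′ ∙ x0 ⊕ lit 2 ⊕ (x0 ⊕ x1) ≼ x2 ∵ room ∙
          ∥ s1 ≅ x0 ⊕ lit 2 ∵ ∣S′∣ ∙ []))
  ... | G , ∣G∣ , S⊑G , G⊑ = linear (S ∷ S′ ∷ G ∷ []) (t ∷ []) 0 (x0 ≼ ∥ s0 ⋒ s1)
      (x0 ≼ ∥ s2 ⋒ s1 ∵ c′ G g ∙ s2 ⋐ (s0 ⋓ (cmpl s1)) ∵ G⊑ ∙ [])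
    where
    g : 𝔽 G
    g = maximal G ∣G∣ (λ F f → ≤-trans (c F f) (linear (F ∷ S ∷ G ∷ []) [] 0 (∥ s0 ⋒ s1 ≼ ∥ s2 ⋒ s0)
        (s1 ⋐ s2 ∵ S⊑G ∙ [])))

  deg≤ : (∀ X → ∣ X ∣ ≡ t + 1 → ∃ λ F → 𝔽 F × ∣ F ∩ X ∣ < t) → ∀ X → ∣ X ∣ ≡ t + 1 →
    deg 𝒮? X ≤ ℓ + 1
  deg≤ noCover X e =
    let F , f , h = noCover X e in ≤-trans
      (deg-branch 𝒮? F X t ℓ 1 (λ S (_ , c) → (linear (S ∷ F ∷ []) (t ∷ []) 0 (x0 ≼ ∥ s0 ⋒ s1)
          (x0 ≼ ∥ s1 ⋒ s0 ∵ c F f ∙ []))) (size𝔽 F f) h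
        (λ Y e′ → deg-top 𝒮? (t + 2) size Y (equation (Y ∷ X ∷ []) (t ∷ []) (∥ s0) (x0 ⊕ lit 2) 0
            (∥ s1 ≅ x0 ⊕ lit 1 ∵ e ∙ ∥ s0 ≅ ∥ s1 ⊕ lit 1 ∵ e′ ∙ []) 0 (∥ s1 ≅˘ x0 ⊕ lit 1 ∵ e ∙
            ∥ s0 ≅˘ ∥ s1 ⊕ lit 1 ∵ e′ ∙ []))))
      (≤-reflexive (trans (*-identityʳ _) (+-comm 1 ℓ)))

  module Nontrivial (noCover : ∀ X → ∣ X ∣ ≡ t + 1 → ∃ λ F → 𝔽 F × ∣ F ∩ X ∣ < t)
                    (nontrivial : ∀ T → ∣ T ∣ ≡ t → ∃ λ S → 𝒮 S × ∣ S ∩ T ∣ < t)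
                    (far : ∀ W → 𝒮 W → ∃ λ S → 𝒮 S × ∣ S ∩ W ∣ ≤ t) where

    open Labels t 𝒮? size meet

    module Heavy (X : Subset n) (∣X∣ : ∣ X ∣ ≡ t + 1) (heavy : 4 ≤ deg 𝒮? X) where

      degX : deg 𝒮? X ≤ ℓ + 1
      degX = deg≤ noCover X ∣X∣

      -- Branching on a `(t+2)`-set that meets `X` in fewer than `t` points leaves at most three
      -- members above `X`. This is the origin of the 4 in `heavy`.
      near : ∀ S → 𝒮 S → t ≤ ∣ S ∩ X ∣
      near S s with t ≤? ∣ S ∩ X ∣
      ... | yes h = h
      ... | no ¬h = contradiction (≤-trans heavy (deg-branch 𝒮? S X t 2 1 (λ S′ s′ → meet S′ S s′ s)
        (proj₁ s) (≰⇒> ¬h)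
        (λ Y e → deg≤1 Y (equation (Y ∷ X ∷ []) (t ∷ []) (∥ s0) (x0 ⊕ lit 2) 0
            (∥ s1 ≅ x0 ⊕ lit 1 ∵ ∣X∣ ∙ ∥ s0 ≅ ∥ s1 ⊕ lit 1 ∵ e ∙ []) 0 (∥ s1 ≅˘ x0 ⊕ lit 1 ∵ ∣X∣ ∙
            ∥ s0 ≅˘ ∥ s1 ⊕ lit 1 ∵ e ∙ []))))) 1+n≰n

      split : # 𝒮? ≤ deg 𝒮? X + # (Mid? X ∣X∣)
      split = #-∪ 𝒮? (above? 𝒮? X) (Mid? X ∣X∣) cases
        where
        cases : ∀ S → 𝒮 S → (𝒮 S × X ⊑ S) ⊎ Mid X ∣X∣ S
        cases S s with X ⊑? S
        ... | yes i = inj₁ (s , i)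
        ... | no ¬i = inj₂ (s , (equation (S ∷ X ∷ []) (t ∷ []) (∥ s0 ⋒ s1) (x0) 0
            (lit 1 ≼ ∥ s1 ∖ s0 ∵ ≰⇒> ¬i ∙ ∥ s1 ≅ x0 ⊕ lit 1 ∵ ∣X∣ ∙ []) 0
            (x0 ≼ ∥ s0 ⋒ s1 ∵ near S s ∙ [])))

      S₀ : Subset n
      S₀ = proj₁ (#-witness (above? 𝒮? X) (≤-trans (s≤s z≤n) heavy))

      s₀ : 𝒮 S₀
      s₀ = proj₁ (proj₂ (#-witness (above? 𝒮? X) (≤-trans (s≤s z≤n) heavy)))

      X⊑S₀ : X ⊑ S₀
      X⊑S₀ = proj₂ (proj₂ (#-witness (above? 𝒮? X) (≤-trans (s≤s z≤n) heavy)))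

      module _ (x : Subset n) (∣x∣ : ∣ x ∣ ≡ 1) (x⊑X : x ⊑ X) (large : 4 ≤ # (Label? X ∣X∣ x)) where

        open LargeLabel t 𝒮? size meet X ∣X∣ (ℓ + 1) (deg≤ noCover) x ∣x∣ x⊑X using (Star; alternatives)

        -- A member that does not contain the `t`-set `X ─ x` still has `t` points in `X`, so it
        -- contains `x` and misses another point of `X`.
        other : ∃ λ S → Other X ∣X∣ x S
        other with nontrivial (X ─ x) (equation (X ∷ x ∷ []) (t ∷ []) (∥ s0 ∖ s1) (x0) 0
            (∥ s0 ≅ x0 ⊕ lit 1 ∵ ∣X∣ ∙ ∥ s1 ≅˘ lit 1 ∵ ∣x∣ ∙ s1 ⋐ s0 ∵ x⊑X ∙ []) 0
            (∥ s0 ≅˘ x0 ⊕ lit 1 ∵ ∣X∣ ∙ ∥ s1 ≅ lit 1 ∵ ∣x∣ ∙ []))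
        ... | S , s , h = S , (s , (equation (S ∷ X ∷ x ∷ []) (t ∷ []) (∥ s0 ⋒ s1) (x0) 0
            (lit 1 ⊕ ∥ s0 ⋒ (s1 ∖ s2) ≼ x0 ∵ h ∙ ∥ s2 ≅ lit 1 ∵ ∣x∣ ∙ []) 0
            (x0 ≼ ∥ s0 ⋒ s1 ∵ near S s ∙ [])))
          , (linear (x ∷ S ∷ X ∷ []) (t ∷ []) 0 (s0 ⋐ s1) (x0 ≼ ∥ s1 ⋒ s2 ∵ near S s ∙
              lit 1 ⊕ ∥ s1 ⋒ (s2 ∖ s0) ≼ x0 ∵ h ∙ ∥ s0 ≅ lit 1 ∵ ∣x∣ ∙ []))

        star : Star → Small (# 𝒮?)
        star (p , ∣p∣ , p-X , all) with covers? (X ∪ p)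
        -- If `X ∪ p` is a cover, every member meets it in more than `t` points: in all of `X`, or
        -- in `t` points of `X` and in `p`. This contradicts `far`.
        ... | inj₁ c with far (X ∪ p) ((equation (X ∷ p ∷ []) (t ∷ []) (∥ s0 ⋓ s1) (x0 ⊕ lit 2) 0
            (∥ s0 ≅ x0 ⊕ lit 1 ∵ ∣X∣ ∙ ∥ s1 ≅ lit 1 ∵ ∣p∣ ∙ []) 0 (∥ s0 ≅˘ x0 ⊕ lit 1 ∵ ∣X∣ ∙
            ∥ s1 ≅˘ lit 1 ∵ ∣p∣ ∙ ∥ s1 ⋒ s0 ≼ lit 0 ∵ p-X ∙ [])) , c)
        ...   | S , s , h with ∣ S ∩ X ∣ ≟ t
        ...     | yes m = impossible (linear (S ∷ X ∷ p ∷ []) (t ∷ []) 0 (lit 1 ≼ lit 0)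
            (∥ s0 ⋒ s1 ≅˘ x0 ∵ m ∙ s2 ⋐ s0 ∵ all S (s , m) ∙ ∥ s0 ⋒ (s1 ⋓ s2) ≼ x0 ∵ h ∙
            ∥ s2 ⋒ s1 ≼ lit 0 ∵ p-X ∙ ∥ s2 ≅˘ lit 1 ∵ ∣p∣ ∙ []))
        ...     | no m  = contradiction (≤-antisym (linear (S ∷ X ∷ p ∷ []) (t ∷ []) 0
            (∥ s0 ⋒ s1 ≼ x0) (∥ s0 ⋒ (s1 ⋓ s2) ≼ x0 ∵ h ∙ [])) (near S s)) m
        -- Otherwise `F` avoids `p` and exactly two points of `X`. A member of `Mid` has `t` points
        -- in `F` although it spends one on `p`, so the point of `X` that it misses is one of those
        -- two.
        star (p , ∣p∣ , p-X , all) | inj₂ (F , f , h) = small₁ (≤-trans split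
          (linear {n = 0} [] ((deg 𝒮? X) ∷ (# (Mid? X ∣X∣)) ∷ ℓ ∷ []) 0 (x0 ⊕ x1 ≼ 3 ⊛ x2 ⊕ lit 3)
              (x0 ≼ x2 ⊕ lit 1 ∵ degX ∙ x1 ≼ 2 ⊛ (x2 ⊕ lit 1) ∵ mid ∙ [])))
          where
          ∣F∩X∣ : 1 + ∣ F ∩ X ∣ ≡ t
          ∣F∩X∣ = equation (F ∷ X ∷ p ∷ S₀ ∷ []) (t ∷ []) (lit 1 ⊕ ∥ s0 ⋒ s1) (x0) 0
              (lit 1 ⊕ ∥ s0 ⋒ (s1 ⋓ s2) ≼ x0 ∵ h ∙ []) 0 (x0 ≼ ∥ s0 ⋒ s3 ∵ proj₂ s₀ F f ∙
              ∥ s3 ≅ x0 ⊕ lit 2 ∵ proj₁ s₀ ∙ s1 ⋐ s3 ∵ X⊑S₀ ∙ ∥ s1 ≅˘ x0 ⊕ lit 1 ∵ ∣X∣ ∙ [])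

          ∣X─F∣ : ∣ X ─ F ∣ ≡ 2
          ∣X─F∣ = equation (X ∷ F ∷ []) (t ∷ []) (∥ s0 ∖ s1) (lit 2) 0
              (lit 1 ⊕ ∥ s1 ⋒ s0 ≅˘ x0 ∵ ∣F∩X∣ ∙ ∥ s0 ≅ x0 ⊕ lit 1 ∵ ∣X∣ ∙ []) 0
              (lit 1 ⊕ ∥ s1 ⋒ s0 ≅ x0 ∵ ∣F∩X∣ ∙ ∥ s0 ≅˘ x0 ⊕ lit 1 ∵ ∣X∣ ∙ [])

          mid : # (Mid? X ∣X∣) ≤ 2 * (ℓ + 1)
          mid = ≤-trans
            (#-union (Mid? X ∣X∣) (Sub? 1 (X ─ F)) (λ y → above? 𝒮? ((X ─ y) ∪ p)) (ℓ + 1)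
              (λ S (s , m) → X ─ S ,
                ( (equation (X ∷ S ∷ []) (t ∷ []) (∥ s0 ∖ s1) (lit 1) 0 (∥ s1 ⋒ s0 ≅˘ x0 ∵ m ∙
                    ∥ s0 ≅ x0 ⊕ lit 1 ∵ ∣X∣ ∙ []) 0 (∥ s1 ⋒ s0 ≅ x0 ∵ m ∙ ∥ s0 ≅˘ x0 ⊕ lit 1 ∵ ∣X∣ ∙
                    []))
                , (linear (X ∷ S ∷ F ∷ p ∷ []) (t ∷ []) 0 ((s0 ∖ s1) ⋐ (s0 ∖ s2))
                    (∥ s1 ⋒ s0 ≅˘ x0 ∵ m ∙ ∥ s1 ≅ x0 ⊕ lit 2 ∵ proj₁ s ∙ s3 ⋐ s1 ∵ all S (s , m) ∙
                    x0 ≼ ∥ s2 ⋒ s1 ∵ proj₂ s F f ∙ lit 1 ⊕ ∥ s2 ⋒ (s0 ⋓ s3) ≼ x0 ∵ h ∙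
                    ∥ s3 ≅˘ lit 1 ∵ ∣p∣ ∙ ∥ s3 ⋒ s0 ≼ lit 0 ∵ p-X ∙ [])) )
                , s , (linear (X ∷ S ∷ p ∷ []) [] 0 (((s0 ∖ (s0 ∖ s1)) ⋓ s2) ⋐ s1)
                    (s2 ⋐ s1 ∵ all S (s , m) ∙ [])))
              (λ y (∣y∣ , i) → deg≤ noCover ((X ─ y) ∪ p) (equation (X ∷ y ∷ p ∷ F ∷ []) (t ∷ [])
                  (∥ (s0 ∖ s1) ⋓ s2) (x0 ⊕ lit 1) 0 (∥ s1 ≅˘ lit 1 ∵ ∣y∣ ∙ s1 ⋐ (s0 ∖ s3) ∵ i ∙
                  ∥ s0 ≅ x0 ⊕ lit 1 ∵ ∣X∣ ∙ ∥ s2 ≅ lit 1 ∵ ∣p∣ ∙ []) 0 (∥ s1 ≅ lit 1 ∵ ∣y∣ ∙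
                  ∥ s0 ≅˘ x0 ⊕ lit 1 ∵ ∣X∣ ∙ ∥ s2 ≅˘ lit 1 ∵ ∣p∣ ∙ ∥ s2 ⋒ s0 ≼ lit 0 ∵ p-X ∙ []))))
            (≤-reflexive (cong (_* (ℓ + 1)) (trans (#-points (X ─ F)) ∣X─F∣)))

        module _ (S′ : Subset n) (o′ : Other X ∣X∣ x S′) where

          private
            e′ : ∣ S′ ─ X ∣ ≡ 2
            e′ = edge X ∣X∣ x ∣x∣ x⊑X (proj₁ o′)

            out : ∀ p → p ⊑ (S′ ─ X) → ∣ p ∩ X ∣ ≤ 0
            out p i = linear (p ∷ X ∷ S′ ∷ []) [] 0 (∥ s0 ⋒ s1 ≼ lit 0) (s0 ⋐ (s2 ∖ s1) ∵ i ∙ [])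

            Labels≤ : ∀ p → Sub 1 (S′ ─ X) p → # (λ S → Label? X ∣X∣ x S ×-dec p ⊑? S) ≤ deg 𝒮?
              ((X ─ x) ∪ p)
            Labels≤ p (∣p∣ , i) = Label∋≤ X ∣X∣ x ∣x∣ x⊑X p ∣p∣ (out p i)

            X─x∪p≤ : ∀ p → Sub 1 (S′ ─ X) p → deg 𝒮? ((X ─ x) ∪ p) ≤ ℓ + 1
            X─x∪p≤ p (∣p∣ , i) = deg≤ noCover ((X ─ x) ∪ p)
              (∣X─x∪p∣ X ∣X∣ x ∣x∣ x⊑X p ∣p∣ (out p i))

          label≤ : # (Label? X ∣X∣ x) ≤ 2 * (ℓ + 1)
          label≤ = Label≤ X ∣X∣ x ∣x∣ x⊑X (ℓ + 1) S′ o′ (λ p i → ≤-trans (Labels≤ p i) (X─x∪p≤ p i))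

          -- The cover `X ∪ p` takes a place in the degree of `(X ─ x) ∪ p` but contains `x`, so it
          -- does not have label `x`.
          label< : ∀ p → Sub 1 (S′ ─ X) p → 𝒮 (X ∪ p) → # (Label? X ∣X∣ x) < 2 * (ℓ + 1)
          label< p i c = ≤-trans
            (#-union-strict (Label? X ∣X∣ x) (Sub? 1 (S′ ─ X))
              (λ p S → Label? X ∣X∣ x S ×-dec p ⊑? S) (ℓ + 1)
              (λ S l → let q , s , j = hit-point S (S′ ─ X) (label-hits X ∣X∣ x ∣x∣ x⊑X l o′) in q ,
                s , l , j)
              (λ p i → ≤-trans (Labels≤ p i) (X─x∪p≤ p i)) p i
              (≤-trans (#-strict (λ S → Label? X ∣X∣ x S ×-dec p ⊑? S) (above? 𝒮? ((X ─ x) ∪ p))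
                (λ S (l , j) → proj₁ (proj₁ l) , ∪-⊑ (X ─ x) p S (label-⊒ X ∣X∣ x ∣x∣ x⊑X l) j)
                (X ∪ p) (c , (linear (X ∷ x ∷ p ∷ []) [] 0 (((s0 ∖ s1) ⋓ s2) ⋐ (s0 ⋓ s2)) []))
                (λ ((_ , d) , _) → (impossible (linear (x ∷ X ∷ p ∷ []) [] 0 (lit 1 ≼ lit 0)
                    (∥ s0 ⋒ (s1 ⋓ s2) ≼ lit 0 ∵ d ∙ s0 ⋐ s1 ∵ x⊑X ∙ ∥ s0 ≅˘ lit 1 ∵ ∣x∣ ∙ [])))))
                (X─x∪p≤ p i)))
            (≤-reflexive (cong (_* (ℓ + 1)) (trans (#-points (S′ ─ X)) e′)))

          private
            F = proj₁ (noCover X ∣X∣)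
            f = proj₁ (proj₂ (noCover X ∣X∣))
            h = proj₂ (proj₂ (noCover X ∣X∣))

          -- A member above `X` adds a point of `F ─ X`. If this point is never in `S′`, it lies in
          -- `F ─ S′`, which has at most `ℓ` points since `S′` is a cover.
          deg-X≤ℓ : (∀ p → Sub 1 (S′ ─ X) p → ¬ 𝒮 (X ∪ p)) → deg 𝒮? X ≤ ℓ
          deg-X≤ℓ none = ≤-trans
            (deg-hit 𝒮? X ((F ─ X) ─ S′) 1 hits
              (λ b (∣b∣ , i) → deg≤1 (X ∪ b) (equation (X ∷ b ∷ F ∷ S′ ∷ []) (t ∷ []) (∥ s0 ⋓ s1)
                  (x0 ⊕ lit 2) 0 (∥ s0 ≅ x0 ⊕ lit 1 ∵ ∣X∣ ∙ ∥ s1 ≅ lit 1 ∵ ∣b∣ ∙ []) 0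
                  (∥ s0 ≅˘ x0 ⊕ lit 1 ∵ ∣X∣ ∙ ∥ s1 ≅˘ lit 1 ∵ ∣b∣ ∙ s1 ⋐ ((s2 ∖ s0) ∖ s3) ∵ i ∙
                    []))))
            (≤-trans (≤-reflexive (*-identityʳ _))
              (linear (F ∷ X ∷ S′ ∷ []) (ℓ ∷ t ∷ []) 0 (∥ (s0 ∖ s1) ∖ s2 ≼ x0)
                  (x1 ≼ ∥ s0 ⋒ s2 ∵ proj₂ (proj₁ (proj₁ o′)) F f ∙ ∥ s0 ≅ x1 ⊕ x0 ∵ size𝔽 F f ∙
                    [])))
            where
            hits : ∀ S → 𝒮 S → X ⊑ S → 1 ≤ ∣ S ∩ ((F ─ X) ─ S′) ∣
            hits S s i with 1 ≤? ∣ S ∩ ((F ─ X) ─ S′) ∣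
            ... | yes g = g
            ... | no ¬g = contradiction (subst 𝒮 (⊑-antisym
                (linear (S ∷ X ∷ []) [] 0 (s0 ⋐ (s1 ⋓ (s0 ∖ s1))) []) (linear (X ∷ S ∷ []) [] 0
                    ((s0 ⋓ (s1 ∖ s0)) ⋐ s1) (s0 ⋐ s1 ∵ i ∙ []))) s)
              (none (S ─ X) ( (equation (S ∷ X ∷ []) (t ∷ []) (∥ s0 ∖ s1) (lit 1) 0
                  (∥ s0 ≅ x0 ⊕ lit 2 ∵ proj₁ s ∙ s1 ⋐ s0 ∵ i ∙ ∥ s1 ≅˘ x0 ⊕ lit 1 ∵ ∣X∣ ∙ []) 0
                  (∥ s0 ≅˘ x0 ⊕ lit 2 ∵ proj₁ s ∙ ∥ s1 ≅ x0 ⊕ lit 1 ∵ ∣X∣ ∙ []))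
                , (linear (S ∷ X ∷ S′ ∷ F ∷ []) (t ∷ []) 0 ((s0 ∖ s1) ⋐ (s2 ∖ s1))
                    (∥ s0 ⋒ ((s3 ∖ s1) ∖ s2) ≼ lit 0 ∵ s≤s⁻¹ (≰⇒> ¬g) ∙
                    x0 ≼ ∥ s3 ⋒ s0 ∵ proj₂ s F f ∙ lit 1 ⊕ ∥ s3 ⋒ s1 ≼ x0 ∵ h ∙
                    ∥ s0 ≅ x0 ⊕ lit 2 ∵ proj₁ s ∙ s1 ⋐ s0 ∵ i ∙ ∥ s1 ≅˘ x0 ⊕ lit 1 ∵ ∣X∣ ∙ [])) ))

          -- The obvious bounds `ℓ + 1`, `2 * (ℓ + 1)` and `t` add up to one more than `small₃`
          -- allows; for `t = 1` and `ℓ = 3` their sum is `N₁` itself. Whether or not some `X ∪ p`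
          -- with `p` in the edge of `S′` is a cover, one of the first two bounds improves.
          one-edge-small : # (Mid? X ∣X∣) ≤ # (Label? X ∣X∣ x) + t → Small (# 𝒮?)
          one-edge-small m with ∃? (λ p → Sub? 1 (S′ ─ X) p ×-dec 𝒮? (X ∪ p))
          ... | yes (p , i , c) = small₃ (linear {n = 0} []
              ((# 𝒮?) ∷ ℓ ∷ t ∷ (deg 𝒮? X) ∷ (# (Mid? X ∣X∣)) ∷ (# (Label? X ∣X∣ x)) ∷ []) 0
              (x0 ≼ 3 ⊛ x1 ⊕ lit 2 ⊕ x2) (x0 ≼ x3 ⊕ x4 ∵ split ∙ x4 ≼ x5 ⊕ x2 ∵ m ∙
              x3 ≼ x1 ⊕ lit 1 ∵ degX ∙ lit 1 ⊕ x5 ≼ 2 ⊛ (x1 ⊕ lit 1) ∵ label< p i c ∙ []))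
          ... | no ¬w = small₃ (linear {n = 0} []
              ((# 𝒮?) ∷ ℓ ∷ t ∷ (deg 𝒮? X) ∷ (# (Mid? X ∣X∣)) ∷ (# (Label? X ∣X∣ x)) ∷ []) 0
              (x0 ≼ 3 ⊛ x1 ⊕ lit 2 ⊕ x2) (x0 ≼ x3 ⊕ x4 ∵ split ∙ x4 ≼ x5 ⊕ x2 ∵ m ∙
              x3 ≼ x1 ∵ deg-X≤ℓ (λ p i c → ¬w (p , i , c)) ∙ x5 ≼ 2 ⊛ (x1 ⊕ lit 1) ∵ label≤ ∙ []))

        large-small : Small (# 𝒮?)
        large-small with alternatives large (proj₁ other) (proj₂ other)
        ... | inj₁ s = star s
        ... | inj₂ (inj₁ m) = one-edge-small (proj₁ other) (proj₂ other) m
        ... | inj₂ (inj₂ (inj₁ m)) = small₄ (linear {n = 0} []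
            ((# 𝒮?) ∷ ℓ ∷ t ∷ (deg 𝒮? X) ∷ (# (Mid? X ∣X∣)) ∷ []) 0 (x0 ≼ 2 ⊛ x1 ⊕ lit 3 ⊕ 2 ⊛ x2)
            (x0 ≼ x3 ⊕ x4 ∵ split ∙ x3 ≼ x1 ⊕ lit 1 ∵ degX ∙ x4 ≼ x1 ⊕ lit 1 ⊕ lit 1 ⊕ 2 ⊛ x2 ∵ m ∙
            []))
        ... | inj₂ (inj₂ (inj₂ m)) = small₄ (linear {n = 0} []
            ((# 𝒮?) ∷ ℓ ∷ t ∷ (deg 𝒮? X) ∷ (# (Mid? X ∣X∣)) ∷ []) 2 (x0 ≼ 2 ⊛ x1 ⊕ lit 3 ⊕ 2 ⊛ x2)
            (3 ⟪ x0 ≼ x3 ⊕ x4 ∵ split ⟫ 3 ⟪ x3 ≼ x1 ⊕ lit 1 ∵ degX ⟫ 3 ⟪ x4 ≼ lit 4 ⊕ 2 ⊛ x2 ∵ m ⟫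
            2 ⟪ lit 3 ≼ x1 ∵ 3≤ℓ ⟫ []))

      small : Small (# 𝒮?)
      small with ∃? (λ x → Sub? 1 X x ×-dec (4 ≤? # (Label? X ∣X∣ x)))
      ... | yes (x , (∣x∣ , i) , large) = large-small x ∣x∣ i large
      ... | no ¬w = small₂ (linear {n = 0} [] ((# 𝒮?) ∷ ℓ ∷ t ∷ (deg 𝒮? X) ∷ (# (Mid? X ∣X∣)) ∷ [])
          0 (x0 ≼ x1 ⊕ 3 ⊛ x2 ⊕ lit 4) (x0 ≼ x3 ⊕ x4 ∵ split ∙ x3 ≼ x1 ⊕ lit 1 ∵ degX ∙
          x4 ≼ 3 ⊛ (x2 ⊕ lit 1) ∵ Mid≤ X ∣X∣ 3 (λ x i → s≤s⁻¹ (≰⇒> (λ l → ¬w (x , i , l)))) ∙ []))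

-- Families in which every (t+1)-set lies in at most three members

C-sym : ∀ t → (t + 4) C (t + 2) ≡ (t + 4) C 2
C-sym t = trans (nCk≡nC[n∸k] {t + 2} {t + 4} (+-monoʳ-≤ t (s≤s (s≤s z≤n))))
  (cong ((t + 4) C_) ([m+n]∸[m+o]≡n∸o t 4 2))

module Light {n} (t ℓ : ℕ) (1≤t : 1 ≤ t) (3≤ℓ : 3 ≤ ℓ) {𝒮 : Subset n → Set} (𝒮? : Decidable 𝒮)
             (size : ∀ S → 𝒮 S → ∣ S ∣ ≡ t + 2)
             (meet : ∀ S S′ → 𝒮 S → 𝒮 S′ → t ≤ ∣ S ∩ S′ ∣)
             (nontrivial : ∀ T → ∣ T ∣ ≡ t → ∃ λ S → 𝒮 S × ∣ S ∩ T ∣ < t) where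

  open Thresholds t ℓ 1≤t 3≤ℓ
  open Labels t 𝒮? size meet

  deg-T : ∀ Δ → (∀ Y → ∣ Y ∣ ≡ t + 1 → deg 𝒮? Y ≤ Δ) → ∀ T → ∣ T ∣ ≡ t → deg 𝒮? T ≤ 3 * Δ
  deg-T Δ d T ∣T∣ = let S , s , h = nontrivial T ∣T∣ in
    deg-branch 𝒮? S T t 2 Δ (λ S′ s′ → meet S′ S s′ s) (size S s) h
      (λ Y e → d Y (trans e (cong (_+ 1) ∣T∣)))

  deg≥2 : ∀ A B Y → 𝒮 A → 𝒮 B → ¬ A ≡ B → Y ⊑ A → Y ⊑ B → 2 ≤ deg 𝒮? Y
  deg≥2 A B Y a b ne i j = ≤-trans
    (s≤s (≤-trans (s≤s z≤n) (others-< (others? (above? 𝒮? Y) A) B ((b , j) , ne ∘ sym))))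
    (others-< (above? 𝒮? Y) A (a , i))

  module At (X : Subset n) (∣X∣ : ∣ X ∣ ≡ t + 1) (Δ : ℕ) (Δ≤3 : Δ ≤ 3)
            (deg≤Δ : ∀ Y → ∣ Y ∣ ≡ t + 1 → deg 𝒮? Y ≤ Δ)
            (S₀ : Subset n) (s₀ : 𝒮 S₀) (X⊑S₀ : X ⊑ S₀) where

    Low : Subset n → Set
    Low S = 𝒮 S × 1 + ∣ S ∩ X ∣ ≡ t

    Low? : Decidable Low
    Low? S = 𝒮? S ×-dec (1 + ∣ S ∩ X ∣ ≟ t)

    Upper : Subset n → Set
    Upper S = 𝒮 S × t ≤ ∣ S ∩ X ∣

    Upper? : Decidable Upper
    Upper? S = 𝒮? S ×-dec (t ≤? ∣ S ∩ X ∣)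

    level : ∀ S → 𝒮 S → Upper S ⊎ Low S
    level S s with t ≤? ∣ S ∩ X ∣
    ... | yes h = inj₁ (s , h)
    ... | no ¬h = inj₂ (s , (equation (S ∷ X ∷ S₀ ∷ []) (t ∷ []) (lit 1 ⊕ ∥ s0 ⋒ s1) (x0) 0
        (lit 1 ⊕ ∥ s0 ⋒ s1 ≼ x0 ∵ ≰⇒> ¬h ∙ []) 0 (x0 ≼ ∥ s0 ⋒ s2 ∵ meet S S₀ s s₀ ∙ s1 ⋐ s2 ∵ X⊑S₀ ∙
        ∥ s2 ≅ x0 ⊕ lit 2 ∵ size S₀ s₀ ∙ ∥ s1 ≅˘ x0 ⊕ lit 1 ∵ ∣X∣ ∙ [])))

    split : # 𝒮? ≤ # Upper? + # Low?
    split = #-∪ 𝒮? Upper? Low? level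

    upper : ∀ S → Upper S → (𝒮 S × X ⊑ S) ⊎ Mid X ∣X∣ S
    upper S (s , h) with X ⊑? S
    ... | yes i = inj₁ (s , i)
    ... | no ¬i = inj₂ (s , (equation (S ∷ X ∷ []) (t ∷ []) (∥ s0 ⋒ s1) (x0) 0
        (lit 1 ≼ ∥ s1 ∖ s0 ∵ ≰⇒> ¬i ∙ ∥ s1 ≅ x0 ⊕ lit 1 ∵ ∣X∣ ∙ []) 0 (x0 ≼ ∥ s0 ⋒ s1 ∵ h ∙ [])))

    Upper≤ : # Upper? ≤ deg 𝒮? X + # (Mid? X ∣X∣)
    Upper≤ = #-∪ Upper? (above? 𝒮? X) (Mid? X ∣X∣) upper

    -- In this order: every label has at most three edges; some label has four and the other edges
    -- coincide; or two of the other edges differ; or there are no other edges, so that all of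
    -- `Upper` contains a common `t`-set.
    Bound : Set
    Bound = # Upper? ≤ deg 𝒮? X + 3 * (t + 1) ⊎ # Upper? ≤ deg 𝒮? X + (2 * Δ + t)
          ⊎ # Upper? ≤ deg 𝒮? X + (4 + 2 * t) ⊎ # Upper? ≤ 3 * Δ

    bound-large : ∀ x → ∣ x ∣ ≡ 1 → x ⊑ X → 4 ≤ # (Label? X ∣X∣ x) → Bound
    bound-large x ∣x∣ x⊑X large with ∃? (Other? X ∣X∣ x)
    ... | no ¬w = inj₂ (inj₂ (inj₂ (≤-trans (#-mono Upper? (above? 𝒮? (X ─ x)) all)
        (deg-T Δ deg≤Δ (X ─ x) (equation (X ∷ x ∷ []) (t ∷ []) (∥ s0 ∖ s1) (x0) 0
            (∥ s0 ≅ x0 ⊕ lit 1 ∵ ∣X∣ ∙ ∥ s1 ≅˘ lit 1 ∵ ∣x∣ ∙ s1 ⋐ s0 ∵ x⊑X ∙ []) 0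
            (∥ s0 ≅˘ x0 ⊕ lit 1 ∵ ∣X∣ ∙ ∥ s1 ≅ lit 1 ∵ ∣x∣ ∙ []))))))
      where
      all : ∀ S → Upper S → 𝒮 S × (X ─ x) ⊑ S
      all S u with upper S u | point x S ∣x∣
      ... | inj₁ (s , i) | _      = s , (linear (X ∷ x ∷ S ∷ []) [] 0 ((s0 ∖ s1) ⋐ s2)
          (s0 ⋐ s2 ∵ i ∙ []))
      ... | inj₂ m       | inj₁ i = contradiction (S , m , i) ¬w
      ... | inj₂ m       | inj₂ d = proj₁ m , label-⊒ X ∣X∣ x ∣x∣ x⊑X (m , d)
    ... | yes (S′ , o′) with LargeLabel.alternatives t 𝒮? size meet X ∣X∣ Δ deg≤Δ x ∣x∣ x⊑X large S′
      o′
    -- A star puts all members with label `x` above the `(t+1)`-set `(X ─ x) ∪ p`, which lies in at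
    -- most three members.
    ...   | inj₁ (p , ∣p∣ , p-X , all) = contradiction (≤-trans large (≤-trans
              (#-mono (Label? X ∣X∣ x) (above? 𝒮? ((X ─ x) ∪ p))
                (λ S l → proj₁ (proj₁ l) , ∪-⊑ (X ─ x) p S (label-⊒ X ∣X∣ x ∣x∣ x⊑X l)
                  (all S (proj₁ l))))
              (≤-trans (deg≤Δ ((X ─ x) ∪ p) (∣X─x∪p∣ X ∣X∣ x ∣x∣ x⊑X p ∣p∣ p-X)) Δ≤3))) 1+n≰n
    ...   | inj₂ (inj₁ m) = inj₂ (inj₁ (≤-trans Upper≤ (+-monoʳ-≤ (deg 𝒮? X) (≤-trans m (+-monoˡ-≤ t
              (Label≤ X ∣X∣ x ∣x∣ x⊑X Δ S′ o′ (λ p (∣p∣ , i) → let p-X = (linear (p ∷ X ∷ S′ ∷ [])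
                                                                     [] 0 (∥ s0 ⋒ s1 ≼ lit 0)
                                                                     (s0 ⋐ (s2 ∖ s1) ∵ i ∙ [])) in
                ≤-trans (Label∋≤ X ∣X∣ x ∣x∣ x⊑X p ∣p∣ p-X)
                  (deg≤Δ ((X ─ x) ∪ p) (∣X─x∪p∣ X ∣X∣ x ∣x∣ x⊑X p ∣p∣ p-X)))))))))
    ...   | inj₂ (inj₂ (inj₁ m)) = inj₂ (inj₂ (inj₁ (≤-trans Upper≤
      (+-monoʳ-≤ (deg 𝒮? X) (≤-trans m (+-monoˡ-≤ (2 * t) (+-monoˡ-≤ 1 Δ≤3)))))))
    ...   | inj₂ (inj₂ (inj₂ m)) = inj₂ (inj₂ (inj₁ (≤-trans Upper≤ (+-monoʳ-≤ (deg 𝒮? X) m))))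

    bound : Bound
    bound with ∃? (λ x → Sub? 1 X x ×-dec (4 ≤? # (Label? X ∣X∣ x)))
    ... | yes (x , (∣x∣ , i) , large) = bound-large x ∣x∣ i large
    ... | no ¬w = inj₁ (≤-trans Upper≤ (+-monoʳ-≤ (deg 𝒮? X)
      (Mid≤ X ∣X∣ 3 (λ x i → s≤s⁻¹ (≰⇒> (λ l → ¬w (x , i , l)))))))

    Missing? : ∀ D → Decidable (λ S → Low S × ∣ D ∩ S ∣ ≤ 0)
    Missing? D S = Low? S ×-dec (∣ D ∩ S ∣ ≤? 0)

    missing : ∀ S → Low S → ∃ λ D → Sub 2 X D × Low S × ∣ D ∩ S ∣ ≤ 0
    missing S (s , m) = X ─ S , ((equation (X ∷ S ∷ []) (t ∷ []) (∥ s0 ∖ s1) (lit 2) 0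
        (lit 1 ⊕ ∥ s1 ⋒ s0 ≅˘ x0 ∵ m ∙ ∥ s0 ≅ x0 ⊕ lit 1 ∵ ∣X∣ ∙ []) 0 (lit 1 ⊕ ∥ s1 ⋒ s0 ≅ x0 ∵ m ∙
        ∥ s0 ≅˘ x0 ⊕ lit 1 ∵ ∣X∣ ∙ [])) , (linear (X ∷ S ∷ []) [] 0 ((s0 ∖ s1) ⋐ s0) []))
      , (s , m) , (linear (X ∷ S ∷ []) [] 0 (∥ (s0 ∖ s1) ⋒ s1 ≼ lit 0) [])

    pairs : # (Sub? 2 X) * 1 ≡ (t + 1) C 2
    pairs = trans (*-identityʳ _) (trans (#-Sub X 2) (cong (_C 2) ∣X∣))

    Low≤ : (∀ D → Sub 2 X D → # (Missing? D) ≤ 1) → # Low? ≤ (t + 1) C 2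
    Low≤ h = ≤-trans (#-union Low? (Sub? 2 X) Missing? 1 missing h) (≤-reflexive pairs)

    Low< : (∀ D → Sub 2 X D → # (Missing? D) ≤ 1) → ∀ D → Sub 2 X D → # (Missing? D) < 1 →
      # Low? < (t + 1) C 2
    Low< h D i l = ≤-trans (#-union-strict Low? (Sub? 2 X) Missing? 1 missing h D i l)
      (≤-reflexive pairs)

  Complete : Set
  Complete = ∃ λ Z → ∣ Z ∣ ≡ t + 4 × (∀ S → Sub (t + 2) Z S → 𝒮 S)

  module Degree3 (deg≤3 : ∀ Y → ∣ Y ∣ ≡ t + 1 → deg 𝒮? Y ≤ 3)
                 (X : Subset n) (∣X∣ : ∣ X ∣ ≡ t + 1)
                 (S₁ S₂ S₃ : Subset n) (s₁ : 𝒮 S₁ × X ⊑ S₁) (s₂ : 𝒮 S₂ × X ⊑ S₂)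
                   (s₃ : 𝒮 S₃ × X ⊑ S₃)
                 (S₁≢S₂ : ¬ S₁ ≡ S₂) (S₁≢S₃ : ¬ S₁ ≡ S₃) (S₂≢S₃ : ¬ S₂ ≡ S₃) where

    distinct : ∀ A B → (𝒮 A × X ⊑ A) → (𝒮 B × X ⊑ B) → ¬ A ≡ B → (A ∩ B) ⊑ X
    distinct A B (a , i) (b , j) ne with (A ∩ B) ⊑? X
    ... | yes h = h
    ... | no ¬h = contradiction (⊑-antisym
        (linear (A ∷ B ∷ X ∷ []) (t ∷ []) 0 (s0 ⋐ s1) (lit 1 ≼ ∥ (s0 ⋒ s1) ∖ s2 ∵ ≰⇒> ¬h ∙
            s2 ⋐ s0 ∵ i ∙ s2 ⋐ s1 ∵ j ∙ ∥ s0 ≅ x0 ⊕ lit 2 ∵ size A a ∙ ∥ s2 ≅˘ x0 ⊕ lit 1 ∵ ∣X∣ ∙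
            []))
        (linear (B ∷ A ∷ X ∷ []) (t ∷ []) 0 (s0 ⋐ s1) (lit 1 ≼ ∥ (s1 ⋒ s0) ∖ s2 ∵ ≰⇒> ¬h ∙
            s2 ⋐ s1 ∵ i ∙ s2 ⋐ s0 ∵ j ∙ ∥ s0 ≅ x0 ⊕ lit 2 ∵ size B b ∙ ∥ s2 ≅˘ x0 ⊕ lit 1 ∵ ∣X∣ ∙
            []))) ne

    open At X ∣X∣ 3 ≤-refl deg≤3 S₁ (proj₁ s₁) (proj₂ s₁)

    Z : Subset n
    Z = S₁ ∪ (S₂ ∪ S₃)

    private
      d₁₂ = distinct S₁ S₂ s₁ s₂ S₁≢S₂
      d₁₃ = distinct S₁ S₃ s₁ s₃ S₁≢S₃
      d₂₃ = distinct S₂ S₃ s₂ s₃ S₂≢S₃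
      i₁ = proj₂ s₁
      i₂ = proj₂ s₂
      i₃ = proj₂ s₃
      e₁ = size S₁ (proj₁ s₁)
      e₂ = size S₂ (proj₁ s₂)
      e₃ = size S₃ (proj₁ s₃)

    ∣Z∣ : ∣ Z ∣ ≡ t + 4
    ∣Z∣ = equation (S₁ ∷ S₂ ∷ S₃ ∷ X ∷ []) (t ∷ []) (∥ s0 ⋓ (s1 ⋓ s2)) (x0 ⊕ lit 4) 0
        (s3 ⋐ s0 ∵ i₁ ∙ s3 ⋐ s1 ∵ i₂ ∙ s3 ⋐ s2 ∵ i₃ ∙ ∥ s0 ≅ x0 ⊕ lit 2 ∵ e₁ ∙
        ∥ s1 ≅ x0 ⊕ lit 2 ∵ e₂ ∙ ∥ s2 ≅ x0 ⊕ lit 2 ∵ e₃ ∙ 2 ⟪ ∥ s3 ≅˘ x0 ⊕ lit 1 ∵ ∣X∣ ⟫ []) 0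
        ((s0 ⋒ s1) ⋐ s3 ∵ d₁₂ ∙ (s0 ⋒ s2) ⋐ s3 ∵ d₁₃ ∙ (s1 ⋒ s2) ⋐ s3 ∵ d₂₃ ∙
        ∥ s0 ≅˘ x0 ⊕ lit 2 ∵ e₁ ∙ ∥ s1 ≅˘ x0 ⊕ lit 2 ∵ e₂ ∙ ∥ s2 ≅˘ x0 ⊕ lit 2 ∵ e₃ ∙
        2 ⟪ ∥ s3 ≅ x0 ⊕ lit 1 ∵ ∣X∣ ⟫ [])

    -- `S` has `t - 1` points in `X` and at least `t` in each of `S₁`, `S₂`, `S₃`, so it contains
    -- the point of each outside `X`. By its size, `S` is then `Z` without two points of `X`.
    low-⊒ : ∀ S → Low S → (Z ─ X) ⊑ S
    low-⊒ S (s , m) = linear (S₁ ∷ S₂ ∷ S₃ ∷ X ∷ S ∷ []) (t ∷ []) 0 (((s0 ⋓ (s1 ⋓ s2)) ∖ s3) ⋐ s4)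
        (x0 ≼ ∥ s4 ⋒ s0 ∵ meet S S₁ s (proj₁ s₁) ∙ x0 ≼ ∥ s4 ⋒ s1 ∵ meet S S₂ s (proj₁ s₂) ∙
        x0 ≼ ∥ s4 ⋒ s2 ∵ meet S S₃ s (proj₁ s₃) ∙ 3 ⟪ lit 1 ⊕ ∥ s4 ⋒ s3 ≅ x0 ∵ m ⟫ s3 ⋐ s0 ∵ i₁ ∙
        s3 ⋐ s1 ∵ i₂ ∙ s3 ⋐ s2 ∵ i₃ ∙ ∥ s0 ≅ x0 ⊕ lit 2 ∵ e₁ ∙ ∥ s1 ≅ x0 ⊕ lit 2 ∵ e₂ ∙
        ∥ s2 ≅ x0 ⊕ lit 2 ∵ e₃ ∙ 3 ⟪ ∥ s3 ≅˘ x0 ⊕ lit 1 ∵ ∣X∣ ⟫ [])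

    Missing≤1 : ∀ D → Sub 2 X D → # (Missing? D) ≤ 1
    Missing≤1 D (∣D∣ , i) = #≤1 (Missing? D) (λ S S′ (l , d) (l′ , d′) →
      ⊑-antisym (same S S′ l d l′ d′) (same S′ S l′ d′ l d))
      where
      same : ∀ S S′ → Low S → ∣ D ∩ S ∣ ≤ 0 → Low S′ → ∣ D ∩ S′ ∣ ≤ 0 → S ⊑ S′
      same S S′ (s , m) d (s′ , m′) d′ = linear (S ∷ S′ ∷ Z ∷ X ∷ D ∷ []) (t ∷ []) 0 (s0 ⋐ s1)
          ((s2 ∖ s3) ⋐ s0 ∵ low-⊒ S (s , m) ∙ (s2 ∖ s3) ⋐ s1 ∵ low-⊒ S′ (s′ , m′) ∙
          ∥ s2 ≅˘ x0 ⊕ lit 4 ∵ ∣Z∣ ∙ lit 1 ⊕ ∥ s0 ⋒ s3 ≅˘ x0 ∵ m ∙ lit 1 ⊕ ∥ s1 ⋒ s3 ≅˘ x0 ∵ m′ ∙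
          ∥ s4 ⋒ s0 ≼ lit 0 ∵ d ∙ ∥ s4 ⋒ s1 ≼ lit 0 ∵ d′ ∙ ∥ s4 ≅˘ lit 2 ∵ ∣D∣ ∙ s4 ⋐ s3 ∵ i ∙
          2 ⟪ ∥ s3 ≅ x0 ⊕ lit 1 ∵ ∣X∣ ⟫ ∥ s0 ≅ x0 ⊕ lit 2 ∵ size S s ∙ [])

    upper≤ : 2 ≤ t → # Upper? ≤ 3 * t + 6
    upper≤ 2≤t with bound
    ... | inj₁ b = linear {n = 0} [] ((# Upper?) ∷ t ∷ (deg 𝒮? X) ∷ []) 0 (x0 ≼ 3 ⊛ x1 ⊕ lit 6)
        (x0 ≼ x2 ⊕ 3 ⊛ (x1 ⊕ lit 1) ∵ b ∙ x2 ≼ lit 3 ∵ deg≤3 X ∣X∣ ∙ [])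
    ... | inj₂ (inj₁ b) = linear {n = 0} [] ((# Upper?) ∷ t ∷ (deg 𝒮? X) ∷ []) 1
        (x0 ≼ 3 ⊛ x1 ⊕ lit 6) (2 ⟪ x0 ≼ x2 ⊕ (lit 6 ⊕ x1) ∵ b ⟫ 2 ⟪ x2 ≼ lit 3 ∵ deg≤3 X ∣X∣ ⟫
        3 ⟪ lit 2 ≼ x1 ∵ 2≤t ⟫ [])
    ... | inj₂ (inj₂ (inj₁ b)) = linear {n = 0} [] ((# Upper?) ∷ t ∷ (deg 𝒮? X) ∷ []) 1
        (x0 ≼ 3 ⊛ x1 ⊕ lit 6) (2 ⟪ x0 ≼ x2 ⊕ (lit 4 ⊕ 2 ⊛ x1) ∵ b ⟫ 2 ⟪ x2 ≼ lit 3 ∵ deg≤3 X ∣X∣ ⟫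
        lit 2 ≼ x1 ∵ 2≤t ∙ [])
    ... | inj₂ (inj₂ (inj₂ b)) = linear {n = 0} [] ((# Upper?) ∷ t ∷ []) 1 (x0 ≼ 3 ⊛ x1 ⊕ lit 6)
        (2 ⟪ x0 ≼ lit 9 ∵ b ⟫ 3 ⟪ lit 2 ≼ x1 ∵ 2≤t ⟫ [])

    upper≤10 : t ≤ 1 → # Upper? ≤ 10
    upper≤10 t≤1 with bound
    ... | inj₁ b = linear {n = 0} [] ((# Upper?) ∷ (deg 𝒮? X) ∷ t ∷ []) 0 (x0 ≼ lit 10)
        (x0 ≼ x1 ⊕ 3 ⊛ (x2 ⊕ lit 1) ∵ b ∙ x1 ≼ lit 3 ∵ deg≤3 X ∣X∣ ∙ 3 ⟪ x2 ≼ lit 1 ∵ t≤1 ⟫ [])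
    ... | inj₂ (inj₁ b) = linear {n = 0} [] ((# Upper?) ∷ (deg 𝒮? X) ∷ t ∷ []) 0 (x0 ≼ lit 10)
        (x0 ≼ x1 ⊕ (lit 6 ⊕ x2) ∵ b ∙ x1 ≼ lit 3 ∵ deg≤3 X ∣X∣ ∙ x2 ≼ lit 1 ∵ t≤1 ∙ [])
    ... | inj₂ (inj₂ (inj₁ b)) = linear {n = 0} [] ((# Upper?) ∷ (deg 𝒮? X) ∷ t ∷ []) 0
        (x0 ≼ lit 10) (x0 ≼ x1 ⊕ (lit 4 ⊕ 2 ⊛ x2) ∵ b ∙ x1 ≼ lit 3 ∵ deg≤3 X ∣X∣ ∙
        2 ⟪ x2 ≼ lit 1 ∵ t≤1 ⟫ [])
    ... | inj₂ (inj₂ (inj₂ b)) = linear {n = 0} [] ((# Upper?) ∷ []) 0 (x0 ≼ lit 10)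
        (x0 ≼ lit 9 ∵ b ∙ [])

    Full : Set
    Full = ∀ D → Sub 2 X D → ∃ λ S → Low S × ∣ D ∩ S ∣ ≤ 0

    -- The member that misses the pair `D` is `Z ─ D`. If `D` lies in `S`, the two points of `D` and
    -- `t` common points with `Z ─ D` are all of `S`. A pair inside `X ∩ S` exists because `2 ≤ t`.
    full⇒inside : 2 ≤ t → Full → ∀ S → 𝒮 S → S ⊑ Z
    full⇒inside 2≤t full S s with level S s
    ... | inj₂ l = linear (S ∷ Z ∷ X ∷ []) (t ∷ []) 0 (s0 ⋐ s1) ((s1 ∖ s2) ⋐ s0 ∵ low-⊒ S l ∙
        ∥ s1 ≅˘ x0 ⊕ lit 4 ∵ ∣Z∣ ∙ lit 1 ⊕ ∥ s0 ⋒ s2 ≅˘ x0 ∵ proj₂ l ∙ ∥ s2 ≅ x0 ⊕ lit 1 ∵ ∣X∣ ∙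
        ∥ s0 ≅ x0 ⊕ lit 2 ∵ size S s ∙ [])
    ... | inj₁ (_ , h) =
      let D , ∣D∣ , i = choose (X ∩ S) 2 (linear (X ∷ S ∷ []) (t ∷ []) 0 (lit 2 ≼ ∥ s0 ⋒ s1)
            (x0 ≼ ∥ s1 ⋒ s0 ∵ h ∙ lit 2 ≼ x0 ∵ 2≤t ∙ []))
          S′ , l , d = full D (∣D∣ , (linear (D ∷ X ∷ S ∷ []) [] 0 (s0 ⋐ s1) (s0 ⋐ (s1 ⋒ s2) ∵ i ∙
              [])))
      in (linear (S ∷ Z ∷ S′ ∷ D ∷ X ∷ []) (t ∷ []) 0 (s0 ⋐ s1)
          (x0 ≼ ∥ s0 ⋒ s2 ∵ meet S S′ s (proj₁ l) ∙ ∥ s3 ⋒ s2 ≼ lit 0 ∵ d ∙ s3 ⋐ (s4 ⋒ s0) ∵ i ∙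
          ∥ s3 ≅˘ lit 2 ∵ ∣D∣ ∙ (s1 ∖ s4) ⋐ s2 ∵ low-⊒ S′ l ∙ ∥ s1 ≅˘ x0 ⊕ lit 4 ∵ ∣Z∣ ∙
          lit 1 ⊕ ∥ s2 ⋒ s4 ≅˘ x0 ∵ proj₂ l ∙ ∥ s4 ≅ x0 ⊕ lit 1 ∵ ∣X∣ ∙
          ∥ s0 ≅ x0 ⊕ lit 2 ∵ size S s ∙ ∥ s2 ≅ x0 ⊕ lit 2 ∵ size S′ (proj₁ l) ∙ []))

    conclusion : Small (# 𝒮?) ⊎ Complete
    conclusion with 2 ≤? t
    -- For `t = 1` the total is at most 10 + 1, which is below `N₁`.
    ... | no t<2 = inj₁ (small₀ (linear {n = 0} []
        ((# 𝒮?) ∷ (# Upper?) ∷ (# Low?) ∷ ((t + 1) C 2) ∷ []) 0 (x0 ≼ lit 12)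
        (x0 ≼ x1 ⊕ x2 ∵ split ∙ x1 ≼ lit 10 ∵ upper≤10 t≤1 ∙ x2 ≼ x3 ∵ Low≤ Missing≤1 ∙
        x3 ≅ lit 1 ∵ cong (λ t → (t + 1) C 2) (≤-antisym t≤1 1≤t) ∙ [])))
      where
      t≤1 = s≤s⁻¹ (≰⇒> t<2)
    ... | yes 2≤t with ∃? (λ D → Sub? 2 X D ×-dec (# (Missing? D) <? 1))
    ...   | yes (D , i , l) = inj₁ (small-N₃ (linear {n = 0} []
        ((# 𝒮?) ∷ t ∷ ((t + 1) C 2) ∷ (# Upper?) ∷ (# Low?) ∷ []) 0
        (lit 1 ⊕ x0 ≼ 3 ⊛ x1 ⊕ lit 6 ⊕ x2) (x0 ≼ x3 ⊕ x4 ∵ split ∙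
        x3 ≼ 3 ⊛ x1 ⊕ lit 6 ∵ upper≤ 2≤t ∙ lit 1 ⊕ x4 ≼ x2 ∵ Low< Missing≤1 D i l ∙ [])))
    ...   | no ¬w with ∀? (Sub? (t + 2) Z) 𝒮?
    ...     | inj₁ all = inj₂ (Z , ∣Z∣ , all)
    -- Every pair is missed by some member here, so `𝒮` lies inside `Z`; a single absent
    -- `(t+2)`-subset of `Z` then makes it smaller than `N₃`.
    ...     | inj₂ (S , i , ¬s) = inj₁ (below₃ (≤-trans
                (#-strict 𝒮? (Sub? (t + 2) Z) (λ S s → size S s , full⇒inside 2≤t full S s) S i ¬s)
                (≤-reflexive (trans (#-Sub Z (t + 2)) (trans (cong (_C (t + 2)) ∣Z∣) (C-sym t))))))
      where
      full : Full
      full D i = #-witness (Missing? D) (≮⇒≥ (λ l → ¬w (D , i , l)))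

  degree3 : (∀ Y → ∣ Y ∣ ≡ t + 1 → deg 𝒮? Y ≤ 3) → ∀ X → ∣ X ∣ ≡ t + 1 → 3 ≤ deg 𝒮? X → Small (# 𝒮?)
    ⊎ Complete
  degree3 deg≤3 X ∣X∣ h =
    let S₁ , s₁ = #-witness (above? 𝒮? X) (≤-trans (s≤s z≤n) h)
        S₂ , S₃ , (s₂ , n₂) , (s₃ , n₃) , ne = two (others? (above? 𝒮? X) S₁)
          (s≤s⁻¹ (≤-trans h (#-others (above? 𝒮? X) S₁)))
    in Degree3.conclusion deg≤3 X ∣X∣ S₁ S₂ S₃ s₁ s₂ s₃ (n₂ ∘ sym) (n₃ ∘ sym) ne

  module Degree≤2 (Δ : ℕ) (Δ≤2 : Δ ≤ 2) (deg≤Δ : ∀ Y → ∣ Y ∣ ≡ t + 1 → deg 𝒮? Y ≤ Δ)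
                  (X : Subset n) (∣X∣ : ∣ X ∣ ≡ t + 1) (S₀ : Subset n) (s₀ : 𝒮 S₀) (X⊑S₀ : X ⊑ S₀)
                    where

    open At X ∣X∣ Δ (≤-trans Δ≤2 (s≤s (s≤s z≤n))) deg≤Δ S₀ s₀ X⊑S₀

    upper≤ : # Upper? ≤ 3 * t + 5
    upper≤ with bound
    ... | inj₁ b = linear {n = 0} [] ((# Upper?) ∷ t ∷ (deg 𝒮? X) ∷ Δ ∷ []) 0 (x0 ≼ 3 ⊛ x1 ⊕ lit 5)
        (x0 ≼ x2 ⊕ 3 ⊛ (x1 ⊕ lit 1) ∵ b ∙ x2 ≼ x3 ∵ deg≤Δ X ∣X∣ ∙ x3 ≼ lit 2 ∵ Δ≤2 ∙ [])
    ... | inj₂ (inj₁ b) = linear {n = 0} [] ((# Upper?) ∷ t ∷ (deg 𝒮? X) ∷ Δ ∷ []) 0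
        (x0 ≼ 3 ⊛ x1 ⊕ lit 5) (x0 ≼ x2 ⊕ (2 ⊛ x3 ⊕ x1) ∵ b ∙ x2 ≼ x3 ∵ deg≤Δ X ∣X∣ ∙
        3 ⟪ x3 ≼ lit 2 ∵ Δ≤2 ⟫ lit 1 ≼ x1 ∵ 1≤t ∙ [])
    ... | inj₂ (inj₂ (inj₁ b)) = linear {n = 0} [] ((# Upper?) ∷ t ∷ (deg 𝒮? X) ∷ Δ ∷ []) 0
        (x0 ≼ 3 ⊛ x1 ⊕ lit 5) (x0 ≼ x2 ⊕ (lit 4 ⊕ 2 ⊛ x1) ∵ b ∙ x2 ≼ x3 ∵ deg≤Δ X ∣X∣ ∙
        x3 ≼ lit 2 ∵ Δ≤2 ∙ lit 1 ≼ x1 ∵ 1≤t ∙ [])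
    ... | inj₂ (inj₂ (inj₂ b)) = linear {n = 0} [] ((# Upper?) ∷ t ∷ Δ ∷ []) 0 (x0 ≼ 3 ⊛ x1 ⊕ lit 5)
        (x0 ≼ 3 ⊛ x2 ∵ b ∙ 3 ⟪ x2 ≼ lit 2 ∵ Δ≤2 ⟫ lit 1 ≼ x1 ∵ 1≤t ∙ [])

    small : (∀ D → Sub 2 X D → # (Missing? D) ≤ 1) → Small (# 𝒮?)
    small h = small-N₃ (linear {n = 0} [] ((# 𝒮?) ∷ t ∷ ((t + 1) C 2) ∷ (# Upper?) ∷ (# Low?) ∷ [])
        0 (lit 1 ⊕ x0 ≼ 3 ⊛ x1 ⊕ lit 6 ⊕ x2) (x0 ≼ x3 ⊕ x4 ∵ split ∙ x3 ≼ 3 ⊛ x1 ⊕ lit 5 ∵ upper≤ ∙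
        x4 ≼ x2 ∵ Low≤ h ∙ []))

    -- If no pair is missed twice, `small` applies. Otherwise the two members missing the same pair
    -- give the rigid configuration that `Doubled` counts around.
    Double : Set
    Double = ∃ λ D → Sub 2 X D × ∃ λ A → ∃ λ B → (Low A × ∣ D ∩ A ∣ ≤ 0) × (Low B × ∣ D ∩ B ∣ ≤ 0) ×
      ¬ A ≡ B

    small-or-double : Small (# 𝒮?) ⊎ Double
    small-or-double with ∃? (λ D → Sub? 2 X D ×-dec (2 ≤? # (Missing? D)))
    ... | yes (D , i , l) = let A , B , a , b , ne = two (Missing? D) l in inj₂
      (D , i , A , B , a , b , ne)
    ... | no ¬w           = inj₁ (small (λ D i → s≤s⁻¹ (≰⇒> (λ l → ¬w (D , i , l)))))

module Doubled {n} (t : ℕ) (1≤t : 1 ≤ t) {𝒮 : Subset n → Set} (𝒮? : Decidable 𝒮)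
               (size : ∀ S → 𝒮 S → ∣ S ∣ ≡ t + 2)
               (meet : ∀ S S′ → 𝒮 S → 𝒮 S′ → t ≤ ∣ S ∩ S′ ∣)
               (X : Subset n) (∣X∣ : ∣ X ∣ ≡ t + 1)
               (D : Subset n) (∣D∣ : ∣ D ∣ ≡ 2) (D⊑X : D ⊑ X)
               (A B : Subset n) (a : 𝒮 A) (b : 𝒮 B) (mA : 1 + ∣ A ∩ X ∣ ≡ t)
                 (mB : 1 + ∣ B ∩ X ∣ ≡ t)
               (dA : ∣ D ∩ A ∣ ≤ 0) (dB : ∣ D ∩ B ∣ ≤ 0) (A≢B : ¬ A ≡ B) where

  open Labels t 𝒮? size meet


  -- When X lies in two members P, Q: writing T = X ─ D, P = T ∪ D ∪ p, Q = T ∪ D ∪ q,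
  -- both A and B are T ∪ p ∪ q and one further point.
  module InTwo (deg≤2 : ∀ Y → ∣ Y ∣ ≡ t + 1 → deg 𝒮? Y ≤ 2)
               (P Q : Subset n) (p : 𝒮 P) (q : 𝒮 Q) (X⊑P : X ⊑ P) (X⊑Q : X ⊑ Q) (P≢Q : ¬ P ≡ Q)
                 where

    P∩Q : (P ∩ Q) ⊑ X
    P∩Q with (P ∩ Q) ⊑? X
    ... | yes h = h
    ... | no ¬h = contradiction (⊑-antisym
        (linear (P ∷ Q ∷ X ∷ []) (t ∷ []) 0 (s0 ⋐ s1) (lit 1 ≼ ∥ (s0 ⋒ s1) ∖ s2 ∵ ≰⇒> ¬h ∙
            s2 ⋐ s0 ∵ X⊑P ∙ s2 ⋐ s1 ∵ X⊑Q ∙ ∥ s0 ≅ x0 ⊕ lit 2 ∵ size P p ∙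
            ∥ s2 ≅˘ x0 ⊕ lit 1 ∵ ∣X∣ ∙ []))
        (linear (Q ∷ P ∷ X ∷ []) (t ∷ []) 0 (s0 ⋐ s1) (lit 1 ≼ ∥ (s1 ⋒ s0) ∖ s2 ∵ ≰⇒> ¬h ∙
            s2 ⋐ s1 ∵ X⊑P ∙ s2 ⋐ s0 ∵ X⊑Q ∙ ∥ s0 ≅ x0 ⊕ lit 2 ∵ size Q q ∙
            ∥ s2 ≅˘ x0 ⊕ lit 1 ∵ ∣X∣ ∙ []))) P≢Q


    A⊒ : ((P ∪ Q) ─ X) ⊑ A
    A⊒ = linear (P ∷ Q ∷ X ∷ A ∷ []) (t ∷ []) 0 (((s0 ⋓ s1) ∖ s2) ⋐ s3)
        (2 ⟪ ∥ s2 ≅˘ x0 ⊕ lit 1 ∵ ∣X∣ ⟫ 2 ⟪ lit 1 ⊕ ∥ s3 ⋒ s2 ≅ x0 ∵ mA ⟫ s2 ⋐ s0 ∵ X⊑P ∙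
        s2 ⋐ s1 ∵ X⊑Q ∙ ∥ s0 ≅ x0 ⊕ lit 2 ∵ size P p ∙ ∥ s1 ≅ x0 ⊕ lit 2 ∵ size Q q ∙
        x0 ≼ ∥ s3 ⋒ s0 ∵ meet A P a p ∙ x0 ≼ ∥ s3 ⋒ s1 ∵ meet A Q a q ∙ [])

    B⊒ : ((P ∪ Q) ─ X) ⊑ B
    B⊒ = linear (P ∷ Q ∷ X ∷ B ∷ []) (t ∷ []) 0 (((s0 ⋓ s1) ∖ s2) ⋐ s3)
        (2 ⟪ ∥ s2 ≅˘ x0 ⊕ lit 1 ∵ ∣X∣ ⟫ 2 ⟪ lit 1 ⊕ ∥ s3 ⋒ s2 ≅ x0 ∵ mB ⟫ s2 ⋐ s0 ∵ X⊑P ∙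
        s2 ⋐ s1 ∵ X⊑Q ∙ ∥ s0 ≅ x0 ⊕ lit 2 ∵ size P p ∙ ∥ s1 ≅ x0 ⊕ lit 2 ∵ size Q q ∙
        x0 ≼ ∥ s3 ⋒ s0 ∵ meet B P b p ∙ x0 ≼ ∥ s3 ⋒ s1 ∵ meet B Q b q ∙ [])


    A∩B : ((A ∩ B) ─ X) ⊑ (P ∪ Q)
    A∩B with ((A ∩ B) ─ X) ⊑? (P ∪ Q)
    ... | yes h = h
    ... | no ¬h = contradiction (⊑-antisym
        (linear (A ∷ B ∷ X ∷ P ∷ Q ∷ D ∷ []) (t ∷ []) 0 (s0 ⋐ s1)
            (lit 1 ≼ ∥ ((s0 ⋒ s1) ∖ s2) ∖ (s3 ⋓ s4) ∵ ≰⇒> ¬h ∙ 3 ⟪ ∥ s2 ≅ x0 ⊕ lit 1 ∵ ∣X∣ ⟫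
            ∥ s5 ≅˘ lit 2 ∵ ∣D∣ ∙ s5 ⋐ s2 ∵ D⊑X ∙ ∥ s0 ≅ x0 ⊕ lit 2 ∵ size A a ∙
            lit 1 ⊕ ∥ s0 ⋒ s2 ≅˘ x0 ∵ mA ∙ lit 1 ⊕ ∥ s1 ⋒ s2 ≅˘ x0 ∵ mB ∙ ∥ s5 ⋒ s0 ≼ lit 0 ∵ dA ∙
            ∥ s5 ⋒ s1 ≼ lit 0 ∵ dB ∙ ∥ s3 ≅˘ x0 ⊕ lit 2 ∵ size P p ∙ ∥ s4 ≅˘ x0 ⊕ lit 2 ∵ size Q q ∙
            (s3 ⋒ s4) ⋐ s2 ∵ P∩Q ∙ ((s3 ⋓ s4) ∖ s2) ⋐ s0 ∵ A⊒ ∙ ((s3 ⋓ s4) ∖ s2) ⋐ s1 ∵ B⊒ ∙ []))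
        (linear (B ∷ A ∷ X ∷ P ∷ Q ∷ D ∷ []) (t ∷ []) 0 (s0 ⋐ s1)
            (lit 1 ≼ ∥ ((s1 ⋒ s0) ∖ s2) ∖ (s3 ⋓ s4) ∵ ≰⇒> ¬h ∙ 3 ⟪ ∥ s2 ≅ x0 ⊕ lit 1 ∵ ∣X∣ ⟫
            ∥ s5 ≅˘ lit 2 ∵ ∣D∣ ∙ s5 ⋐ s2 ∵ D⊑X ∙ ∥ s0 ≅ x0 ⊕ lit 2 ∵ size B b ∙
            lit 1 ⊕ ∥ s1 ⋒ s2 ≅˘ x0 ∵ mA ∙ lit 1 ⊕ ∥ s0 ⋒ s2 ≅˘ x0 ∵ mB ∙ ∥ s5 ⋒ s1 ≼ lit 0 ∵ dA ∙
            ∥ s5 ⋒ s0 ≼ lit 0 ∵ dB ∙ ∥ s3 ≅˘ x0 ⊕ lit 2 ∵ size P p ∙ ∥ s4 ≅˘ x0 ⊕ lit 2 ∵ size Q q ∙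
            (s3 ⋒ s4) ⋐ s2 ∵ P∩Q ∙ ((s3 ⋓ s4) ∖ s2) ⋐ s1 ∵ A⊒ ∙ ((s3 ⋓ s4) ∖ s2) ⋐ s0 ∵ B⊒ ∙ [])))
              A≢B

    T : Subset n
    T = X ─ D

    ∣T∣ : 1 + ∣ T ∣ ≡ t
    ∣T∣ = equation (X ∷ D ∷ []) (t ∷ []) (lit 1 ⊕ ∥ s0 ∖ s1) (x0) 0 (∥ s0 ≅ x0 ⊕ lit 1 ∵ ∣X∣ ∙
        ∥ s1 ≅˘ lit 2 ∵ ∣D∣ ∙ s1 ⋐ s0 ∵ D⊑X ∙ []) 0 (∥ s0 ≅˘ x0 ⊕ lit 1 ∵ ∣X∣ ∙ ∥ s1 ≅ lit 2 ∵ ∣D∣ ∙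
        [])


    Miss? : ∀ x → Decidable (λ S → (𝒮 S × 2 + ∣ S ∩ T ∣ ≡ t) × ∣ x ∩ S ∣ ≤ 0)
    Miss? x S = (𝒮? S ×-dec (2 + ∣ S ∩ T ∣ ≟ t)) ×-dec (∣ x ∩ S ∣ ≤? 0)

    level : ∀ S → 𝒮 S → (𝒮 S × T ⊑ S) ⊎ (𝒮 S × 2 + ∣ S ∩ T ∣ ≡ t)
    level S s with T ⊑? S | t ≤? 2 + ∣ S ∩ T ∣
    ... | yes i | _     = inj₁ (s , i)
    ... | no ¬i | yes h = inj₂ (s , (equation (S ∷ X ∷ D ∷ []) (t ∷ []) (lit 2 ⊕ ∥ s0 ⋒ (s1 ∖ s2))
        (x0) 0 (lit 1 ≼ ∥ (s1 ∖ s2) ∖ s0 ∵ ≰⇒> ¬i ∙ lit 1 ⊕ ∥ s1 ∖ s2 ≅ x0 ∵ ∣T∣ ∙ []) 0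
        (x0 ≼ lit 2 ⊕ ∥ s0 ⋒ (s1 ∖ s2) ∵ h ∙ [])))
    -- With at most `t - 3` points in `T`, the set `S` would have to contain all three points
    -- outside `T` of each of `P`, `A` and `B`. These are six points, too many for a `(t+2)`-set.
    ... | no ¬i | no ¬h = impossible (linear (S ∷ X ∷ D ∷ A ∷ B ∷ P ∷ Q ∷ []) (t ∷ []) 0
        (lit 1 ≼ lit 0) (2 ⟪ lit 1 ⊕ (lit 2 ⊕ ∥ s0 ⋒ (s1 ∖ s2)) ≼ x0 ∵ ≰⇒> ¬h ⟫
        3 ⟪ ∥ s1 ≅˘ x0 ⊕ lit 1 ∵ ∣X∣ ⟫ ∥ s2 ⋒ s3 ≼ lit 0 ∵ dA ∙ ∥ s2 ⋒ s4 ≼ lit 0 ∵ dB ∙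
        2 ⟪ s1 ⋐ s5 ∵ X⊑P ⟫ s1 ⋐ s6 ∵ X⊑Q ∙ 2 ⟪ ∥ s5 ≅ x0 ⊕ lit 2 ∵ size P p ⟫
        ∥ s6 ≅ x0 ⊕ lit 2 ∵ size Q q ∙ x0 ≼ ∥ s0 ⋒ s5 ∵ meet S P s p ∙
        x0 ≼ ∥ s0 ⋒ s3 ∵ meet S A s a ∙ x0 ≼ ∥ s0 ⋒ s4 ∵ meet S B s b ∙
        ∥ s0 ≅ x0 ⊕ lit 2 ∵ size S s ∙ ((s3 ⋒ s4) ∖ s1) ⋐ (s5 ⋓ s6) ∵ A∩B ∙ []))

    points-D : # (Sub? 1 D) ≡ 2
    points-D = trans (#-points D) ∣D∣

    -- `S` has four points outside `T`, and needs two such points from each of `P`, `Q`, `A` and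
    -- `B`. Without the point of `P` outside `X`, it would need both points of `D`, the point of
    -- `Q`, and the last points of `A` and `B`: five. The same holds with `P` and `Q` exchanged.
    miss-⊒ : ∀ S → 𝒮 S → 2 + ∣ S ∩ T ∣ ≡ t → ((P ∪ Q) ─ X) ⊑ S
    miss-⊒ S s m with ((P ∪ Q) ─ X) ⊑? S
    ... | yes h = h
    ... | no ¬h = impossible (linear (P ∷ Q ∷ X ∷ S ∷ D ∷ A ∷ B ∷ []) (t ∷ []) 0 (lit 1 ≼ lit 0)
        (3 ⟪ lit 1 ≼ ∥ ((s0 ⋓ s1) ∖ s2) ∖ s3 ∵ ≰⇒> ¬h ⟫ 4 ⟪ lit 2 ⊕ ∥ s3 ⋒ (s2 ∖ s4) ≅ x0 ∵ m ⟫
        6 ⟪ ∥ s2 ≅˘ x0 ⊕ lit 1 ∵ ∣X∣ ⟫ 2 ⟪ ∥ s4 ⋒ s5 ≼ lit 0 ∵ dA ⟫ 2 ⟪ ∥ s4 ⋒ s6 ≼ lit 0 ∵ dB ⟫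
        3 ⟪ s2 ⋐ s0 ∵ X⊑P ⟫ 3 ⟪ s2 ⋐ s1 ∵ X⊑Q ⟫ 3 ⟪ ∥ s0 ≅ x0 ⊕ lit 2 ∵ size P p ⟫
        3 ⟪ ∥ s1 ≅ x0 ⊕ lit 2 ∵ size Q q ⟫ x0 ≼ ∥ s3 ⋒ s0 ∵ meet S P s p ∙
        x0 ≼ ∥ s3 ⋒ s1 ∵ meet S Q s q ∙ 2 ⟪ x0 ≼ ∥ s3 ⋒ s5 ∵ meet S A s a ⟫
        2 ⟪ x0 ≼ ∥ s3 ⋒ s6 ∵ meet S B s b ⟫ 2 ⟪ ∥ s3 ≅ x0 ⊕ lit 2 ∵ size S s ⟫
        2 ⟪ ((s5 ⋒ s6) ∖ s2) ⋐ (s0 ⋓ s1) ∵ A∩B ⟫ []))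

    -- Such S contain p, q and a point of D.
    miss≤4 : ∀ x → Sub 1 T x → # (Miss? x) ≤ 4
    miss≤4 x (∣x∣ , i) = ≤-trans
      (#-union (Miss? x) (Sub? 1 D) (λ d → above? 𝒮? (U ∪ d)) 2
        (λ S ((s , m) , e) →
          let d , j , k = hit-point S D (linear (S ∷ D ∷ X ∷ P ∷ []) (t ∷ []) 0 (lit 1 ≼ ∥ s0 ⋒ s1)
                (lit 2 ⊕ ∥ s0 ⋒ (s2 ∖ s1) ≅ x0 ∵ m ∙ ∥ s2 ≅˘ x0 ⊕ lit 1 ∵ ∣X∣ ∙ s2 ⋐ s3 ∵ X⊑P ∙
                ∥ s3 ≅ x0 ⊕ lit 2 ∵ size P p ∙ x0 ≼ ∥ s0 ⋒ s3 ∵ meet S P s p ∙ []))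
          in d , j , s , ∪-⊑ U d S
            (linear (X ∷ D ∷ x ∷ P ∷ Q ∷ S ∷ []) (t ∷ []) 0
                ((((s0 ∖ s1) ∖ s2) ⋓ ((s3 ⋓ s4) ∖ s0)) ⋐ s5) (((s3 ⋓ s4) ∖ s0) ⋐ s5 ∵ miss-⊒ S s m ∙
                lit 2 ⊕ ∥ s5 ⋒ (s0 ∖ s1) ≅˘ x0 ∵ m ∙ ∥ s2 ⋒ s5 ≼ lit 0 ∵ e ∙ ∥ s2 ≅˘ lit 1 ∵ ∣x∣ ∙
                s2 ⋐ (s0 ∖ s1) ∵ i ∙ ∥ s0 ≅ x0 ⊕ lit 1 ∵ ∣X∣ ∙ ∥ s1 ≅˘ lit 2 ∵ ∣D∣ ∙ s1 ⋐ s0 ∵ D⊑X ∙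
                [])) k)
        (λ d (∣d∣ , j) → deg≤2 (U ∪ d) (equation (X ∷ D ∷ x ∷ P ∷ Q ∷ d ∷ []) (t ∷ [])
            (∥ (((s0 ∖ s1) ∖ s2) ⋓ ((s3 ⋓ s4) ∖ s0)) ⋓ s5) (x0 ⊕ lit 1) 0 (∥ s5 ≅ lit 1 ∵ ∣d∣ ∙
            ∥ s2 ≅˘ lit 1 ∵ ∣x∣ ∙ s2 ⋐ (s0 ∖ s1) ∵ i ∙ ∥ s0 ≅˘ x0 ⊕ lit 1 ∵ ∣X∣ ∙
            ∥ s1 ≅˘ lit 2 ∵ ∣D∣ ∙ s1 ⋐ s0 ∵ D⊑X ∙ s0 ⋐ s3 ∵ X⊑P ∙ s0 ⋐ s4 ∵ X⊑Q ∙
            ∥ s3 ≅ x0 ⊕ lit 2 ∵ size P p ∙ ∥ s4 ≅ x0 ⊕ lit 2 ∵ size Q q ∙ []) 0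
            (∥ s5 ≅˘ lit 1 ∵ ∣d∣ ∙ s5 ⋐ s1 ∵ j ∙ ∥ s2 ≅ lit 1 ∵ ∣x∣ ∙ ∥ s0 ≅ x0 ⊕ lit 1 ∵ ∣X∣ ∙
            ∥ s1 ≅ lit 2 ∵ ∣D∣ ∙ ∥ s3 ≅˘ x0 ⊕ lit 2 ∵ size P p ∙ ∥ s4 ≅˘ x0 ⊕ lit 2 ∵ size Q q ∙
            (s3 ⋒ s4) ⋐ s0 ∵ P∩Q ∙ []))))
      (≤-reflexive (cong (_* 2) points-D))
      where
      U : Subset n
      U = (T ─ x) ∪ ((P ∪ Q) ─ X)

    -- For each of the two points `d` of `D`, the known member `V` is one of the at most two members
    -- above `R ∪ d`, so only one other is left.
    except : ∀ V → 𝒮 V → ∀ R → ∣ R ─ X ∣ ≡ 1 → T ⊑ R → ∣ R ∩ D ∣ ≤ 0 → ∣ (R ∩ X) ─ T ∣ ≤ 0 →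
      (R ∪ D) ⊑ V →
             ∀ {K : Subset n → Set} (K? : Decidable K) →
               (∀ S → K S → 𝒮 S × R ⊑ S × 1 ≤ ∣ S ∩ D ∣ × ¬ S ≡ V) → # K? ≤ 2
    except V v R ∣R∣ T⊑R R-D R-X h K? k = ≤-trans
      (#-union K? (Sub? 1 D) (λ d → others? (above? 𝒮? (R ∪ d)) V) 1
        (λ S κ → let s , i , g , ne = k S κ ; d , j , l = hit-point S D g in d , j ,
          (s , ∪-⊑ R d S i l) , ne)
        (λ d (∣d∣ , j) → s≤s⁻¹ (≤-trans
          (others-< (above? 𝒮? (R ∪ d)) V (v , (linear (R ∷ d ∷ V ∷ D ∷ []) [] 0 ((s0 ⋓ s1) ⋐ s2)
              ((s0 ⋓ s3) ⋐ s2 ∵ h ∙ s1 ⋐ s3 ∵ j ∙ []))))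
          (deg≤2 (R ∪ d) (equation (R ∷ d ∷ X ∷ D ∷ []) (t ∷ []) (∥ s0 ⋓ s1) (x0 ⊕ lit 1) 0
              (∥ s1 ≅ lit 1 ∵ ∣d∣ ∙ ∥ s0 ∖ s2 ≅ lit 1 ∵ ∣R∣ ∙ ∥ s0 ⋒ s3 ≼ lit 0 ∵ R-D ∙
              lit 1 ⊕ ∥ s2 ∖ s3 ≅ x0 ∵ ∣T∣ ∙ []) 0 (∥ s1 ≅˘ lit 1 ∵ ∣d∣ ∙ s1 ⋐ s3 ∵ j ∙
              ∥ s0 ∖ s2 ≅˘ lit 1 ∵ ∣R∣ ∙ (s2 ∖ s3) ⋐ s0 ∵ T⊑R ∙ ∥ s0 ⋒ s3 ≼ lit 0 ∵ R-D ∙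
              lit 1 ⊕ ∥ s2 ∖ s3 ≅˘ x0 ∵ ∣T∣ ∙ []))))))
      (≤-reflexive (trans (*-identityʳ _) points-D))

    C₁? : Decidable (λ S → (𝒮 S × (T ∪ ((P ∪ Q) ─ X)) ⊑ S) ⊎ (𝒮 S × X ⊑ S))
    C₁? S = above? 𝒮? (T ∪ ((P ∪ Q) ─ X)) S ⊎-dec above? 𝒮? X S

    Hits? : ∀ V R → Decidable (λ S → (𝒮 S × R ⊑ S) × 1 ≤ ∣ S ∩ D ∣ × ¬ S ≡ V)
    Hits? V R S = above? 𝒮? R S ×-dec ((1 ≤? ∣ S ∩ D ∣) ×-dec ¬? (S ≟ˢ V))

    Both? : Decidable (λ S → 𝒮 S × (A ∪ B) ⊑ (S ∪ (P ∪ Q)) × (T ⊑ S × 1 ≤ ∣ S ∩ D ∣))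
    Both? S = 𝒮? S ×-dec (((A ∪ B) ⊑? (S ∪ (P ∪ Q))) ×-dec ((T ⊑? S) ×-dec (1 ≤? ∣ S ∩ D ∣)))

    C₁≤4 : # C₁? ≤ 4
    C₁≤4 = ≤-trans (#-∪ C₁? (above? 𝒮? (T ∪ ((P ∪ Q) ─ X))) (above? 𝒮? X) (λ S → id))
      (+-mono-≤ (deg≤2 (T ∪ ((P ∪ Q) ─ X)) (equation (X ∷ D ∷ P ∷ Q ∷ []) (t ∷ [])
          (∥ (s0 ∖ s1) ⋓ ((s2 ⋓ s3) ∖ s0)) (x0 ⊕ lit 1) 0 (∥ s0 ≅˘ x0 ⊕ lit 1 ∵ ∣X∣ ∙
          ∥ s1 ≅˘ lit 2 ∵ ∣D∣ ∙ s1 ⋐ s0 ∵ D⊑X ∙ s0 ⋐ s2 ∵ X⊑P ∙ s0 ⋐ s3 ∵ X⊑Q ∙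
          ∥ s2 ≅ x0 ⊕ lit 2 ∵ size P p ∙ ∥ s3 ≅ x0 ⊕ lit 2 ∵ size Q q ∙ []) 0
          (∥ s0 ≅ x0 ⊕ lit 1 ∵ ∣X∣ ∙ ∥ s1 ≅ lit 2 ∵ ∣D∣ ∙ ∥ s2 ≅˘ x0 ⊕ lit 2 ∵ size P p ∙
          ∥ s3 ≅˘ x0 ⊕ lit 2 ∵ size Q q ∙ (s2 ⋒ s3) ⋐ s0 ∵ P∩Q ∙ []))) (deg≤2 X ∣X∣))

    Both≤2 : # Both? ≤ 2
    Both≤2 = ≤-trans
      (#-union Both? (Sub? 1 D) (λ d → above? 𝒮? (U ∪ d)) 1
        (λ S (s , h , i , g) → let d , j , l = hit-point S D g in
          d , j , s , ∪-⊑ U d S (linear (X ∷ D ∷ A ∷ B ∷ P ∷ Q ∷ S ∷ []) [] 0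
              (((s0 ∖ s1) ⋓ ((s2 ⋓ s3) ∖ (s4 ⋓ s5))) ⋐ s6) ((s2 ⋓ s3) ⋐ (s6 ⋓ (s4 ⋓ s5)) ∵ h ∙
              (s0 ∖ s1) ⋐ s6 ∵ i ∙ [])) l)
        (λ d (∣d∣ , j) → deg≤1 (U ∪ d) (equation (X ∷ D ∷ A ∷ B ∷ P ∷ Q ∷ d ∷ []) (t ∷ [])
            (∥ ((s0 ∖ s1) ⋓ ((s2 ⋓ s3) ∖ (s4 ⋓ s5))) ⋓ s6) (x0 ⊕ lit 2) 0 (∥ s6 ≅ lit 1 ∵ ∣d∣ ∙
            5 ⟪ ∥ s0 ≅ x0 ⊕ lit 1 ∵ ∣X∣ ⟫ ∥ s1 ≅˘ lit 2 ∵ ∣D∣ ∙ s1 ⋐ s0 ∵ D⊑X ∙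
            ∥ s2 ≅ x0 ⊕ lit 2 ∵ size A a ∙ ∥ s3 ≅ x0 ⊕ lit 2 ∵ size B b ∙
            lit 1 ⊕ ∥ s2 ⋒ s0 ≅˘ x0 ∵ mA ∙ lit 1 ⊕ ∥ s3 ⋒ s0 ≅˘ x0 ∵ mB ∙
            2 ⟪ ∥ s4 ≅˘ x0 ⊕ lit 2 ∵ size P p ⟫ 2 ⟪ ∥ s5 ≅˘ x0 ⊕ lit 2 ∵ size Q q ⟫
            2 ⟪ (s4 ⋒ s5) ⋐ s0 ∵ P∩Q ⟫ ((s4 ⋓ s5) ∖ s0) ⋐ s2 ∵ A⊒ ∙ ((s4 ⋓ s5) ∖ s0) ⋐ s3 ∵ B⊒ ∙ [])
            0 (∥ s6 ≅˘ lit 1 ∵ ∣d∣ ∙ s6 ⋐ s1 ∵ j ∙ 4 ⟪ ∥ s0 ≅˘ x0 ⊕ lit 1 ∵ ∣X∣ ⟫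
            ∥ s2 ≅˘ x0 ⊕ lit 2 ∵ size A a ∙ ∥ s3 ≅˘ x0 ⊕ lit 2 ∵ size B b ∙
            lit 1 ⊕ ∥ s3 ⋒ s0 ≅ x0 ∵ mB ∙ ∥ s1 ⋒ s2 ≼ lit 0 ∵ dA ∙ ∥ s1 ⋒ s3 ≼ lit 0 ∵ dB ∙
            2 ⟪ s0 ⋐ s4 ∵ X⊑P ⟫ 2 ⟪ s0 ⋐ s5 ∵ X⊑Q ⟫ 2 ⟪ ∥ s4 ≅ x0 ⊕ lit 2 ∵ size P p ⟫
            2 ⟪ ∥ s5 ≅ x0 ⊕ lit 2 ∵ size Q q ⟫ ((s2 ⋒ s3) ∖ s0) ⋐ (s4 ⋓ s5) ∵ A∩B ∙ []))))
      (≤-reflexive (trans (*-identityʳ _) points-D))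
      where
      U : Subset n
      U = T ∪ ((A ∪ B) ─ (P ∪ Q))

    RP RQ : Subset n
    RP = P ─ D
    RQ = Q ─ D

    R-P : # (Hits? P RP) ≤ 2
    R-P = except P p RP (equation (P ∷ D ∷ X ∷ []) (t ∷ []) (∥ (s0 ∖ s1) ∖ s2) (lit 1) 0
        (∥ s2 ≅˘ x0 ⊕ lit 1 ∵ ∣X∣ ∙ s2 ⋐ s0 ∵ X⊑P ∙ ∥ s0 ≅ x0 ⊕ lit 2 ∵ size P p ∙ []) 0
        (∥ s2 ≅ x0 ⊕ lit 1 ∵ ∣X∣ ∙ s1 ⋐ s2 ∵ D⊑X ∙ ∥ s0 ≅˘ x0 ⊕ lit 2 ∵ size P p ∙ [])) (linear
        (X ∷ D ∷ P ∷ []) [] 0 ((s0 ∖ s1) ⋐ (s2 ∖ s1)) (s0 ⋐ s2 ∵ X⊑P ∙ [])) (linear (P ∷ D ∷ []) []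
        0 (∥ (s0 ∖ s1) ⋒ s1 ≼ lit 0) [])
      (linear (P ∷ D ∷ X ∷ []) [] 0 (∥ ((s0 ∖ s1) ⋒ s2) ∖ (s2 ∖ s1) ≼ lit 0) []) (linear
          (P ∷ D ∷ X ∷ []) [] 0 (((s0 ∖ s1) ⋓ s1) ⋐ s0) (s1 ⋐ s2 ∵ D⊑X ∙ s2 ⋐ s0 ∵ X⊑P ∙ []))
            (Hits? P RP)
      (λ S ((s , i) , g , ne) → s , i , g , ne)

    R-Q : # (Hits? Q RQ) ≤ 2
    R-Q = except Q q RQ (equation (Q ∷ D ∷ X ∷ []) (t ∷ []) (∥ (s0 ∖ s1) ∖ s2) (lit 1) 0
        (∥ s2 ≅˘ x0 ⊕ lit 1 ∵ ∣X∣ ∙ s2 ⋐ s0 ∵ X⊑Q ∙ ∥ s0 ≅ x0 ⊕ lit 2 ∵ size Q q ∙ []) 0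
        (∥ s2 ≅ x0 ⊕ lit 1 ∵ ∣X∣ ∙ s1 ⋐ s2 ∵ D⊑X ∙ ∥ s0 ≅˘ x0 ⊕ lit 2 ∵ size Q q ∙ [])) (linear
        (X ∷ D ∷ Q ∷ []) [] 0 ((s0 ∖ s1) ⋐ (s2 ∖ s1)) (s0 ⋐ s2 ∵ X⊑Q ∙ [])) (linear (Q ∷ D ∷ []) []
        0 (∥ (s0 ∖ s1) ⋒ s1 ≼ lit 0) [])
      (linear (Q ∷ D ∷ X ∷ []) [] 0 (∥ ((s0 ∖ s1) ⋒ s2) ∖ (s2 ∖ s1) ≼ lit 0) []) (linear
          (Q ∷ D ∷ X ∷ []) [] 0 (((s0 ∖ s1) ⋓ s1) ⋐ s0) (s1 ⋐ s2 ∵ D⊑X ∙ s2 ⋐ s0 ∵ X⊑Q ∙ []))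
            (Hits? Q RQ)
      (λ S ((s , i) , g , ne) → s , i , g , ne)

    C₂? : Decidable (λ S → ((𝒮 S × RP ⊑ S) × 1 ≤ ∣ S ∩ D ∣ × ¬ S ≡ P)
      ⊎ ((𝒮 S × RQ ⊑ S) × 1 ≤ ∣ S ∩ D ∣ × ¬ S ≡ Q))
    C₂? S = Hits? P RP S ⊎-dec Hits? Q RQ S

    C₃? : Decidable _
    C₃? = λ S → C₂? S ⊎-dec Both? S

    -- With p and q the points of `P` and `Q` outside `X`, there are at most two members in each of
    -- five classes: above `X`; with p and q; with p only; with q only; with neither. The last ones
    -- contain the final points of `A` and `B` and a point of `D`.
    deg-T≤10 : deg 𝒮? T ≤ 10
    deg-T≤10 = ≤-trans (#-∪ (above? 𝒮? T) C₁? C₃? cases)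
      (+-mono-≤ C₁≤4 (≤-trans (#-∪ C₃? C₂? Both? (λ S → id))
        (+-mono-≤ (≤-trans (#-∪ C₂? (Hits? P RP) (Hits? Q RQ) (λ S → id)) (+-mono-≤ R-P R-Q))
          Both≤2)))
      where
      cases : ∀ S → 𝒮 S × T ⊑ S → _
      cases S (s , i) with X ⊑? S
      ... | yes j = inj₁ (inj₂ (s , j))
      ... | no ¬j with (P ─ X) ⊑? S | (Q ─ X) ⊑? S
      ...   | yes k | yes l = inj₁ (inj₁ (s , (linear (X ∷ D ∷ P ∷ Q ∷ S ∷ []) [] 0
          (((s0 ∖ s1) ⋓ ((s2 ⋓ s3) ∖ s0)) ⋐ s4) ((s0 ∖ s1) ⋐ s4 ∵ i ∙ (s2 ∖ s0) ⋐ s4 ∵ k ∙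
          (s3 ∖ s0) ⋐ s4 ∵ l ∙ []))))
      ...   | yes k | no ¬l = inj₂ (inj₁ (inj₁ ((s , (linear (P ∷ D ∷ S ∷ X ∷ []) [] 0
          ((s0 ∖ s1) ⋐ s2) ((s3 ∖ s1) ⋐ s2 ∵ i ∙ (s0 ∖ s3) ⋐ s2 ∵ k ∙ []))) ,
                (linear (S ∷ D ∷ X ∷ Q ∷ []) (t ∷ []) 0 (lit 1 ≼ ∥ s0 ⋒ s1) (∥ s1 ≅˘ lit 2 ∵ ∣D∣ ∙
                    s1 ⋐ s2 ∵ D⊑X ∙ s2 ⋐ s3 ∵ X⊑Q ∙ ∥ s3 ≅ x0 ⊕ lit 2 ∵ size Q q ∙
                    x0 ≼ ∥ s0 ⋒ s3 ∵ meet S Q s q ∙ lit 1 ≼ ∥ (s3 ∖ s2) ∖ s0 ∵ ≰⇒> ¬l ∙ [])) , λ e →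
                      ¬j (subst (X ⊑_) (sym e) X⊑P))))
      ...   | no ¬k | yes l = inj₂ (inj₁ (inj₂ ((s , (linear (Q ∷ D ∷ S ∷ X ∷ []) [] 0
          ((s0 ∖ s1) ⋐ s2) ((s3 ∖ s1) ⋐ s2 ∵ i ∙ (s0 ∖ s3) ⋐ s2 ∵ l ∙ []))) ,
                (linear (S ∷ D ∷ X ∷ P ∷ []) (t ∷ []) 0 (lit 1 ≼ ∥ s0 ⋒ s1) (∥ s1 ≅˘ lit 2 ∵ ∣D∣ ∙
                    s1 ⋐ s2 ∵ D⊑X ∙ s2 ⋐ s3 ∵ X⊑P ∙ ∥ s3 ≅ x0 ⊕ lit 2 ∵ size P p ∙
                    x0 ≼ ∥ s0 ⋒ s3 ∵ meet S P s p ∙ lit 1 ≼ ∥ (s3 ∖ s2) ∖ s0 ∵ ≰⇒> ¬k ∙ [])) , λ e →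
                      ¬j (subst (X ⊑_) (sym e) X⊑Q))))
      ...   | no ¬k | no ¬l = inj₂ (inj₂ (s , (linear (A ∷ B ∷ S ∷ P ∷ Q ∷ X ∷ []) (t ∷ []) 0
          ((s0 ⋓ s1) ⋐ (s2 ⋓ (s3 ⋓ s4))) (∥ s0 ≅ x0 ⊕ lit 2 ∵ size A a ∙
          ∥ s1 ≅ x0 ⊕ lit 2 ∵ size B b ∙ 2 ⟪ (s3 ⋒ s4) ⋐ s5 ∵ P∩Q ⟫ ((s3 ⋓ s4) ∖ s5) ⋐ s0 ∵ A⊒ ∙
          ((s3 ⋓ s4) ∖ s5) ⋐ s1 ∵ B⊒ ∙ x0 ≼ ∥ s2 ⋒ s0 ∵ meet S A s a ∙
          x0 ≼ ∥ s2 ⋒ s1 ∵ meet S B s b ∙ 2 ⟪ lit 1 ≼ ∥ (s3 ∖ s5) ∖ s2 ∵ ≰⇒> ¬k ⟫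
          2 ⟪ lit 1 ≼ ∥ (s4 ∖ s5) ∖ s2 ∵ ≰⇒> ¬l ⟫ [])) ,
                i , (linear (S ∷ D ∷ X ∷ P ∷ []) (t ∷ []) 0 (lit 1 ≼ ∥ s0 ⋒ s1)
                    (∥ s1 ≅˘ lit 2 ∵ ∣D∣ ∙ s1 ⋐ s2 ∵ D⊑X ∙ s2 ⋐ s3 ∵ X⊑P ∙
                    ∥ s3 ≅ x0 ⊕ lit 2 ∵ size P p ∙ x0 ≼ ∥ s0 ⋒ s3 ∵ meet S P s p ∙
                    lit 1 ≼ ∥ (s3 ∖ s2) ∖ s0 ∵ ≰⇒> ¬k ∙ []))))

    Miss : Subset n → Set
    Miss S = 𝒮 S × 2 + ∣ S ∩ T ∣ ≡ t

    Misses? : Decidable Miss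
    Misses? S = 𝒮? S ×-dec (2 + ∣ S ∩ T ∣ ≟ t)

    bound : # 𝒮? ≤ 4 * t + 6
    bound = ≤-trans (#-∪ 𝒮? (above? 𝒮? T) Misses? level)
      (linear ((T) ∷ []) ((deg 𝒮? T) ∷ (# Misses?) ∷ t ∷ []) 0 (x0 ⊕ x1 ≼ 4 ⊛ x2 ⊕ lit 6)
          (x0 ≼ lit 10 ∵ deg-T≤10 ∙ x1 ≼ 4 ⊛ (∥ s0) ∵ misses ∙ 4 ⟪ lit 1 ⊕ ∥ s0 ≅ x2 ∵ ∣T∣ ⟫ []))
      where
      misses : # Misses? ≤ 4 * ∣ T ∣
      misses = ≤-trans
        (#-union Misses? (Sub? 1 T) Miss? 4
          (λ S (s , m) → T ─ S , ((equation ((T) ∷ S ∷ []) (t ∷ []) (∥ s0 ∖ s1) (lit 1) 0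
              (lit 2 ⊕ ∥ s1 ⋒ s0 ≅˘ x0 ∵ m ∙ lit 1 ⊕ ∥ s0 ≅ x0 ∵ ∣T∣ ∙ []) 0
              (lit 2 ⊕ ∥ s1 ⋒ s0 ≅ x0 ∵ m ∙ lit 1 ⊕ ∥ s0 ≅˘ x0 ∵ ∣T∣ ∙ [])) , (linear ((T) ∷ S ∷ [])
              [] 0 ((s0 ∖ s1) ⋐ s0) [])) ,
            (s , m) , (linear ((T) ∷ S ∷ []) [] 0 (∥ (s0 ∖ s1) ⋒ s1 ≼ lit 0) [])) miss≤4)
        (≤-reflexive (trans (cong (_* 4) (#-points T)) (*-comm ∣ T ∣ 4)))

  -- When every (t+1)-set lies in at most one member and X ⊑ P: writing T for X ─ D with
  -- the point of P outside X, the sets P, A, B are T with three disjoint edges.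
  module InOne (deg≤1′ : ∀ Y → ∣ Y ∣ ≡ t + 1 → deg 𝒮? Y ≤ 1)
               (deg-T≤3 : ∀ T → ∣ T ∣ ≡ t → deg 𝒮? T ≤ 3)
               (deg≥2 : ∀ A B Y → 𝒮 A → 𝒮 B → ¬ A ≡ B → Y ⊑ A → Y ⊑ B → 2 ≤ deg 𝒮? Y)
               (P : Subset n) (p : 𝒮 P) (X⊑P : X ⊑ P) where


    A⊒ : (P ─ X) ⊑ A
    A⊒ = linear (P ∷ X ∷ A ∷ []) (t ∷ []) 0 ((s0 ∖ s1) ⋐ s2) (∥ s1 ≅˘ x0 ⊕ lit 1 ∵ ∣X∣ ∙
        lit 1 ⊕ ∥ s2 ⋒ s1 ≅ x0 ∵ mA ∙ s1 ⋐ s0 ∵ X⊑P ∙ ∥ s0 ≅ x0 ⊕ lit 2 ∵ size P p ∙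
        x0 ≼ ∥ s2 ⋒ s0 ∵ meet A P a p ∙ [])

    B⊒ : (P ─ X) ⊑ B
    B⊒ = linear (P ∷ X ∷ B ∷ []) (t ∷ []) 0 ((s0 ∖ s1) ⋐ s2) (∥ s1 ≅˘ x0 ⊕ lit 1 ∵ ∣X∣ ∙
        lit 1 ⊕ ∥ s2 ⋒ s1 ≅ x0 ∵ mB ∙ s1 ⋐ s0 ∵ X⊑P ∙ ∥ s0 ≅ x0 ⊕ lit 2 ∵ size P p ∙
        x0 ≼ ∥ s2 ⋒ s0 ∵ meet B P b p ∙ [])

    A∩B≤t : ∣ A ∩ B ∣ ≤ t
    A∩B≤t with ∣ A ∩ B ∣ ≤? t
    ... | yes h = h
    ... | no ¬h = let Y , ∣Y∣ , i = choose (A ∩ B) (t + 1) (linear (A ∷ B ∷ []) (t ∷ []) 0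
                        (x0 ⊕ lit 1 ≼ ∥ s0 ⋒ s1) (lit 1 ⊕ x0 ≼ ∥ s0 ⋒ s1 ∵ ≰⇒> ¬h ∙ [])) in
      contradiction (≤-trans (deg≥2 A B Y a b A≢B (linear (Y ∷ A ∷ B ∷ []) [] 0 (s0 ⋐ s1)
          (s0 ⋐ (s1 ⋒ s2) ∵ i ∙ [])) (linear (Y ∷ B ∷ A ∷ []) [] 0 (s0 ⋐ s1) (s0 ⋐ (s2 ⋒ s1) ∵ i ∙
          []))) (deg≤1′ Y ∣Y∣)) 1+n≰n

    T : Subset n
    T = (X ─ D) ∪ (P ─ X)

    ∣T∣ : ∣ T ∣ ≡ t
    ∣T∣ = equation (X ∷ D ∷ P ∷ []) (t ∷ []) (∥ (s0 ∖ s1) ⋓ (s2 ∖ s0)) (x0) 0 (∥ s1 ≅˘ lit 2 ∵ ∣D∣ ∙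
        s1 ⋐ s0 ∵ D⊑X ∙ s0 ⋐ s2 ∵ X⊑P ∙ ∥ s2 ≅ x0 ⊕ lit 2 ∵ size P p ∙ []) 0 (∥ s1 ≅ lit 2 ∵ ∣D∣ ∙
        ∥ s2 ≅˘ x0 ⊕ lit 2 ∵ size P p ∙ [])


    Misses? : Decidable (λ S → 𝒮 S × 1 + ∣ S ∩ T ∣ ≡ t)
    Misses? S = 𝒮? S ×-dec (1 + ∣ S ∩ T ∣ ≟ t)

    level : ∀ S → 𝒮 S → (𝒮 S × T ⊑ S) ⊎ (𝒮 S × 1 + ∣ S ∩ T ∣ ≡ t)
    level S s with T ⊑? S
    ... | yes i = inj₁ (s , i)
    -- With at most `t - 2` points in `T`, the set `S` would have to contain all three disjoint
    -- edges, six points, which exceeds its size.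
    ... | no ¬i = inj₂ (s , (equation (S ∷ X ∷ D ∷ P ∷ A ∷ B ∷ []) (t ∷ [])
        (lit 1 ⊕ ∥ s0 ⋒ ((s1 ∖ s2) ⋓ (s3 ∖ s1))) (x0) 0
        (lit 1 ≼ ∥ ((s1 ∖ s2) ⋓ (s3 ∖ s1)) ∖ s0 ∵ ≰⇒> ¬i ∙ ∥ s2 ≅˘ lit 2 ∵ ∣D∣ ∙ s2 ⋐ s1 ∵ D⊑X ∙
        s1 ⋐ s3 ∵ X⊑P ∙ ∥ s3 ≅ x0 ⊕ lit 2 ∵ size P p ∙ []) 1 (2 ⟪ ∥ s1 ≅ x0 ⊕ lit 1 ∵ ∣X∣ ⟫
        ∥ s2 ≅˘ lit 2 ∵ ∣D∣ ∙ s2 ⋐ s1 ∵ D⊑X ∙ lit 1 ⊕ ∥ s4 ⋒ s1 ≅˘ x0 ∵ mA ∙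
        lit 1 ⊕ ∥ s5 ⋒ s1 ≅˘ x0 ∵ mB ∙ 2 ⟪ ∥ s2 ⋒ s4 ≼ lit 0 ∵ dA ⟫ 2 ⟪ ∥ s2 ⋒ s5 ≼ lit 0 ∵ dB ⟫
        ∥ s3 ≅˘ x0 ⊕ lit 2 ∵ size P p ∙ (s3 ∖ s1) ⋐ s4 ∵ A⊒ ∙ (s3 ∖ s1) ⋐ s5 ∵ B⊒ ∙
        ∥ s4 ⋒ s5 ≼ x0 ∵ A∩B≤t ∙ x0 ≼ ∥ s0 ⋒ s3 ∵ meet S P s p ∙ x0 ≼ ∥ s0 ⋒ s4 ∵ meet S A s a ∙
        x0 ≼ ∥ s0 ⋒ s5 ∵ meet S B s b ∙ ∥ s0 ≅ x0 ⊕ lit 2 ∵ size S s ∙ [])))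

    Miss? : ∀ x → Decidable (λ S → (𝒮 S × 1 + ∣ S ∩ T ∣ ≡ t) × ∣ x ∩ S ∣ ≤ 0)
    Miss? x S = Misses? S ×-dec (∣ x ∩ S ∣ ≤? 0)

    -- Such S meet each of the three edges.
    miss≤4 : ∀ x → Sub 1 T x → # (Miss? x) ≤ 4
    miss≤4 x (∣x∣ , i) = ≤-trans
      (#-union (Miss? x) (Sub? 1 D) (λ d S → Miss? x S ×-dec d ⊑? S) 2
        (λ S ((s , m) , e) →
          let d , j , k = hit-point S D (linear (S ∷ D ∷ X ∷ P ∷ []) (t ∷ []) 0 (lit 1 ≼ ∥ s0 ⋒ s1)
                (lit 1 ⊕ ∥ s0 ⋒ ((s2 ∖ s1) ⋓ (s3 ∖ s2)) ≅ x0 ∵ m ∙ x0 ≼ ∥ s0 ⋒ s3 ∵ meet S P s p ∙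
                []))
          in d , j , ((s , m) , e) , k)
        (λ d (∣d∣ , j) → ≤-trans
          (#-union (λ S → Miss? x S ×-dec d ⊑? S) (Sub? 1 (A ─ T))
            (λ c → above? 𝒮? ((T ─ x) ∪ (d ∪ c))) 1
            (λ S (((s , m) , e) , k) →
              let c , h , l = hit-point S (A ─ T)
                    (linear (S ∷ A ∷ X ∷ D ∷ P ∷ []) (t ∷ []) 0
                        (lit 1 ≼ ∥ s0 ⋒ (s1 ∖ ((s2 ∖ s3) ⋓ (s4 ∖ s2))))
                        (lit 1 ⊕ ∥ s0 ⋒ ((s2 ∖ s3) ⋓ (s4 ∖ s2)) ≅ x0 ∵ m ∙
                        x0 ≼ ∥ s0 ⋒ s1 ∵ meet S A s a ∙ []))
              in c , h , s , ∪-⊑ (T ─ x) (d ∪ c) S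
                (linear (X ∷ D ∷ P ∷ x ∷ S ∷ []) (t ∷ []) 0 ((((s0 ∖ s1) ⋓ (s2 ∖ s0)) ∖ s3) ⋐ s4)
                    (lit 1 ⊕ ∥ s4 ⋒ ((s0 ∖ s1) ⋓ (s2 ∖ s0)) ≅˘ x0 ∵ m ∙ ∥ s3 ⋒ s4 ≼ lit 0 ∵ e ∙
                    ∥ s3 ≅˘ lit 1 ∵ ∣x∣ ∙ s3 ⋐ ((s0 ∖ s1) ⋓ (s2 ∖ s0)) ∵ i ∙ ∥ s1 ≅˘ lit 2 ∵ ∣D∣ ∙
                    s1 ⋐ s0 ∵ D⊑X ∙ s0 ⋐ s2 ∵ X⊑P ∙ ∥ s2 ≅ x0 ⊕ lit 2 ∵ size P p ∙ []))
                      (∪-⊑ d c S k l))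
            (λ c (∣c∣ , h) → deg≤1′ ((T ─ x) ∪ (d ∪ c)) (equation (X ∷ D ∷ P ∷ x ∷ d ∷ c ∷ A ∷ [])
                (t ∷ []) (∥ (((s0 ∖ s1) ⋓ (s2 ∖ s0)) ∖ s3) ⋓ (s4 ⋓ s5)) (x0 ⊕ lit 1) 0
                (∥ s5 ≅ lit 1 ∵ ∣c∣ ∙ ∥ s4 ≅ lit 1 ∵ ∣d∣ ∙ ∥ s3 ≅˘ lit 1 ∵ ∣x∣ ∙
                s3 ⋐ ((s0 ∖ s1) ⋓ (s2 ∖ s0)) ∵ i ∙ ∥ s1 ≅˘ lit 2 ∵ ∣D∣ ∙ s1 ⋐ s0 ∵ D⊑X ∙
                s0 ⋐ s2 ∵ X⊑P ∙ ∥ s2 ≅ x0 ⊕ lit 2 ∵ size P p ∙ []) 0 (∥ s5 ≅˘ lit 1 ∵ ∣c∣ ∙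
                ∥ s4 ≅˘ lit 1 ∵ ∣d∣ ∙ ∥ s3 ≅ lit 1 ∵ ∣x∣ ∙ s4 ⋐ s1 ∵ j ∙
                s5 ⋐ (s6 ∖ ((s0 ∖ s1) ⋓ (s2 ∖ s0))) ∵ h ∙ ∥ s1 ≅ lit 2 ∵ ∣D∣ ∙
                ∥ s1 ⋒ s6 ≼ lit 0 ∵ dA ∙ ∥ s2 ≅˘ x0 ⊕ lit 2 ∵ size P p ∙ []))))
          (≤-reflexive (trans (*-identityʳ _) (trans (#-points (A ─ T))
            (equation (A ∷ X ∷ D ∷ P ∷ []) (t ∷ []) (∥ s0 ∖ ((s1 ∖ s2) ⋓ (s3 ∖ s1))) (lit 2) 0
                (∥ s1 ≅ x0 ⊕ lit 1 ∵ ∣X∣ ∙ ∥ s0 ≅ x0 ⊕ lit 2 ∵ size A a ∙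
                lit 1 ⊕ ∥ s0 ⋒ s1 ≅˘ x0 ∵ mA ∙ ∥ s2 ⋒ s0 ≼ lit 0 ∵ dA ∙
                ∥ s3 ≅˘ x0 ⊕ lit 2 ∵ size P p ∙ (s3 ∖ s1) ⋐ s0 ∵ A⊒ ∙ []) 0
                (∥ s1 ≅˘ x0 ⊕ lit 1 ∵ ∣X∣ ∙ ∥ s0 ≅˘ x0 ⊕ lit 2 ∵ size A a ∙
                lit 1 ⊕ ∥ s0 ⋒ s1 ≅ x0 ∵ mA ∙ s1 ⋐ s3 ∵ X⊑P ∙ ∥ s3 ≅ x0 ⊕ lit 2 ∵ size P p ∙
                  []))))))
      )
      (≤-reflexive (cong (_* 2) (trans (#-points D) ∣D∣)))

    bound : # 𝒮? ≤ 4 * t + 3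
    bound = ≤-trans (#-∪ 𝒮? (above? 𝒮? T) Misses? level)
      (linear ((T) ∷ []) ((deg 𝒮? T) ∷ (# Misses?) ∷ t ∷ []) 0 (x0 ⊕ x1 ≼ 4 ⊛ x2 ⊕ lit 3)
          (x0 ≼ lit 3 ∵ deg-T≤3 T ∣T∣ ∙ x1 ≼ 4 ⊛ (∥ s0) ∵ misses ∙ 4 ⟪ ∥ s0 ≅ x2 ∵ ∣T∣ ⟫ []))
      where
      misses : # Misses? ≤ 4 * ∣ T ∣
      misses = ≤-trans
        (#-union Misses? (Sub? 1 T) Miss? 4
          (λ S (s , m) → T ─ S , ((equation ((T) ∷ S ∷ []) (t ∷ []) (∥ s0 ∖ s1) (lit 1) 0
              (lit 1 ⊕ ∥ s1 ⋒ s0 ≅˘ x0 ∵ m ∙ ∥ s0 ≅ x0 ∵ ∣T∣ ∙ []) 0 (lit 1 ⊕ ∥ s1 ⋒ s0 ≅ x0 ∵ m ∙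
              ∥ s0 ≅˘ x0 ∵ ∣T∣ ∙ [])) , (linear ((T) ∷ S ∷ []) [] 0 ((s0 ∖ s1) ⋐ s0) [])) ,
            (s , m) , (linear ((T) ∷ S ∷ []) [] 0 (∥ (s0 ∖ s1) ⋒ s1 ≼ lit 0) [])) miss≤4)
        (≤-reflexive (trans (cong (_* 4) (#-points T)) (*-comm ∣ T ∣ 4)))

module LightConclusion {n} (t ℓ : ℕ) (1≤t : 1 ≤ t) (3≤ℓ : 3 ≤ ℓ) {𝒮 : Subset n → Set}
  (𝒮? : Decidable 𝒮)
             (size : ∀ S → 𝒮 S → ∣ S ∣ ≡ t + 2)
             (meet : ∀ S S′ → 𝒮 S → 𝒮 S′ → t ≤ ∣ S ∩ S′ ∣)
             (nontrivial : ∀ T → ∣ T ∣ ≡ t → ∃ λ S → 𝒮 S × ∣ S ∩ T ∣ < t)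
             (deg≤3 : ∀ Y → ∣ Y ∣ ≡ t + 1 → deg 𝒮? Y ≤ 3)
             (room : t ≤ n) where

  open Thresholds t ℓ 1≤t 3≤ℓ
  open Light t ℓ 1≤t 3≤ℓ 𝒮? size meet nontrivial

  private
    Heavier? : ∀ d → Decidable (λ X → ∣ X ∣ ≡ t + 1 × d ≤ deg 𝒮? X)
    Heavier? d X = (∣ X ∣ ≟ t + 1) ×-dec (d ≤? deg 𝒮? X)

    lighter : ∀ d → ¬ (∃ λ X → ∣ X ∣ ≡ t + 1 × suc d ≤ deg 𝒮? X) → ∀ Y → ∣ Y ∣ ≡ t + 1 →
      deg 𝒮? Y ≤ d
    lighter d ¬w Y e = s≤s⁻¹ (≰⇒> (λ l → ¬w (Y , e , l)))

    degree2 : (∀ Y → ∣ Y ∣ ≡ t + 1 → deg 𝒮? Y ≤ 2) → ∀ X → ∣ X ∣ ≡ t + 1 → 2 ≤ deg 𝒮? X →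
      Small (# 𝒮?)
    degree2 deg≤2 X ∣X∣ h with two (above? 𝒮? X) h
    ... | P , Q , (p , X⊑P) , (q , X⊑Q) , P≢Q with Degree≤2.small-or-double 2 ≤-refl deg≤2 X ∣X∣ P p
      X⊑P
    ...   | inj₁ s = s
    ...   | inj₂ (D , (∣D∣ , i) , A , B , ((a , mA) , dA) , ((b , mB) , dB) , A≢B) = small₅
            (Doubled.InTwo.bound t 1≤t 𝒮? size meet X ∣X∣ D ∣D∣ i A B a b mA mB dA dB A≢B deg≤2 P Q
              p q X⊑P X⊑Q P≢Q)

    degree1 : (∀ Y → ∣ Y ∣ ≡ t + 1 → deg 𝒮? Y ≤ 1) → ∀ X → ∣ X ∣ ≡ t + 1 → ∀ P → 𝒮 P → X ⊑ P →
      Small (# 𝒮?)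
    degree1 deg≤1 X ∣X∣ P p X⊑P with Degree≤2.small-or-double 1 (s≤s z≤n) deg≤1 X ∣X∣ P p X⊑P
    ... | inj₁ s = s
    ... | inj₂ (D , (∣D∣ , i) , A , B , ((a , mA) , dA) , ((b , mB) , dB) , A≢B) = small₅ (≤-trans
            (Doubled.InOne.bound t 1≤t 𝒮? size meet X ∣X∣ D ∣D∣ i A B a b mA mB dA dB A≢B deg≤1
              (deg-T 1 deg≤1) deg≥2 P p X⊑P)
            (+-monoʳ-≤ (4 * t) (s≤s (s≤s (s≤s z≤n)))))

  light : Small (# 𝒮?) ⊎ Complete
  light with ∃? (Heavier? 3)
  ... | yes (X , ∣X∣ , h) = degree3 deg≤3 X ∣X∣ h
  ... | no ¬3 with ∃? (Heavier? 2)
  ...   | yes (X , ∣X∣ , h) = inj₁ (degree2 (lighter 2 ¬3) X ∣X∣ h)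
  ...   | no ¬2 =
    -- Any `t`-set will do: `nontrivial` serves here only to produce some member `P`.
    let T , ∣T∣ , _ = choose ⊤ t (≤-trans room (≤-reflexive (sym (∣⊤∣≡n n))))
        P , p , _ = nontrivial T ∣T∣
        X , ∣X∣ , i = choose P (t + 1) (linear (P ∷ []) (t ∷ []) 0 (x0 ⊕ lit 1 ≼ ∥ s0)
            (∥ s0 ≅˘ x0 ⊕ lit 2 ∵ size P p ∙ []))
    in inj₁ (degree1 (lighter 1 ¬2) X ∣X∣ P p i)

-- Type II

module _ {n : ℕ} (k t : ℕ) where

  -- The three types with inclusion, nonemptiness and disjointness turned into inequalities between
  -- cardinalities, so that `linear` applies. `F ∩ (A ∪ T) ≡ T` becomes `T ⊑ F` together with
  -- avoiding `A ─ T`, and the point `u` becomes a one-element set.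
  FamilyI : (T A B C′ u : Subset n) → Subset n → Set
  FamilyI T A B C′ u F =
      (∣ F ∣ ≡ k × (T ⊑ F × ∣ F ∩ (A ─ T) ∣ ≤ 0) × (1 ≤ ∣ F ∩ B ∣ × 1 ≤ ∣ F ∩ C′ ∣))
    ⊎ (∣ F ∣ ≡ k × (A ∪ T) ⊑ F × 1 ≤ ∣ F ∩ (B ∪ u) ∣)
    ⊎ (F ≡ A ∪ B ⊎ F ≡ A ∪ C′ ⊎ F ≡ (T ∩ A) ∪ B ∪ u)

  FamilyII : (M W : Subset n) → Subset n → Set
  FamilyII M W F =
      (∣ F ∣ ≡ k × W ⊑ F)
    ⊎ (∣ F ∣ ≡ k × ∣ F ∩ W ∣ ≡ t + 1 × 1 ≤ ∣ F ∩ (M ─ W) ∣)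
    ⊎ (∣ F ∣ ≡ k × F ⊑ M × ∣ F ∩ W ∣ ≡ t)

  FamilyIII : (Z : Subset n) → Subset n → Set
  FamilyIII Z F = ∣ F ∣ ≡ k × t + 2 ≤ ∣ F ∩ Z ∣

module Pivot {n} (t ℓ : ℕ) (1≤t : 1 ≤ t) (3≤ℓ : 3 ≤ ℓ) (room : (t + 2) + (t + ℓ) ≤ n)
             {𝔽 : Subset n → Set} (𝔽? : Decidable 𝔽)
             (size𝔽 : ∀ F → 𝔽 F → ∣ F ∣ ≡ t + ℓ)
             (meet𝔽 : ∀ F G → 𝔽 F → 𝔽 G → t ≤ ∣ F ∩ G ∣)
             (maximal : ∀ X → ∣ X ∣ ≡ t + ℓ → (∀ F → 𝔽 F → t ≤ ∣ X ∩ F ∣) → 𝔽 X)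
             (noCover : ∀ X → ∣ X ∣ ≡ t + 1 → ∃ λ F → 𝔽 F × ∣ F ∩ X ∣ < t) where

  open Setting t ℓ 1≤t 3≤ℓ room 𝔽? size𝔽 meet𝔽 maximal

  StructureII : Set
  StructureII = ∃ λ M → ∃ λ W → ∣ M ∣ ≡ t + ℓ + 2 × W ⊑ M × ∣ W ∣ ≡ t + 2 ×
    (∀ F → 𝔽 F → FamilyII (t + ℓ) t M W F)

  module _ (W : Subset n) (W∈𝒮 : 𝒮 W) (near : ∀ S → 𝒮 S → t + 1 ≤ ∣ S ∩ W ∣) where

    ∣W∣ : ∣ W ∣ ≡ t + 2
    ∣W∣ = proj₁ W∈𝒮

    ∣W─w∣ : ∀ w → Sub 1 W w → ∣ W ─ w ∣ ≡ t + 1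
    ∣W─w∣ w (∣w∣ , i) = equation (W ∷ w ∷ []) (t ∷ []) (∥ s0 ∖ s1) (x0 ⊕ lit 1) 0
        (∥ s1 ≅˘ lit 1 ∵ ∣w∣ ∙ s1 ⋐ s0 ∵ i ∙ ∥ s0 ≅ x0 ⊕ lit 2 ∵ ∣W∣ ∙ []) 0 (∥ s1 ≅ lit 1 ∵ ∣w∣ ∙
        ∥ s0 ≅˘ x0 ⊕ lit 2 ∵ ∣W∣ ∙ [])

    Neighbour? : ∀ w → Decidable (λ S → (𝒮 S × (W ─ w) ⊑ S) × ¬ S ≡ W)
    Neighbour? w = others? (above? 𝒮? (W ─ w)) W

    -- `W` itself is among the at most `ℓ + 1` members above `W ─ w`.
    neighbours≤ℓ : ∀ w → Sub 1 W w → # (Neighbour? w) ≤ ℓ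
    neighbours≤ℓ w i = s≤s⁻¹ (≤-trans (others-< (above? 𝒮? (W ─ w)) W (W∈𝒮 , (linear (W ∷ w ∷ []) []
        0 ((s0 ∖ s1) ⋐ s0) [])))
      (≤-trans (deg≤ noCover (W ─ w) (∣W─w∣ w i)) (≤-reflexive (+-comm ℓ 1))))

    neighbour : ∀ S → 𝒮 S × ¬ S ≡ W → ∃ λ w → Sub 1 W w × (𝒮 S × (W ─ w) ⊑ S) × ¬ S ≡ W
    neighbour S (s , ne) with W ⊑? S
    ... | yes i = contradiction (⊑-antisym (linear (S ∷ W ∷ []) (t ∷ []) 0 (s0 ⋐ s1) (s1 ⋐ s0 ∵ i ∙
        ∥ s1 ≅˘ x0 ⊕ lit 2 ∵ ∣W∣ ∙ ∥ s0 ≅ x0 ⊕ lit 2 ∵ size S s ∙ [])) i) ne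
    ... | no ¬i = W ─ S ,
      ((equation (W ∷ S ∷ []) (t ∷ []) (∥ s0 ∖ s1) (lit 1) 0 (x0 ⊕ lit 1 ≼ ∥ s1 ⋒ s0 ∵ near S s ∙
          ∥ s0 ≅ x0 ⊕ lit 2 ∵ ∣W∣ ∙ []) 0 (lit 1 ≼ ∥ s0 ∖ s1 ∵ ≰⇒> ¬i ∙ [])) , (linear (W ∷ S ∷ [])
          [] 0 ((s0 ∖ s1) ⋐ s0) [])) ,
      (s , (linear (W ∷ S ∷ []) [] 0 ((s0 ∖ (s0 ∖ s1)) ⋐ s1) [])) , ne

    points-W : # (Sub? 1 W) * ℓ ≡ (t + 2) * ℓ
    points-W = cong (_* ℓ) (trans (#-points W) ∣W∣)

    𝒮≤N₂ : # 𝒮? ≤ N₂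
    𝒮≤N₂ = ≤-trans (#-others 𝒮? W) (≤-trans (s≤s
      (≤-trans (#-union (others? 𝒮? W) (Sub? 1 W) Neighbour? ℓ neighbour neighbours≤ℓ)
        (≤-reflexive points-W)))
      (≤-reflexive (+-comm 1 _)))

    few-neighbours : ∀ w → Sub 1 W w → # (Neighbour? w) < ℓ → # 𝒮? < N₂
    few-neighbours w i l = ≤-trans (s≤s (#-others 𝒮? W)) (≤-trans (s≤s
      (≤-trans (#-union-strict (others? 𝒮? W) (Sub? 1 W) Neighbour? ℓ neighbour neighbours≤ℓ w i l)
        (≤-reflexive points-W)))
      (≤-reflexive (+-comm 1 _)))

    module _ (3≤t : 3 ≤ t) (many : N₂ ≤ # 𝒮?) where

      -- A neighbour of `W` that drops `w` keeps only `t - 1` points of `F ∩ W`, so its new point is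
      -- one of the `ℓ` points of `F ─ W`. If one of these did not occur, there would be fewer than
      -- `N₂` covers.
      neighbour-∈ : ∀ F → 𝔽 F → ∣ F ∩ W ∣ ≡ t → ∀ w → Sub 1 (F ∩ W) w → ∀ q → Sub 1 (F ─ W) q →
        𝒮 ((W ─ w) ∪ q)
      neighbour-∈ F f m w (∣w∣ , i) q (∣q∣ , j) with 𝒮? ((W ─ w) ∪ q)
      ... | yes s = s
      ... | no ¬s = contradiction (≤-trans (few-neighbours w (∣w∣ , w⊑W) few) many) 1+n≰n
        where
        w⊑W : w ⊑ W
        w⊑W = linear (w ∷ W ∷ F ∷ []) [] 0 (s0 ⋐ s1) (s0 ⋐ (s2 ⋒ s1) ∵ i ∙ [])
        hits : ∀ S → (𝒮 S × (W ─ w) ⊑ S) × ¬ S ≡ W → 1 ≤ ∣ S ∩ ((F ─ W) ─ q) ∣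
        hits S ((s , h) , ne) with q ⊑? S
        ... | yes k = contradiction (subst 𝒮 (⊑-antisym
              (linear (S ∷ W ∷ w ∷ q ∷ F ∷ []) (t ∷ []) 0 (s0 ⋐ ((s1 ∖ s2) ⋓ s3))
                  ((s1 ∖ s2) ⋐ s0 ∵ h ∙ s3 ⋐ s0 ∵ k ∙ s3 ⋐ (s4 ∖ s1) ∵ j ∙ ∥ s3 ≅˘ lit 1 ∵ ∣q∣ ∙
                  ∥ s2 ≅ lit 1 ∵ ∣w∣ ∙ ∥ s0 ≅ x0 ⊕ lit 2 ∵ size S s ∙ ∥ s1 ≅˘ x0 ⊕ lit 2 ∵ ∣W∣ ∙
                  []))
              (linear (W ∷ w ∷ q ∷ S ∷ []) [] 0 (((s0 ∖ s1) ⋓ s2) ⋐ s3) ((s0 ∖ s1) ⋐ s3 ∵ h ∙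
                  s2 ⋐ s3 ∵ k ∙ []))) s) ¬s
        ... | no ¬k with W ⊑? S
        ...   | yes l = contradiction (⊑-antisym (linear (S ∷ W ∷ []) (t ∷ []) 0 (s0 ⋐ s1)
            (s1 ⋐ s0 ∵ l ∙ ∥ s1 ≅˘ x0 ⊕ lit 2 ∵ ∣W∣ ∙ ∥ s0 ≅ x0 ⊕ lit 2 ∵ size S s ∙ [])) l) ne
        ...   | no ¬l = linear (S ∷ F ∷ W ∷ q ∷ w ∷ []) (t ∷ []) 0 (lit 1 ≼ ∥ s0 ⋒ ((s1 ∖ s2) ∖ s3))
            (x0 ≼ ∥ s1 ⋒ s0 ∵ proj₂ s F f ∙ lit 1 ≼ ∥ s3 ∖ s0 ∵ ≰⇒> ¬k ∙
            lit 1 ≼ ∥ s2 ∖ s0 ∵ ≰⇒> ¬l ∙ (s2 ∖ s4) ⋐ s0 ∵ h ∙ s4 ⋐ (s1 ⋒ s2) ∵ i ∙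
            ∥ s3 ≅ lit 1 ∵ ∣q∣ ∙ ∥ s1 ⋒ s2 ≅ x0 ∵ m ∙ [])
        few : # (Neighbour? w) < ℓ
        few = ≤-trans (s≤s (#-union (Neighbour? w) (Sub? 1 ((F ─ W) ─ q))
          (λ b → above? 𝒮? ((W ─ w) ∪ b)) 1
            (λ S (κ , ne) → let b , k , l = hit-point S ((F ─ W) ─ q) (hits S (κ , ne)) in b , k ,
              proj₁ κ , ∪-⊑ (W ─ w) b S (proj₂ κ) l)
            (λ b (∣b∣ , k) → deg-top 𝒮? (t + 2) size ((W ─ w) ∪ b) (equation
                (W ∷ w ∷ b ∷ F ∷ q ∷ []) (t ∷ []) (∥ (s0 ∖ s1) ⋓ s2) (x0 ⊕ lit 2) 0
                (∥ s2 ≅ lit 1 ∵ ∣b∣ ∙ ∥ s1 ≅˘ lit 1 ∵ ∣w∣ ∙ s1 ⋐ s0 ∵ w⊑W ∙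
                ∥ s0 ≅ x0 ⊕ lit 2 ∵ ∣W∣ ∙ []) 0 (∥ s2 ≅˘ lit 1 ∵ ∣b∣ ∙ s2 ⋐ ((s3 ∖ s0) ∖ s4) ∵ k ∙
                ∥ s1 ≅ lit 1 ∵ ∣w∣ ∙ ∥ s0 ≅˘ x0 ⊕ lit 2 ∵ ∣W∣ ∙ [])))))
          (≤-trans (s≤s (≤-reflexive (trans (*-identityʳ _) (#-points ((F ─ W) ─ q)))))
            (linear (F ∷ W ∷ q ∷ []) (ℓ ∷ t ∷ []) 0 (lit 1 ⊕ ∥ (s0 ∖ s1) ∖ s2 ≼ x0)
                (s2 ⋐ (s0 ∖ s1) ∵ j ∙ ∥ s2 ≅˘ lit 1 ∵ ∣q∣ ∙ ∥ s0 ⋒ s1 ≅˘ x1 ∵ m ∙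
                ∥ s0 ≅ x1 ⊕ x0 ∵ size𝔽 F f ∙ [])))

      -- `W` is a cover and `W ─ w` is not; an `F` that shows this has exactly `t` points in `W`,
      -- among them `w`.
      through : ∀ w → Sub 1 W w → ∃ λ F → 𝔽 F × w ⊑ F × ∣ F ∩ W ∣ ≡ t
      through w (∣w∣ , i) with noCover (W ─ w) (∣W─w∣ w (∣w∣ , i))
      ... | F , f , h = F , f , (linear (w ∷ F ∷ W ∷ []) (t ∷ []) 0 (s0 ⋐ s1)
          (lit 1 ⊕ ∥ s1 ⋒ (s2 ∖ s0) ≼ x0 ∵ h ∙ x0 ≼ ∥ s1 ⋒ s2 ∵ proj₂ W∈𝒮 F f ∙ ∥ s0 ≅ lit 1 ∵ ∣w∣ ∙
          [])) ,
        (equation (F ∷ W ∷ w ∷ []) (t ∷ []) (∥ s0 ⋒ s1) (x0) 0 (lit 1 ⊕ ∥ s0 ⋒ (s1 ∖ s2) ≼ x0 ∵ h ∙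
            ∥ s2 ≅ lit 1 ∵ ∣w∣ ∙ []) 0 (x0 ≼ ∥ s0 ⋒ s1 ∵ proj₂ W∈𝒮 F f ∙ []))

      -- Exchanging a common point `w` of `F`, `G` and `W` for a point `q` of `F ─ W` gives a cover,
      -- which forces `q` into `G`. Two `t`-subsets of the `(t+2)`-set `W` share at least `t - 2`
      -- points, so `w` exists because `3 ≤ t`.
      same-outside : ∀ F G → 𝔽 F → 𝔽 G → ∣ F ∩ W ∣ ≡ t → ∣ G ∩ W ∣ ≡ t → (F ─ W) ⊑ G
      same-outside F G f g m m′ with (F ─ W) ⊑? G
      ... | yes h = h
      ... | no ¬h =
        let q , ∣q∣ , j = choose ((F ─ W) ─ G) 1 (≰⇒> ¬h)
            w , ∣w∣ , i = choose ((F ∩ G) ∩ W) 1 (linear (F ∷ G ∷ W ∷ []) (t ∷ []) 0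
                (lit 1 ≼ ∥ (s0 ⋒ s1) ⋒ s2) (∥ s0 ⋒ s2 ≅˘ x0 ∵ m ∙ ∥ s1 ⋒ s2 ≅˘ x0 ∵ m′ ∙
                ∥ s2 ≅ x0 ⊕ lit 2 ∵ ∣W∣ ∙ lit 3 ≼ x0 ∵ 3≤t ∙ []))
            s = neighbour-∈ F f m w (∣w∣ , (linear (w ∷ F ∷ W ∷ G ∷ []) [] 0 (s0 ⋐ (s1 ⋒ s2))
                (s0 ⋐ ((s1 ⋒ s3) ⋒ s2) ∵ i ∙ []))) q (∣q∣ , (linear (q ∷ F ∷ W ∷ G ∷ []) [] 0
                (s0 ⋐ (s1 ∖ s2)) (s0 ⋐ ((s1 ∖ s2) ∖ s3) ∵ j ∙ [])))
        in (impossible (linear (G ∷ W ∷ w ∷ q ∷ F ∷ []) (t ∷ []) 0 (lit 1 ≼ lit 0)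
            (x0 ≼ ∥ s0 ⋒ ((s1 ∖ s2) ⋓ s3) ∵ proj₂ s G g ∙ ∥ s0 ⋒ s1 ≅ x0 ∵ m′ ∙
            s2 ⋐ ((s4 ⋒ s0) ⋒ s1) ∵ i ∙ ∥ s2 ≅˘ lit 1 ∵ ∣w∣ ∙ s3 ⋐ ((s4 ∖ s1) ∖ s0) ∵ j ∙ [])))

      structure : StructureII
      structure =
        let w , i = choose W 1 (linear (W ∷ []) (t ∷ []) 1 (lit 1 ≼ ∥ s0)
              (∥ s0 ≅˘ x0 ⊕ lit 2 ∵ ∣W∣ ∙ []))
            G , g , _ , m = through w i
        in W ∪ G , W , (equation (W ∷ G ∷ []) (t ∷ ℓ ∷ []) (∥ s0 ⋓ s1) (x0 ⊕ x1 ⊕ lit 2) 0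
            (∥ s1 ⋒ s0 ≅˘ x0 ∵ m ∙ ∥ s1 ≅ x0 ⊕ x1 ∵ size𝔽 G g ∙ ∥ s0 ≅ x0 ⊕ lit 2 ∵ ∣W∣ ∙ []) 0
            (∥ s1 ⋒ s0 ≅ x0 ∵ m ∙ ∥ s1 ≅˘ x0 ⊕ x1 ∵ size𝔽 G g ∙ ∥ s0 ≅˘ x0 ⊕ lit 2 ∵ ∣W∣ ∙ [])) ,
              (linear
            (W ∷ G ∷ []) [] 0 (s0 ⋐ (s0 ⋓ s1)) []) ,
           ∣W∣ , classify G g m
        where
        classify : ∀ G → 𝔽 G → ∣ G ∩ W ∣ ≡ t → ∀ F → 𝔽 F → FamilyII (t + ℓ) t (W ∪ G) W F
        classify G g m F f with W ⊑? F | ∣ F ∩ W ∣ ≟ t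
        ... | yes i | _      = inj₁ (size𝔽 F f , i)
        ... | no _  | yes m′ = inj₂ (inj₂ (size𝔽 F f , (linear (F ∷ W ∷ G ∷ []) [] 0
            (s0 ⋐ (s1 ⋓ s2)) ((s0 ∖ s1) ⋐ s2 ∵ same-outside F G f g m′ m ∙ [])) , m′))
        ... | no ¬i | no ¬m  =
          let m′ = ≤∧≢⇒< (proj₂ W∈𝒮 F f) (¬m ∘ sym)
              ∣F∩W∣ = equation (F ∷ W ∷ []) (t ∷ []) (∥ s0 ⋒ s1) (x0 ⊕ lit 1) 0
                  (lit 1 ≼ ∥ s1 ∖ s0 ∵ ≰⇒> ¬i ∙ ∥ s1 ≅ x0 ⊕ lit 2 ∵ ∣W∣ ∙ []) 0
                  (lit 1 ⊕ x0 ≼ ∥ s0 ⋒ s1 ∵ m′ ∙ [])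
              -- `H` contains the one point of `W` that `F` misses, so `F` and `H` share only
              -- `t - 1` points of `W`. They share another one outside `W`, where `H` lies in `G`.
              H , h , i , e = through (W ─ F) ((equation (W ∷ F ∷ []) (t ∷ []) (∥ s0 ∖ s1) (lit 1) 0
                  (∥ s1 ⋒ s0 ≅˘ x0 ⊕ lit 1 ∵ ∣F∩W∣ ∙ ∥ s0 ≅ x0 ⊕ lit 2 ∵ ∣W∣ ∙ []) 0
                  (∥ s1 ⋒ s0 ≅ x0 ⊕ lit 1 ∵ ∣F∩W∣ ∙ ∥ s0 ≅˘ x0 ⊕ lit 2 ∵ ∣W∣ ∙ [])) , (linear
                  (W ∷ F ∷ []) [] 0 ((s0 ∖ s1) ⋐ s0) []))
          in inj₂ (inj₁ (size𝔽 F f , ∣F∩W∣ ,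
               (linear (F ∷ W ∷ G ∷ H ∷ []) (t ∷ []) 0 (lit 1 ≼ ∥ s0 ⋒ ((s1 ⋓ s2) ∖ s1))
                   (x0 ≼ ∥ s0 ⋒ s3 ∵ meet𝔽 F H f h ∙ (s1 ∖ s0) ⋐ s3 ∵ i ∙ ∥ s3 ⋒ s1 ≅ x0 ∵ e ∙
                   ∥ s0 ⋒ s1 ≅ x0 ⊕ lit 1 ∵ ∣F∩W∣ ∙ ∥ s1 ≅˘ x0 ⊕ lit 2 ∵ ∣W∣ ∙
                   (s3 ∖ s1) ⋐ s2 ∵ same-outside H G h g e m ∙ []))))

    pivot : Small (# 𝒮?) ⊎ StructureII
    pivot with 3 ≤? t | N₂ ≤? # 𝒮?
    ... | no ¬3 | _       = inj₁ (small-N₂ (s≤s⁻¹ (≰⇒> ¬3)) 𝒮≤N₂)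
    ... | yes _ | no l    = inj₁ (below₂ (≰⇒> l))
    ... | yes 3≤t | yes m = inj₂ (structure 3≤t m)

-- Type I

C2-square : ∀ m → 2 * (m C 2) + m ≡ m * m
C2-square zero    = refl
C2-square (suc m) = begin
  2 * (suc m C 2) + suc m         ≡⟨ cong (λ c → 2 * c + suc m) (C2-suc m) ⟩
  2 * (m + m C 2) + suc m
    ≡⟨ (equation {n = 0} [] (m ∷ (m C 2) ∷ []) (2 ⊛ (x0 ⊕ x1) ⊕ (lit 1 ⊕ x0))
        (lit 1 ⊕ x0 ⊕ (x0 ⊕ (2 ⊛ x1 ⊕ x0))) 0 [] 0 []) ⟩
  suc m + (m + (2 * (m C 2) + m)) ≡⟨ cong (λ c → suc m + (m + c)) (C2-square m) ⟩
  suc m + (m + m * m)             ≡⟨ cong (suc m +_) (sym (*-suc m m)) ⟩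
  suc m * suc m                   ∎
  where open ≡-Reasoning

module PairBound (ℓ : ℕ) (3≤ℓ : 3 ≤ ℓ) (p q : ℕ) (p+q : p + q ≡ ℓ + 1) where

  -- Since `p + q = ℓ + 1`, the quantity `p * (ℓ + 1) + q * q` is (ℓ + 1)² - pq. It equals `N₁` if
  -- `p` or `q` is 1, for then pq = ℓ, and it is smaller if both are at least 2.
  expand : p * (ℓ + 1) + q * q + p * q ≡ (ℓ * ℓ + ℓ + 1) + ℓ
  expand = begin
    p * (ℓ + 1) + q * q + p * q ≡⟨ cong (λ a → p * a + q * q + p * q) (sym p+q) ⟩
    p * (p + q) + q * q + p * q ≡⟨ Ring.solve (p List.∷ q List.∷ List.[]) ⟩
    (p + q) * (p + q)           ≡⟨ cong (λ a → a * a) p+q ⟩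
    (ℓ + 1) * (ℓ + 1)           ≡⟨ Ring.solve (ℓ List.∷ List.[]) ⟩
    (ℓ * ℓ + ℓ + 1) + ℓ         ∎
    where open ≡-Reasoning

  pair-total : p * q ≡ ℓ → p * (ℓ + 1) + q * q ≡ ℓ * ℓ + ℓ + 1
  pair-total e = equation {n = 0} [] ((p * (ℓ + 1)) ∷ (q * q) ∷ (ℓ * ℓ) ∷ ℓ ∷ (p * q) ∷ [])
      (x0 ⊕ x1) (x2 ⊕ x3 ⊕ lit 1) 0 (x0 ⊕ x1 ⊕ x4 ≅ x2 ⊕ x3 ⊕ lit 1 ⊕ x3 ∵ expand ∙ x4 ≅˘ x3 ∵ e ∙
      []) 0 (x0 ⊕ x1 ⊕ x4 ≅˘ x2 ⊕ x3 ⊕ lit 1 ⊕ x3 ∵ expand ∙ x4 ≅ x3 ∵ e ∙ [])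

  pair-total-< : 2 ≤ p → 2 ≤ q → p * (ℓ + 1) + q * q < ℓ * ℓ + ℓ + 1
  pair-total-< 2≤p 2≤q = linear {n = 0} []
      ((p * (ℓ + 1)) ∷ (q * q) ∷ (ℓ * ℓ) ∷ ℓ ∷ (p * q) ∷ q ∷ p ∷ []) 0
      (lit 1 ⊕ (x0 ⊕ x1) ≼ x2 ⊕ x3 ⊕ lit 1) (x0 ⊕ x1 ⊕ x4 ≅ x2 ⊕ x3 ⊕ lit 1 ⊕ x3 ∵ expand ∙
      2 ⊛ x5 ⊕ 2 ⊛ x6 ≼ x4 ⊕ lit 4 ∵ cross 2≤p 2≤q ∙ 2 ⟪ x6 ⊕ x5 ≅˘ x3 ⊕ lit 1 ∵ p+q ⟫
      lit 3 ≼ x3 ∵ 3≤ℓ ∙ [])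

module Trivial {n} (t ℓ : ℕ) (1≤t : 1 ≤ t) (3≤ℓ : 3 ≤ ℓ) (room : (t + 2) + (t + ℓ) ≤ n)
               {𝔽 : Subset n → Set} (𝔽? : Decidable 𝔽)
               (size𝔽 : ∀ F → 𝔽 F → ∣ F ∣ ≡ t + ℓ)
               (meet𝔽 : ∀ F G → 𝔽 F → 𝔽 G → t ≤ ∣ F ∩ G ∣)
               (maximal : ∀ X → ∣ X ∣ ≡ t + ℓ → (∀ F → 𝔽 F → t ≤ ∣ X ∩ F ∣) → 𝔽 X)
               (noCover : ∀ X → ∣ X ∣ ≤ t + 1 → ∃ λ F → 𝔽 F × ∣ F ∩ X ∣ < t)
               (T : Subset n) (∣T∣ : ∣ T ∣ ≡ t) where

  open Setting t ℓ 1≤t 3≤ℓ room 𝔽? size𝔽 meet𝔽 maximal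

  StructureI : Set
  StructureI = ∃ λ A → ∃ λ B → ∃ λ C′ → ∃ λ u →
    (∣ A ∣ ≡ t × ∣ B ∣ ≡ ℓ × ∣ C′ ∣ ≡ ℓ × ∣ u ∣ ≡ 1 × 1 + ∣ T ∩ A ∣ ≡ t) ×
    (∣ T ∩ (B ∪ C′) ∣ ≤ 0 × ∣ A ∩ B ∣ ≤ 0 × ∣ A ∩ C′ ∣ ≤ 0 × ∣ B ∩ C′ ∣ ≤ 0 × u ⊑ C′) ×
    (∀ F → 𝔽 F → FamilyI (t + ℓ) t T A B C′ u F)

  module _ (T⊑ : ∀ S → 𝒮 S → T ⊑ S) where

    -- A member of `𝒮` contains `T`, so its two further points must make up for the points of `T`
    -- missing from `F`. If two are missing, both further points lie among the ℓ + 2 points of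
    -- `F ─ T`, and the C(ℓ+2, 2) pairs there are fewer than `N₁`; if more are missing, `𝒮` is
    -- empty.
    far-small : ∀ F → 𝔽 F → 2 + ∣ F ∩ T ∣ ≤ t → Small (# 𝒮?)
    far-small F f h with 2 + ∣ F ∩ T ∣ ≟ t
    ... | no ne = small₀ (≤-trans (≤-reflexive (#-none 𝒮? (λ S s →
            (impossible (linear (F ∷ S ∷ T ∷ []) (t ∷ []) 0 (lit 1 ≼ lit 0)
                (x0 ≼ ∥ s0 ⋒ s1 ∵ proj₂ s F f ∙ lit 1 ⊕ (lit 2 ⊕ ∥ s0 ⋒ s2) ≼ x0 ∵ ≤∧≢⇒< h ne ∙
                s2 ⋐ s1 ∵ T⊑ S s ∙ ∥ s2 ≅˘ x0 ∵ ∣T∣ ∙ ∥ s1 ≅ x0 ⊕ lit 2 ∵ size S s ∙ [])))))) z≤n)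
    ... | yes e = below₁ (≤-trans (s≤s (≤-trans
            (#-mono 𝒮? (Interval? (t + 2) T (T ∪ F))
              (λ S s → size S s , T⊑ S s ,
                (linear (S ∷ T ∷ F ∷ []) (t ∷ []) 0 (s0 ⋐ (s1 ⋓ s2)) (x0 ≼ ∥ s2 ⋒ s0 ∵ proj₂ s F f ∙
                    lit 2 ⊕ ∥ s2 ⋒ s1 ≅ x0 ∵ e ∙ s1 ⋐ s0 ∵ T⊑ S s ∙ ∥ s1 ≅˘ x0 ∵ ∣T∣ ∙
                    ∥ s0 ≅ x0 ⊕ lit 2 ∵ size S s ∙ []))))
            (≤-reflexive (trans (#-interval T (T ∪ F) 2 (t + 2) (linear (T ∷ F ∷ []) [] 0
                (s0 ⋐ (s0 ⋓ s1)) []) (cong (_+ 2) (sym ∣T∣)))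
              (trans (cong (_C 2) (equation (T ∷ F ∷ []) (ℓ ∷ t ∷ []) (∥ (s0 ⋓ s1) ∖ s0)
                  (lit 2 ⊕ x0) 0 (lit 2 ⊕ ∥ s1 ⋒ s0 ≅˘ x1 ∵ e ∙ ∥ s1 ≅ x1 ⊕ x0 ∵ size𝔽 F f ∙ []) 0
                  (lit 2 ⊕ ∥ s1 ⋒ s0 ≅ x1 ∵ e ∙ ∥ s1 ≅˘ x1 ⊕ x0 ∵ size𝔽 F f ∙ [])))
                (trans (C2-suc (1 + ℓ)) (cong (1 + ℓ +_) (C2-suc ℓ))))))))
            (linear {n = 0} [] (ℓ ∷ (ℓ C 2) ∷ (ℓ * ℓ) ∷ []) 17
                (lit 1 ⊕ (lit 1 ⊕ x0 ⊕ (x0 ⊕ x1)) ≼ x2 ⊕ x0 ⊕ lit 1)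
                (9 ⟪ 2 ⊛ x1 ⊕ x0 ≅ x2 ∵ C2-square ℓ ⟫ 5 ⟪ 3 ⊛ x0 ≼ x2 ∵ *-monoˡ-≤ ℓ 3≤ℓ ⟫
                6 ⟪ lit 3 ≼ x0 ∵ 3≤ℓ ⟫ [])))

    module _ (close : ∀ F → 𝔽 F → t ≤ 1 + ∣ F ∩ T ∣) where

      -- By close, these are the members of 𝔽 that do not contain T.
      Off : Subset n → Set
      Off F = 𝔽 F × 1 + ∣ F ∩ T ∣ ≡ t

      -- The empty `x` yields a first member of `Off`, and a point `x` outside `T` yields one that
      -- avoids this point.
      avoiding : ∀ x → ∣ x ∣ ≤ 1 → ∃ λ F → Off F × ∣ F ∩ (T ∪ x) ∣ < t
      avoiding x h with noCover (T ∪ x) (linear (T ∷ x ∷ []) (t ∷ []) 0 (∥ s0 ⋓ s1 ≼ x0 ⊕ lit 1)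
          (∥ s0 ≅ x0 ∵ ∣T∣ ∙ ∥ s1 ≼ lit 1 ∵ h ∙ []))
      ... | F , f , l = F , (f , (equation (F ∷ T ∷ x ∷ []) (t ∷ []) (lit 1 ⊕ ∥ s0 ⋒ s1) (x0) 0
          (lit 1 ⊕ ∥ s0 ⋒ (s1 ⋓ s2) ≼ x0 ∵ l ∙ []) 0 (x0 ≼ lit 1 ⊕ ∥ s0 ⋒ s1 ∵ close F f ∙ []))) , l

      hits : ∀ F → Off F → ∀ S → 𝒮 S → 1 ≤ ∣ S ∩ (F ─ T) ∣
      hits F (f , m) S s = linear (S ∷ F ∷ T ∷ []) (t ∷ []) 0 (lit 1 ≼ ∥ s0 ⋒ (s1 ∖ s2))
          (x0 ≼ ∥ s1 ⋒ s0 ∵ proj₂ s F f ∙ lit 1 ⊕ ∥ s1 ⋒ s2 ≅ x0 ∵ m ∙ [])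

      deg≤ℓ+1 : ∀ v → Sub 1 (∁ T) v → deg 𝒮? (T ∪ v) ≤ ℓ + 1
      deg≤ℓ+1 v (∣v∣ , i) = deg≤ (λ X e → noCover X (≤-reflexive e)) (T ∪ v)
        (equation (T ∷ v ∷ []) (t ∷ []) (∥ s0 ⋓ s1) (x0 ⊕ lit 1) 0 (∥ s1 ≅ lit 1 ∵ ∣v∣ ∙
            ∥ s0 ≅ x0 ∵ ∣T∣ ∙ []) 0 (∥ s1 ≅˘ lit 1 ∵ ∣v∣ ∙ s1 ⋐ (cmpl s0) ∵ i ∙ ∥ s0 ≅˘ x0 ∵ ∣T∣ ∙
            []))

      pair≤1 : ∀ v w → Sub 1 (∁ T) v → Sub 1 (∁ T) w → ∣ v ∩ w ∣ ≤ 0 → deg 𝒮? ((T ∪ v) ∪ w) ≤ 1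
      pair≤1 v w (∣v∣ , i) (∣w∣ , j) d = deg-top 𝒮? (t + 2) size ((T ∪ v) ∪ w)
        (equation (T ∷ v ∷ w ∷ []) (t ∷ []) (∥ (s0 ⋓ s1) ⋓ s2) (x0 ⊕ lit 2) 0 (∥ s1 ≅ lit 1 ∵ ∣v∣ ∙
            ∥ s2 ≅ lit 1 ∵ ∣w∣ ∙ ∥ s0 ≅ x0 ∵ ∣T∣ ∙ []) 0 (∥ s1 ≅˘ lit 1 ∵ ∣v∣ ∙ s1 ⋐ (cmpl s0) ∵ i ∙
            ∥ s2 ≅˘ lit 1 ∵ ∣w∣ ∙ s2 ⋐ (cmpl s0) ∵ j ∙ ∥ s1 ⋒ s2 ≼ lit 0 ∵ d ∙ ∥ s0 ≅˘ x0 ∵ ∣T∣ ∙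
            []))

      is-pair : ∀ v w S → Sub 1 (∁ T) v → Sub 1 (∁ T) w → ∣ v ∩ w ∣ ≤ 0 → 𝒮 S → v ⊑ S → w ⊑ S →
        S ≡ (T ∪ v) ∪ w
      is-pair v w S (∣v∣ , i) (∣w∣ , j) d s k l = ⊑-antisym
        (linear (S ∷ T ∷ v ∷ w ∷ []) (t ∷ []) 0 (s0 ⋐ ((s1 ⋓ s2) ⋓ s3)) (∥ s2 ≅˘ lit 1 ∵ ∣v∣ ∙
            s2 ⋐ (cmpl s1) ∵ i ∙ ∥ s3 ≅˘ lit 1 ∵ ∣w∣ ∙ s3 ⋐ (cmpl s1) ∵ j ∙ ∥ s2 ⋒ s3 ≼ lit 0 ∵ d ∙
            ∥ s1 ≅˘ x0 ∵ ∣T∣ ∙ s1 ⋐ s0 ∵ T⊑ S s ∙ s2 ⋐ s0 ∵ k ∙ s3 ⋐ s0 ∵ l ∙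
            ∥ s0 ≅ x0 ⊕ lit 2 ∵ size S s ∙ []))
        (linear (T ∷ v ∷ w ∷ S ∷ []) [] 0 (((s0 ⋓ s1) ⋓ s2) ⋐ s3) (s0 ⋐ s3 ∵ T⊑ S s ∙ s1 ⋐ s3 ∵ k ∙
            s2 ⋐ s3 ∵ l ∙ []))

      -- A missing edge at v lowers the degree of v, since the edges at v lead to F ─ T.
      missing-edge : ∀ F → Off F → ∀ v → Sub 1 (∁ T) v → ∣ F ∩ v ∣ ≤ 0 → ∀ w → Sub 1 (F ─ T) w →
                     ¬ 𝒮 ((T ∪ v) ∪ w) → deg 𝒮? (T ∪ v) < ℓ + 1
      missing-edge F o v (∣v∣ , i) d w (∣w∣ , j) ¬s = ≤-trans (s≤s (≤-trans
          (deg-hit 𝒮? (T ∪ v) ((F ─ T) ─ w) 1 hit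
            (λ b (∣b∣ , k) → pair≤1 v b (∣v∣ , i) (∣b∣ , (linear (b ∷ T ∷ F ∷ w ∷ []) [] 0
                (s0 ⋐ (cmpl s1)) (s0 ⋐ ((s2 ∖ s1) ∖ s3) ∵ k ∙ [])))
               (linear (v ∷ b ∷ F ∷ T ∷ w ∷ []) [] 0 (∥ s0 ⋒ s1 ≼ lit 0)
                   (s1 ⋐ ((s2 ∖ s3) ∖ s4) ∵ k ∙ ∥ s2 ⋒ s0 ≼ lit 0 ∵ d ∙ []))))
          (≤-reflexive (*-identityʳ _))))
        (linear (F ∷ T ∷ w ∷ []) (ℓ ∷ t ∷ []) 0 (lit 1 ⊕ ∥ (s0 ∖ s1) ∖ s2 ≼ x0 ⊕ lit 1)
            (∥ s0 ≅ x1 ⊕ x0 ∵ size𝔽 F (proj₁ o) ∙ lit 1 ⊕ ∥ s0 ⋒ s1 ≅˘ x1 ∵ proj₂ o ∙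
            ∥ s2 ≅˘ lit 1 ∵ ∣w∣ ∙ s2 ⋐ (s0 ∖ s1) ∵ j ∙ []))
        where
        hit : ∀ S → 𝒮 S → (T ∪ v) ⊑ S → 1 ≤ ∣ S ∩ ((F ─ T) ─ w) ∣
        hit S s k with w ⊑? S
        ... | yes l = contradiction (subst 𝒮 (is-pair v w S (∣v∣ , i) (∣w∣ , (linear
            (w ∷ T ∷ F ∷ []) [] 0 (s0 ⋐ (cmpl s1)) (s0 ⋐ (s2 ∖ s1) ∵ j ∙ [])))
              (linear (v ∷ w ∷ F ∷ T ∷ []) [] 0 (∥ s0 ⋒ s1 ≼ lit 0) (s1 ⋐ (s2 ∖ s3) ∵ j ∙
                  ∥ s2 ⋒ s0 ≼ lit 0 ∵ d ∙ [])) s (linear (v ∷ S ∷ T ∷ []) [] 0 (s0 ⋐ s1)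
                  ((s2 ⋓ s0) ⋐ s1 ∵ k ∙ [])) l) s) ¬s
        ... | no ¬l = linear (S ∷ F ∷ T ∷ w ∷ []) [] 0 (lit 1 ≼ ∥ s0 ⋒ ((s1 ∖ s2) ∖ s3))
            (lit 1 ≼ ∥ s0 ⋒ (s1 ∖ s2) ∵ hits F o S s ∙ lit 1 ≼ ∥ s3 ∖ s0 ∵ ≰⇒> ¬l ∙
            ∥ s3 ≅ lit 1 ∵ ∣w∣ ∙ [])

      -- `F ─ T` and `G ─ T` are vertex covers. So an edge has an end in `P`, or it joins one of the
      -- `q` points of `F ─ T` outside `G` to one of the `q` points of `G ─ T` outside `F`. As
      -- degrees are at most `ℓ + 1`, there are at most `p * (ℓ + 1) + q * q` edges.
      module Pair (F G : Subset n) (f : Off F) (g : Off G) where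

        P : Subset n
        P = (F ∩ G) ─ T

        p q : ℕ
        p = ∣ P ∣
        q = ∣ (F ─ T) ─ G ∣


        p+q : p + q ≡ ℓ + 1
        p+q = equation (F ∷ G ∷ T ∷ []) (ℓ ∷ t ∷ []) (∥ (s0 ⋒ s1) ∖ s2 ⊕ ∥ (s0 ∖ s2) ∖ s1)
            (x0 ⊕ lit 1) 0 (lit 1 ⊕ ∥ s0 ⋒ s2 ≅˘ x1 ∵ proj₂ f ∙ ∥ s0 ≅ x1 ⊕ x0 ∵ size𝔽 F (proj₁ f) ∙
            []) 0 (lit 1 ⊕ ∥ s0 ⋒ s2 ≅ x1 ∵ proj₂ f ∙ ∥ s0 ≅˘ x1 ⊕ x0 ∵ size𝔽 F (proj₁ f) ∙ [])

        q′ : ∣ (G ─ T) ─ F ∣ ≡ q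
        q′ = equation (G ∷ T ∷ F ∷ []) (t ∷ ℓ ∷ []) (∥ (s0 ∖ s1) ∖ s2) (∥ (s2 ∖ s1) ∖ s0) 0
            (lit 1 ⊕ ∥ s2 ⋒ s1 ≅ x0 ∵ proj₂ f ∙ lit 1 ⊕ ∥ s0 ⋒ s1 ≅˘ x0 ∵ proj₂ g ∙
            ∥ s2 ≅˘ x0 ⊕ x1 ∵ size𝔽 F (proj₁ f) ∙ ∥ s0 ≅ x0 ⊕ x1 ∵ size𝔽 G (proj₁ g) ∙ []) 0
            (lit 1 ⊕ ∥ s2 ⋒ s1 ≅˘ x0 ∵ proj₂ f ∙ lit 1 ⊕ ∥ s0 ⋒ s1 ≅ x0 ∵ proj₂ g ∙
            ∥ s2 ≅ x0 ⊕ x1 ∵ size𝔽 F (proj₁ f) ∙ ∥ s0 ≅˘ x0 ⊕ x1 ∵ size𝔽 G (proj₁ g) ∙ [])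

        1≤p : 1 ≤ p
        1≤p = linear (F ∷ G ∷ T ∷ []) (t ∷ []) 0 (lit 1 ≼ ∥ (s0 ⋒ s1) ∖ s2)
            (lit 1 ⊕ ∥ s0 ⋒ s2 ≅ x0 ∵ proj₂ f ∙ x0 ≼ ∥ s0 ⋒ s1 ∵ meet𝔽 F G (proj₁ f) (proj₁ g) ∙ [])

        Through? : Decidable (λ S → 𝒮 S × 1 ≤ ∣ S ∩ P ∣)
        Through? S = 𝒮? S ×-dec (1 ≤? ∣ S ∩ P ∣)

        Across? : Decidable (λ S → 𝒮 S × ∣ S ∩ P ∣ ≤ 0)
        Across? S = 𝒮? S ×-dec (∣ S ∩ P ∣ ≤? 0)

        split : # 𝒮? ≤ # Through? + # Across?
        split = #-∪ 𝒮? Through? Across? cases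
          where
          cases : ∀ S → 𝒮 S → (𝒮 S × 1 ≤ ∣ S ∩ P ∣) ⊎ (𝒮 S × ∣ S ∩ P ∣ ≤ 0)
          cases S s with 1 ≤? ∣ S ∩ P ∣
          ... | yes h = inj₁ (s , h)
          ... | no ¬h = inj₂ (s , s≤s⁻¹ (≰⇒> ¬h))

        P⊑∁T : ∀ v → Sub 1 P v → Sub 1 (∁ T) v
        P⊑∁T v (∣v∣ , i) = ∣v∣ , (linear (v ∷ T ∷ F ∷ G ∷ []) [] 0 (s0 ⋐ (cmpl s1))
            (s0 ⋐ ((s2 ⋒ s3) ∖ s1) ∵ i ∙ []))

        through : ∀ S → 𝒮 S × 1 ≤ ∣ S ∩ P ∣ → ∃ λ v → Sub 1 P v × 𝒮 S × (T ∪ v) ⊑ S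
        through S (s , h) = let v , i , j = hit-point S P h in v , i , s , ∪-⊑ T v S (T⊑ S s) j

        through-deg : ∀ v → Sub 1 P v → deg 𝒮? (T ∪ v) ≤ ℓ + 1
        through-deg v i = deg≤ℓ+1 v (P⊑∁T v i)

        ∣P∣* : # (Sub? 1 P) * (ℓ + 1) ≡ p * (ℓ + 1)
        ∣P∣* = cong (_* (ℓ + 1)) (#-points P)

        Through≤ : # Through? ≤ p * (ℓ + 1)
        Through≤ = ≤-trans (#-union Through? (Sub? 1 P) (λ v → above? 𝒮? (T ∪ v)) (ℓ + 1) through
          through-deg) (≤-reflexive ∣P∣*)

        Through< : ∀ v → Sub 1 P v → deg 𝒮? (T ∪ v) < ℓ + 1 → # Through? < p * (ℓ + 1)
        Through< v i h = ≤-trans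
          (#-union-strict Through? (Sub? 1 P) (λ v → above? 𝒮? (T ∪ v)) (ℓ + 1) through through-deg
            v i h) (≤-reflexive ∣P∣*)

        -- An edge inside P is counted at both ends.
        Through<′ : ∀ v w → Sub 1 P v → Sub 1 P w → ∣ v ∩ w ∣ ≤ 0 → 𝒮 ((T ∪ v) ∪ w) →
          # Through? < p * (ℓ + 1)
        Through<′ v w i j d s₀ = ≤-trans
          (#-union-strict Through? (Sub? 1 P) Q? (ℓ + 1) cover
            (λ y k → ≤-trans (#-mono (Q? y) (above? 𝒮? (T ∪ y)) (λ S → proj₁)) (through-deg y k)) v
              i
            (≤-trans (#-strict (Q? v) (above? 𝒮? (T ∪ v)) (λ S → proj₁) ((T ∪ v) ∪ w)
              (s₀ , (linear (T ∷ v ∷ w ∷ []) [] 0 ((s0 ⋓ s1) ⋐ ((s0 ⋓ s1) ⋓ s2)) []))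
                (λ (_ , ne) → ne (refl , refl))) (through-deg v i)))
          (≤-reflexive ∣P∣*)
          where
          Q? : ∀ y → Decidable (λ S → (𝒮 S × (T ∪ y) ⊑ S) × ¬ (y ≡ v × S ≡ (T ∪ v) ∪ w))
          Q? y S = above? 𝒮? (T ∪ y) S ×-dec ¬? ((y ≟ˢ v) ×-dec (S ≟ˢ ((T ∪ v) ∪ w)))
          w≢v : ¬ w ≡ v
          w≢v refl = impossible (linear (v ∷ []) [] 0 (lit 1 ≼ lit 0) (∥ s0 ⋒ s0 ≼ lit 0 ∵ d ∙
              ∥ s0 ≅˘ lit 1 ∵ proj₁ i ∙ []))
          cover : ∀ S → 𝒮 S × 1 ≤ ∣ S ∩ P ∣ → ∃ λ y →
            Sub 1 P y × (𝒮 S × (T ∪ y) ⊑ S) × ¬ (y ≡ v × S ≡ (T ∪ v) ∪ w)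
          cover S h with S ≟ˢ ((T ∪ v) ∪ w)
          ... | yes refl = w , j , (s₀ , (linear (T ∷ w ∷ v ∷ []) [] 0
              ((s0 ⋓ s1) ⋐ ((s0 ⋓ s2) ⋓ s1)) [])) , w≢v ∘ proj₁
          ... | no ne    = let y , k , κ = through S h in y , k , κ , ne ∘ proj₂

        Side? : ∀ a → Decidable (λ S → (𝒮 S × ∣ S ∩ P ∣ ≤ 0) × a ⊑ S)
        Side? a S = Across? S ×-dec a ⊑? S

        side : ∀ S → 𝒮 S × ∣ S ∩ P ∣ ≤ 0 → ∃ λ a → Sub 1 ((F ─ T) ─ G) a × (𝒮 S × ∣ S ∩ P ∣ ≤ 0) × a
          ⊑ S
        side S (s , h) = let a , i , j = hit-point S ((F ─ T) ─ G)
                                           (linear (S ∷ F ∷ T ∷ G ∷ []) [] 0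
                                               (lit 1 ≼ ∥ s0 ⋒ ((s1 ∖ s2) ∖ s3))
                                               (lit 1 ≼ ∥ s0 ⋒ (s1 ∖ s2) ∵ hits F f S s ∙
                                               ∥ s0 ⋒ ((s1 ⋒ s3) ∖ s2) ≼ lit 0 ∵ h ∙ []))
                         in a , i , (s , h) , j

        edge : ∀ a S → (𝒮 S × ∣ S ∩ P ∣ ≤ 0) × a ⊑ S → ∃ λ b →
          Sub 1 ((G ─ T) ─ F) b × 𝒮 S × ((T ∪ a) ∪ b) ⊑ S
        edge a S ((s , h) , j) = let b , i , k = hit-point S ((G ─ T) ─ F)
                                                   (linear (S ∷ G ∷ T ∷ F ∷ []) [] 0
                                                       (lit 1 ≼ ∥ s0 ⋒ ((s1 ∖ s2) ∖ s3))
                                                       (lit 1 ≼ ∥ s0 ⋒ (s1 ∖ s2) ∵ hits G g S s ∙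
                                                       ∥ s0 ⋒ ((s3 ⋒ s1) ∖ s2) ≼ lit 0 ∵ h ∙ []))
                                 in b , i , s , ∪-⊑ (T ∪ a) b S (∪-⊑ T a S (T⊑ S s) j) k

        edge≤1 : ∀ a → Sub 1 ((F ─ T) ─ G) a → ∀ b → Sub 1 ((G ─ T) ─ F) b →
          deg 𝒮? ((T ∪ a) ∪ b) ≤ 1
        edge≤1 a (∣a∣ , i) b (∣b∣ , j) = pair≤1 a b (∣a∣ , (linear (a ∷ T ∷ F ∷ G ∷ []) [] 0
            (s0 ⋐ (cmpl s1)) (s0 ⋐ ((s2 ∖ s1) ∖ s3) ∵ i ∙ []))) (∣b∣ , (linear (b ∷ T ∷ G ∷ F ∷ [])
            [] 0 (s0 ⋐ (cmpl s1)) (s0 ⋐ ((s2 ∖ s1) ∖ s3) ∵ j ∙ [])))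
          (linear (a ∷ b ∷ F ∷ T ∷ G ∷ []) [] 0 (∥ s0 ⋒ s1 ≼ lit 0) (s0 ⋐ ((s2 ∖ s3) ∖ s4) ∵ i ∙
              s1 ⋐ ((s4 ∖ s3) ∖ s2) ∵ j ∙ []))

        ∣G─F∣ : # (Sub? 1 ((G ─ T) ─ F)) * 1 ≡ q
        ∣G─F∣ = trans (*-identityʳ _) (trans (#-points ((G ─ T) ─ F)) q′)

        Side≤ : ∀ a → Sub 1 ((F ─ T) ─ G) a → # (Side? a) ≤ q
        Side≤ a i = ≤-trans (#-union (Side? a) (Sub? 1 ((G ─ T) ─ F))
          (λ b → above? 𝒮? ((T ∪ a) ∪ b)) 1 (edge a) (edge≤1 a i))
          (≤-reflexive ∣G─F∣)

        Across≤ : # Across? ≤ q * q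
        Across≤ = ≤-trans (#-union Across? (Sub? 1 ((F ─ T) ─ G)) Side? q side Side≤)
          (≤-reflexive (cong (_* q) (#-points ((F ─ T) ─ G))))

        Across< : ∀ a → Sub 1 ((F ─ T) ─ G) a → ∀ b → Sub 1 ((G ─ T) ─ F) b → ¬ 𝒮 ((T ∪ a) ∪ b) →
          # Across? < q * q
        Across< a i b j ¬s = ≤-trans
          (#-union-strict Across? (Sub? 1 ((F ─ T) ─ G)) Side? q side Side≤ a i
            (≤-trans (#-union-strict (Side? a) (Sub? 1 ((G ─ T) ─ F))
              (λ b → above? 𝒮? ((T ∪ a) ∪ b)) 1 (edge a) (edge≤1 a i) b j
              (s≤s (≤-reflexive (#-none (above? 𝒮? ((T ∪ a) ∪ b)) none)))) (≤-reflexive ∣G─F∣)))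
          (≤-reflexive (cong (_* q) (#-points ((F ─ T) ─ G))))
          where
          none : ∀ S → ¬ (𝒮 S × ((T ∪ a) ∪ b) ⊑ S)
          none S (s , k) = ¬s (subst 𝒮 (is-pair a b S (proj₁ i , (linear (a ∷ T ∷ F ∷ G ∷ []) [] 0
              (s0 ⋐ (cmpl s1)) (s0 ⋐ ((s2 ∖ s1) ∖ s3) ∵ proj₂ i ∙ [])))
            (proj₁ j , (linear (b ∷ T ∷ G ∷ F ∷ []) [] 0 (s0 ⋐ (cmpl s1))
                (s0 ⋐ ((s2 ∖ s1) ∖ s3) ∵ proj₂ j ∙ [])))
            (linear (a ∷ b ∷ F ∷ T ∷ G ∷ []) [] 0 (∥ s0 ⋒ s1 ≼ lit 0)
                (s0 ⋐ ((s2 ∖ s3) ∖ s4) ∵ proj₂ i ∙ s1 ⋐ ((s4 ∖ s3) ∖ s2) ∵ proj₂ j ∙ [])) s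
            (linear (a ∷ S ∷ T ∷ b ∷ []) [] 0 (s0 ⋐ s1) (((s2 ⋓ s0) ⋓ s3) ⋐ s1 ∵ k ∙ [])) (linear
                (b ∷ S ∷ T ∷ a ∷ []) [] 0 (s0 ⋐ s1) (((s2 ⋓ s3) ⋓ s0) ⋐ s1 ∵ k ∙ []))) s)

      -- The graph contains the complete bipartite graph between `B` and `C′`, and all edges from
      -- `v` to `H ─ T`, which consists of `B` and `u`. Being vertex covers of size `ℓ + 1` and
      -- meeting each other in `t` points, the members of `Off` can then only be `F`, `G` and `H`.
      module Configuration (F G H : Subset n) (f : Off F) (g : Off G) (h : Off H)
                           (v : Subset n) (∣v∣ : ∣ v ∣ ≡ 1) (v-T : ∣ v ∩ T ∣ ≤ 0) (v⊑F : v ⊑ F)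
                             (v⊑G : v ⊑ G) (v-H : ∣ H ∩ v ∣ ≤ 0)
                           (F∩G : (F ∩ G) ⊑ (T ∪ v))
                           (across : ∀ a → Sub 1 ((F ─ T) ─ v) a → ∀ b → Sub 1 ((G ─ T) ─ v) b →
                             𝒮 ((T ∪ a) ∪ b))
                           (spoke : ∀ w → Sub 1 (H ─ T) w → 𝒮 ((T ∪ v) ∪ w))
                           (B⊑H′ : ((F ─ T) ─ v) ⊑ H) where

        A B C′ u : Subset n
        A  = (F ∩ T) ∪ v
        B  = (F ─ T) ─ v
        C′ = (G ─ T) ─ v
        u  = (H ─ T) ─ F


        ∣B∣ : ∣ B ∣ ≡ ℓ
        ∣B∣ = equation (F ∷ T ∷ v ∷ []) (ℓ ∷ t ∷ []) (∥ (s0 ∖ s1) ∖ s2) (x0) 0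
            (lit 1 ⊕ ∥ s0 ⋒ s1 ≅˘ x1 ∵ proj₂ f ∙ ∥ s0 ≅ x1 ⊕ x0 ∵ size𝔽 F (proj₁ f) ∙
            ∥ s2 ≅˘ lit 1 ∵ ∣v∣ ∙ ∥ s2 ⋒ s1 ≼ lit 0 ∵ v-T ∙ s2 ⋐ s0 ∵ v⊑F ∙ []) 0
            (lit 1 ⊕ ∥ s0 ⋒ s1 ≅ x1 ∵ proj₂ f ∙ ∥ s0 ≅˘ x1 ⊕ x0 ∵ size𝔽 F (proj₁ f) ∙
            ∥ s2 ≅ lit 1 ∵ ∣v∣ ∙ [])

        ∣C′∣ : ∣ C′ ∣ ≡ ℓ
        ∣C′∣ = equation (G ∷ T ∷ v ∷ []) (ℓ ∷ t ∷ []) (∥ (s0 ∖ s1) ∖ s2) (x0) 0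
            (lit 1 ⊕ ∥ s0 ⋒ s1 ≅˘ x1 ∵ proj₂ g ∙ ∥ s0 ≅ x1 ⊕ x0 ∵ size𝔽 G (proj₁ g) ∙
            ∥ s2 ≅˘ lit 1 ∵ ∣v∣ ∙ ∥ s2 ⋒ s1 ≼ lit 0 ∵ v-T ∙ s2 ⋐ s0 ∵ v⊑G ∙ []) 0
            (lit 1 ⊕ ∥ s0 ⋒ s1 ≅ x1 ∵ proj₂ g ∙ ∥ s0 ≅˘ x1 ⊕ x0 ∵ size𝔽 G (proj₁ g) ∙
            ∥ s2 ≅ lit 1 ∵ ∣v∣ ∙ [])

        ∣u∣ : ∣ u ∣ ≡ 1
        ∣u∣ = equation (H ∷ T ∷ F ∷ v ∷ []) (t ∷ ℓ ∷ []) (∥ (s0 ∖ s1) ∖ s2) (lit 1) 0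
            (lit 1 ⊕ ∥ s2 ⋒ s1 ≅ x0 ∵ proj₂ f ∙ ∥ s2 ≅˘ x0 ⊕ x1 ∵ size𝔽 F (proj₁ f) ∙
            ∥ s3 ≅ lit 1 ∵ ∣v∣ ∙ lit 1 ⊕ ∥ s0 ⋒ s1 ≅˘ x0 ∵ proj₂ h ∙
            ∥ s0 ≅ x0 ⊕ x1 ∵ size𝔽 H (proj₁ h) ∙ ((s2 ∖ s1) ∖ s3) ⋐ s0 ∵ B⊑H′ ∙ []) 0
            (lit 1 ⊕ ∥ s2 ⋒ s1 ≅˘ x0 ∵ proj₂ f ∙ ∥ s2 ≅ x0 ⊕ x1 ∵ size𝔽 F (proj₁ f) ∙
            ∥ s3 ≅˘ lit 1 ∵ ∣v∣ ∙ ∥ s3 ⋒ s1 ≼ lit 0 ∵ v-T ∙ s3 ⋐ s2 ∵ v⊑F ∙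
            lit 1 ⊕ ∥ s0 ⋒ s1 ≅ x0 ∵ proj₂ h ∙ ∥ s0 ≅˘ x0 ⊕ x1 ∵ size𝔽 H (proj₁ h) ∙
            ∥ s0 ⋒ s3 ≼ lit 0 ∵ v-H ∙ [])

        u⊑C′ : u ⊑ C′
        u⊑C′ = linear (H ∷ T ∷ F ∷ G ∷ v ∷ []) (t ∷ []) 0 (((s0 ∖ s1) ∖ s2) ⋐ ((s3 ∖ s1) ∖ s4))
            (lit 1 ⊕ ∥ s3 ⋒ s1 ≅ x0 ∵ proj₂ g ∙ (s2 ⋒ s3) ⋐ (s1 ⋓ s4) ∵ F∩G ∙
            ∥ s0 ⋒ s4 ≼ lit 0 ∵ v-H ∙ x0 ≼ ∥ s3 ⋒ s0 ∵ meet𝔽 G H (proj₁ g) (proj₁ h) ∙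
            ∥ (s0 ∖ s1) ∖ s2 ≅ lit 1 ∵ ∣u∣ ∙ [])

        F∩T⊑G : (F ∩ T) ⊑ G
        F∩T⊑G = linear (F ∷ T ∷ G ∷ v ∷ []) (t ∷ []) 0 ((s0 ⋒ s1) ⋐ s2)
            (lit 1 ⊕ ∥ s0 ⋒ s1 ≅ x0 ∵ proj₂ f ∙ ∥ s3 ≅ lit 1 ∵ ∣v∣ ∙ (s0 ⋒ s2) ⋐ (s1 ⋓ s3) ∵ F∩G ∙
            x0 ≼ ∥ s0 ⋒ s2 ∵ meet𝔽 F G (proj₁ f) (proj₁ g) ∙ [])

        G∩T⊑F : (G ∩ T) ⊑ F
        G∩T⊑F = linear (G ∷ T ∷ F ∷ v ∷ []) (t ∷ []) 0 ((s0 ⋒ s1) ⋐ s2)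
            (lit 1 ⊕ ∥ s0 ⋒ s1 ≅ x0 ∵ proj₂ g ∙ ∥ s3 ≅ lit 1 ∵ ∣v∣ ∙ (s2 ⋒ s0) ⋐ (s1 ⋓ s3) ∵ F∩G ∙
            x0 ≼ ∥ s2 ⋒ s0 ∵ meet𝔽 F G (proj₁ f) (proj₁ g) ∙ [])

        H∩T⊑F : (H ∩ T) ⊑ F
        H∩T⊑F = linear (H ∷ T ∷ F ∷ G ∷ v ∷ []) (t ∷ []) 0 ((s0 ⋒ s1) ⋐ s2)
            ((s2 ⋒ s3) ⋐ (s1 ⋓ s4) ∵ F∩G ∙ lit 1 ⊕ ∥ s0 ⋒ s1 ≅ x0 ∵ proj₂ h ∙
            ∥ s0 ⋒ s4 ≼ lit 0 ∵ v-H ∙ x0 ≼ ∥ s3 ⋒ s0 ∵ meet𝔽 G H (proj₁ g) (proj₁ h) ∙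
            ∥ (s0 ∖ s1) ∖ s2 ≅ lit 1 ∵ ∣u∣ ∙ (s3 ⋒ s1) ⋐ s2 ∵ G∩T⊑F ∙ [])

        -- A vertex cover of a complete bipartite graph contains one of the two sides.
        one-side : ∀ K → Off K → B ⊑ K ⊎ C′ ⊑ K
        one-side K (k , m) with B ⊑? K | C′ ⊑? K
        ... | yes i | _     = inj₁ i
        ... | no _  | yes j = inj₂ j
        ... | no ¬i | no ¬j =
          let a , ∣a∣ , i = choose (((F ─ T) ─ v) ─ K) 1 (≰⇒> ¬i)
              b , ∣b∣ , j = choose (((G ─ T) ─ v) ─ K) 1 (≰⇒> ¬j)
              s = across a (∣a∣ , (linear (a ∷ F ∷ T ∷ v ∷ K ∷ []) [] 0 (s0 ⋐ ((s1 ∖ s2) ∖ s3))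
                  (s0 ⋐ (((s1 ∖ s2) ∖ s3) ∖ s4) ∵ i ∙ []))) b (∣b∣ , (linear
                  (b ∷ G ∷ T ∷ v ∷ K ∷ []) [] 0 (s0 ⋐ ((s1 ∖ s2) ∖ s3))
                  (s0 ⋐ (((s1 ∖ s2) ∖ s3) ∖ s4) ∵ j ∙ [])))
          in (impossible (linear (K ∷ T ∷ a ∷ b ∷ F ∷ v ∷ G ∷ []) (t ∷ []) 0 (lit 1 ≼ lit 0)
              (x0 ≼ ∥ s0 ⋒ ((s1 ⋓ s2) ⋓ s3) ∵ proj₂ s K k ∙ lit 1 ⊕ ∥ s0 ⋒ s1 ≅ x0 ∵ m ∙
              s2 ⋐ (((s4 ∖ s1) ∖ s5) ∖ s0) ∵ i ∙ s3 ⋐ (((s6 ∖ s1) ∖ s5) ∖ s0) ∵ j ∙ [])))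

        spoke-hit : ∀ K → Off K → ∣ v ∩ K ∣ ≤ 0 → (H ─ T) ⊑ K
        spoke-hit K (k , m) d with (H ─ T) ⊑? K
        ... | yes i = i
        ... | no ¬i =
          let w , ∣w∣ , i = choose ((H ─ T) ─ K) 1 (≰⇒> ¬i)
              s = spoke w (∣w∣ , (linear (w ∷ H ∷ T ∷ K ∷ []) [] 0 (s0 ⋐ (s1 ∖ s2))
                  (s0 ⋐ ((s1 ∖ s2) ∖ s3) ∵ i ∙ [])))
          in (impossible (linear (K ∷ T ∷ v ∷ w ∷ H ∷ []) (t ∷ []) 0 (lit 1 ≼ lit 0)
              (x0 ≼ ∥ s0 ⋒ ((s1 ⋓ s2) ⋓ s3) ∵ proj₂ s K k ∙ lit 1 ⊕ ∥ s0 ⋒ s1 ≅ x0 ∵ m ∙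
              s3 ⋐ ((s4 ∖ s1) ∖ s0) ∵ i ∙ ∥ s2 ⋒ s0 ≼ lit 0 ∵ d ∙ [])))

        F≡ : F ≡ A ∪ B
        F≡ = ⊑-antisym (linear (F ∷ T ∷ v ∷ []) [] 0 (s0 ⋐ (((s0 ⋒ s1) ⋓ s2) ⋓ ((s0 ∖ s1) ∖ s2)))
            []) (linear (F ∷ T ∷ v ∷ []) [] 0 ((((s0 ⋒ s1) ⋓ s2) ⋓ ((s0 ∖ s1) ∖ s2)) ⋐ s0)
            (s2 ⋐ s0 ∵ v⊑F ∙ []))

        G≡ : G ≡ A ∪ C′
        G≡ = ⊑-antisym (linear (G ∷ F ∷ T ∷ v ∷ []) [] 0
            (s0 ⋐ (((s1 ⋒ s2) ⋓ s3) ⋓ ((s0 ∖ s2) ∖ s3))) ((s0 ⋒ s2) ⋐ s1 ∵ G∩T⊑F ∙ []))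
                       (linear (F ∷ T ∷ v ∷ G ∷ []) [] 0
                           ((((s0 ⋒ s1) ⋓ s2) ⋓ ((s3 ∖ s1) ∖ s2)) ⋐ s3) (s2 ⋐ s3 ∵ v⊑G ∙
                           (s0 ⋒ s1) ⋐ s3 ∵ F∩T⊑G ∙ []))

        H≡ : H ≡ (T ∩ A) ∪ B ∪ u
        H≡ = ⊑-antisym
          (linear (H ∷ T ∷ F ∷ v ∷ []) [] 0
              (s0 ⋐ ((s1 ⋒ ((s2 ⋒ s1) ⋓ s3)) ⋓ (((s2 ∖ s1) ∖ s3) ⋓ ((s0 ∖ s1) ∖ s2))))
              ((s0 ⋒ s1) ⋐ s2 ∵ H∩T⊑F ∙ ∥ s0 ⋒ s3 ≼ lit 0 ∵ v-H ∙ []))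
          (linear (T ∷ F ∷ v ∷ H ∷ []) (t ∷ []) 0
              (((s0 ⋒ ((s1 ⋒ s0) ⋓ s2)) ⋓ (((s1 ∖ s0) ∖ s2) ⋓ ((s3 ∖ s0) ∖ s1))) ⋐ s3)
              (lit 1 ⊕ ∥ s1 ⋒ s0 ≅ x0 ∵ proj₂ f ∙ s2 ⋐ s1 ∵ v⊑F ∙
              lit 1 ⊕ ∥ s3 ⋒ s0 ≅˘ x0 ∵ proj₂ h ∙ ((s1 ∖ s0) ∖ s2) ⋐ s3 ∵ B⊑H′ ∙
              (s3 ⋒ s0) ⋐ s1 ∵ H∩T⊑F ∙ []))

        off : ∀ K → Off K → K ≡ F ⊎ K ≡ G ⊎ K ≡ H
        off K (k , m) with one-side K (k , m) | point v K ∣v∣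
        ... | inj₁ i | inj₁ j = inj₁ (⊑-antisym (linear (K ∷ F ∷ T ∷ v ∷ G ∷ []) (t ∷ ℓ ∷ []) 0
            (s0 ⋐ s1) (2 ⟪ ((s1 ∖ s2) ∖ s3) ⋐ s0 ∵ i ⟫ s3 ⋐ s0 ∵ j ∙ lit 1 ⊕ ∥ s0 ⋒ s2 ≅˘ x0 ∵ m ∙
            2 ⟪ ∥ s0 ≅ x0 ⊕ x1 ∵ size𝔽 K k ⟫ 2 ⟪ lit 1 ⊕ ∥ s1 ⋒ s2 ≅ x0 ∵ proj₂ f ⟫
            2 ⟪ ∥ s1 ≅˘ x0 ⊕ x1 ∵ size𝔽 F (proj₁ f) ⟫ ∥ s3 ≅ lit 1 ∵ ∣v∣ ∙
            (s1 ⋒ s4) ⋐ (s2 ⋓ s3) ∵ F∩G ∙ x0 ≼ ∥ s0 ⋒ s4 ∵ meet𝔽 K G k (proj₁ g) ∙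
            (s4 ⋒ s2) ⋐ s1 ∵ G∩T⊑F ∙ [])) (linear (F ∷ K ∷ T ∷ v ∷ G ∷ []) (t ∷ ℓ ∷ []) 0 (s0 ⋐ s1)
            (2 ⟪ ((s0 ∖ s2) ∖ s3) ⋐ s1 ∵ i ⟫ s3 ⋐ s1 ∵ j ∙ lit 1 ⊕ ∥ s1 ⋒ s2 ≅˘ x0 ∵ m ∙
            ∥ s1 ≅ x0 ⊕ x1 ∵ size𝔽 K k ∙ 2 ⟪ lit 1 ⊕ ∥ s0 ⋒ s2 ≅ x0 ∵ proj₂ f ⟫
            ∥ s0 ≅˘ x0 ⊕ x1 ∵ size𝔽 F (proj₁ f) ∙ ∥ s3 ≅ lit 1 ∵ ∣v∣ ∙ (s0 ⋒ s4) ⋐ (s2 ⋓ s3) ∵ F∩G ∙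
            x0 ≼ ∥ s1 ⋒ s4 ∵ meet𝔽 K G k (proj₁ g) ∙ (s4 ⋒ s2) ⋐ s0 ∵ G∩T⊑F ∙ [])))
        ... | inj₁ i | inj₂ d = inj₂ (inj₂ (⊑-antisym
            (linear (K ∷ H ∷ T ∷ F ∷ v ∷ G ∷ []) (t ∷ ℓ ∷ []) 0 (s0 ⋐ s1)
                (2 ⟪ (s1 ∖ s2) ⋐ s0 ∵ spoke-hit K (k , m) d ⟫ lit 1 ⊕ ∥ s0 ⋒ s2 ≅˘ x0 ∵ m ∙
                2 ⟪ ∥ s0 ≅ x0 ⊕ x1 ∵ size𝔽 K k ⟫ 2 ⟪ lit 1 ⊕ ∥ s3 ⋒ s2 ≅ x0 ∵ proj₂ f ⟫
                ∥ s3 ≅˘ x0 ⊕ x1 ∵ size𝔽 F (proj₁ f) ∙ ∥ s4 ≅ lit 1 ∵ ∣v∣ ∙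
                (s3 ⋒ s5) ⋐ (s2 ⋓ s4) ∵ F∩G ∙ ∥ s1 ≅˘ x0 ⊕ x1 ∵ size𝔽 H (proj₁ h) ∙
                ((s3 ∖ s2) ∖ s4) ⋐ s1 ∵ B⊑H′ ∙ x0 ≼ ∥ s0 ⋒ s5 ∵ meet𝔽 K G k (proj₁ g) ∙
                (s5 ⋒ s2) ⋐ s3 ∵ G∩T⊑F ∙ (s1 ⋒ s2) ⋐ s3 ∵ H∩T⊑F ∙ []))
            (linear (H ∷ K ∷ T ∷ v ∷ F ∷ G ∷ []) (t ∷ ℓ ∷ []) 0 (s0 ⋐ s1)
                (2 ⟪ (s0 ∖ s2) ⋐ s1 ∵ spoke-hit K (k , m) d ⟫ ∥ s3 ⋒ s1 ≼ lit 0 ∵ d ∙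
                lit 1 ⊕ ∥ s1 ⋒ s2 ≅˘ x0 ∵ m ∙ ∥ s1 ≅ x0 ⊕ x1 ∵ size𝔽 K k ∙
                2 ⟪ lit 1 ⊕ ∥ s4 ⋒ s2 ≅ x0 ∵ proj₂ f ⟫ (s4 ⋒ s5) ⋐ (s2 ⋓ s3) ∵ F∩G ∙
                ∥ s0 ≅˘ x0 ⊕ x1 ∵ size𝔽 H (proj₁ h) ∙ x0 ≼ ∥ s1 ⋒ s5 ∵ meet𝔽 K G k (proj₁ g) ∙
                (s5 ⋒ s2) ⋐ s4 ∵ G∩T⊑F ∙ 2 ⟪ (s0 ⋒ s2) ⋐ s4 ∵ H∩T⊑F ⟫
                ∥ (s0 ∖ s2) ∖ s4 ≅ lit 1 ∵ ∣u∣ ∙ []))))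
        ... | inj₂ i | inj₁ j = inj₂ (inj₁ (⊑-antisym (linear (K ∷ G ∷ T ∷ v ∷ F ∷ []) (t ∷ ℓ ∷ [])
            0 (s0 ⋐ s1) (2 ⟪ ((s1 ∖ s2) ∖ s3) ⋐ s0 ∵ i ⟫ s3 ⋐ s0 ∵ j ∙ lit 1 ⊕ ∥ s0 ⋒ s2 ≅˘ x0 ∵ m ∙
            2 ⟪ ∥ s0 ≅ x0 ⊕ x1 ∵ size𝔽 K k ⟫ 2 ⟪ lit 1 ⊕ ∥ s1 ⋒ s2 ≅ x0 ∵ proj₂ g ⟫
            2 ⟪ ∥ s1 ≅˘ x0 ⊕ x1 ∵ size𝔽 G (proj₁ g) ⟫ ∥ s3 ≅ lit 1 ∵ ∣v∣ ∙
            (s4 ⋒ s1) ⋐ (s2 ⋓ s3) ∵ F∩G ∙ x0 ≼ ∥ s0 ⋒ s4 ∵ meet𝔽 K F k (proj₁ f) ∙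
            (s4 ⋒ s2) ⋐ s1 ∵ F∩T⊑G ∙ [])) (linear (G ∷ K ∷ T ∷ v ∷ F ∷ []) (t ∷ ℓ ∷ []) 0 (s0 ⋐ s1)
            (2 ⟪ ((s0 ∖ s2) ∖ s3) ⋐ s1 ∵ i ⟫ s3 ⋐ s1 ∵ j ∙ lit 1 ⊕ ∥ s1 ⋒ s2 ≅˘ x0 ∵ m ∙
            ∥ s1 ≅ x0 ⊕ x1 ∵ size𝔽 K k ∙ 2 ⟪ lit 1 ⊕ ∥ s0 ⋒ s2 ≅ x0 ∵ proj₂ g ⟫
            ∥ s0 ≅˘ x0 ⊕ x1 ∵ size𝔽 G (proj₁ g) ∙ ∥ s3 ≅ lit 1 ∵ ∣v∣ ∙ (s4 ⋒ s0) ⋐ (s2 ⋓ s3) ∵ F∩G ∙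
            x0 ≼ ∥ s1 ⋒ s4 ∵ meet𝔽 K F k (proj₁ f) ∙ (s4 ⋒ s2) ⋐ s0 ∵ F∩T⊑G ∙ []))))
        -- `K` would contain `C′` and also `H ─ T`, hence `B`: together `2 * ℓ` points outside `T`,
        -- where it has only `ℓ + 1`.
        ... | inj₂ i | inj₂ d =
          (impossible (linear (H ∷ T ∷ K ∷ G ∷ v ∷ F ∷ []) (t ∷ ℓ ∷ []) 1 (lit 1 ≼ lit 0)
              ((s0 ∖ s1) ⋐ s2 ∵ spoke-hit K (k , m) d ∙ ((s3 ∖ s1) ∖ s4) ⋐ s2 ∵ i ∙
              lit 1 ⊕ ∥ s2 ⋒ s1 ≅˘ x0 ∵ m ∙ ∥ s2 ≅ x0 ⊕ x1 ∵ size𝔽 K k ∙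
              lit 1 ⊕ ∥ s5 ⋒ s1 ≅ x0 ∵ proj₂ f ∙ lit 1 ⊕ ∥ s3 ⋒ s1 ≅ x0 ∵ proj₂ g ∙
              ∥ s5 ≅˘ x0 ⊕ x1 ∵ size𝔽 F (proj₁ f) ∙ ∥ s3 ≅˘ x0 ⊕ x1 ∵ size𝔽 G (proj₁ g) ∙
              2 ⟪ ∥ s4 ≅ lit 1 ∵ ∣v∣ ⟫ (s5 ⋒ s3) ⋐ (s1 ⋓ s4) ∵ F∩G ∙ ((s5 ∖ s1) ∖ s4) ⋐ s0 ∵ B⊑H′ ∙
              lit 3 ≼ x1 ∵ 3≤ℓ ∙ [])))

        classify : ∀ K → 𝔽 K → FamilyI (t + ℓ) t T A B C′ u K
        classify K k with T ⊑? K | point v K ∣v∣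
        ... | yes i | inj₁ j = inj₂ (inj₁ (size𝔽 K k , (linear (F ∷ T ∷ v ∷ K ∷ []) [] 0
            ((((s0 ⋒ s1) ⋓ s2) ⋓ s1) ⋐ s3) (s1 ⋐ s3 ∵ i ∙ s2 ⋐ s3 ∵ j ∙ [])) ,
                (linear (K ∷ F ∷ T ∷ v ∷ H ∷ []) (t ∷ []) 0
                    (lit 1 ≼ ∥ s0 ⋒ (((s1 ∖ s2) ∖ s3) ⋓ ((s4 ∖ s2) ∖ s1)))
                    (x0 ≼ ∥ s0 ⋒ s4 ∵ meet𝔽 K H k (proj₁ h) ∙ lit 1 ⊕ ∥ s4 ⋒ s2 ≅ x0 ∵ proj₂ h ∙
                    ∥ s4 ⋒ s3 ≼ lit 0 ∵ v-H ∙ []))))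
        ... | yes i | inj₂ d = inj₁ (size𝔽 K k , (i , (linear (K ∷ F ∷ T ∷ v ∷ []) [] 0
            (∥ s0 ⋒ (((s1 ⋒ s2) ⋓ s3) ∖ s2) ≼ lit 0) (∥ s3 ⋒ s0 ≼ lit 0 ∵ d ∙ []))) ,
                ( (linear (K ∷ F ∷ T ∷ v ∷ []) (t ∷ []) 0 (lit 1 ≼ ∥ s0 ⋒ ((s1 ∖ s2) ∖ s3))
                    (x0 ≼ ∥ s0 ⋒ s1 ∵ meet𝔽 K F k (proj₁ f) ∙ ∥ s3 ⋒ s0 ≼ lit 0 ∵ d ∙
                    lit 1 ⊕ ∥ s1 ⋒ s2 ≅ x0 ∵ proj₂ f ∙ []))
                , (linear (K ∷ G ∷ T ∷ v ∷ []) (t ∷ []) 0 (lit 1 ≼ ∥ s0 ⋒ ((s1 ∖ s2) ∖ s3))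
                    (x0 ≼ ∥ s0 ⋒ s1 ∵ meet𝔽 K G k (proj₁ g) ∙ ∥ s3 ⋒ s0 ≼ lit 0 ∵ d ∙
                    lit 1 ⊕ ∥ s1 ⋒ s2 ≅ x0 ∵ proj₂ g ∙ [])) ))
        ... | no ¬i | _ with off K (k , (equation (K ∷ T ∷ []) (t ∷ []) (lit 1 ⊕ ∥ s0 ⋒ s1) (x0) 0
            (lit 1 ≼ ∥ s1 ∖ s0 ∵ ≰⇒> ¬i ∙ ∥ s1 ≅ x0 ∵ ∣T∣ ∙ []) 0
            (x0 ≼ lit 1 ⊕ ∥ s0 ⋒ s1 ∵ close K k ∙ [])))
        ...   | inj₁ e        = inj₂ (inj₂ (inj₁ (trans e F≡)))
        ...   | inj₂ (inj₁ e) = inj₂ (inj₂ (inj₂ (inj₁ (trans e G≡))))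
        ...   | inj₂ (inj₂ e) = inj₂ (inj₂ (inj₂ (inj₂ (trans e H≡))))

        structure : StructureI
        structure = A , B , C′ , u ,
          ((equation (F ∷ T ∷ v ∷ []) (t ∷ []) (∥ (s0 ⋒ s1) ⋓ s2) (x0) 0
              (lit 1 ⊕ ∥ s0 ⋒ s1 ≅ x0 ∵ proj₂ f ∙ ∥ s2 ≅ lit 1 ∵ ∣v∣ ∙ []) 0
              (lit 1 ⊕ ∥ s0 ⋒ s1 ≅˘ x0 ∵ proj₂ f ∙ ∥ s2 ≅˘ lit 1 ∵ ∣v∣ ∙ ∥ s2 ⋒ s1 ≼ lit 0 ∵ v-T ∙
              [])) , ∣B∣ , ∣C′∣ , ∣u∣ , (equation (T ∷ F ∷ v ∷ []) (t ∷ [])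
              (lit 1 ⊕ ∥ s0 ⋒ ((s1 ⋒ s0) ⋓ s2)) (x0) 0 (lit 1 ⊕ ∥ s1 ⋒ s0 ≅ x0 ∵ proj₂ f ∙
              s2 ⋐ s1 ∵ v⊑F ∙ []) 0 (lit 1 ⊕ ∥ s1 ⋒ s0 ≅˘ x0 ∵ proj₂ f ∙ []))) ,
          ((linear (T ∷ F ∷ v ∷ G ∷ []) [] 0 (∥ s0 ⋒ (((s1 ∖ s0) ∖ s2) ⋓ ((s3 ∖ s0) ∖ s2)) ≼ lit 0)
              []) , (linear (F ∷ T ∷ v ∷ []) [] 0 (∥ ((s0 ⋒ s1) ⋓ s2) ⋒ ((s0 ∖ s1) ∖ s2) ≼ lit 0)
              []) ,
           (linear (F ∷ T ∷ v ∷ G ∷ []) [] 0 (∥ ((s0 ⋒ s1) ⋓ s2) ⋒ ((s3 ∖ s1) ∖ s2) ≼ lit 0) []) ,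
             (linear
               (F ∷ T ∷ v ∷ G ∷ []) [] 0 (∥ ((s0 ∖ s1) ∖ s2) ⋒ ((s3 ∖ s1) ∖ s2) ≼ lit 0)
               ((s0 ⋒ s3) ⋐ (s1 ⋓ s2) ∵ F∩G ∙ [])) , u⊑C′) ,
          classify

      module Many (many : N₁ ≤ # 𝒮?) where

        -- For `p = 1` the bound of `Pair` is exactly `N₁`, so nothing may be missing: all edges
        -- across exist, and so do all edges from `v` to `H ─ T` for a member `H` of `Off` that
        -- avoids `v`. Covering the edges across, `H` contains one of the two sides.
        single : ∀ F G (f : Off F) (g : Off G) → ∣ (F ∩ G) ─ T ∣ ≡ 1 → StructureI
        single F G f g p≡1 = finish (H∋ (proj₁ avoid) (proj₁ (proj₂ avoid)) v-H)
          where
          open Pair F G f g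
          v = P
          avoid = avoiding P (≤-reflexive p≡1)
          H = proj₁ avoid
          h = proj₁ (proj₂ avoid)

          total : # 𝒮? < p * (ℓ + 1) + q * q → Data.Empty.⊥
          total l = <⇒≱ (≤-trans l (≤-reflexive (PairBound.pair-total ℓ 3≤ℓ p q p+q
            (trans (cong (_* q) p≡1) (trans (*-identityˡ q)
              (suc-injective (trans (cong (_+ q) (sym p≡1)) (trans p+q (+-comm ℓ 1))))))))) many

          v-H : ∣ H ∩ ((F ∩ G) ─ T) ∣ ≤ 0
          v-H = linear (H ∷ F ∷ G ∷ T ∷ []) (t ∷ []) 0 (∥ s0 ⋒ ((s1 ⋒ s2) ∖ s3) ≼ lit 0)
              (lit 1 ⊕ ∥ s0 ⋒ (s3 ⋓ ((s1 ⋒ s2) ∖ s3)) ≼ x0 ∵ proj₂ (proj₂ avoid) ∙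
              lit 1 ⊕ ∥ s0 ⋒ s3 ≅˘ x0 ∵ proj₂ h ∙ [])

          across : ∀ a → Sub 1 ((F ─ T) ─ G) a → ∀ b → Sub 1 ((G ─ T) ─ F) b → 𝒮 ((T ∪ a) ∪ b)
          across a i b j = decidable-stable (𝒮? ((T ∪ a) ∪ b)) (λ ¬s → total (≤-trans (s≤s split)
            (≤-trans (≤-reflexive (sym (+-suc _ _))) (+-mono-≤ Through≤ (Across< a i b j ¬s)))))

          spoke : ∀ w → Sub 1 (H ─ T) w → 𝒮 ((T ∪ v) ∪ w)
          spoke w i = decidable-stable (𝒮? ((T ∪ v) ∪ w)) (λ ¬s → total (≤-trans (s≤s split)
            (+-mono-≤ (Through< v (p≡1 , ⊑-refl v) (missing-edge H h v (p≡1 , (linear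
                (F ∷ G ∷ T ∷ []) [] 0 (((s0 ⋒ s1) ∖ s2) ⋐ (cmpl s2)) [])) v-H w i ¬s)) Across≤)))

          H∋ : ∀ H → Off H → ∣ H ∩ ((F ∩ G) ─ T) ∣ ≤ 0 → ((F ─ T) ─ G) ⊑ H ⊎ ((G ─ T) ─ F) ⊑ H
          H∋ H (k , m) d with ((F ─ T) ─ G) ⊑? H | ((G ─ T) ─ F) ⊑? H
          ... | yes i | _     = inj₁ i
          ... | no _  | yes j = inj₂ j
          ... | no ¬i | no ¬j =
            let a , ∣a∣ , i = choose (((F ─ T) ─ G) ─ H) 1 (≰⇒> ¬i)
                b , ∣b∣ , j = choose (((G ─ T) ─ F) ─ H) 1 (≰⇒> ¬j)
                s = across a (∣a∣ , (linear (a ∷ F ∷ T ∷ G ∷ H ∷ []) [] 0 (s0 ⋐ ((s1 ∖ s2) ∖ s3))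
                    (s0 ⋐ (((s1 ∖ s2) ∖ s3) ∖ s4) ∵ i ∙ []))) b (∣b∣ , (linear
                    (b ∷ G ∷ T ∷ F ∷ H ∷ []) [] 0 (s0 ⋐ ((s1 ∖ s2) ∖ s3))
                    (s0 ⋐ (((s1 ∖ s2) ∖ s3) ∖ s4) ∵ j ∙ [])))
            in (impossible (linear (H ∷ T ∷ a ∷ b ∷ F ∷ G ∷ []) (t ∷ []) 0 (lit 1 ≼ lit 0)
                (x0 ≼ ∥ s0 ⋒ ((s1 ⋓ s2) ⋓ s3) ∵ proj₂ s H k ∙ lit 1 ⊕ ∥ s0 ⋒ s1 ≅ x0 ∵ m ∙
                s2 ⋐ (((s4 ∖ s1) ∖ s5) ∖ s0) ∵ i ∙ s3 ⋐ (((s5 ∖ s1) ∖ s4) ∖ s0) ∵ j ∙ [])))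

          finish : ((F ─ T) ─ G) ⊑ H ⊎ ((G ─ T) ─ F) ⊑ H → StructureI
          finish (inj₁ i) = Configuration.structure F G H f g h v p≡1 (linear (F ∷ G ∷ T ∷ []) [] 0
              (∥ ((s0 ⋒ s1) ∖ s2) ⋒ s2 ≼ lit 0) []) (linear (F ∷ G ∷ T ∷ []) [] 0
              (((s0 ⋒ s1) ∖ s2) ⋐ s0) []) (linear (F ∷ G ∷ T ∷ []) [] 0 (((s0 ⋒ s1) ∖ s2) ⋐ s1) [])
                v-H
            (linear (F ∷ G ∷ T ∷ []) [] 0 ((s0 ⋒ s1) ⋐ (s2 ⋓ ((s0 ⋒ s1) ∖ s2))) [])
            (λ a (∣a∣ , k) b (∣b∣ , l) → across a (∣a∣ , (linear (a ∷ F ∷ T ∷ G ∷ []) [] 0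
                (s0 ⋐ ((s1 ∖ s2) ∖ s3)) (s0 ⋐ ((s1 ∖ s2) ∖ ((s1 ⋒ s3) ∖ s2)) ∵ k ∙ [])))
                                                b (∣b∣ , (linear (b ∷ G ∷ T ∷ F ∷ []) [] 0
                                                    (s0 ⋐ ((s1 ∖ s2) ∖ s3))
                                                    (s0 ⋐ ((s1 ∖ s2) ∖ ((s3 ⋒ s1) ∖ s2)) ∵ l ∙
                                                      []))))
            spoke (linear (F ∷ T ∷ G ∷ H ∷ []) [] 0 (((s0 ∖ s1) ∖ ((s0 ⋒ s2) ∖ s1)) ⋐ s3)
                (((s0 ∖ s1) ∖ s2) ⋐ s3 ∵ i ∙ []))
          -- The same configuration with `F` and `G` exchanged.
          finish (inj₂ i) = Configuration.structure G F H g f h v p≡1 (linear (F ∷ G ∷ T ∷ []) [] 0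
              (∥ ((s0 ⋒ s1) ∖ s2) ⋒ s2 ≼ lit 0) []) (linear (F ∷ G ∷ T ∷ []) [] 0
              (((s0 ⋒ s1) ∖ s2) ⋐ s1) []) (linear (F ∷ G ∷ T ∷ []) [] 0 (((s0 ⋒ s1) ∖ s2) ⋐ s0) [])
                v-H
            (linear (G ∷ F ∷ T ∷ []) [] 0 ((s0 ⋒ s1) ⋐ (s2 ⋓ ((s1 ⋒ s0) ∖ s2))) [])
            (λ b (∣b∣ , l) a (∣a∣ , k) → subst 𝒮 (⊑-antisym (linear (T ∷ a ∷ b ∷ []) [] 0
                (((s0 ⋓ s1) ⋓ s2) ⋐ ((s0 ⋓ s2) ⋓ s1)) []) (linear (T ∷ b ∷ a ∷ []) [] 0
                (((s0 ⋓ s1) ⋓ s2) ⋐ ((s0 ⋓ s2) ⋓ s1)) []))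
                (across a (∣a∣ , (linear (a ∷ F ∷ T ∷ G ∷ []) [] 0 (s0 ⋐ ((s1 ∖ s2) ∖ s3))
                    (s0 ⋐ ((s1 ∖ s2) ∖ ((s1 ⋒ s3) ∖ s2)) ∵ k ∙ [])))
                        b (∣b∣ , (linear (b ∷ G ∷ T ∷ F ∷ []) [] 0 (s0 ⋐ ((s1 ∖ s2) ∖ s3))
                            (s0 ⋐ ((s1 ∖ s2) ∖ ((s3 ⋒ s1) ∖ s2)) ∵ l ∙ [])))))
            spoke (linear (G ∷ T ∷ F ∷ H ∷ []) [] 0 (((s0 ∖ s1) ∖ ((s2 ⋒ s0) ∖ s1)) ⋐ s3)
                (((s0 ∖ s1) ∖ s2) ⋐ s3 ∵ i ∙ []))

        -- If F and G differ outside T in one point only, some third member meets F in one point outside T.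
        nested : ∀ F G (f : Off F) (g : Off G) → ∣ (F ─ T) ─ G ∣ ≡ 1 → StructureI
        nested F G f g q≡1 = single F H f h (equation (F ∷ H ∷ T ∷ G ∷ []) [] (∥ (s0 ⋒ s1) ∖ s2)
            (lit 1) 0 (∥ (s0 ∖ s2) ∖ s3 ≅ lit 1 ∵ q≡1 ∙ ∥ s1 ⋒ ((s0 ⋒ s3) ∖ s2) ≼ lit 0 ∵ H-P ∙ [])
            0 (lit 1 ≼ ∥ (s0 ⋒ s1) ∖ s2 ∵ Pair.1≤p F H f h ∙ []))
          where
          open Pair F G f g
          choice = choose P 1 1≤p
          v = proj₁ choice
          ∣v∣ = proj₁ (proj₂ choice)
          v⊑P = proj₂ (proj₂ choice)
          avoid = avoiding v (≤-reflexive ∣v∣)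
          H = proj₁ avoid
          h = proj₁ (proj₂ avoid)

          total : # Through? < p * (ℓ + 1) → Data.Empty.⊥
          total l = <⇒≱ (≤-trans (≤-trans (s≤s split) (+-mono-≤ l Across≤))
            (≤-reflexive (PairBound.pair-total ℓ 3≤ℓ p q p+q
              (trans (cong (p *_) q≡1) (trans (*-identityʳ p)
            (suc-injective (trans (+-comm 1 p) (trans (cong (p +_) (sym q≡1))
              (trans p+q (+-comm ℓ 1)))))))))) many

          v-H : ∣ H ∩ v ∣ ≤ 0
          v-H = linear (H ∷ v ∷ T ∷ F ∷ G ∷ []) (t ∷ []) 0 (∥ s0 ⋒ s1 ≼ lit 0)
              (lit 1 ⊕ ∥ s0 ⋒ (s2 ⋓ s1) ≼ x0 ∵ proj₂ (proj₂ avoid) ∙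
              lit 1 ⊕ ∥ s0 ⋒ s2 ≅˘ x0 ∵ proj₂ h ∙ s1 ⋐ ((s3 ⋒ s4) ∖ s2) ∵ v⊑P ∙ [])

          -- Consider the edge from `v` to a point `w` of `P` in `H`. If it is present, it is
          -- counted at both ends; if it is absent, the degree of `v` is below `ℓ + 1`. Either way
          -- the total falls short of `N₁`.
          H-P : ∣ H ∩ ((F ∩ G) ─ T) ∣ ≤ 0
          H-P with ∣ H ∩ ((F ∩ G) ─ T) ∣ ≤? 0
          ... | yes d = d
          ... | no ¬d with choose (H ∩ ((F ∩ G) ─ T)) 1 (≰⇒> ¬d)
          ...   | w , ∣w∣ , i with 𝒮? ((T ∪ v) ∪ w)
          ...     | yes s = contradiction (Through<′ v w (∣v∣ , v⊑P) (∣w∣ , (linear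
              (w ∷ F ∷ G ∷ T ∷ H ∷ []) [] 0 (s0 ⋐ ((s1 ⋒ s2) ∖ s3))
              (s0 ⋐ (s4 ⋒ ((s1 ⋒ s2) ∖ s3)) ∵ i ∙ [])))
                      (linear (v ∷ w ∷ H ∷ F ∷ G ∷ T ∷ []) [] 0 (∥ s0 ⋒ s1 ≼ lit 0)
                          (∥ s2 ⋒ s0 ≼ lit 0 ∵ v-H ∙ s1 ⋐ (s2 ⋒ ((s3 ⋒ s4) ∖ s5)) ∵ i ∙ [])) s)
                            total
          ...     | no ¬s = contradiction (Through< v (∣v∣ , v⊑P) (missing-edge H h v (∣v∣ , (linear
              (v ∷ T ∷ F ∷ G ∷ []) [] 0 (s0 ⋐ (cmpl s1)) (s0 ⋐ ((s2 ⋒ s3) ∖ s1) ∵ v⊑P ∙ []))) v-H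
                      w (∣w∣ , (linear (w ∷ H ∷ T ∷ F ∷ G ∷ []) [] 0 (s0 ⋐ (s1 ∖ s2))
                          (s0 ⋐ (s1 ⋒ ((s3 ⋒ s4) ∖ s2)) ∵ i ∙ []))) ¬s)) total

        pair : ∀ F G (f : Off F) (g : Off G) → 1 ≤ ∣ (F ─ T) ─ G ∣ → StructureI
        pair F G f g 1≤q with ∣ (F ∩ G) ─ T ∣ ≟ 1 | ∣ (F ─ T) ─ G ∣ ≟ 1
        ... | yes p≡1 | _       = single F G f g p≡1
        ... | no _    | yes q≡1 = nested F G f g q≡1
        ... | no p≢1  | no q≢1  = contradiction (≤-trans
          (s≤s (≤-trans split (+-mono-≤ Through≤ Across≤)))
                (PairBound.pair-total-< ℓ 3≤ℓ p q p+q (≤∧≢⇒< 1≤p (p≢1 ∘ sym))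
                  (≤∧≢⇒< 1≤q (q≢1 ∘ sym)))) (≤⇒≯ many)
          where open Pair F G f g

        structure : StructureI
        structure =
          let F , f , _     = avoiding ⊥ (≤-trans (≤-reflexive (∣⊥∣≡0 n)) z≤n)
              x , ∣x∣ , i   = choose (F ─ T) 1 (linear (F ∷ T ∷ []) (t ∷ ℓ ∷ []) 0
                  (lit 1 ≼ ∥ s0 ∖ s1) (∥ s0 ≅˘ x0 ⊕ x1 ∵ size𝔽 F (proj₁ f) ∙
                  lit 1 ⊕ ∥ s0 ⋒ s1 ≅ x0 ∵ proj₂ f ∙ []))
              G , g , l     = avoiding x (≤-reflexive ∣x∣)
          in pair F G f g (linear (F ∷ T ∷ G ∷ x ∷ []) (t ∷ []) 0 (lit 1 ≼ ∥ (s0 ∖ s1) ∖ s2)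
              (s3 ⋐ (s0 ∖ s1) ∵ i ∙ ∥ s3 ≅˘ lit 1 ∵ ∣x∣ ∙ lit 1 ⊕ ∥ s2 ⋒ (s1 ⋓ s3) ≼ x0 ∵ l ∙
              lit 1 ⊕ ∥ s2 ⋒ s1 ≅˘ x0 ∵ proj₂ g ∙ []))

    trivial : Small (# 𝒮?) ⊎ StructureI
    trivial with ∀? 𝔽? (λ F → t ≤? 1 + ∣ F ∩ T ∣)
    ... | inj₂ (F , f , h) = inj₁ (far-small F f (≰⇒> h))
    ... | inj₁ close with N₁ ≤? # 𝒮?
    ...   | no l  = inj₁ (below₁ (≰⇒> l))
    ...   | yes m = inj₂ (Many.structure close m)

-- Upper bounds for the maximal family

Contains? : ∀ {n} (Y : Subset n) k → Decidable (λ F → ∣ F ∣ ≡ k × Y ⊑ F)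
Contains? Y k F = ∣ F ∣ ≟ k ×-dec Y ⊑? F

Avoids? : ∀ {n} (Y E : Subset n) k → Decidable (λ F → ∣ F ∣ ≡ k × Y ⊑ F × ∣ F ∩ E ∣ ≤ 0)
Avoids? Y E k F = ∣ F ∣ ≟ k ×-dec (Y ⊑? F ×-dec (∣ F ∩ E ∣ ≤? 0))

#-avoids : ∀ {n} (Y E : Subset n) k j m → ∣ Y ∩ E ∣ ≤ 0 → k ≡ ∣ Y ∣ + j → n ≡ ∣ Y ∣ + ∣ E ∣ + m →
  # (Avoids? Y E k) ≡ m C j
#-avoids {n} Y E k j m d e e′ = trans
  (cnt-cong (Avoids? Y E k) (Interval? k Y (∁ E)) (subsets n)
    (λ F (a , b , c) → a , b , (linear (F ∷ E ∷ []) [] 0 (s0 ⋐ (cmpl s1)) (∥ s0 ⋒ s1 ≼ lit 0 ∵ c ∙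
        []))) (λ F (a , b , c) → a , b , (linear (F ∷ E ∷ []) [] 0 (∥ s0 ⋒ s1 ≼ lit 0)
        (s0 ⋐ (cmpl s1) ∵ c ∙ []))))
  (trans (#-interval Y (∁ E) j k (linear (Y ∷ E ∷ []) [] 0 (s0 ⋐ (cmpl s1)) (∥ s0 ⋒ s1 ≼ lit 0 ∵ d ∙
      [])) e)
    (cong (_C j) (equation (E ∷ Y ∷ []) (m ∷ n ∷ []) (∥ (cmpl s0) ∖ s1) (x0) 0
        (∥ s1 ⋒ s0 ≼ lit 0 ∵ d ∙ x1 ≅ ∥ s1 ⊕ ∥ s0 ⊕ x0 ∵ e′ ∙ ∥ s0 ⋓ (cmpl s0) ≅ x1 ∵ whole E ∙ [])
        0 (x1 ≅˘ ∥ s1 ⊕ ∥ s0 ⊕ x0 ∵ e′ ∙ ∥ s0 ⋓ (cmpl s0) ≅˘ x1 ∵ whole E ∙ []))))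

#-contains : ∀ {n} (Y : Subset n) k j m → k ≡ ∣ Y ∣ + j → n ≡ ∣ Y ∣ + m → # (Contains? Y k) ≤ m C j
#-contains {n} Y k j m e e′ = ≤-trans
  (#-mono (Contains? Y k) (Avoids? Y ⊥ k) (λ F (a , b) → a , b , disjoint F))
  (≤-reflexive (#-avoids Y ⊥ k j m (disjoint Y) e (trans e′
    (cong (_+ m) (sym (trans (cong (∣ Y ∣ +_) (∣⊥∣≡0 n)) (+-identityʳ _)))))))
  where
  disjoint′ : ∀ (E F : Subset n) → ∣ E ∣ ≡ 0 → ∣ F ∩ E ∣ ≤ 0
  disjoint′ E F e = linear (F ∷ E ∷ []) [] 0 (∥ s0 ⋒ s1 ≼ lit 0) (∥ s1 ≅ lit 0 ∵ e ∙ [])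
  disjoint : ∀ F → ∣ F ∩ ⊥ ∣ ≤ 0
  disjoint F = disjoint′ ⊥ F (∣⊥∣≡0 n)

module Classification {n} (t ℓ : ℕ) (1≤t : 1 ≤ t) (3≤ℓ : 3 ≤ ℓ) (room : (t + 2) + (t + ℓ) ≤ n)
                      {𝔽 : Subset n → Set} (𝔽? : Decidable 𝔽)
                      (size𝔽 : ∀ F → 𝔽 F → ∣ F ∣ ≡ t + ℓ)
                      (meet𝔽 : ∀ F G → 𝔽 F → 𝔽 G → t ≤ ∣ F ∩ G ∣)
                      (maximal : ∀ X → ∣ X ∣ ≡ t + ℓ → (∀ F → 𝔽 F → t ≤ ∣ X ∩ F ∣) → 𝔽 X)
                      (noCover : ∀ X → ∣ X ∣ ≤ t + 1 → ∃ λ F → 𝔽 F × ∣ F ∩ X ∣ < t) where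

  open Setting t ℓ 1≤t 3≤ℓ room 𝔽? size𝔽 meet𝔽 maximal public

  private
    noCover′ : ∀ X → ∣ X ∣ ≡ t + 1 → ∃ λ F → 𝔽 F × ∣ F ∩ X ∣ < t
    noCover′ X e = noCover X (≤-reflexive e)

    module Tr = Trivial t ℓ 1≤t 3≤ℓ room 𝔽? size𝔽 meet𝔽 maximal noCover
    module Pi = Pivot t ℓ 1≤t 3≤ℓ room 𝔽? size𝔽 meet𝔽 maximal noCover′

  StructureI StructureII StructureIII : Set
  StructureI   = ∃ λ T → ∣ T ∣ ≡ t × ∃ λ A → ∃ λ B → ∃ λ C′ → ∃ λ u →
    (∣ A ∣ ≡ t × ∣ B ∣ ≡ ℓ × ∣ C′ ∣ ≡ ℓ × ∣ u ∣ ≡ 1 × 1 + ∣ T ∩ A ∣ ≡ t) ×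
    (∣ T ∩ (B ∪ C′) ∣ ≤ 0 × ∣ A ∩ B ∣ ≤ 0 × ∣ A ∩ C′ ∣ ≤ 0 × ∣ B ∩ C′ ∣ ≤ 0 × u ⊑ C′) ×
    (∀ F → 𝔽 F → FamilyI (t + ℓ) t T A B C′ u F)
  StructureII  = Pi.StructureII
  StructureIII = ∃ λ Z → ∣ Z ∣ ≡ t + 4 × (∀ F → 𝔽 F → FamilyIII (t + ℓ) t Z F)

  complete⇒III : ∀ Z → ∣ Z ∣ ≡ t + 4 → (∀ S → Sub (t + 2) Z S → 𝒮 S) → StructureIII
  complete⇒III Z ∣Z∣ all = Z , ∣Z∣ , λ F f → size𝔽 F f , large F f
    where
    large : ∀ F → 𝔽 F → t + 2 ≤ ∣ F ∩ Z ∣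
    large F f with t + 2 ≤? ∣ F ∩ Z ∣
    ... | yes h = h
    ... | no ¬h =
      -- Three points of `Z` outside `F` fit into a `(t+2)`-subset of `Z`, which would meet `F` in
      -- at most `t - 1` points and not be a cover.
      let D , ∣D∣ , i = choose (Z ─ F) 3 (linear (Z ∷ F ∷ []) (t ∷ []) 0 (lit 3 ≼ ∥ s0 ∖ s1)
            (∥ s0 ≅˘ x0 ⊕ lit 4 ∵ ∣Z∣ ∙ lit 1 ⊕ ∥ s1 ⋒ s0 ≼ x0 ⊕ lit 2 ∵ ≰⇒> ¬h ∙ []))
          S , ∣S∣ , j , k = between D Z (t + 2) (linear (D ∷ Z ∷ F ∷ []) [] 0 (s0 ⋐ s1)
              (s0 ⋐ (s1 ∖ s2) ∵ i ∙ []))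
            (linear (D ∷ []) (t ∷ []) 0 (∥ s0 ≼ x0 ⊕ lit 2) (∥ s0 ≅ lit 3 ∵ ∣D∣ ∙ lit 1 ≼ x0 ∵ 1≤t ∙
                [])) (linear (Z ∷ []) (t ∷ []) 0 (x0 ⊕ lit 2 ≼ ∥ s0) (∥ s0 ≅˘ x0 ⊕ lit 4 ∵ ∣Z∣ ∙
                []))
      in (impossible (linear (F ∷ S ∷ D ∷ Z ∷ []) (t ∷ []) 0 (lit 1 ≼ lit 0)
          (x0 ≼ ∥ s0 ⋒ s1 ∵ proj₂ (all S (∣S∣ , k)) F f ∙ s2 ⋐ (s3 ∖ s0) ∵ i ∙ ∥ s2 ≅˘ lit 3 ∵ ∣D∣ ∙
          s2 ⋐ s1 ∵ j ∙ ∥ s1 ≅ x0 ⊕ lit 2 ∵ ∣S∣ ∙ [])))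

  Common? : ∀ T → Dec (∀ S → 𝒮 S → T ⊑ S)
  Common? T with ∀? 𝒮? (λ S → T ⊑? S)
  ... | inj₁ h           = yes h
  ... | inj₂ (S , s , ¬i) = no λ h → ¬i (h S s)

  Near? : ∀ W → Dec (∀ S → 𝒮 S → t + 1 ≤ ∣ S ∩ W ∣)
  Near? W with ∀? 𝒮? (λ S → t + 1 ≤? ∣ S ∩ W ∣)
  ... | inj₁ h           = yes h
  ... | inj₂ (S , s , ¬i) = no λ h → ¬i (h S s)

  classify : Small (# 𝒮?) ⊎ StructureI ⊎ StructureII ⊎ StructureIII
  classify with ∃? (λ T → (∣ T ∣ ≟ t) ×-dec Common? T)
  ... | yes (T , ∣T∣ , common) = [ inj₁ , (λ s → inj₂ (inj₁ (T , ∣T∣ , s))) ]′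
    (Tr.trivial T ∣T∣ common)
  ... | no ¬common with ∃? (λ W → 𝒮? W ×-dec Near? W)
  ...   | yes (W , s , near) = [ inj₁ , (λ s → inj₂ (inj₂ (inj₁ s))) ]′ (Pi.pivot W s near)
  ...   | no ¬near with ∃? (λ X → (∣ X ∣ ≟ t + 1) ×-dec (4 ≤? deg 𝒮? X))
  ...     | yes (X , ∣X∣ , heavy) = inj₁ (Nontrivial.Heavy.small noCover′ nontrivial far X ∣X∣
    heavy)
    where
    nontrivial : ∀ T → ∣ T ∣ ≡ t → ∃ λ S → 𝒮 S × ∣ S ∩ T ∣ < t
    nontrivial T ∣T∣ with counterexample 𝒮? (λ S → T ⊑? S) (λ h → ¬common (T , ∣T∣ , h))
    ... | S , s , ¬i = S , s , (linear (S ∷ T ∷ []) (t ∷ []) 0 (lit 1 ⊕ ∥ s0 ⋒ s1 ≼ x0)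
        (lit 1 ≼ ∥ s1 ∖ s0 ∵ ≰⇒> ¬i ∙ ∥ s1 ≅ x0 ∵ ∣T∣ ∙ []))
    far : ∀ W → 𝒮 W → ∃ λ S → 𝒮 S × ∣ S ∩ W ∣ ≤ t
    far W w with counterexample 𝒮? (λ S → t + 1 ≤? ∣ S ∩ W ∣) (λ h → ¬near (W , w , h))
    ... | S , s , ¬h = S , s , (linear (S ∷ W ∷ []) (t ∷ []) 0 (∥ s0 ⋒ s1 ≼ x0)
        (lit 1 ⊕ ∥ s0 ⋒ s1 ≼ x0 ⊕ lit 1 ∵ ≰⇒> ¬h ∙ []))
  ...     | no ¬heavy = [ inj₁ , (λ (Z , ∣Z∣ , all) → inj₂ (inj₂ (inj₂ (complete⇒III Z ∣Z∣ all))))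
    ]′
      (LightConclusion.light t ℓ 1≤t 3≤ℓ 𝒮? size meet nontrivial
        (λ Y e → s≤s⁻¹ (≰⇒> (λ l → ¬heavy (Y , e , l))))
        (linear {n = 0} [] (t ∷ n ∷ ℓ ∷ []) 1 (x0 ≼ x1) (x0 ⊕ lit 2 ⊕ (x0 ⊕ x2) ≼ x1 ∵ room ∙ [])))
    where
    nontrivial : ∀ T → ∣ T ∣ ≡ t → ∃ λ S → 𝒮 S × ∣ S ∩ T ∣ < t
    nontrivial T ∣T∣ with counterexample 𝒮? (λ S → T ⊑? S) (λ h → ¬common (T , ∣T∣ , h))
    ... | S , s , ¬i = S , s , (linear (S ∷ T ∷ []) (t ∷ []) 0 (lit 1 ⊕ ∥ s0 ⋒ s1 ≼ x0)
        (lit 1 ≼ ∥ s1 ∖ s0 ∵ ≰⇒> ¬i ∙ ∥ s1 ≅ x0 ∵ ∣T∣ ∙ []))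

  branch𝔽 : ∀ {𝒢 : Subset n → Set} (𝒢? : Decidable 𝒢) → (∀ G → 𝒢 G → 𝔽 G) → ∀ X c →
            (∃ λ F → 𝔽 F × ∣ F ∩ X ∣ < t) → (∀ Y → ∣ Y ∣ ≡ ∣ X ∣ + 1 → deg 𝒢? Y ≤ c) →
              deg 𝒢? X ≤ (1 + ℓ) * c
  branch𝔽 𝒢? sub X c (F , f , h) d = deg-branch 𝒢? F X t ℓ c (λ G g → meet𝔽 G F (sub G g) f)
    (size𝔽 F f) h d

  contains≤ : ∀ Y j m → t + ℓ ≡ ∣ Y ∣ + j → n ≡ ∣ Y ∣ + m → deg 𝔽? Y ≤ m C j
  contains≤ Y j m e e′ = ≤-trans (#-mono (above? 𝔽? Y) (Contains? Y (t + ℓ))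
    (λ F (f , i) → size𝔽 F f , i))
    (#-contains Y (t + ℓ) j m e e′)

  module WithCover (l m : ℕ) (ℓ≡ : ℓ ≡ 3 + l) (n≡ : n ≡ t + 3 + m) (H : Subset n) (H∈𝒮 : 𝒮 H) where

    Rest : Subset n → Set
    Rest F = 𝔽 F × ¬ (∃ λ S → 𝒮 S × S ⊑ F)

    Rest? : Decidable Rest
    Rest? F = 𝔽? F ×-dec ¬? (∃? (λ S → 𝒮? S ×-dec S ⊑? F))

    Full? : Decidable (λ F → 𝔽 F × (∃ λ S → 𝒮 S × S ⊑ F))
    Full? F = 𝔽? F ×-dec ∃? (λ S → 𝒮? S ×-dec S ⊑? F)

    full≤ : # Full? ≤ # 𝒮? * ((1 + m) C (1 + l))
    full≤ = #-union Full? 𝒮? (above? 𝔽?) ((1 + m) C (1 + l)) (λ F (f , S , s , i) → S , s , f , i)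
      (λ S (∣S∣ , _) → contains≤ S (1 + l) (1 + m)
        (equation (S ∷ []) (t ∷ ℓ ∷ l ∷ []) (x0 ⊕ x1) (∥ s0 ⊕ (lit 1 ⊕ x2)) 0
            (x1 ≅ lit 3 ⊕ x2 ∵ ℓ≡ ∙ ∥ s0 ≅˘ x0 ⊕ lit 2 ∵ ∣S∣ ∙ []) 0 (x1 ≅˘ lit 3 ⊕ x2 ∵ ℓ≡ ∙
            ∥ s0 ≅ x0 ⊕ lit 2 ∵ ∣S∣ ∙ []))
        (equation (S ∷ []) (n ∷ m ∷ t ∷ []) (x0) (∥ s0 ⊕ (lit 1 ⊕ x1)) 0
            (x0 ≅ x2 ⊕ lit 3 ⊕ x1 ∵ n≡ ∙ ∥ s0 ≅˘ x2 ⊕ lit 2 ∵ ∣S∣ ∙ []) 0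
            (x0 ≅˘ x2 ⊕ lit 3 ⊕ x1 ∵ n≡ ∙ ∥ s0 ≅ x2 ⊕ lit 2 ∵ ∣S∣ ∙ [])))

    level₃ : ∀ Y → ∣ Y ∣ ≡ t + 3 → deg Rest? Y ≤ m C l
    level₃ Y e = ≤-trans (#-mono (above? Rest? Y) (above? 𝔽? Y) (λ F (r , i) → proj₁ r , i))
      (contains≤ Y l m (equation (Y ∷ []) (t ∷ ℓ ∷ l ∷ []) (x0 ⊕ x1) (∥ s0 ⊕ x2) 0
          (x1 ≅ lit 3 ⊕ x2 ∵ ℓ≡ ∙ ∥ s0 ≅˘ x0 ⊕ lit 3 ∵ e ∙ []) 0 (x1 ≅˘ lit 3 ⊕ x2 ∵ ℓ≡ ∙
          ∥ s0 ≅ x0 ⊕ lit 3 ∵ e ∙ [])) (equation (Y ∷ []) (n ∷ m ∷ t ∷ []) (x0) (∥ s0 ⊕ x1) 0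
          (x0 ≅ x2 ⊕ lit 3 ⊕ x1 ∵ n≡ ∙ ∥ s0 ≅˘ x2 ⊕ lit 3 ∵ e ∙ []) 0 (x0 ≅˘ x2 ⊕ lit 3 ⊕ x1 ∵ n≡ ∙
          ∥ s0 ≅ x2 ⊕ lit 3 ∵ e ∙ [])))

    -- If `Y` is a cover, no member of `Rest` contains it. If it is not, a third branching is
    -- possible; separating `Rest` from the sets above covers is what allows it.
    level₂ : ∀ Y → ∣ Y ∣ ≡ t + 2 → deg Rest? Y ≤ (1 + ℓ) * (m C l)
    level₂ Y e with covers? Y
    ... | inj₁ c = ≤-trans (≤-reflexive (#-none (above? Rest? Y)
      (λ F (r , i) → proj₂ r (Y , (e , c) , i)))) z≤n
    ... | inj₂ w = branch𝔽 Rest? (λ _ → proj₁) Y (m C l) w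
      (λ Z e′ → level₃ Z (trans e′ (trans (cong (_+ 1) e) (+-assoc t 2 1))))

    level₁ : ∀ Y → ∣ Y ∣ ≡ t + 1 → deg Rest? Y ≤ (1 + ℓ) * ((1 + ℓ) * (m C l))
    level₁ Y e = branch𝔽 Rest? (λ _ → proj₁) Y _ (noCover Y (≤-reflexive e))
      (λ Z e′ → level₂ Z (trans e′ (trans (cong (_+ 1) e) (+-assoc t 1 1))))

    level₀ : ∀ Y → ∣ Y ∣ ≡ t → deg Rest? Y ≤ (1 + ℓ) * ((1 + ℓ) * ((1 + ℓ) * (m C l)))
    level₀ Y e = branch𝔽 Rest? (λ _ → proj₁) Y _ (noCover Y (≤-trans (≤-reflexive e) (m≤m+n t 1)))
      (λ Z e′ → level₁ Z (trans e′ (cong (_+ 1) e)))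

    rest≤ : # Rest? ≤ ((t + 2) C 2) * ((1 + ℓ) * ((1 + ℓ) * ((1 + ℓ) * (m C l))))
    rest≤ = ≤-trans
      (#-union Rest? (Sub? 2 H) (λ D → above? Rest? (H ─ D)) _
        (λ F r → let K , ∣K∣ , i = choose (F ∩ H) t (proj₂ H∈𝒮 F (proj₁ r)) in H ─ K ,
          ( (equation (H ∷ K ∷ F ∷ []) (t ∷ []) (∥ s0 ∖ s1) (lit 2) 0 (∥ s1 ≅˘ x0 ∵ ∣K∣ ∙
              s1 ⋐ (s2 ⋒ s0) ∵ i ∙ ∥ s0 ≅ x0 ⊕ lit 2 ∵ proj₁ H∈𝒮 ∙ []) 0 (∥ s1 ≅ x0 ∵ ∣K∣ ∙
              ∥ s0 ≅˘ x0 ⊕ lit 2 ∵ proj₁ H∈𝒮 ∙ [])) ,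
                (linear (H ∷ K ∷ []) [] 0 ((s0 ∖ s1) ⋐ s0) []))
          , r , (linear (H ∷ K ∷ F ∷ []) [] 0 ((s0 ∖ (s0 ∖ s1)) ⋐ s2) (s1 ⋐ (s2 ⋒ s0) ∵ i ∙ [])))
        (λ D (∣D∣ , i) → level₀ (H ─ D) (equation (H ∷ D ∷ []) (t ∷ []) (∥ s0 ∖ s1) (x0) 0
            (∥ s1 ≅˘ lit 2 ∵ ∣D∣ ∙ s1 ⋐ s0 ∵ i ∙ ∥ s0 ≅ x0 ⊕ lit 2 ∵ proj₁ H∈𝒮 ∙ []) 0
            (∥ s1 ≅ lit 2 ∵ ∣D∣ ∙ ∥ s0 ≅˘ x0 ⊕ lit 2 ∵ proj₁ H∈𝒮 ∙ []))))
      (≤-reflexive (cong (_* ((1 + ℓ) * ((1 + ℓ) * ((1 + ℓ) * (m C l)))))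
        (trans (#-Sub H 2) (cong (_C 2) (proj₁ H∈𝒮)))))

    upper : # 𝔽? ≤ # 𝒮? * ((1 + m) C (1 + l)) + ((t + 2) C 2) *
      ((1 + ℓ) * ((1 + ℓ) * ((1 + ℓ) * (m C l))))
    upper = ≤-trans (≤-reflexive (#-split 𝔽? (λ F → ∃? (λ S → 𝒮? S ×-dec S ⊑? F))))
      (+-mono-≤ full≤ rest≤)

    upper≤ : ∀ {β₂ β₃ γ q} → (1 + m) C (1 + l) ≤ β₂ → m C l ≤ β₃ → (t + 2) C 2 ≤ γ → 1 + ℓ ≤ q →
             # 𝔽? ≤ # 𝒮? * β₂ + γ * (q * (q * (q * β₃)))
    upper≤ h₂ h₃ hγ hq = ≤-trans upper (+-mono-≤ (*-monoʳ-≤ (# 𝒮?) h₂)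
      (*-mono-≤ hγ (*-mono-≤ hq (*-mono-≤ hq (*-mono-≤ hq h₃)))))

  no-small-cover : ¬ ∃ 𝒮 → ∀ X → ∣ X ∣ < t + 3 → ∃ λ F → 𝔽 F × ∣ F ∩ X ∣ < t
  no-small-cover ¬w X h with ∣ X ∣ ≟ t + 2
  ... | no ne = let h′ = ≤∧≢⇒< (linear (X ∷ []) (t ∷ []) 0 (∥ s0 ≼ x0 ⊕ lit 2)
                      (lit 1 ⊕ ∥ s0 ≼ x0 ⊕ lit 3 ∵ h ∙ [])) ne in noCover X (linear (X ∷ [])
                      (t ∷ []) 0 (∥ s0 ≼ x0 ⊕ lit 1) (lit 1 ⊕ ∥ s0 ≼ x0 ⊕ lit 2 ∵ h′ ∙ []))
  ... | yes e with covers? X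
  ...   | inj₁ c = contradiction (X , e , c) ¬w
  ...   | inj₂ d = d

  -- The bound obtained by branching from a cover of size `t + i` when no smaller set is a cover;
  -- here `j` is ℓ - i and `m` is n - t - i.
  level : ℕ → ℕ → ℕ → ℕ
  level i j m = ((t + i) C i) * ((1 + ℓ) ^ i * (m C j))

  level≤ : ∀ i j m {γ q β} → (t + i) C i ≤ γ → 1 + ℓ ≤ q → m C j ≤ β → level i j m ≤ γ * (q ^ i * β)
  level≤ i j m hγ hq hβ = *-mono-≤ hγ (*-mono-≤ (^-monoˡ-≤ i hq) hβ)

  level-step : ∀ i j m {q} → 1 + ℓ ≡ q →
    ((t + suc i) C suc i) * (q ^ suc i * (m C j)) ≤ ((t + i) C i) * (q ^ i * (suc m C suc j)) →
      level (suc i) j m ≤ level i (suc j) (suc m)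
  level-step i j m refl h = h

  deg≤power : ∀ i j m r → i + j ≡ ℓ → n ≡ t + i + m →
    (∀ X → ∣ X ∣ < t + i → ∃ λ F → 𝔽 F × ∣ F ∩ X ∣ < t) →
              ∀ X → ∣ X ∣ + r ≡ t + i → deg 𝔽? X ≤ (1 + ℓ) ^ r * (m C j)
  deg≤power i j m zero    e e′ small X ∣X∣ = ≤-trans (contains≤ X j m
    (equation (X ∷ []) (t ∷ ℓ ∷ j ∷ i ∷ []) (x0 ⊕ x1) (∥ s0 ⊕ x2) 0 (x3 ⊕ x2 ≅˘ x1 ∵ e ∙
        ∥ s0 ⊕ lit 0 ≅˘ x0 ⊕ x3 ∵ ∣X∣ ∙ []) 0 (x3 ⊕ x2 ≅ x1 ∵ e ∙ ∥ s0 ⊕ lit 0 ≅ x0 ⊕ x3 ∵ ∣X∣ ∙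
        [])) (equation (X ∷ []) (n ∷ m ∷ t ∷ i ∷ []) (x0) (∥ s0 ⊕ x1) 0 (x0 ≅ x2 ⊕ x3 ⊕ x1 ∵ e′ ∙
        ∥ s0 ⊕ lit 0 ≅˘ x2 ⊕ x3 ∵ ∣X∣ ∙ []) 0 (x0 ≅˘ x2 ⊕ x3 ⊕ x1 ∵ e′ ∙
        ∥ s0 ⊕ lit 0 ≅ x2 ⊕ x3 ∵ ∣X∣ ∙ [])))
    (≤-reflexive (sym (+-identityʳ _)))
  deg≤power i j m (suc r) e e′ small X ∣X∣ = ≤-trans
    (branch𝔽 𝔽? (λ _ → id) X ((1 + ℓ) ^ r * (m C j)) (small X (linear (X ∷ []) (t ∷ i ∷ r ∷ []) 0
        (lit 1 ⊕ ∥ s0 ≼ x0 ⊕ x1) (∥ s0 ⊕ (lit 1 ⊕ x2) ≅ x0 ⊕ x1 ∵ ∣X∣ ∙ [])))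
      (λ Y ∣Y∣ → deg≤power i j m r e e′ small Y (equation (Y ∷ X ∷ []) (r ∷ t ∷ i ∷ []) (∥ s0 ⊕ x0)
          (x1 ⊕ x2) 0 (∥ s1 ⊕ (lit 1 ⊕ x0) ≅ x1 ⊕ x2 ∵ ∣X∣ ∙ ∥ s0 ≅ ∥ s1 ⊕ lit 1 ∵ ∣Y∣ ∙ []) 0
          (∥ s1 ⊕ (lit 1 ⊕ x0) ≅˘ x1 ⊕ x2 ∵ ∣X∣ ∙ ∥ s0 ≅˘ ∥ s1 ⊕ lit 1 ∵ ∣Y∣ ∙ []))))
    (≤-reflexive (sym (*-assoc (1 + ℓ) ((1 + ℓ) ^ r) (m C j))))

  cover≤ : ∀ i j m → i + j ≡ ℓ → n ≡ t + i + m → (∀ X → ∣ X ∣ < t + i → ∃ λ F → 𝔽 F × ∣ F ∩ X ∣ < t)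
    →
           ∀ H → ∣ H ∣ ≡ t + i → Covers H → # 𝔽? ≤ level i j m
  cover≤ i j m e e′ small H ∣H∣ c = ≤-trans
    (#-union 𝔽? (Sub? i H) (λ D → above? 𝔽? (H ─ D)) ((1 + ℓ) ^ i * (m C j))
      (λ F f → let K , ∣K∣ , k = choose (F ∩ H) t (c F f) in H ─ K ,
        ( (equation (H ∷ K ∷ F ∷ []) (i ∷ t ∷ []) (∥ s0 ∖ s1) (x0) 0 (∥ s1 ≅˘ x1 ∵ ∣K∣ ∙
            s1 ⋐ (s2 ⋒ s0) ∵ k ∙ ∥ s0 ≅ x1 ⊕ x0 ∵ ∣H∣ ∙ []) 0 (∥ s1 ≅ x1 ∵ ∣K∣ ∙
            ∥ s0 ≅˘ x1 ⊕ x0 ∵ ∣H∣ ∙ [])) , (linear (H ∷ K ∷ []) [] 0 ((s0 ∖ s1) ⋐ s0) []))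
        , f , (linear (H ∷ K ∷ F ∷ []) [] 0 ((s0 ∖ (s0 ∖ s1)) ⋐ s2) (s1 ⋐ (s2 ⋒ s0) ∵ k ∙ [])))
      (λ D (∣D∣ , k) → deg≤power i j m i e e′ small (H ─ D) (equation (H ∷ D ∷ []) (i ∷ t ∷ [])
          (∥ s0 ∖ s1 ⊕ x0) (x1 ⊕ x0) 0 (∥ s1 ≅˘ x0 ∵ ∣D∣ ∙ s1 ⋐ s0 ∵ k ∙ ∥ s0 ≅ x1 ⊕ x0 ∵ ∣H∣ ∙ [])
          0 (∥ s1 ≅ x0 ∵ ∣D∣ ∙ ∥ s0 ≅˘ x1 ⊕ x0 ∵ ∣H∣ ∙ []))))
    (≤-reflexive (cong (_* ((1 + ℓ) ^ i * (m C j))) (trans (#-Sub H i) (cong (_C i) ∣H∣))))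

  -- The induction raises t + i up to the covering number.
  no-cover≤ : (∀ i j m → i + suc j ≡ ℓ → n ≡ t + i + suc m →
    level (suc i) j m ≤ level i (suc j) (suc m)) →
              ∀ i j m → i + j ≡ ℓ → n ≡ t + i + m → j ≤ m →
                (∀ X → ∣ X ∣ < t + i → ∃ λ F → 𝔽 F × ∣ F ∩ X ∣ < t) → # 𝔽? ≤ level i j m
  -- For `i = ℓ` any member of `𝔽` is itself a cover of size `t + i`, so the induction ends here.
  no-cover≤ decreasing i zero m e e′ j≤m small with 1 ≤? # 𝔽?
  ... | no l  = ≤-trans (s≤s⁻¹ (≰⇒> l)) z≤n
  ... | yes h = let F , f = #-witness 𝔽? h in
    cover≤ i 0 m e e′ small F (trans (size𝔽 F f) (cong (t +_)
      (sym (trans (sym (+-identityʳ i)) e)))) (λ G g → meet𝔽 G F g f)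
  no-cover≤ decreasing i (suc j) zero e e′ () small
  no-cover≤ decreasing i (suc j) (suc m) e e′ (s≤s j≤m) small with ∃?
    (λ H → (∣ H ∣ ≟ t + i) ×-dec Covers? H)
  ... | yes (H , ∣H∣ , c) = cover≤ i (suc j) (suc m) e e′ small H ∣H∣ c
  ... | no ¬w = ≤-trans
    (no-cover≤ decreasing (suc i) j m (trans (sym (+-suc i j)) e)
      (equation {n = 0} [] (n ∷ t ∷ i ∷ m ∷ []) (x0) (x1 ⊕ (lit 1 ⊕ x2) ⊕ x3) 0
          (x0 ≅ x1 ⊕ x2 ⊕ (lit 1 ⊕ x3) ∵ e′ ∙ []) 0 (x0 ≅˘ x1 ⊕ x2 ⊕ (lit 1 ⊕ x3) ∵ e′ ∙ [])) j≤m
            small′)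
    (decreasing i j m e e′)
    where
    small′ : ∀ X → ∣ X ∣ < t + suc i → ∃ λ F → 𝔽 F × ∣ F ∩ X ∣ < t
    small′ X h with ∣ X ∣ ≟ t + i
    ... | no ne = small X (≤∧≢⇒< (s≤s⁻¹ (≤-trans h (≤-reflexive (+-suc t i)))) ne)
    ... | yes e with covers? X
    ...   | inj₁ c = contradiction (X , e , c) ¬w
    ...   | inj₂ w = w

-- Sizes of the three families

pascal : ∀ m r → suc m C suc r ≡ m C r + m C suc r
pascal m r = sym (nCk+nC[k+1]≡[n+1]C[k+1] m r)

C-mono : ∀ r {m m′} → m ≤ m′ → m C r ≤ m′ C r
C-mono r h = go (≤⇒≤′ h)
  where
  step : ∀ r m → m C r ≤ suc m C r
  step zero    m = ≤-refl
  step (suc r) m = ≤-trans (m≤n+m (m C suc r) (m C r)) (≤-reflexive (sym (pascal m r)))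
  go : ∀ {m m′} → m ≤′ m′ → m C r ≤ m′ C r
  go ≤′-refl      = ≤-refl
  go (≤′-step h′) = ≤-trans (go h′) (step r _)

-- The number of k-sets containing a (t+4)-set; there are none when ℓ = 3.
top : ℕ → ℕ → ℕ
top zero    m = 0
top (suc l) m = m C l

-- `w` is n - 2k + t - 1, the least upper index in `f₁`. In terms of `t`, `l` and `w` all upper
-- indices are sums, and no truncated subtraction is left.
module Counts {n} (t l w : ℕ) (n≡ : n ≡ t + (7 + 2 * l + w)) where

  ℓ k : ℕ
  ℓ = 3 + l
  k = t + ℓ

  ≤2 : ∀ {P Q : Subset n → Set} (P? : Decidable P) (Q? : Decidable Q) →
    # (λ F → P? F ⊎-dec Q? F) ≤ # P? + # Q?
  ≤2 P? Q? = #-∪ (λ F → P? F ⊎-dec Q? F) P? Q? (λ F → id)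

  module I (T A B C′ u : Subset n) (∣T∣ : ∣ T ∣ ≡ t) (∣A∣ : ∣ A ∣ ≡ t) (∣B∣ : ∣ B ∣ ≡ ℓ)
    (∣C′∣ : ∣ C′ ∣ ≡ ℓ) (∣u∣ : ∣ u ∣ ≡ 1) (T∩A : 1 + ∣ T ∩ A ∣ ≡ t)
           (T-BC : ∣ T ∩ (B ∪ C′) ∣ ≤ 0) (A-B : ∣ A ∩ B ∣ ≤ 0) (A-C : ∣ A ∩ C′ ∣ ≤ 0)
             (B-C : ∣ B ∩ C′ ∣ ≤ 0) (u⊑C : u ⊑ C′) where


    a : Subset n
    a = A ─ T

    onT? : Decidable (λ F → ∣ F ∣ ≡ k × (T ⊑ F × ∣ F ∩ (A ─ T) ∣ ≤ 0) ×
      (1 ≤ ∣ F ∩ B ∣ × 1 ≤ ∣ F ∩ C′ ∣))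
    onT? F = (∣ F ∣ ≟ k) ×-dec (((T ⊑? F) ×-dec (∣ F ∩ (A ─ T) ∣ ≤? 0)) ×-dec
      ((1 ≤? ∣ F ∩ B ∣) ×-dec (1 ≤? ∣ F ∩ C′ ∣)))

    onAT? : Decidable (λ F → ∣ F ∣ ≡ k × (A ∪ T) ⊑ F × 1 ≤ ∣ F ∩ (B ∪ u) ∣)
    onAT? F = (∣ F ∣ ≟ k) ×-dec (((A ∪ T) ⊑? F) ×-dec (1 ≤? ∣ F ∩ (B ∪ u) ∣))

    exceptional? : Decidable (λ F → F ≡ A ∪ B ⊎ F ≡ A ∪ C′ ⊎ F ≡ (T ∩ A) ∪ B ∪ u)
    exceptional? F = (F ≟ˢ (A ∪ B)) ⊎-dec ((F ≟ˢ (A ∪ C′)) ⊎-dec (F ≟ˢ ((T ∩ A) ∪ B ∪ u)))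

    Family? : Decidable (FamilyI k t T A B C′ u)
    Family? F = onT? F ⊎-dec (onAT? F ⊎-dec exceptional? F)

    base? : Decidable (λ F → ∣ F ∣ ≡ k × T ⊑ F × ∣ F ∩ a ∣ ≤ 0)
    base? = Avoids? T a k

    hitB? : ∀ F → Dec (1 ≤ ∣ F ∩ B ∣)
    hitB? F = 1 ≤? ∣ F ∩ B ∣
    hitC? : ∀ F → Dec (1 ≤ ∣ F ∩ C′ ∣)
    hitC? F = 1 ≤? ∣ F ∩ C′ ∣

    both? : Decidable (λ F → ((∣ F ∣ ≡ k × T ⊑ F × ∣ F ∩ a ∣ ≤ 0) × 1 ≤ ∣ F ∩ B ∣) × 1 ≤ ∣ F ∩ C′ ∣)
    both? F = (base? F ×-dec hitB? F) ×-dec hitC? F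

    onlyB? : Decidable (λ F → ((∣ F ∣ ≡ k × T ⊑ F × ∣ F ∩ a ∣ ≤ 0) × 1 ≤ ∣ F ∩ B ∣) × ¬ 1 ≤ ∣ F ∩ C′
      ∣)
    onlyB? F = (base? F ×-dec hitB? F) ×-dec ¬? (hitC? F)

    noB? : Decidable (λ F → (∣ F ∣ ≡ k × T ⊑ F × ∣ F ∩ a ∣ ≤ 0) × ¬ 1 ≤ ∣ F ∩ B ∣)
    noB? F = base? F ×-dec ¬? (hitB? F)

    splits : # base? ≡ (# both? + # onlyB?) + # noB?
    splits = trans (#-split base? hitB?) (cong (_+ # noB?)
      (#-split (λ F → base? F ×-dec hitB? F) hitC?))

    base# : # base? ≡ (6 + 2 * l + w) C ℓ
    base# = #-avoids T a k ℓ (6 + 2 * l + w) (linear (T ∷ A ∷ []) [] 0 (∥ s0 ⋒ (s1 ∖ s0) ≼ lit 0)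
        []) (cong (_+ ℓ) (sym ∣T∣))
      (equation (T ∷ A ∷ []) (n ∷ l ∷ w ∷ t ∷ []) (x0) (∥ s0 ⊕ ∥ s1 ∖ s0 ⊕ (lit 6 ⊕ 2 ⊛ x1 ⊕ x2)) 0
          (∥ s0 ≅˘ x3 ∵ ∣T∣ ∙ ∥ s1 ≅˘ x3 ∵ ∣A∣ ∙ lit 1 ⊕ ∥ s0 ⋒ s1 ≅ x3 ∵ T∩A ∙
          x0 ≅ x3 ⊕ (lit 7 ⊕ 2 ⊛ x1 ⊕ x2) ∵ n≡ ∙ []) 0 (∥ s0 ≅ x3 ∵ ∣T∣ ∙ ∥ s1 ≅ x3 ∵ ∣A∣ ∙
          lit 1 ⊕ ∥ s0 ⋒ s1 ≅˘ x3 ∵ T∩A ∙ x0 ≅˘ x3 ⊕ (lit 7 ⊕ 2 ⊛ x1 ⊕ x2) ∵ n≡ ∙ []))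

    noB≥ : (3 + l + w) C ℓ ≤ # noB?
    noB≥ = ≤-trans (≤-reflexive (sym (#-avoids T (a ∪ B) k ℓ (3 + l + w) (linear
        (T ∷ A ∷ B ∷ C′ ∷ []) [] 0 (∥ s0 ⋒ ((s1 ∖ s0) ⋓ s2) ≼ lit 0)
        (∥ s0 ⋒ (s2 ⋓ s3) ≼ lit 0 ∵ T-BC ∙ [])) (cong (_+ ℓ) (sym ∣T∣))
        (equation (T ∷ A ∷ B ∷ []) (n ∷ l ∷ w ∷ t ∷ []) (x0)
            (∥ s0 ⊕ ∥ (s1 ∖ s0) ⋓ s2 ⊕ (lit 3 ⊕ x1 ⊕ x2)) 0 (∥ s0 ≅˘ x3 ∵ ∣T∣ ∙ ∥ s1 ≅˘ x3 ∵ ∣A∣ ∙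
            ∥ s2 ≅˘ lit 3 ⊕ x1 ∵ ∣B∣ ∙ lit 1 ⊕ ∥ s0 ⋒ s1 ≅ x3 ∵ T∩A ∙ ∥ s1 ⋒ s2 ≼ lit 0 ∵ A-B ∙
            x0 ≅ x3 ⊕ (lit 7 ⊕ 2 ⊛ x1 ⊕ x2) ∵ n≡ ∙ []) 0 (∥ s0 ≅ x3 ∵ ∣T∣ ∙ ∥ s1 ≅ x3 ∵ ∣A∣ ∙
            ∥ s2 ≅ lit 3 ⊕ x1 ∵ ∣B∣ ∙ lit 1 ⊕ ∥ s0 ⋒ s1 ≅˘ x3 ∵ T∩A ∙
            x0 ≅˘ x3 ⊕ (lit 7 ⊕ 2 ⊛ x1 ⊕ x2) ∵ n≡ ∙ [])))))
      (#-mono (Avoids? T (a ∪ B) k) noB? (λ F (e , i , d) → (e , i , (linear (F ∷ A ∷ T ∷ B ∷ []) []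
          0 (∥ s0 ⋒ (s1 ∖ s2) ≼ lit 0) (∥ s0 ⋒ ((s1 ∖ s2) ⋓ s3) ≼ lit 0 ∵ d ∙ []))) ,
        λ h → (impossible (linear (F ∷ B ∷ A ∷ T ∷ []) [] 0 (lit 1 ≼ lit 0) (lit 1 ≼ ∥ s0 ⋒ s1 ∵ h ∙
            ∥ s0 ⋒ ((s2 ∖ s3) ⋓ s1) ≼ lit 0 ∵ d ∙ [])))))

    neither? : Decidable (λ F → ∣ F ∣ ≡ k × T ⊑ F × ∣ F ∩ (a ∪ (B ∪ C′)) ∣ ≤ 0)
    neither? = Avoids? T (a ∪ (B ∪ C′)) k

    neither# : # neither? ≡ w C ℓ
    neither# = #-avoids T (a ∪ (B ∪ C′)) k ℓ w (linear (T ∷ A ∷ B ∷ C′ ∷ []) [] 0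
        (∥ s0 ⋒ ((s1 ∖ s0) ⋓ (s2 ⋓ s3)) ≼ lit 0) (∥ s0 ⋒ (s2 ⋓ s3) ≼ lit 0 ∵ T-BC ∙ []))
          (cong (_+ ℓ) (sym ∣T∣))
        (equation (T ∷ A ∷ B ∷ C′ ∷ []) (n ∷ w ∷ t ∷ l ∷ []) (x0)
            (∥ s0 ⊕ ∥ (s1 ∖ s0) ⋓ (s2 ⋓ s3) ⊕ x1) 0 (∥ s0 ≅˘ x2 ∵ ∣T∣ ∙ ∥ s1 ≅˘ x2 ∵ ∣A∣ ∙
            ∥ s2 ≅˘ lit 3 ⊕ x3 ∵ ∣B∣ ∙ ∥ s3 ≅˘ lit 3 ⊕ x3 ∵ ∣C′∣ ∙ lit 1 ⊕ ∥ s0 ⋒ s1 ≅ x2 ∵ T∩A ∙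
            ∥ s1 ⋒ s2 ≼ lit 0 ∵ A-B ∙ ∥ s1 ⋒ s3 ≼ lit 0 ∵ A-C ∙ ∥ s2 ⋒ s3 ≼ lit 0 ∵ B-C ∙
            x0 ≅ x2 ⊕ (lit 7 ⊕ 2 ⊛ x3 ⊕ x1) ∵ n≡ ∙ []) 0 (∥ s0 ≅ x2 ∵ ∣T∣ ∙ ∥ s1 ≅ x2 ∵ ∣A∣ ∙
            ∥ s2 ≅ lit 3 ⊕ x3 ∵ ∣B∣ ∙ ∥ s3 ≅ lit 3 ⊕ x3 ∵ ∣C′∣ ∙ lit 1 ⊕ ∥ s0 ⋒ s1 ≅˘ x2 ∵ T∩A ∙
            x0 ≅˘ x2 ⊕ (lit 7 ⊕ 2 ⊛ x3 ⊕ x1) ∵ n≡ ∙ []))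

    onlyB≥ : (3 + l + w) C ℓ ≤ # onlyB? + w C ℓ
    onlyB≥ = ≤-trans (≤-reflexive (sym (#-avoids T (a ∪ C′) k ℓ (3 + l + w) (linear
        (T ∷ A ∷ C′ ∷ B ∷ []) [] 0 (∥ s0 ⋒ ((s1 ∖ s0) ⋓ s2) ≼ lit 0)
        (∥ s0 ⋒ (s3 ⋓ s2) ≼ lit 0 ∵ T-BC ∙ [])) (cong (_+ ℓ) (sym ∣T∣))
        (equation (T ∷ A ∷ C′ ∷ []) (n ∷ l ∷ w ∷ t ∷ []) (x0)
            (∥ s0 ⊕ ∥ (s1 ∖ s0) ⋓ s2 ⊕ (lit 3 ⊕ x1 ⊕ x2)) 0 (∥ s0 ≅˘ x3 ∵ ∣T∣ ∙ ∥ s1 ≅˘ x3 ∵ ∣A∣ ∙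
            ∥ s2 ≅˘ lit 3 ⊕ x1 ∵ ∣C′∣ ∙ lit 1 ⊕ ∥ s0 ⋒ s1 ≅ x3 ∵ T∩A ∙ ∥ s1 ⋒ s2 ≼ lit 0 ∵ A-C ∙
            x0 ≅ x3 ⊕ (lit 7 ⊕ 2 ⊛ x1 ⊕ x2) ∵ n≡ ∙ []) 0 (∥ s0 ≅ x3 ∵ ∣T∣ ∙ ∥ s1 ≅ x3 ∵ ∣A∣ ∙
            ∥ s2 ≅ lit 3 ⊕ x1 ∵ ∣C′∣ ∙ lit 1 ⊕ ∥ s0 ⋒ s1 ≅˘ x3 ∵ T∩A ∙
            x0 ≅˘ x3 ⊕ (lit 7 ⊕ 2 ⊛ x1 ⊕ x2) ∵ n≡ ∙ [])))))
      (≤-trans (#-∪ (Avoids? T (a ∪ C′) k) onlyB? neither? cases)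
        (+-monoʳ-≤ (# onlyB?) (≤-reflexive neither#)))
      where
      cases : ∀ F → ∣ F ∣ ≡ k × T ⊑ F × ∣ F ∩ (a ∪ C′) ∣ ≤ 0 → _
      cases F (e , i , d) with 1 ≤? ∣ F ∩ B ∣
      ... | yes h = inj₁ (((e , i , (linear (F ∷ A ∷ T ∷ C′ ∷ []) [] 0 (∥ s0 ⋒ (s1 ∖ s2) ≼ lit 0)
          (∥ s0 ⋒ ((s1 ∖ s2) ⋓ s3) ≼ lit 0 ∵ d ∙ []))) , h) ,
                      λ g → (impossible (linear (F ∷ C′ ∷ A ∷ T ∷ []) [] 0 (lit 1 ≼ lit 0)
                          (lit 1 ≼ ∥ s0 ⋒ s1 ∵ g ∙ ∥ s0 ⋒ ((s2 ∖ s3) ⋓ s1) ≼ lit 0 ∵ d ∙ []))))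
      ... | no ¬h = inj₂ (e , i , (linear (F ∷ A ∷ T ∷ B ∷ C′ ∷ []) [] 0
          (∥ s0 ⋒ ((s1 ∖ s2) ⋓ (s3 ⋓ s4)) ≼ lit 0) (∥ s0 ⋒ ((s1 ∖ s2) ⋓ s4) ≼ lit 0 ∵ d ∙
          ∥ s0 ⋒ s3 ≼ lit 0 ∵ s≤s⁻¹ (≰⇒> ¬h) ∙ [])))

    onT≤ : # onT? ≤ # both?
    onT≤ = #-mono onT? both? (λ F (e , i , h , g) → ((e , i) , h) , g)

    onAT≤ : # onAT? + (2 + l + w) C (2 + l) ≤ (6 + 2 * l + w) C (2 + l)
    onAT≤ = ≤-trans (+-monoʳ-≤ (# onAT?) (≤-reflexive
      (sym (#-avoids (A ∪ T) (B ∪ u) k (2 + l) (2 + l + w)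
        (linear (A ∷ T ∷ B ∷ u ∷ C′ ∷ []) [] 0 (∥ (s0 ⋓ s1) ⋒ (s2 ⋓ s3) ≼ lit 0)
            (∥ s1 ⋒ (s2 ⋓ s4) ≼ lit 0 ∵ T-BC ∙ ∥ s0 ⋒ s2 ≼ lit 0 ∵ A-B ∙ ∥ s0 ⋒ s4 ≼ lit 0 ∵ A-C ∙
            s3 ⋐ s4 ∵ u⊑C ∙ [])) (equation (A ∷ T ∷ []) (t ∷ l ∷ []) (x0 ⊕ (lit 3 ⊕ x1))
            (∥ s0 ⋓ s1 ⊕ (lit 2 ⊕ x1)) 0 (∥ s1 ≅˘ x0 ∵ ∣T∣ ∙ ∥ s0 ≅˘ x0 ∵ ∣A∣ ∙
            lit 1 ⊕ ∥ s1 ⋒ s0 ≅ x0 ∵ T∩A ∙ []) 0 (∥ s1 ≅ x0 ∵ ∣T∣ ∙ ∥ s0 ≅ x0 ∵ ∣A∣ ∙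
            lit 1 ⊕ ∥ s1 ⋒ s0 ≅˘ x0 ∵ T∩A ∙ []))
        (equation (A ∷ T ∷ B ∷ u ∷ C′ ∷ []) (n ∷ l ∷ w ∷ t ∷ []) (x0)
            (∥ s0 ⋓ s1 ⊕ ∥ s2 ⋓ s3 ⊕ (lit 2 ⊕ x1 ⊕ x2)) 0 (∥ s1 ≅˘ x3 ∵ ∣T∣ ∙ ∥ s0 ≅˘ x3 ∵ ∣A∣ ∙
            ∥ s2 ≅˘ lit 3 ⊕ x1 ∵ ∣B∣ ∙ ∥ s3 ≅˘ lit 1 ∵ ∣u∣ ∙ lit 1 ⊕ ∥ s1 ⋒ s0 ≅ x3 ∵ T∩A ∙
            ∥ s2 ⋒ s4 ≼ lit 0 ∵ B-C ∙ s3 ⋐ s4 ∵ u⊑C ∙ x0 ≅ x3 ⊕ (lit 7 ⊕ 2 ⊛ x1 ⊕ x2) ∵ n≡ ∙ []) 0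
            (∥ s1 ≅ x3 ∵ ∣T∣ ∙ ∥ s0 ≅ x3 ∵ ∣A∣ ∙ ∥ s2 ≅ lit 3 ⊕ x1 ∵ ∣B∣ ∙ ∥ s3 ≅ lit 1 ∵ ∣u∣ ∙
            lit 1 ⊕ ∥ s1 ⋒ s0 ≅˘ x3 ∵ T∩A ∙ x0 ≅˘ x3 ⊕ (lit 7 ⊕ 2 ⊛ x1 ⊕ x2) ∵ n≡ ∙ []))))))
      (≤-trans (+-mono-≤
          (#-mono onAT? (λ F → Contains? (A ∪ T) k F ×-dec (1 ≤? ∣ F ∩ (B ∪ u) ∣))
            (λ F (e , i , h) → (e , i) , h))
          (#-mono (Avoids? (A ∪ T) (B ∪ u) k) (λ F → Contains? (A ∪ T) k F ×-dec ¬?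
            (1 ≤? ∣ F ∩ (B ∪ u) ∣))
            (λ F (e , i , d) → (e , i) , λ h → <⇒≱ h d)))
        (≤-trans (≤-reflexive (sym (#-split (Contains? (A ∪ T) k) (λ F → 1 ≤? ∣ F ∩ (B ∪ u) ∣))))
          (#-contains (A ∪ T) k (2 + l) (6 + 2 * l + w) (equation (A ∷ T ∷ []) (t ∷ l ∷ [])
              (x0 ⊕ (lit 3 ⊕ x1)) (∥ s0 ⋓ s1 ⊕ (lit 2 ⊕ x1)) 0 (∥ s1 ≅˘ x0 ∵ ∣T∣ ∙
              ∥ s0 ≅˘ x0 ∵ ∣A∣ ∙ lit 1 ⊕ ∥ s1 ⋒ s0 ≅ x0 ∵ T∩A ∙ []) 0 (∥ s1 ≅ x0 ∵ ∣T∣ ∙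
              ∥ s0 ≅ x0 ∵ ∣A∣ ∙ lit 1 ⊕ ∥ s1 ⋒ s0 ≅˘ x0 ∵ T∩A ∙ []))
            (equation (A ∷ T ∷ []) (n ∷ l ∷ w ∷ t ∷ []) (x0) (∥ s0 ⋓ s1 ⊕ (lit 6 ⊕ 2 ⊛ x1 ⊕ x2)) 0
                (∥ s1 ≅˘ x3 ∵ ∣T∣ ∙ ∥ s0 ≅˘ x3 ∵ ∣A∣ ∙ lit 1 ⊕ ∥ s1 ⋒ s0 ≅ x3 ∵ T∩A ∙
                x0 ≅ x3 ⊕ (lit 7 ⊕ 2 ⊛ x1 ⊕ x2) ∵ n≡ ∙ []) 0 (∥ s1 ≅ x3 ∵ ∣T∣ ∙ ∥ s0 ≅ x3 ∵ ∣A∣ ∙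
                lit 1 ⊕ ∥ s1 ⋒ s0 ≅˘ x3 ∵ T∩A ∙ x0 ≅˘ x3 ⊕ (lit 7 ⊕ 2 ⊛ x1 ⊕ x2) ∵ n≡ ∙ [])))))

    exceptional≤3 : # exceptional? ≤ 3
    exceptional≤3 = ≤-trans (≤2 (_≟ˢ (A ∪ B)) (λ F → (F ≟ˢ (A ∪ C′)) ⊎-dec
      (F ≟ˢ ((T ∩ A) ∪ B ∪ u))))
      (+-mono-≤ (one (A ∪ B)) (≤-trans (≤2 (_≟ˢ (A ∪ C′)) (_≟ˢ ((T ∩ A) ∪ B ∪ u)))
        (+-mono-≤ (one (A ∪ C′)) (one ((T ∩ A) ∪ B ∪ u)))))
      where
      one : ∀ S → # (_≟ˢ S) ≤ 1
      one S = #≤1 (_≟ˢ S) (λ _ _ e e′ → trans e (sym e′))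

    -- Inclusion and exclusion over the sets above `T` that hit both `B` and `C′`, plus the sets
    -- above `A ∪ T` that hit `B ∪ u`. Two uses of Pascal's rule bring the sum into the shape of
    -- `f₁`, whose negative term stands on the left.
    count : # Family? + 3 * ((3 + l + w) C ℓ) ≤ (7 + 2 * l + w) C ℓ + (2 + l + w) C ℓ + w C ℓ + 3
    count = linear {n = 0} []
        ((# Family?) ∷ ((3 + l + w) C ℓ) ∷ ((7 + 2 * l + w) C ℓ) ∷ ((2 + l + w) C ℓ) ∷ (w C ℓ) ∷
          (# onT?) ∷ (# (λ F → onAT? F ⊎-dec exceptional? F)) ∷ (# onAT?) ∷ (# exceptional?) ∷
            ((2 + l + w) C (2 + l)) ∷ ((6 + 2 * l + w) C (2 + l)) ∷ (# both?) ∷ (# onlyB?) ∷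
              (# noB?) ∷ (# base?) ∷ ((6 + 2 * l + w) C ℓ) ∷ [])
        0 (x0 ⊕ 3 ⊛ x1 ≼ x2 ⊕ x3 ⊕ x4 ⊕ lit 3)
        (x0 ≼ x5 ⊕ x6 ∵ ≤2 onT? (λ F → onAT? F ⊎-dec exceptional? F) ∙
        x6 ≼ x7 ⊕ x8 ∵ ≤2 onAT? exceptional? ∙ x8 ≼ lit 3 ∵ exceptional≤3 ∙ x7 ⊕ x9 ≼ x10 ∵ onAT≤ ∙
        x5 ≼ x11 ∵ onT≤ ∙ x14 ≅˘ x11 ⊕ x12 ⊕ x13 ∵ splits ∙ x14 ≅ x15 ∵ base# ∙ x1 ≼ x13 ∵ noB≥ ∙
        x1 ≼ x12 ⊕ x4 ∵ onlyB≥ ∙ x2 ≅˘ x10 ⊕ x15 ∵ pascal (6 + 2 * l + w) (2 + l) ∙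
        x1 ≅ x9 ⊕ x3 ∵ pascal (2 + l + w) (2 + l) ∙ [])

  module II (M W : Subset n) (∣M∣ : ∣ M ∣ ≡ t + ℓ + 2) (W⊑M : W ⊑ M) (∣W∣ : ∣ W ∣ ≡ t + 2) where


    proper? : Decidable (λ F → ∣ F ∣ ≡ k × ∣ F ∩ W ∣ ≡ t + 1 × 1 ≤ ∣ F ∩ (M ─ W) ∣)
    proper? F = (∣ F ∣ ≟ k) ×-dec ((∣ F ∩ W ∣ ≟ t + 1) ×-dec (1 ≤? ∣ F ∩ (M ─ W) ∣))

    inner? : Decidable (λ F → ∣ F ∣ ≡ k × F ⊑ M × ∣ F ∩ W ∣ ≡ t)
    inner? F = (∣ F ∣ ≟ k) ×-dec ((F ⊑? M) ×-dec (∣ F ∩ W ∣ ≟ t))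

    Family? : Decidable (FamilyII k t M W)
    Family? F = Contains? W k F ⊎-dec (proper? F ⊎-dec inner? F)

    all few c : ℕ
    all = (5 + 2 * l + w) C (2 + l)
    few = (2 + l + w) C (2 + l)
    c   = all ∸ few

    few≤all : few ≤ all
    few≤all = C-mono (2 + l) (linear {n = 0} [] (l ∷ w ∷ []) 0
        (lit 2 ⊕ x0 ⊕ x1 ≼ lit 5 ⊕ 2 ⊛ x0 ⊕ x1) [])

    through? : ∀ x → Decidable (λ F → (∣ F ∣ ≡ k × (W ─ x) ⊑ F × ∣ F ∩ x ∣ ≤ 0) × 1 ≤ ∣ F ∩ (M ─ W)
      ∣)
    through? x F = Avoids? (W ─ x) x k F ×-dec (1 ≤? ∣ F ∩ (M ─ W) ∣)

    through≤ : ∀ x → Sub 1 W x → # (through? x) ≤ c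
    through≤ x (∣x∣ , i) = m+n≤o⇒m≤o∸n (# (through? x)) (≤-trans
      (+-monoʳ-≤ (# (through? x)) (≤-trans
        (≤-reflexive (sym (#-avoids (W ─ x) (x ∪ (M ─ W)) k (2 + l) (2 + l + w)
          (linear (W ∷ x ∷ M ∷ []) [] 0 (∥ (s0 ∖ s1) ⋒ (s1 ⋓ (s2 ∖ s0)) ≼ lit 0) []) (equation
              (W ∷ x ∷ []) (t ∷ l ∷ []) (x0 ⊕ (lit 3 ⊕ x1)) (∥ s0 ∖ s1 ⊕ (lit 2 ⊕ x1)) 0
              (∥ s1 ≅ lit 1 ∵ ∣x∣ ∙ ∥ s0 ≅˘ x0 ⊕ lit 2 ∵ ∣W∣ ∙ []) 0 (∥ s1 ≅˘ lit 1 ∵ ∣x∣ ∙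
              s1 ⋐ s0 ∵ i ∙ ∥ s0 ≅ x0 ⊕ lit 2 ∵ ∣W∣ ∙ []))
          (equation (W ∷ x ∷ M ∷ []) (n ∷ l ∷ w ∷ t ∷ []) (x0)
              (∥ s0 ∖ s1 ⊕ ∥ s1 ⋓ (s2 ∖ s0) ⊕ (lit 2 ⊕ x1 ⊕ x2)) 0
              (∥ s2 ≅˘ x3 ⊕ (lit 3 ⊕ x1) ⊕ lit 2 ∵ ∣M∣ ∙ x0 ≅ x3 ⊕ (lit 7 ⊕ 2 ⊛ x1 ⊕ x2) ∵ n≡ ∙ [])
              0 (s1 ⋐ s0 ∵ i ∙ ∥ s2 ≅ x3 ⊕ (lit 3 ⊕ x1) ⊕ lit 2 ∵ ∣M∣ ∙ s0 ⋐ s2 ∵ W⊑M ∙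
              x0 ≅˘ x3 ⊕ (lit 7 ⊕ 2 ⊛ x1 ⊕ x2) ∵ n≡ ∙ [])))))
        (#-mono (Avoids? (W ─ x) (x ∪ (M ─ W)) k) (λ F →
          Avoids? (W ─ x) x k F ×-dec ¬? (1 ≤? ∣ F ∩ (M ─ W) ∣))
          (λ F (e , j , d) → (e , j , (linear (F ∷ x ∷ M ∷ W ∷ []) [] 0 (∥ s0 ⋒ s1 ≼ lit 0)
              (∥ s0 ⋒ (s1 ⋓ (s2 ∖ s3)) ≼ lit 0 ∵ d ∙ []))) ,
            λ h → (impossible (linear (F ∷ M ∷ W ∷ x ∷ []) [] 0 (lit 1 ≼ lit 0)
                (lit 1 ≼ ∥ s0 ⋒ (s1 ∖ s2) ∵ h ∙ ∥ s0 ⋒ (s3 ⋓ (s1 ∖ s2)) ≼ lit 0 ∵ d ∙ [])))))))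
      (≤-reflexive (trans (sym (#-split (Avoids? (W ─ x) x k) (λ F → 1 ≤? ∣ F ∩ (M ─ W) ∣)))
        (#-avoids (W ─ x) x k (2 + l) (5 + 2 * l + w) (linear (W ∷ x ∷ []) [] 0
            (∥ (s0 ∖ s1) ⋒ s1 ≼ lit 0) [])
          (equation (W ∷ x ∷ []) (t ∷ l ∷ []) (x0 ⊕ (lit 3 ⊕ x1)) (∥ s0 ∖ s1 ⊕ (lit 2 ⊕ x1)) 0
              (∥ s1 ≅ lit 1 ∵ ∣x∣ ∙ ∥ s0 ≅˘ x0 ⊕ lit 2 ∵ ∣W∣ ∙ []) 0 (∥ s1 ≅˘ lit 1 ∵ ∣x∣ ∙
              s1 ⋐ s0 ∵ i ∙ ∥ s0 ≅ x0 ⊕ lit 2 ∵ ∣W∣ ∙ []))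
          (equation (W ∷ x ∷ []) (n ∷ l ∷ w ∷ t ∷ []) (x0)
              (∥ s0 ∖ s1 ⊕ ∥ s1 ⊕ (lit 5 ⊕ 2 ⊛ x1 ⊕ x2)) 0 (∥ s0 ≅˘ x3 ⊕ lit 2 ∵ ∣W∣ ∙
              x0 ≅ x3 ⊕ (lit 7 ⊕ 2 ⊛ x1 ⊕ x2) ∵ n≡ ∙ []) 0 (s1 ⋐ s0 ∵ i ∙ ∥ s0 ≅ x3 ⊕ lit 2 ∵ ∣W∣ ∙
              x0 ≅˘ x3 ⊕ (lit 7 ⊕ 2 ⊛ x1 ⊕ x2) ∵ n≡ ∙ []))))))

    proper≤ : # proper? ≤ (t + 2) * c
    proper≤ = ≤-trans
      (#-union proper? (Sub? 1 W) through? c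
        (λ F (e , m , h) → W ─ F , ((equation (W ∷ F ∷ []) (t ∷ []) (∥ s0 ∖ s1) (lit 1) 0
            (∥ s1 ⋒ s0 ≅˘ x0 ⊕ lit 1 ∵ m ∙ ∥ s0 ≅ x0 ⊕ lit 2 ∵ ∣W∣ ∙ []) 0
            (∥ s1 ⋒ s0 ≅ x0 ⊕ lit 1 ∵ m ∙ ∥ s0 ≅˘ x0 ⊕ lit 2 ∵ ∣W∣ ∙ [])) , (linear (W ∷ F ∷ []) []
            0 ((s0 ∖ s1) ⋐ s0) [])) ,
          (e , (linear (W ∷ F ∷ []) [] 0 ((s0 ∖ (s0 ∖ s1)) ⋐ s1) []) , (linear (F ∷ W ∷ []) [] 0
              (∥ s0 ⋒ (s1 ∖ s0) ≼ lit 0) [])) , h) through≤)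
      (≤-reflexive (cong (_* c) (trans (#-points W) ∣W∣)))

    inner≤ : # inner? ≤ (t + 2) C 2
    inner≤ = ≤-trans
      (#-union inner? (Sub? 2 W) (λ D F → inner? F ×-dec (∣ F ∩ D ∣ ≤? 0)) 1
        (λ F (e , i , m) → W ─ F , ((equation (W ∷ F ∷ []) (t ∷ []) (∥ s0 ∖ s1) (lit 2) 0
            (∥ s1 ⋒ s0 ≅˘ x0 ∵ m ∙ ∥ s0 ≅ x0 ⊕ lit 2 ∵ ∣W∣ ∙ []) 0 (∥ s1 ⋒ s0 ≅ x0 ∵ m ∙
            ∥ s0 ≅˘ x0 ⊕ lit 2 ∵ ∣W∣ ∙ [])) , (linear (W ∷ F ∷ []) [] 0 ((s0 ∖ s1) ⋐ s0) [])) ,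
          (e , i , m) , (linear (F ∷ W ∷ []) [] 0 (∥ s0 ⋒ (s1 ∖ s0) ≼ lit 0) []))
        (λ D (∣D∣ , j) → #≤1 (λ F → inner? F ×-dec (∣ F ∩ D ∣ ≤? 0))
          (λ F G (f , d) (g , d′) → trans (only D ∣D∣ j F f d) (sym (only D ∣D∣ j G g d′)))))
      (≤-reflexive (trans (*-identityʳ _) (trans (#-Sub W 2) (cong (_C 2) ∣W∣))))
      where
      -- `F` has `k` of the `k + 2` points of `M`, so the two points that it misses determine it.
      only : ∀ D → ∣ D ∣ ≡ 2 → D ⊑ W → ∀ F → ∣ F ∣ ≡ k × F ⊑ M × ∣ F ∩ W ∣ ≡ t → ∣ F ∩ D ∣ ≤ 0 →
        F ≡ M ─ D
      only D ∣D∣ j F (e , i , m) d = ⊑-antisym (linear (F ∷ M ∷ D ∷ []) [] 0 (s0 ⋐ (s1 ∖ s2))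
          (s0 ⋐ s1 ∵ i ∙ ∥ s0 ⋒ s2 ≼ lit 0 ∵ d ∙ []))
        (linear (M ∷ D ∷ F ∷ W ∷ []) (t ∷ l ∷ []) 0 ((s0 ∖ s1) ⋐ s2) (s2 ⋐ s0 ∵ i ∙
            ∥ s2 ⋒ s1 ≼ lit 0 ∵ d ∙ ∥ s2 ≅˘ x0 ⊕ (lit 3 ⊕ x1) ∵ e ∙ ∥ s1 ≅˘ lit 2 ∵ ∣D∣ ∙
            s1 ⋐ s3 ∵ j ∙ ∥ s0 ≅ x0 ⊕ (lit 3 ⊕ x1) ⊕ lit 2 ∵ ∣M∣ ∙ s3 ⋐ s0 ∵ W⊑M ∙ []))

    count : # Family? + (t + 2) * few ≤ (5 + 2 * l + w) C (1 + l) + (t + 2) * all + (t + 2) C 2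
    count = linear {n = 0} []
        ((# Family?) ∷ ((t + 2) * few) ∷ ((5 + 2 * l + w) C (1 + l)) ∷ ((t + 2) * all) ∷
          ((t + 2) C 2) ∷ (# (Contains? W k)) ∷ (# (λ F → proper? F ⊎-dec inner? F)) ∷ (# proper?) ∷
            (# inner?) ∷ ((t + 2) * c) ∷ [])
        0 (x0 ⊕ x1 ≼ x2 ⊕ x3 ⊕ x4)
        (x0 ≼ x5 ⊕ x6 ∵ ≤2 (Contains? W k) (λ F → proper? F ⊎-dec inner? F) ∙
        x6 ≼ x7 ⊕ x8 ∵ ≤2 proper? inner? ∙ x7 ≼ x9 ∵ proper≤ ∙ x8 ≼ x4 ∵ inner≤ ∙
        x5 ≼ x2 ∵ #-contains W k (1 + l) (5 + 2 * l + w) whole-k whole-n ∙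
        x9 ⊕ x1 ≅ x3 ∵ trans (sym (*-distribˡ-+ (t + 2) c few))
          (cong ((t + 2) *_) (m∸n+n≡m few≤all)) ∙
        [])
      where
      whole-k : k ≡ ∣ W ∣ + (1 + l)
      whole-k = equation (W ∷ []) (t ∷ l ∷ []) (x0 ⊕ (lit 3 ⊕ x1)) (∥ s0 ⊕ (lit 1 ⊕ x1)) 0
          (∥ s0 ≅˘ x0 ⊕ lit 2 ∵ ∣W∣ ∙ []) 0 (∥ s0 ≅ x0 ⊕ lit 2 ∵ ∣W∣ ∙ [])
      whole-n : n ≡ ∣ W ∣ + (5 + 2 * l + w)
      whole-n = equation (W ∷ []) (n ∷ l ∷ w ∷ t ∷ []) (x0) (∥ s0 ⊕ (lit 5 ⊕ 2 ⊛ x1 ⊕ x2)) 0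
          (∥ s0 ≅˘ x3 ⊕ lit 2 ∵ ∣W∣ ∙ x0 ≅ x3 ⊕ (lit 7 ⊕ 2 ⊛ x1 ⊕ x2) ∵ n≡ ∙ []) 0
          (∥ s0 ≅ x3 ⊕ lit 2 ∵ ∣W∣ ∙ x0 ≅˘ x3 ⊕ (lit 7 ⊕ 2 ⊛ x1 ⊕ x2) ∵ n≡ ∙ [])

  module III (Z : Subset n) (∣Z∣ : ∣ Z ∣ ≡ t + 4) where

    m : ℕ
    m = 3 + 2 * l + w

    Family? : Decidable (FamilyIII k t Z)
    Family? F = (∣ F ∣ ≟ k) ×-dec (t + 2 ≤? ∣ F ∩ Z ∣)

    Level? : ∀ s → Decidable (λ F → ∣ F ∣ ≡ k × ∣ F ∩ Z ∣ + s ≡ t + 4)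
    Level? s F = (∣ F ∣ ≟ k) ×-dec (∣ F ∩ Z ∣ + s ≟ t + 4)

    Level≤ : ∀ s j → s ≤ t + 4 → s + (3 + l) ≡ 4 + j → # (Level? s) ≤ ((t + 4) C s) * (m C j)
    Level≤ s j s≤ e = ≤-trans
      (#-union (Level? s) (Sub? s Z) (λ D → Avoids? (Z ─ D) D k) (m C j)
        (λ F (f , h) → Z ─ F , ((equation (Z ∷ F ∷ []) (s ∷ t ∷ []) (∥ s0 ∖ s1) (x0) 0
            (∥ s1 ⋒ s0 ⊕ x0 ≅˘ x1 ⊕ lit 4 ∵ h ∙ ∥ s0 ≅ x1 ⊕ lit 4 ∵ ∣Z∣ ∙ []) 0
            (∥ s1 ⋒ s0 ⊕ x0 ≅ x1 ⊕ lit 4 ∵ h ∙ ∥ s0 ≅˘ x1 ⊕ lit 4 ∵ ∣Z∣ ∙ [])) , (linear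
            (Z ∷ F ∷ []) [] 0 ((s0 ∖ s1) ⋐ s0) [])) ,
          f , (linear (Z ∷ F ∷ []) [] 0 ((s0 ∖ (s0 ∖ s1)) ⋐ s1) []) , (linear (F ∷ Z ∷ []) [] 0
              (∥ s0 ⋒ (s1 ∖ s0) ≼ lit 0) []))
        (λ D (∣D∣ , i) → ≤-reflexive (#-avoids (Z ─ D) D k j m (linear (Z ∷ D ∷ []) [] 0
            (∥ (s0 ∖ s1) ⋒ s1 ≼ lit 0) [])
          (equation (Z ∷ D ∷ []) (t ∷ l ∷ j ∷ s ∷ []) (x0 ⊕ (lit 3 ⊕ x1)) (∥ s0 ∖ s1 ⊕ x2) 0
              (x3 ⊕ (lit 3 ⊕ x1) ≅ lit 4 ⊕ x2 ∵ e ∙ ∥ s1 ≅ x3 ∵ ∣D∣ ∙ ∥ s0 ≅˘ x0 ⊕ lit 4 ∵ ∣Z∣ ∙ [])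
              0 (x3 ⊕ (lit 3 ⊕ x1) ≅˘ lit 4 ⊕ x2 ∵ e ∙ ∥ s1 ≅˘ x3 ∵ ∣D∣ ∙ s1 ⋐ s0 ∵ i ∙
              ∥ s0 ≅ x0 ⊕ lit 4 ∵ ∣Z∣ ∙ []))
          (equation (Z ∷ D ∷ []) (n ∷ l ∷ w ∷ t ∷ []) (x0)
              (∥ s0 ∖ s1 ⊕ ∥ s1 ⊕ (lit 3 ⊕ 2 ⊛ x1 ⊕ x2)) 0 (∥ s0 ≅˘ x3 ⊕ lit 4 ∵ ∣Z∣ ∙
              x0 ≅ x3 ⊕ (lit 7 ⊕ 2 ⊛ x1 ⊕ x2) ∵ n≡ ∙ []) 0 (s1 ⋐ s0 ∵ i ∙ ∥ s0 ≅ x3 ⊕ lit 4 ∵ ∣Z∣ ∙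
              x0 ≅˘ x3 ⊕ (lit 7 ⊕ 2 ⊛ x1 ⊕ x2) ∵ n≡ ∙ [])))))
      (≤-reflexive (cong (_* (m C j)) (trans (#-Sub Z s) (cong (_C s) ∣Z∣))))

    top≤ : # (Level? 0) ≤ top l m
    top≤ = go l refl
      where
      go : ∀ l′ → l′ ≡ l → # (Level? 0) ≤ top l′ m
      go zero    refl = ≤-reflexive (#-none (Level? 0) (λ F (e , h) → (impossible (linear
          (F ∷ Z ∷ []) (t ∷ []) 0 (lit 1 ≼ lit 0) (∥ s0 ≅ x0 ⊕ lit 3 ∵ e ∙
          ∥ s0 ⋒ s1 ⊕ lit 0 ≅˘ x0 ⊕ lit 4 ∵ h ∙ [])))))
      go (suc j) refl = ≤-trans (Level≤ 0 j z≤n refl) (≤-reflexive (*-identityˡ (m C j)))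

    count : # Family? ≤ ((t + 4) C 2) * (m C (1 + l)) + (t + 4) * (m C l) + top l m
    count = ≤-trans (#-∪ Family? (Level? 2) Upper? cases)
      (≤-trans (+-mono-≤ (Level≤ 2 (1 + l) (linear
        {n = 0} [] (t ∷ []) 0 (lit 2 ≼ x0 ⊕ lit 4) []) refl)
        (≤-trans (≤2 (Level? 1) (Level? 0)) (+-mono-≤ (≤-trans (Level≤ 1 l (linear {n = 0} []
            (t ∷ []) 0 (lit 1 ≼ x0 ⊕ lit 4) []) refl)
              (≤-reflexive (cong (_* (m C l)) (nC1≡n (t + 4))))) top≤)))
        (≤-reflexive (sym (+-assoc (((t + 4) C 2) * (m C (1 + l))) _ _))))
      where
      Upper? : Decidable (λ F → (∣ F ∣ ≡ k × ∣ F ∩ Z ∣ + 1 ≡ t + 4)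
        ⊎ (∣ F ∣ ≡ k × ∣ F ∩ Z ∣ + 0 ≡ t + 4))
      Upper? F = Level? 1 F ⊎-dec Level? 0 F
      cases : ∀ F → FamilyIII k t Z F → (∣ F ∣ ≡ k × ∣ F ∩ Z ∣ + 2 ≡ t + 4)
        ⊎ (∣ F ∣ ≡ k × ∣ F ∩ Z ∣ + 1 ≡ t + 4) ⊎ (∣ F ∣ ≡ k × ∣ F ∩ Z ∣ + 0 ≡ t + 4)
      cases F (e , h) with ∣ F ∩ Z ∣ + 2 ≟ t + 4 | ∣ F ∩ Z ∣ + 1 ≟ t + 4
      ... | yes p | _     = inj₁ (e , p)
      ... | no _  | yes p = inj₂ (inj₁ (e , p))
      ... | no p  | no q  =
        let h₁ = ≤∧≢⇒< (linear (F ∷ Z ∷ []) (t ∷ []) 0 (x0 ⊕ lit 4 ≼ ∥ s0 ⋒ s1 ⊕ lit 2)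
              (x0 ⊕ lit 2 ≼ ∥ s0 ⋒ s1 ∵ h ∙ [])) (p ∘ sym)
            h₂ = ≤∧≢⇒< (linear (F ∷ Z ∷ []) (t ∷ []) 0 (x0 ⊕ lit 4 ≼ ∥ s0 ⋒ s1 ⊕ lit 1)
                (lit 1 ⊕ (x0 ⊕ lit 4) ≼ ∥ s0 ⋒ s1 ⊕ lit 2 ∵ h₁ ∙ [])) (q ∘ sym)
        in inj₂ (inj₂ (e , (equation (F ∷ Z ∷ []) (t ∷ []) (∥ s0 ⋒ s1 ⊕ lit 0) (x0 ⊕ lit 4) 0
            (∥ s1 ≅ x0 ⊕ lit 4 ∵ ∣Z∣ ∙ []) 0 (lit 1 ⊕ (x0 ⊕ lit 4) ≼ ∥ s0 ⋒ s1 ⊕ lit 1 ∵ h₂ ∙ []))))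

-- Estimates of binomial coefficients

absorption : ∀ m r → suc r * (suc m C suc r) ≡ suc m * (m C r)
absorption zero    zero    = refl
absorption zero    (suc r) = trans (cong (suc (suc r) *_) (pascal 0 (suc r)))
  (*-zeroʳ (suc (suc r)))
absorption (suc m) zero    = trans (*-identityˡ _) (trans (nC1≡n (suc (suc m)))
  (sym (*-identityʳ (suc (suc m)))))
absorption (suc m) (suc r) = begin
  suc (suc r) * (suc (suc m) C suc (suc r))
    ≡⟨ cong (suc (suc r) *_) (pascal (suc m) (suc r)) ⟩
  suc (suc r) * (x + y)
    ≡⟨ *-distribˡ-+ (suc (suc r)) x y ⟩
  (x + suc r * x) + suc (suc r) * y
    ≡⟨ cong₂ (λ a b → (x + a) + b) (absorption m r) (absorption m (suc r)) ⟩
  (x + suc m * (m C r)) + suc m * (m C suc r)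
    ≡⟨ +-assoc x _ _ ⟩
  x + (suc m * (m C r) + suc m * (m C suc r))
    ≡⟨ cong (x +_) (sym (*-distribˡ-+ (suc m) (m C r) (m C suc r))) ⟩
  x + suc m * (m C r + m C suc r)
    ≡⟨ cong (λ z → x + suc m * z) (sym (pascal m r)) ⟩
  x + suc m * x ∎
  where
  open ≡-Reasoning
  x = suc m C suc r
  y = suc m C suc (suc r)

-- The difference of binomials counts the sets of size s + 1 that hit an `r`-set; those with exactly
-- one point in it number `r * (m C s)`.
difference : ∀ r m s → r * (m C s) + m C suc s ≤ (r + m) C suc s
difference zero    m s = ≤-refl
difference (suc r) m s = begin
  m C s + r * (m C s) + m C suc s   ≡⟨ +-assoc (m C s) _ _ ⟩
  m C s + (r * (m C s) + m C suc s) ≤⟨ +-mono-≤ (C-mono s (m≤n+m m r)) (difference r m s) ⟩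
  (r + m) C s + (r + m) C suc s     ≡⟨ sym (pascal (r + m) s) ⟩
  suc (r + m) C suc s               ∎
  where open ≤-Reasoning

-- Each of the `r` steps of Pascal's rule adds a binomial with upper index at most `K`.
difference-upper : ∀ r m s K → r + m ≤ suc K → (r + m) C suc s ≤ m C suc s + r * (K C s)
difference-upper zero    m s K h = m≤m+n _ _
difference-upper (suc r) m s K h = begin
  suc (r + m) C suc s               ≡⟨ pascal (r + m) s ⟩
  (r + m) C s + (r + m) C suc s     ≤⟨ +-mono-≤ (C-mono s (s≤s⁻¹ h))
    (difference-upper r m s K (m≤n⇒m≤1+n (s≤s⁻¹ h))) ⟩
  K C s + (m C suc s + r * (K C s)) ≡⟨ (equation {n = 0} []
      ((K C s) ∷ (m C suc s) ∷ (r * (K C s)) ∷ []) (x0 ⊕ (x1 ⊕ x2)) (x1 ⊕ (x0 ⊕ x2)) 0 [] 0 []) ⟩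
  m C suc s + (K C s + r * (K C s)) ∎
  where open ≤-Reasoning

-- The alternating sum counts the sets of size s + 2 that hit both an `r`-set and a disjoint
-- `q`-set; the left product counts those with exactly one point in each.
second-difference : ∀ r q m s → r * (q * (m C s)) + ((q + m) C suc (suc s) + (r + m) C suc (suc s))
  ≤ (r + (q + m)) C suc (suc s) + m C suc (suc s)
second-difference zero    q m s = ≤-refl
second-difference (suc r) q m s =
  (linear {n = 0} []
      ((q * (m C s)) ∷ (r * (q * (m C s))) ∷ ((q + m) C suc (suc s)) ∷ (suc (r + m) C suc (suc s)) ∷
        (suc (r + (q + m)) C suc (suc s)) ∷ (m C suc (suc s)) ∷ ((r + m) C suc (suc s)) ∷
          ((r + (q + m)) C suc (suc s)) ∷ ((r + m) C suc s) ∷ ((r + (q + m)) C suc s) ∷ [])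
      0 (x0 ⊕ x1 ⊕ (x2 ⊕ x3) ≼ x4 ⊕ x5) (x1 ⊕ (x2 ⊕ x6) ≼ x7 ⊕ x5 ∵ second-difference r q m s ∙
      x3 ≅ x8 ⊕ x6 ∵ pascal (r + m) (suc s) ∙ x4 ≅˘ x9 ⊕ x7 ∵ pascal (r + (q + m)) (suc s) ∙
      x0 ⊕ x8 ≼ x9 ∵ step ∙ []))
  where
  step : q * (m C s) + (r + m) C suc s ≤ (r + (q + m)) C suc s
  step = ≤-trans (+-monoˡ-≤ _ (*-monoʳ-≤ q (C-mono s (m≤n+m m r))))
    (≤-trans (difference q (r + m) s)
    (≤-reflexive (cong (_C suc s) (equation {n = 0} [] (q ∷ r ∷ m ∷ []) (x0 ⊕ (x1 ⊕ x2))
        (x1 ⊕ (x0 ⊕ x2)) 0 [] 0 []))))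

module Polynomials (l : ℕ) where

  q r Q : ℕ
  q = 4 + l
  r = q * (q * q)
  Q = q * r

  private
    -- The witnesses `d` below are the differences of the polynomials in `l`. All their coefficients
    -- are nonnegative, so each inequality reduces to a ring identity.
    bounded : ∀ {x d y} → x + d ≡ y → x ≤ y
    bounded {x} {d} e = ≤-trans (m≤m+n x d) (≤-reflexive e)

  poly₁ : (1 + l) * (((3 + l) * (3 + l) + (3 + l) + 1) * (5 + 2 * l)) ≤ 2 * Q
  poly₁ = bounded {d = 447 + 386 * l + 112 * (l * l) + 11 * (l * (l * l))}
    {2 * ((4 + l) * ((4 + l) * ((4 + l) * (4 + l))))} (Ring.solve (l List.∷ List.[]))

  poly₂ : (1 + l) * ((5 + 2 * l) * (4 + l)) + 2 ≤ Q
  poly₂ = bounded {d = 234 + 223 * l + 81 * (l * l) + 14 * (l * (l * l)) + l * (l * (l * l))}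
    {((4 + l) * ((4 + l) * ((4 + l) * (4 + l))))} (Ring.solve (l List.∷ List.[]))

  poly₃ : 4 * ((1 + l) * (5 + 2 * l)) ≤ 3 * r
  poly₃ = bounded {d = 172 + 116 * l + 28 * (l * l) + 3 * (l * (l * l))}
    {3 * ((4 + l) * ((4 + l) * (4 + l)))} (Ring.solve (l List.∷ List.[]))

  poly₄ : (1 + l) * (5 + 2 * l) ≤ Q
  poly₄ = bounded {d = 251 + 249 * l + 94 * (l * l) + 16 * (l * (l * l)) + l * (l * (l * l))}
    {((4 + l) * ((4 + l) * ((4 + l) * (4 + l))))} (Ring.solve (l List.∷ List.[]))

  poly₅ : (3 + l) * (4 + l) + 1 ≤ q * q
  poly₅ = bounded {d = 3 + l} {(4 + l) * (4 + l)} (Ring.solve (l List.∷ List.[]))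

  q⁴ : q ^ 4 ≡ Q
  q⁴ = cong (λ z → q * (q * (q * z))) (*-identityʳ q)

  4≤q : 4 ≤ q
  4≤q = m≤m+n 4 l

  4≤r : 4 ≤ r
  4≤r = ≤-trans 4≤q (m≤m*n q (q * q))

  4≤Q : 4 ≤ Q
  4≤Q = ≤-trans 4≤r (m≤n*m r q)

  4*≤ : ∀ u {y} → 4 ≤ y → 4 * u ≤ u * y
  4*≤ u h = ≤-trans (≤-reflexive (*-comm 4 u)) (*-monoʳ-≤ u h)

  -- Since `q` is (1 + l) + 3, the error term takes 1 + l of the `q` shares in `c * Q`, and three
  -- shares remain.
  split-r : ∀ c → (1 + l) * (c * r) + 3 * (c * r) ≡ c * Q
  split-r c = trans (sym (*-distribʳ-+ (c * r) (1 + l) 3)) (trans (sym (*-assoc (1 + l + 3) c r))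
    (trans (cong (_* r) (*-comm (1 + l + 3) c)) (trans (*-assoc c (1 + l + 3) r)
      (cong (λ z → c * (z * r)) (equation
        {n = 0} [] (l ∷ []) (lit 1 ⊕ x0 ⊕ lit 3) (lit 4 ⊕ x0) 0 [] 0 [])))))

module Estimates (t l w : ℕ) (1≤t : 1 ≤ t) (big : ((t + 3) C 2) * (4 + l) ^ 4 ≤ t + (7 + 2 * l + w))
  where

  open Polynomials l public
  open Thresholds t (3 + l) 1≤t (m≤m+n 3 l) public

  -- `X` is n - t - 2. The `k`-sets above a set of size t + 2 number `b₂`, those above a set of size
  -- t + 3 number `b₃`, and `c` is the number of `t`-subsets of a cover. `e` approximates `b₂` from
  -- below, up to the multiple of `b₃` in `b₂≤`.
  ℓ c X b₂ b₃ e : ℕ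
  ℓ  = 3 + l
  c  = (t + 2) C 2
  X  = 5 + 2 * l + w
  b₂ = X C (1 + l)
  b₃ = (4 + 2 * l + w) C l
  e  = w C (1 + l)

  C-t+3 : (t + 3) C 2 ≡ c + (t + 2)
  C-t+3 = trans (cong (_C 2) (+-suc t 2)) (trans (C2-suc (t + 2)) (+-comm (t + 2) c))

  big′ : (c + (t + 2)) * Q ≤ t + (2 + X)
  big′ = ≤-trans (≤-reflexive (sym (cong₂ _*_ C-t+3 q⁴))) big

  expand : (c + (t + 2)) * Q ≡ c * Q + t * Q + 2 * Q
  expand = trans (*-distribʳ-+ Q c (t + 2)) (trans (cong (c * Q +_) (*-distribʳ-+ Q t 2))
    (sym (+-assoc (c * Q) (t * Q) (2 * Q))))

  3t≤c : 3 * t ≤ c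
  3t≤c = +-cancelʳ-≤ 3 (3 * t) c (≤-trans (≤-reflexive (trans (+-comm (3 * t) 3) (sym (*-suc 3 t))))
    (≤-trans (tangent 3 (suc t)) (≤-reflexive (cong (λ z → z C 2 + 3) (sym (+-suc t 1))))))


  -- By absorption `b₂` is X / (1 + l) times `b₃`. So `Gap` says that one cover, worth `b₂`,
  -- outweighs both the loss `N * (5 + 2 * l)` times `b₃` in the lower estimate of fᵢ and the error
  -- term `c * r` times `b₃` in the upper bound.
  Gap : ℕ → Set
  Gap N = (1 + l) * (N * (5 + 2 * l) + c * r) < X

  private
    unfold : ∀ N → (1 + l) * (N * (5 + 2 * l) + c * r) ≡ (1 + l) * (N * (5 + 2 * l)) + (1 + l) *
      (c * r)
    unfold N = *-distribˡ-+ (1 + l) (N * (5 + 2 * l)) (c * r)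

  gap₁ : Gap N₁
  gap₁ = linear {n = 0} []
      (((1 + l) * (N₁ * (5 + 2 * l) + c * r)) ∷ X ∷ ((1 + l) * (N₁ * (5 + 2 * l))) ∷
        ((1 + l) * (c * r)) ∷ Q ∷ (c * r) ∷ (c * Q) ∷ ((c + (t + 2)) * Q) ∷ t ∷ (t * Q) ∷ [])
      0 (lit 1 ⊕ x0 ≼ x1) (x0 ≅ x2 ⊕ x3 ∵ unfold N₁ ∙ x2 ≼ 2 ⊛ x4 ∵ poly₁ ∙
      x3 ⊕ 3 ⊛ x5 ≅ x6 ∵ split-r c ∙ x7 ≼ x8 ⊕ (lit 2 ⊕ x1) ∵ big′ ∙
      x7 ≅˘ x6 ⊕ x9 ⊕ 2 ⊛ x4 ∵ expand ∙ 4 ⊛ x8 ≼ x9 ∵ 4*≤ t 4≤Q ∙ 3 ⟪ lit 1 ≼ x8 ∵ 1≤t ⟫ [])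

  gap₂ : Gap N₂
  gap₂ = linear {n = 0} []
      (((1 + l) * (N₂ * (5 + 2 * l) + c * r)) ∷ X ∷ ((1 + l) * (N₂ * (5 + 2 * l))) ∷
        ((1 + l) * (c * r)) ∷ ((t + 2) * p) ∷ ((t + 2) * (p + 2)) ∷ ((t + 2) * Q) ∷ ((t + 2) * 2) ∷
          t ∷ (t * Q) ∷ Q ∷ (c * r) ∷ (c * Q) ∷ ((c + (t + 2)) * Q) ∷ [])
      3 (lit 1 ⊕ x0 ≼ x1) (4 ⟪ x0 ≅ x2 ⊕ x3 ∵ unfold N₂ ⟫ 4 ⟪ x2 ≼ x4 ∵ main ⟫
      4 ⟪ x5 ≼ x6 ∵ *-monoʳ-≤ (t + 2) poly₂ ⟫ 4 ⟪ x5 ≅˘ x4 ⊕ x7 ∵ *-distribˡ-+ (t + 2) p 2 ⟫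
      3 ⟪ x7 ≅˘ 2 ⊛ (x8 ⊕ lit 2) ∵ *-comm (t + 2) 2 ⟫ 4 ⟪ x6 ≅ x9 ⊕ 2 ⊛ x10 ∵ *-distribʳ-+ Q t 2 ⟫
      4 ⟪ x3 ⊕ 3 ⊛ x11 ≅ x12 ∵ split-r c ⟫ 4 ⟪ x13 ≼ x8 ⊕ (lit 2 ⊕ x1) ∵ big′ ⟫
      4 ⟪ x13 ≅˘ x12 ⊕ x9 ⊕ 2 ⊛ x10 ∵ expand ⟫ [])
    where
    p = (1 + l) * ((5 + 2 * l) * (4 + l))
    N₂≤ : N₂ ≤ (t + 2) * (4 + l)
    N₂≤ = linear {n = 0} [] (((t + 2) * ℓ) ∷ ((t + 2) * (4 + l)) ∷ t ∷ []) 0 (x0 ⊕ lit 1 ≼ x1)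
        (x1 ≅˘ x2 ⊕ lit 2 ⊕ x0 ∵ *-suc (t + 2) ℓ ∙ [])
    main : (1 + l) * (N₂ * (5 + 2 * l)) ≤ (t + 2) * p
    regroup : ∀ l u → (1 + l) * ((u * (4 + l)) * (5 + 2 * l)) ≡ u *
      ((1 + l) * ((5 + 2 * l) * (4 + l)))
    regroup = Ring.solve-∀
    main = ≤-trans (*-monoʳ-≤ (1 + l) (*-monoˡ-≤ (5 + 2 * l) N₂≤)) (≤-reflexive (regroup l (t + 2)))

  N₃≤4c : N₃ ≤ 4 * c
  N₃≤4c = linear {n = 0} [] (((t + 4) C 2) ∷ c ∷ t ∷ ((t + 3) C 2) ∷ []) 2 (x0 ≼ 4 ⊛ x1)
      (3 ⟪ x0 ≅ x2 ⊕ lit 3 ⊕ x3 ∵ trans (cong (_C 2) (+-suc t 3)) (C2-suc (t + 3)) ⟫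
      3 ⟪ x3 ≅ x1 ⊕ (x2 ⊕ lit 2) ∵ C-t+3 ⟫ 7 ⟪ 3 ⊛ x2 ≼ x1 ∵ 3t≤c ⟫ 15 ⟪ lit 1 ≼ x2 ∵ 1≤t ⟫ [])

  c≤N₃ : c ≤ N₃
  c≤N₃ = C-mono 2 (+-monoʳ-≤ t (s≤s (s≤s z≤n)))

  gap₃ : Gap N₃
  gap₃ = linear {n = 0} []
      (((1 + l) * (N₃ * (5 + 2 * l) + c * r)) ∷ X ∷ ((1 + l) * (N₃ * (5 + 2 * l))) ∷
        ((1 + l) * (c * r)) ∷ (c * (3 * r)) ∷ (c * r) ∷ (c * Q) ∷ ((c + (t + 2)) * Q) ∷ t ∷ (t * Q)
          ∷ Q ∷ [])
      3 (lit 1 ⊕ x0 ≼ x1) (4 ⟪ x0 ≅ x2 ⊕ x3 ∵ unfold N₃ ⟫ 4 ⟪ x2 ≼ x4 ∵ main ⟫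
      4 ⟪ x4 ≅ 3 ⊛ x5 ∵ shuffle c r ⟫ 4 ⟪ x3 ⊕ 3 ⊛ x5 ≅ x6 ∵ split-r c ⟫
      4 ⟪ x7 ≼ x8 ⊕ (lit 2 ⊕ x1) ∵ big′ ⟫ 4 ⟪ x7 ≅˘ x6 ⊕ x9 ⊕ 2 ⊛ x10 ∵ expand ⟫
      4 ⊛ x8 ≼ x9 ∵ 4*≤ t 4≤Q ∙ 3 ⟪ lit 4 ≼ x10 ∵ 4≤Q ⟫ [])
    where
    shuffle : ∀ a b → a * (3 * b) ≡ 3 * (a * b)
    shuffle = Ring.solve-∀
    regroup : ∀ l a → (1 + l) * ((4 * a) * (5 + 2 * l)) ≡ a * (4 * ((1 + l) * (5 + 2 * l)))
    regroup = Ring.solve-∀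
    main : (1 + l) * (N₃ * (5 + 2 * l)) ≤ c * (3 * r)
    -- The three shares left over by `split-r` accommodate this term, by `poly₃`.
    main = ≤-trans (*-monoʳ-≤ (1 + l) (*-monoˡ-≤ (5 + 2 * l) N₃≤4c))
      (≤-trans (≤-reflexive (regroup l c)) (*-monoʳ-≤ c poly₃))

  1≤b₃ : 1 ≤ b₃
  1≤b₃ = ≤-trans (≤-reflexive (sym (nCn≡1 l))) (C-mono l (linear {n = 0} [] (l ∷ w ∷ []) 0
      (x0 ≼ lit 4 ⊕ 2 ⊛ x0 ⊕ x1) []))

  scale : ∀ Y → (1 + l) * Y < X → Y * b₃ < b₂
  scale Y h = *-cancelˡ-< (1 + l) (Y * b₃) b₂ (≤-trans
    (≤-trans (≤-reflexive (cong suc (sym (*-assoc (1 + l) Y b₃))))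
      (*-monoˡ-< b₃ {{>-nonZero 1≤b₃}} h))
    (≤-reflexive (sym (absorption (4 + 2 * l + w) l))))

  error : ℕ
  error = c * (q * (q * (q * b₃)))

  gap-scaled : ∀ N → Gap N → N * ((5 + 2 * l) * b₃) + error < b₂
  gap-scaled N g = ≤-trans (s≤s (≤-reflexive (regroup N (5 + 2 * l) c q b₃)))
    (scale (N * (5 + 2 * l) + c * r) g)
    where
    regroup : ∀ N a c q b → N * (a * b) + c * (q * (q * (q * b))) ≡ (N * a + c * (q * (q * q))) * b
    regroup = Ring.solve-∀

  b₂≤ : b₂ ≤ e + (5 + 2 * l) * b₃
  b₂≤ = difference-upper (5 + 2 * l) w l (4 + 2 * l + w) ≤-refl

  m : ℕ
  m = 3 + 2 * l + w

  P₁ Q₁ P₂ Q₂ P₃ : ℕ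
  P₁ = (7 + 2 * l + w) C ℓ + (2 + l + w) C ℓ + w C ℓ + 3
  Q₁ = 3 * ((3 + l + w) C ℓ)
  P₂ = b₂ + (t + 2) * (X C (2 + l)) + (t + 2) C 2
  Q₂ = (t + 2) * ((2 + l + w) C (2 + l))
  P₃ = N₃ * (m C (1 + l)) + (t + 4) * (m C l) + top l m

  -- The summand `ℓ * ℓ` of `N₁` is matched by `second-difference` with the sets that hit both `B`
  -- and `C′`, and the remaining `ℓ + 1` by `difference` with those above `A ∪ T` that hit `B ∪ u`.
  lower₁ : N₁ * b₂ + Q₁ ≤ P₁ + N₁ * ((5 + 2 * l) * b₃)
  lower₁ = linear {n = 0} []
      ((N₁ * b₂) ∷ ((3 + l + w) C ℓ) ∷ ((7 + 2 * l + w) C ℓ) ∷ ((2 + l + w) C ℓ) ∷ (w C ℓ) ∷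
        (N₁ * ((5 + 2 * l) * b₃)) ∷ (N₁ * (e + (5 + 2 * l) * b₃)) ∷ (N₁ * e) ∷ (ℓ * (ℓ * e)) ∷
          ((4 + l) * e) ∷ ((ℓ + (ℓ + w)) C ℓ) ∷ ((6 + 2 * l + w) C ℓ) ∷ ((6 + 2 * l + w) C (2 + l))
            ∷ ((2 + l + w) C (2 + l)) ∷ ((4 + l) * ((2 + l + w) C (1 + l))) ∷
              ((4 + l + (2 + l + w)) C (2 + l)) ∷ [])
      0 (x0 ⊕ 3 ⊛ x1 ≼ x2 ⊕ x3 ⊕ x4 ⊕ lit 3 ⊕ x5) (x0 ≼ x6 ∵ *-monoʳ-≤ N₁ b₂≤ ∙
      x6 ≅ x7 ⊕ x5 ∵ *-distribˡ-+ N₁ e ((5 + 2 * l) * b₃) ∙ x7 ≅ x8 ⊕ x9 ∵ regroup ℓ e ∙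
      x8 ⊕ (x1 ⊕ x1) ≼ x10 ⊕ x4 ∵ second-difference ℓ ℓ w (1 + l) ∙ x10 ≅ x11 ∵ cong (_C ℓ) top₁ ∙
      x2 ≅˘ x12 ⊕ x11 ∵ pascal (6 + 2 * l + w) (2 + l) ∙
      x1 ≅ x13 ⊕ x3 ∵ pascal (2 + l + w) (2 + l) ∙
      x9 ≼ x14 ∵ *-monoʳ-≤ (4 + l) (C-mono (1 + l) (m≤n+m w (2 + l))) ∙
      x14 ⊕ x13 ≼ x15 ∵ difference (4 + l) (2 + l + w) (1 + l) ∙
      x15 ≅ x12 ∵ cong (_C (2 + l)) top₂ ∙ [])
    where
    regroup : ∀ a e → (a * a + a + 1) * e ≡ a * (a * e) + (1 + a) * e
    regroup = Ring.solve-∀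
    top₁ : ℓ + (ℓ + w) ≡ 6 + 2 * l + w
    top₁ = equation {n = 0} [] (l ∷ w ∷ []) (lit 3 ⊕ x0 ⊕ (lit 3 ⊕ x0 ⊕ x1)) (lit 6 ⊕ 2 ⊛ x0 ⊕ x1) 0
        [] 0 []
    top₂ : 4 + l + (2 + l + w) ≡ 6 + 2 * l + w
    top₂ = equation {n = 0} [] (l ∷ w ∷ []) (lit 4 ⊕ x0 ⊕ (lit 2 ⊕ x0 ⊕ x1)) (lit 6 ⊕ 2 ⊛ x0 ⊕ x1) 0
        [] 0 []

  lower₂ : N₂ * b₂ + Q₂ ≤ P₂ + N₂ * ((5 + 2 * l) * b₃)
  lower₂ = linear {n = 0} []
      ((N₂ * b₂) ∷ ((t + 2) * ((2 + l + w) C (2 + l))) ∷ b₂ ∷ ((t + 2) * (X C (2 + l))) ∷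
        ((t + 2) C 2) ∷ (N₂ * ((5 + 2 * l) * b₃)) ∷ ((t + 2) * (ℓ * b₂)) ∷ ((t + 2) * (ℓ * (e + d)))
          ∷ ((t + 2) * (ℓ * e)) ∷ ((t + 2) * (ℓ * d)) ∷ d ∷
            ((t + 2) * (ℓ * e + (2 + l + w) C (2 + l))) ∷ [])
      0 (x0 ⊕ x1 ≼ x2 ⊕ x3 ⊕ x4 ⊕ x5) (x0 ≅ x6 ⊕ x2 ∵ regroup (t + 2) ℓ b₂ ∙
      x6 ≼ x7 ∵ *-monoʳ-≤ (t + 2) (*-monoʳ-≤ ℓ b₂≤) ∙ x7 ≅ x8 ⊕ x9 ∵ regroup′ (t + 2) ℓ e d ∙
      x5 ≅˘ x9 ⊕ x10 ∵ regroup (t + 2) ℓ d ∙ x11 ≼ x3 ∵ *-monoʳ-≤ (t + 2) diff ∙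
      x11 ≅˘ x8 ⊕ x1 ∵ *-distribˡ-+ (t + 2) (ℓ * e) ((2 + l + w) C (2 + l)) ∙ [])
    where
    d = (5 + 2 * l) * b₃
    regroup : ∀ u a b → (u * a + 1) * b ≡ u * (a * b) + b
    regroup = Ring.solve-∀
    regroup′ : ∀ u a x y → u * (a * (x + y)) ≡ u * (a * x) + u * (a * y)
    regroup′ = Ring.solve-∀
    diff : ℓ * e + (2 + l + w) C (2 + l) ≤ X C (2 + l)
    diff = ≤-trans (+-monoˡ-≤ _ (*-monoʳ-≤ ℓ (C-mono (1 + l) (m≤n+m w (2 + l)))))
      (≤-trans (difference ℓ (2 + l + w) (1 + l))
      (≤-reflexive (cong (_C (2 + l)) (equation {n = 0} [] (l ∷ w ∷ [])
          (lit 3 ⊕ x0 ⊕ (lit 2 ⊕ x0 ⊕ x1)) (lit 5 ⊕ 2 ⊛ x0 ⊕ x1) 0 [] 0 []))))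

  lower₃ : N₃ * b₂ ≤ P₃ + N₃ * ((5 + 2 * l) * b₃)
  lower₃ = ≤-trans (*-monoʳ-≤ N₃ (≤-trans b₂≤ (+-monoˡ-≤ _ (C-mono (1 + l) (m≤n+m w (3 + 2 * l))))))
    (≤-trans (≤-reflexive (*-distribˡ-+ N₃ (m C (1 + l)) ((5 + 2 * l) * b₃)))
      (+-monoˡ-≤ _ (≤-trans (m≤m+n _ _) (≤-reflexive (sym (+-assoc (N₃ * (m C (1 + l))) _ _))))))

  -- As `s` is at most N - 1, a whole `b₂` is left to absorb `error` and the loss in the lower
  -- estimate. The value fᵢ is `P` minus `Q′`, kept as two natural numbers.
  below : ∀ {N s f P Q′} → s < N → Gap N → N * b₂ + Q′ ≤ P + N * ((5 + 2 * l) * b₃) →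
    f ≤ s * b₂ + error → f + Q′ < P
  below {N} {s} {f} {P} {Q′} s<N g low h = linear {n = 0} []
      (f ∷ Q′ ∷ P ∷ (s * b₂) ∷ error ∷ (N * b₂) ∷ (N * ((5 + 2 * l) * b₃)) ∷ b₂ ∷ []) 0
      (lit 1 ⊕ (x0 ⊕ x1) ≼ x2) (x0 ≼ x3 ⊕ x4 ∵ h ∙ x5 ⊕ x1 ≼ x2 ⊕ x6 ∵ low ∙
      lit 1 ⊕ (x6 ⊕ x4) ≼ x7 ∵ gap-scaled N g ∙ x7 ⊕ x3 ≼ x5 ∵ *-monoˡ-≤ b₂ s<N ∙ [])

  -- A family with covering number at least t + 3 is smaller than the third bound.
  no-cover-below : ∀ {f} → f ≤ ((t + 3) C 3) * (q ^ 3 * b₃) → f < P₃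
  no-cover-below {f} h = linear {n = 0} []
      (f ∷ P₃ ∷ (((t + 3) C 3) * (q ^ 3 * b₃)) ∷ (N₃ * ((t + 3) * (r * b₃))) ∷ (N₃ * b₂) ∷
        (N₃ * ((5 + 2 * l) * b₃)) ∷ (N₃ * (1 + ((5 + 2 * l) * b₃ + (t + 3) * (r * b₃)))) ∷ N₃ ∷ t ∷
          [])
      2 (lit 1 ⊕ x0 ≼ x1) (3 ⟪ x0 ≼ x2 ∵ h ⟫ 3 ⟪ x2 ≼ x3 ∵ bound ⟫ 3 ⟪ x4 ≼ x1 ⊕ x5 ∵ lower₃ ⟫
      3 ⟪ x6 ≼ x4 ∵ *-monoʳ-≤ N₃ gap ⟫
      3 ⟪ x6 ≅˘ x7 ⊕ (x5 ⊕ x3) ∵ regroup N₃ ((5 + 2 * l) * b₃) ((t + 3) * (r * b₃)) ⟫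
      3 ⊛ x8 ≼ x7 ∵ ≤-trans 3t≤c c≤N₃ ∙ 3 ⟪ lit 1 ≼ x8 ∵ 1≤t ⟫ [])
    where
    regroup : ∀ a x y → a * (1 + (x + y)) ≡ a + (a * x + a * y)
    regroup = Ring.solve-∀
    regroup′ : ∀ x y z b → x * b + y * (z * b) ≡ (x + y * z) * b
    regroup′ = Ring.solve-∀
    C3≤ : (t + 3) C 3 ≤ (t + 3) * N₃
    C3≤ = begin
      (t + 3) C 3             ≤⟨ m≤n*m _ 3 ⟩
      3 * ((t + 3) C 3)       ≡⟨ cong (λ z → 3 * (z C 3)) (+-suc t 2) ⟩
      3 * (suc (t + 2) C 3)   ≡⟨ absorption (t + 2) 2 ⟩
      suc (t + 2) * c         ≡⟨ cong (_* c) (sym (+-suc t 2)) ⟩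
      (t + 3) * c             ≤⟨ *-monoʳ-≤ (t + 3) c≤N₃ ⟩
      (t + 3) * N₃            ∎
      where open ≤-Reasoning
    bound : ((t + 3) C 3) * (q ^ 3 * b₃) ≤ N₃ * ((t + 3) * (r * b₃))
    bound = ≤-trans (*-monoˡ-≤ (q ^ 3 * b₃) C3≤) (≤-reflexive
      (trans (cong (λ z → (t + 3) * N₃ * (z * b₃)) q³)
      (trans (cong (_* (r * b₃)) (*-comm (t + 3) N₃)) (*-assoc N₃ (t + 3) (r * b₃)))))
      where
      q³ : q ^ 3 ≡ r
      q³ = cong (λ z → q * (q * z)) (*-identityʳ q)
    gap : 1 + ((5 + 2 * l) * b₃ + (t + 3) * (r * b₃)) ≤ b₂
    gap = ≤-trans (s≤s (≤-reflexive (regroup′ (5 + 2 * l) (t + 3) r b₃)))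
      (scale (5 + 2 * l + (t + 3) * r)
      (linear {n = 0} []
          (((1 + l) * (5 + 2 * l + (t + 3) * r)) ∷ X ∷ ((1 + l) * (5 + 2 * l)) ∷
            ((1 + l) * ((t + 3) * r)) ∷ ((t + 3) * r) ∷ ((t + 3) * Q) ∷ (t * Q) ∷ Q ∷ (c * Q) ∷ t ∷
              ((c + (t + 2)) * Q) ∷ [])
          11 (lit 1 ⊕ x0 ≼ x1) (12 ⟪ x0 ≅ x2 ⊕ x3 ∵ *-distribˡ-+ (1 + l) (5 + 2 * l) ((t + 3) * r) ⟫
          12 ⟪ x3 ⊕ 3 ⊛ x4 ≅ x5 ∵ split-r (t + 3) ⟫ 12 ⟪ x5 ≅ x6 ⊕ 3 ⊛ x7 ∵ *-distribʳ-+ Q t 3 ⟫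
          8 ⟪ 3 ⊛ x7 ≼ x8 ∵ *-monoˡ-≤ Q (≤-trans (*-monoʳ-≤ 3 1≤t) 3t≤c) ⟫
          3 ⟪ 4 ⊛ (x9 ⊕ lit 3) ≼ x4 ∵ 4*≤ (t + 3) 4≤r ⟫ 12 ⟪ x2 ≼ x7 ∵ poly₄ ⟫
          12 ⟪ x10 ≼ x9 ⊕ (lit 2 ⊕ x1) ∵ big′ ⟫ 12 ⟪ x10 ≅˘ x8 ⊕ x6 ⊕ 2 ⊛ x7 ∵ expand ⟫ [])))

-- The values of f₁, f₂ and f₃

open import Data.Integer using (ℤ; +_; -_; _⊔_) renaming (_≤_ to _≤ℤ_)
import Data.Integer.Base as ℤ
import Data.Integer.Properties as ℤ
import Data.Integer.Tactic.RingSolver as Ringℤ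

private
  f+q-q : ∀ a q → (a ℤ.+ q) ℤ.- q ≡ a
  f+q-q = Ringℤ.solve-∀

≤-difference : ∀ {f p q} → f + q ≤ p → + f ℤ.≤ + p ℤ.- + q
≤-difference {f} {p} {q} h = subst (ℤ._≤ + p ℤ.- + q) (f+q-q (+ f) (+ q))
  (ℤ.+-monoˡ-≤ (- + q) (ℤ.+≤+ h))

<-difference : ∀ {f p q} → f + q < p → + f ℤ.< + p ℤ.- + q
<-difference {f} {p} {q} h = subst (ℤ._< + p ℤ.- + q) (f+q-q (+ f) (+ q))
  (ℤ.+-monoˡ-< (- + q) (ℤ.+<+ h))

private
  cancel : ∀ i j → (i ℤ.+ j) ℤ.- i ≡ j
  cancel = Ringℤ.solve-∀

  cancel₂ : ∀ i j x → (i ℤ.+ (j ℤ.+ x)) ℤ.- i ℤ.- j ≡ x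
  cancel₂ = Ringℤ.solve-∀

  shift : ∀ {a b c x} → a ≡ b + (c + x) → + a ℤ.- + b ℤ.- + c ≡ + x
  shift {b = b} {c} {x} refl = cancel₂ (+ b) (+ c) (+ x)

  last-top : ∀ T L W → (T ℤ.+ (+ 7 ℤ.+ (L ℤ.+ (L ℤ.+ + 0)) ℤ.+ W)) ℤ.- + 2 ℤ.* (T ℤ.+ (+ 3 ℤ.+ L))
    ℤ.+ T ℤ.- + 1 ≡ W
  last-top = Ringℤ.solve-∀

module Values (t l w : ℕ) (1≤t : 1 ≤ t) (big : ((t + 3) C 2) * (4 + l) ^ 4 ≤ t + (7 + 2 * l + w))
  where

  open Estimates t l w 1≤t big

  n₀ k : ℕ
  n₀ = t + (7 + 2 * l + w)
  k = t + (3 + l)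

  n-k : ∀ a x → 4 + l + w ≡ a + x → n₀ ≡ k + (a + x)
  n-k a x e = trans (equation {n = 0} [] (t ∷ l ∷ w ∷ []) (x0 ⊕ (lit 7 ⊕ 2 ⊛ x1 ⊕ x2))
      (x0 ⊕ (lit 3 ⊕ x1) ⊕ (lit 4 ⊕ x1 ⊕ x2)) 0 [] 0 []) (cong (λ z → k + z) e)

  -- `f₁` with the arguments of its binomials abstracted, so that all of them are replaced at once.
  shape₁ : (a b c d r : ℤ) → ℤ
  shape₁ a b c d r = binom a r ℤ.- + 3 ℤ.* binom b r ℤ.+ binom c r ℤ.+ binom d r ℤ.+ + 3

  shape₁-cong : ∀ {a a′ b b′ c c′ d d′ r r′} → a ≡ a′ → b ≡ b′ → c ≡ c′ → d ≡ d′ → r ≡ r′ →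
    shape₁ a b c d r ≡ shape₁ a′ b′ c′ d′ r′
  shape₁-cong refl refl refl refl refl = refl

  f₁≡ : f₁ (+ n₀) (+ k) (+ t) ≡ + P₁ ℤ.- + Q₁
  f₁≡ = trans (shape₁-cong {r′ = + (3 + l)} (cancel (+ t) (+ (7 + 2 * l + w)))
    (shift {n₀} {k} {1} {3 + l + w} (n-k 1 (3 + l + w) refl))
      (shift {n₀} {k} {2} {2 + l + w} (n-k 2 (2 + l + w) refl))
                (last-top (+ t) (+ l) (+ w)) (cancel (+ t) (+ (3 + l))))
    (trans (regroup (+ ((7 + 2 * l + w) C (3 + l))) (+ ((3 + l + w) C (3 + l)))
      (+ ((2 + l + w) C (3 + l))) (+ (w C (3 + l))))
      (cong (ℤ._-_ (+ P₁)) (sym (ℤ.pos-* 3 ((3 + l + w) C (3 + l))))))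
    where
    regroup : ∀ a b c d → a ℤ.- + 3 ℤ.* b ℤ.+ c ℤ.+ d ℤ.+ + 3 ≡ (a ℤ.+ c ℤ.+ d ℤ.+ + 3) ℤ.- + 3 ℤ.*
      b
    regroup = Ringℤ.solve-∀

  shape₂ : (a b r s : ℤ) → ℤ
  shape₂ a b r s = binom a r ℤ.+ (+ t ℤ.+ + 2) ℤ.* (binom a s ℤ.- binom b s) ℤ.+ binom (+ t ℤ.+ + 2)
    (+ 2)

  shape₂-cong : ∀ {a a′ b b′ r r′ s s′} → a ≡ a′ → b ≡ b′ → r ≡ r′ → s ≡ s′ →
    shape₂ a b r s ≡ shape₂ a′ b′ r′ s′
  shape₂-cong refl refl refl refl = refl

  f₂≡ : f₂ (+ n₀) (+ k) (+ t) ≡ + P₂ ℤ.- + Q₂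
  f₂≡ = trans (shape₂-cong {r′ = + (1 + l)} {s′ = + (2 + l)}
    (shift {b = t} {2} {5 + 2 * l + w} refl) (shift {n₀} {k} {2} {2 + l + w}
      (n-k 2 (2 + l + w) refl))
                (shift {b = t} {2} {1 + l} refl) (shift {b = t} {1} {2 + l} refl))
    (trans (regroup (+ b₂) (+ (t + 2)) (+ (X C (2 + l))) (+ ((2 + l + w) C (2 + l)))
      (+ ((t + 2) C 2)))
      (cong₂ (λ a b → + b₂ ℤ.+ a ℤ.+ + ((t + 2) C 2) ℤ.- b) (sym (ℤ.pos-* (t + 2) (X C (2 + l))))
        (sym (ℤ.pos-* (t + 2) ((2 + l + w) C (2 + l))))))
    where
    regroup : ∀ b u x y d → b ℤ.+ u ℤ.* (x ℤ.- y) ℤ.+ d ≡ b ℤ.+ u ℤ.* x ℤ.+ d ℤ.- u ℤ.* y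
    regroup = Ringℤ.solve-∀

  shape₃ : (a r s v : ℤ) → ℤ
  shape₃ a r s v = binom (+ t ℤ.+ + 4) (+ 2) ℤ.* binom a r ℤ.+ (+ t ℤ.+ + 4) ℤ.* binom a s ℤ.+ binom
    a v

  shape₃-cong : ∀ {a a′ r r′ s s′ v v′} → a ≡ a′ → r ≡ r′ → s ≡ s′ → v ≡ v′ →
    shape₃ a r s v ≡ shape₃ a′ r′ s′ v′
  shape₃-cong refl refl refl refl = refl

  k-t-4 : ∀ l → + (t + (3 + l)) ℤ.- + t ℤ.- + 4 ≡ + l ℤ.- + 1
  k-t-4 l = shape (+ t) (+ l)
    where
    shape : ∀ T L → (T ℤ.+ (+ 3 ℤ.+ L)) ℤ.- T ℤ.- + 4 ≡ L ℤ.- + 1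
    shape = Ringℤ.solve-∀

  -- For `l = 0` the lower index is -1 and both sides are 0.
  binom-top : ∀ l m → binom (+ m) (+ l ℤ.- + 1) ≡ + top l m
  binom-top zero    m = refl
  binom-top (suc l) m = refl

  f₃≡ : f₃ (+ n₀) (+ k) (+ t) ≡ + P₃
  f₃≡ = trans (shape₃-cong {r′ = + (1 + l)} {s′ = + l} (shift {b = t} {4} {3 + 2 * l + w} refl)
    (shift {b = t} {2} {1 + l} refl) (shift {b = t} {3} {l} refl) (k-t-4 l))
    (trans (cong (λ z → + ((t + 4) C 2) ℤ.* + (m C (1 + l)) ℤ.+ + (t + 4) ℤ.* + (m C l) ℤ.+ z)
      (binom-top l m))
      (cong₂ (λ a b → a ℤ.+ b ℤ.+ + top l m) (sym (ℤ.pos-* ((t + 4) C 2) (m C (1 + l))))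
        (sym (ℤ.pos-* (t + 4) (m C l)))))

-- Decrease of the bounds as the covering number grows

module Descent (t l w : ℕ) (1≤t : 1 ≤ t) (big : ((t + 3) C 2) * (4 + l) ^ 4 ≤ t + (7 + 2 * l + w))
  where

  open Estimates t l w 1≤t big

  private
    n₀ = t + (7 + 2 * l + w)

    t+ℓ≤ : t + ℓ ≤ (t + 2) * q
    t+ℓ≤ = linear {n = 0} [] (t ∷ l ∷ ((t + 2) * q) ∷ (t * q) ∷ []) 3 (x0 ⊕ (lit 3 ⊕ x1) ≼ x2)
        (2 ⟪ x2 ≅˘ x3 ⊕ 2 ⊛ (lit 4 ⊕ x1) ∵ *-distribʳ-+ q t 2 ⟫ 4 ⊛ x0 ≼ x3 ∵ 4*≤ t 4≤q ∙ [])

    cubic : (t + ℓ) * (ℓ * q) + (t + ℓ) ≤ n₀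
    cubic = begin
      (t + ℓ) * (ℓ * q) + (t + ℓ)     ≡⟨ regroup (t + ℓ) (ℓ * q) ⟩
      (t + ℓ) * (ℓ * q + 1)           ≤⟨ *-mono-≤ t+ℓ≤ poly₅ ⟩
      (t + 2) * q * (q * q)           ≡⟨ *-assoc (t + 2) q (q * q) ⟩
      (t + 2) * r                     ≤⟨ *-monoʳ-≤ (t + 2) (m≤n*m r q) ⟩
      (t + 2) * Q                     ≤⟨ *-monoˡ-≤ Q (m≤n+m (t + 2) c) ⟩
      (c + (t + 2)) * Q               ≤⟨ big′ ⟩
      t + (2 + X)                     ∎
      where
      open ≤-Reasoning
      regroup : ∀ a b → a * b + a ≡ a * (b + 1)
      regroup = Ring.solve-∀

  -- Passing to `suc i` multiplies the first two factors by at most `(t + ℓ) * q`. The last factor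
  -- shrinks by (m + 1)/(j + 1), where m + 1 is at least `(t + ℓ) * (ℓ * q)` and j + 1 is at most
  -- `ℓ`.
  descend : ∀ i j m → i + suc j ≡ ℓ → n₀ ≡ t + i + suc m →
            ((t + suc i) C suc i) * (q ^ suc i * (m C j)) ≤ ((t + i) C i) *
              (q ^ i * (suc m C suc j))
  descend i j m e e′ = begin
    ((t + suc i) C suc i) * (q ^ suc i * (m C j))
      ≤⟨ *-monoˡ-≤ (q ^ suc i * (m C j)) head ⟩
    ((t + ℓ) * a) * (q * q ^ i * (m C j))
      ≡⟨ regroup (t + ℓ) a q (q ^ i) (m C j) ⟩
    a * (q ^ i * ((t + ℓ) * (q * (m C j))))
      ≤⟨ *-monoʳ-≤ a (*-monoʳ-≤ (q ^ i) tail) ⟩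
    a * (q ^ i * (suc m C suc j)) ∎
    where
    open ≤-Reasoning
    a = (t + i) C i
    regroup : ∀ u a q p b → (u * a) * (q * p * b) ≡ a * (p * (u * (q * b)))
    regroup = Ring.solve-∀
    head : (t + suc i) C suc i ≤ (t + ℓ) * a
    head = begin
      (t + suc i) C suc i               ≡⟨ cong (_C suc i) (+-suc t i) ⟩
      suc (t + i) C suc i               ≤⟨ m≤n*m _ (suc i) ⟩
      suc i * (suc (t + i) C suc i)     ≡⟨ absorption (t + i) i ⟩
      suc (t + i) * a                   ≤⟨ *-monoˡ-≤ a (linear {n = 0} [] (t ∷ i ∷ ℓ ∷ j ∷ []) 0
          (lit 1 ⊕ (x0 ⊕ x1) ≼ x0 ⊕ x2) (x1 ⊕ (lit 1 ⊕ x3) ≅ x2 ∵ e ∙ [])) ⟩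
      (t + ℓ) * a                       ∎
    m-large : (t + ℓ) * (ℓ * q) ≤ suc m
    m-large = linear {n = 0} [] (((t + ℓ) * (ℓ * q)) ∷ m ∷ t ∷ ℓ ∷ n₀ ∷ i ∷ j ∷ []) 0
        (x0 ≼ lit 1 ⊕ x1) (x0 ⊕ (x2 ⊕ x3) ≼ x4 ∵ cubic ∙ x4 ≅ x2 ⊕ x5 ⊕ (lit 1 ⊕ x1) ∵ e′ ∙
        x5 ⊕ (lit 1 ⊕ x6) ≅ x3 ∵ e ∙ [])
    tail : (t + ℓ) * (q * (m C j)) ≤ suc m C suc j
    tail = *-cancelˡ-≤ ℓ (begin
      ℓ * ((t + ℓ) * (q * (m C j)))     ≡⟨ regroup′ ℓ (t + ℓ) q (m C j) ⟩
      (t + ℓ) * (ℓ * q) * (m C j)       ≤⟨ *-monoˡ-≤ (m C j) m-large ⟩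
      suc m * (m C j)                   ≡⟨ sym (absorption m j) ⟩
      suc j * (suc m C suc j)           ≤⟨ *-monoˡ-≤ (suc m C suc j) (linear {n = 0} []
          (j ∷ ℓ ∷ i ∷ []) 0 (lit 1 ⊕ x0 ≼ x1) (x2 ⊕ (lit 1 ⊕ x0) ≅ x1 ∵ e ∙ [])) ⟩
      ℓ * (suc m C suc j)               ∎)
      where
      regroup′ : ∀ a u q b → a * (u * (q * b)) ≡ u * (a * q) * b
      regroup′ = Ring.solve-∀

-- Extension to a maximal intersecting family

module Extension {n : ℕ} (t k : ℕ) where

  record Uniform-Intersecting : Set₁ where
    field
      𝔽     : Subset n → Set
      𝔽?    : Decidable 𝔽
      size  : ∀ F → 𝔽 F → ∣ F ∣ ≡ k
      meet  : ∀ F G → 𝔽 F → 𝔽 G → t ≤ ∣ F ∩ G ∣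
  open Uniform-Intersecting

  Compatible : Uniform-Intersecting → Subset n → Set
  Compatible 𝒢 X = ∀ F → 𝔽 𝒢 F → t ≤ ∣ X ∩ F ∣

  module _ (t≤k : t ≤ k) where

    insert : ∀ 𝒢 X → ∣ X ∣ ≡ k → Compatible 𝒢 X → Uniform-Intersecting
    insert 𝒢 X ∣X∣ c = record
      { 𝔽    = λ F → 𝔽 𝒢 F ⊎ F ≡ X
      ; 𝔽?   = λ F → 𝔽? 𝒢 F ⊎-dec (F ≟ˢ X)
      ; size = λ { F (inj₁ f) → size 𝒢 F f ; F (inj₂ refl) → ∣X∣ }
      ; meet = λ { F G (inj₁ f) (inj₁ g)       → meet 𝒢 F G f g
                 ; F G (inj₁ f) (inj₂ refl)    → (linear (F ∷ X ∷ []) (t ∷ []) 0 (x0 ≼ ∥ s0 ⋒ s1)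
                     (x0 ≼ ∥ s1 ⋒ s0 ∵ c F f ∙ []))
                 ; F G (inj₂ refl) (inj₁ g)    → c G g
                 ; F G (inj₂ refl) (inj₂ refl) → (linear (X ∷ []) (t ∷ k ∷ []) 0 (x0 ≼ ∥ s0 ⋒ s0)
                     (∥ s0 ≅˘ x1 ∵ ∣X∣ ∙ x0 ≼ x1 ∵ t≤k ∙ [])) }
      }

    -- Greedy: each set is inserted if it is compatible with the family so far. The family only
    -- grows, so a set rejected once stays incompatible.
    extend : ∀ (Xs : List (Subset n)) 𝒢 → ∃ λ ℋ → (∀ F → 𝔽 𝒢 F → 𝔽 ℋ F) ×
             (∀ X → X ∈ Xs → ∣ X ∣ ≡ k → Compatible ℋ X → 𝔽 ℋ X)
    extend []       𝒢 = 𝒢 , (λ _ → id) , λ X ()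
    extend (Y ∷ Xs) 𝒢 with ∣ Y ∣ ≟ k | ∀? (𝔽? 𝒢) (λ F → t ≤? ∣ Y ∩ F ∣)
    ... | yes e | inj₁ c =
      let ℋ , sub , max = extend Xs (insert 𝒢 Y e c)
      in ℋ , (λ F f → sub F (inj₁ f)) , λ { X (here refl) _ _ → sub X (inj₂ refl) ; X (there i) →
        max X i }
    ... | no ¬e | _ =
      let ℋ , sub , max = extend Xs 𝒢
      in ℋ , sub , λ { X (here refl) e _ → contradiction e ¬e ; X (there i) → max X i }
    ... | yes _ | inj₂ (F , f , ¬h) =
      let ℋ , sub , max = extend Xs 𝒢
      in ℋ , sub , λ { X (here refl) _ c → contradiction (c F (sub F f)) ¬h ; X (there i) →
        max X i }

-- From cardinalities back to the definitions of the three types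

⊑⇒⊆ : ∀ {n} (A B : Subset n) → A ⊑ B → A ⊆ B
⊑⇒⊆ (true ∷ A)  (true ∷ B)  h here      = here
⊑⇒⊆ (true ∷ A)  (false ∷ B) () here
⊑⇒⊆ (true ∷ A)  (true ∷ B)  h (there i) = there (⊑⇒⊆ A B h i)
⊑⇒⊆ (true ∷ A)  (false ∷ B) () (there i)
⊑⇒⊆ (false ∷ A) (true ∷ B)  h (there i) = there (⊑⇒⊆ A B h i)
⊑⇒⊆ (false ∷ A) (false ∷ B) h (there i) = there (⊑⇒⊆ A B h i)

⊆⇒⊑ : ∀ {n} (A B : Subset n) → A ⊆ B → A ⊑ B
⊆⇒⊑ []          []          h = z≤n
⊆⇒⊑ (true ∷ A)  (true ∷ B)  h = ⊆⇒⊑ A B (drop-∷-⊆ h)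
⊆⇒⊑ (false ∷ A) (true ∷ B)  h = ⊆⇒⊑ A B (drop-∷-⊆ h)
⊆⇒⊑ (false ∷ A) (false ∷ B) h = ⊆⇒⊑ A B (drop-∷-⊆ h)
⊆⇒⊑ (true ∷ A)  (false ∷ B) h with h here
... | ()

1≤⇒Nonempty : ∀ {n} (A : Subset n) → 1 ≤ ∣ A ∣ → Nonempty A
1≤⇒Nonempty (true ∷ A)  h = zero , here
1≤⇒Nonempty (false ∷ A) h = let i , j = 1≤⇒Nonempty A h in suc i , there j

Nonempty⇒1≤ : ∀ {n} (A : Subset n) → Nonempty A → 1 ≤ ∣ A ∣
Nonempty⇒1≤ (true ∷ A)  _                 = s≤s z≤n
Nonempty⇒1≤ (false ∷ A) (suc i , there j) = Nonempty⇒1≤ A (i , j)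

0⇒Empty : ∀ {n} (A : Subset n) → ∣ A ∣ ≤ 0 → Empty A
0⇒Empty A h ne = <⇒≱ (Nonempty⇒1≤ A ne) h

∣p∣≡0⇒p≡⊥ : ∀ {n} (p : Subset n) → ∣ p ∣ ≡ 0 → p ≡ ⊥
∣p∣≡0⇒p≡⊥ []          e = refl
∣p∣≡0⇒p≡⊥ (false ∷ p) e = cong (false ∷_) (∣p∣≡0⇒p≡⊥ p e)

singleton : ∀ {n} (p : Subset n) → ∣ p ∣ ≡ 1 → ∃ λ i → p ≡ ⁅ i ⁆
singleton (true ∷ p)  e = zero , cong (true ∷_) (∣p∣≡0⇒p≡⊥ p (suc-injective e))
singleton (false ∷ p) e = let i , h = singleton p e in suc i , cong (false ∷_) h

≡⇒⊑ : ∀ {n} {A B : Subset n} → A ≡ B → A ⊑ B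
≡⇒⊑ {A = A} refl = ⊑-refl A

module Translation {n : ℕ} (t ℓ : ℕ) (𝓕 : Family n) where

  private
    k = t + ℓ
    k∸t : k ∸ t ≡ ℓ
    k∸t = m+n∸m≡n t ℓ

  MembersI : (T A B C′ : Subset n) → Fin n → Subset n → Set
  MembersI T A B C′ i F =
      (∣ F ∣ ≡ k × F ∩ (A ∪ T) ≡ T × Nonempty (F ∩ B) × Nonempty (F ∩ C′))
    ⊎ (∣ F ∣ ≡ k × (A ∪ T) ⊆ F × Nonempty (F ∩ (B ∪ ⁅ i ⁆)))
    ⊎ (F ≡ A ∪ B ⊎ F ≡ A ∪ C′ ⊎ F ≡ (T ∩ A) ∪ B ∪ ⁅ i ⁆)

  MembersII : (M W : Subset n) → Subset n → Set
  MembersII M W F =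
      (∣ F ∣ ≡ k × W ⊆ F)
    ⊎ (∣ F ∣ ≡ k × ∣ F ∩ W ∣ ≡ t + 1 × Nonempty (F ∩ (M ─ W)))
    ⊎ (∣ F ∣ ≡ k × F ⊆ M × ∣ F ∩ W ∣ ≡ t)

  typeI : ∀ T A B C′ u → ∣ T ∣ ≡ t → (∣ A ∣ ≡ t × ∣ B ∣ ≡ ℓ × ∣ C′ ∣ ≡ ℓ × ∣ u ∣ ≡ 1 × 1 + ∣ T ∩ A ∣
    ≡ t) →
          (∣ T ∩ (B ∪ C′) ∣ ≤ 0 × ∣ A ∩ B ∣ ≤ 0 × ∣ A ∩ C′ ∣ ≤ 0 × ∣ B ∩ C′ ∣ ≤ 0 × u ⊑ C′) →
          (∀ F → F ∈ 𝓕 → FamilyI k t T A B C′ u F) → (∀ F → FamilyI k t T A B C′ u F → F ∈ 𝓕) →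
            TypeI k t 𝓕
  typeI T A B C′ u ∣T∣ (∣A∣ , ∣B∣ , ∣C′∣ , ∣u∣ , T∩A) (T-BC , A-B , A-C , B-C , u⊑C) to from with
    singleton u ∣u∣
  ... | i , refl = record
    { T = T ; A = A ; B = B ; C = C′ ; u = i ; ∣T∣≡t = ∣T∣ ; ∣A∣≡t = ∣A∣
    ; ∣B∣≡k-t = trans ∣B∣ (sym k∸t) ; ∣C∣≡k-t = trans ∣C′∣ (sym k∸t) ; ∣T∩A∣ = cong (_∸ 1) T∩A
    ; T∩[B∪C] = 0⇒Empty (T ∩ (B ∪ C′)) T-BC ; A∩B = 0⇒Empty (A ∩ B) A-B ; A∩C = 0⇒Empty (A ∩ C′) A-C
      ; B∩C = 0⇒Empty (B ∩ C′) B-C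
    ; u∈C = ⊑⇒⊆ ⁅ i ⁆ C′ u⊑C (x∈⁅x⁆ i)
    ; members = (λ {F} f → forth F (to F f)) , λ {F} h → from F (back F h)
    }
    where
    forth : ∀ F → FamilyI k t T A B C′ ⁅ i ⁆ F → MembersI T A B C′ i F
    forth F (inj₁ (e , (j , d) , b , c)) = inj₁ (e , ⊑-antisym (linear (F ∷ A ∷ T ∷ []) [] 0
        ((s0 ⋒ (s1 ⋓ s2)) ⋐ s2) (∥ s0 ⋒ (s1 ∖ s2) ≼ lit 0 ∵ d ∙ [])) (linear (T ∷ F ∷ A ∷ []) [] 0
        (s0 ⋐ (s1 ⋒ (s2 ⋓ s0))) (s0 ⋐ s1 ∵ j ∙ []))
      , 1≤⇒Nonempty (F ∩ B) b , 1≤⇒Nonempty (F ∩ C′) c)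
    forth F (inj₂ (inj₁ (e , j , b))) = inj₂ (inj₁ (e , ⊑⇒⊆ (A ∪ T) F j , 1≤⇒Nonempty
      (F ∩ (B ∪ ⁅ i ⁆)) b))
    forth F (inj₂ (inj₂ h)) = inj₂ (inj₂ h)
    back : ∀ F → MembersI T A B C′ i F → FamilyI k t T A B C′ ⁅ i ⁆ F
    back F (inj₁ (e , h , b , c)) = inj₁ (e , ((linear (T ∷ F ∷ A ∷ []) [] 0 (s0 ⋐ s1)
        (s0 ⋐ (s1 ⋒ (s2 ⋓ s0)) ∵ ≡⇒⊑ (sym h) ∙ [])) , (linear (F ∷ A ∷ T ∷ []) [] 0
        (∥ s0 ⋒ (s1 ∖ s2) ≼ lit 0) ((s0 ⋒ (s1 ⋓ s2)) ⋐ s2 ∵ ≡⇒⊑ h ∙ []))) ,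
      Nonempty⇒1≤ (F ∩ B) b , Nonempty⇒1≤ (F ∩ C′) c)
    back F (inj₂ (inj₁ (e , j , b))) = inj₂ (inj₁ (e , ⊆⇒⊑ (A ∪ T) F j , Nonempty⇒1≤
      (F ∩ (B ∪ ⁅ i ⁆)) b))
    back F (inj₂ (inj₂ h)) = inj₂ (inj₂ h)

  typeII : ∀ M W → ∣ M ∣ ≡ k + 2 → W ⊑ M → ∣ W ∣ ≡ t + 2 →
           (∀ F → F ∈ 𝓕 → FamilyII k t M W F) → (∀ F → FamilyII k t M W F → F ∈ 𝓕) → TypeII k t 𝓕
  typeII M W ∣M∣ W⊑M ∣W∣ to from = record
    { M = M ; W = W ; ∣M∣≡k+2 = ∣M∣ ; W⊆M = ⊑⇒⊆ W M W⊑M ; ∣W∣≡t+2 = ∣W∣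
    ; members = (λ {F} f → forth F (to F f)) , λ {F} h → from F (back F h)
    }
    where
    forth : ∀ F → FamilyII k t M W F → MembersII M W F
    forth F (inj₁ (e , j)) = inj₁ (e , ⊑⇒⊆ W F j)
    forth F (inj₂ (inj₁ (e , m , h))) = inj₂ (inj₁ (e , m , 1≤⇒Nonempty (F ∩ (M ─ W)) h))
    forth F (inj₂ (inj₂ (e , j , m))) = inj₂ (inj₂ (e , ⊑⇒⊆ F M j , m))
    back : ∀ F → MembersII M W F → FamilyII k t M W F
    back F (inj₁ (e , j)) = inj₁ (e , ⊆⇒⊑ W F j)
    back F (inj₂ (inj₁ (e , m , h))) = inj₂ (inj₁ (e , m , Nonempty⇒1≤ (F ∩ (M ─ W)) h))
    back F (inj₂ (inj₂ (e , j , m))) = inj₂ (inj₂ (e , ⊆⇒⊑ F M j , m))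

  typeIII : ∀ Z → ∣ Z ∣ ≡ t + 4 → (∀ F → F ∈ 𝓕 → FamilyIII k t Z F) →
    (∀ F → FamilyIII k t Z F → F ∈ 𝓕) → TypeIII k t 𝓕
  typeIII Z ∣Z∣ to from = record { Z = Z ; ∣Z∣≡t+4 = ∣Z∣ ; members = (λ {F} → to F) , λ {F} →
    from F }

-- The bound and the case of equality

module Main (t l w : ℕ) (1≤t : 1 ≤ t) (big : ((t + 3) C 2) * (4 + l) ^ 4 ≤ t + (7 + 2 * l + w))
  where

  open Estimates t l w 1≤t big
  open Values t l w 1≤t big using (f₁≡; f₂≡; f₃≡)

  private
    n₀ = t + (7 + 2 * l + w)
    k = t + (3 + l)

    room : (t + 2) + (t + ℓ) ≤ n₀
    room = linear {n = 0} [] (t ∷ l ∷ X ∷ ((c + (t + 2)) * Q) ∷ (c * Q) ∷ (t * Q) ∷ Q ∷ []) 11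
        (x0 ⊕ lit 2 ⊕ (x0 ⊕ (lit 3 ⊕ x1)) ≼ x0 ⊕ (lit 2 ⊕ x2)) (4 ⟪ x3 ≼ x0 ⊕ (lit 2 ⊕ x2) ∵ big′ ⟫
        4 ⟪ x3 ≅˘ x4 ⊕ x5 ⊕ 2 ⊛ x6 ∵ expand ⟫ 3 ⟪ 4 ⊛ (lit 4 ⊕ x1) ≼ x6 ∵ 4*≤ q 4≤r ⟫
        4 ⟪ 4 ⊛ x0 ≼ x5 ∵ 4*≤ t 4≤Q ⟫ [])

    F₁ F₂ F₃ : ℤ.ℤ
    F₁ = f₁ (+ n₀) (+ k) (+ t)
    F₂ = f₂ (+ n₀) (+ k) (+ t)
    F₃ = f₃ (+ n₀) (+ k) (+ t)

    bound : ℤ.ℤ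
    bound = F₁ ⊔ F₂ ⊔ F₃

    F₁≤ : F₁ ℤ.≤ bound
    F₁≤ = ℤ.≤-trans (ℤ.i≤i⊔j F₁ F₂) (ℤ.i≤i⊔j (F₁ ⊔ F₂) F₃)
    F₂≤ : F₂ ℤ.≤ bound
    F₂≤ = ℤ.≤-trans (ℤ.i≤j⊔i F₁ F₂) (ℤ.i≤i⊔j (F₁ ⊔ F₂) F₃)
    F₃≤ : F₃ ℤ.≤ bound
    F₃≤ = ℤ.i≤j⊔i (F₁ ⊔ F₂) F₃

  module _ (𝓕 : Family n₀) (unique : Unique 𝓕) (uniform : Uniform k 𝓕)
    (intersecting : Intersecting t 𝓕) (τ≥ : τ t 𝓕 ≥ t + 2) where

    _∈?_ : ∀ F (𝓖 : Family n₀) → Dec (F ∈ 𝓖)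
    F ∈? 𝓖 = any? (F ≟ˢ_) 𝓖

    length≤ : ∀ 𝓖 → Unique 𝓖 → length 𝓖 ≤ # (_∈? 𝓖)
    length≤ []      _       = z≤n
    length≤ (F ∷ 𝓖) (F∉ ∷ u) = ≤-trans (s≤s (length≤ 𝓖 u))
      (#-strict (_∈? 𝓖) (_∈? (F ∷ 𝓖)) (λ _ → there) F (here refl) (λ i → All.lookup F∉ i refl))

    large-covers : ∀ S → Cover t 𝓕 S → t + 2 ≤ ∣ S ∣
    large-covers S c = ≤-trans τ≥ (min≤v⁺ n₀ _ (inj₂ (lose
      (∈-map⁺ ∣_∣ (∈-filter⁺ (cover? t 𝓕) (∈-subsets S) c)) ≤-refl)))

    noCover𝓕 : ∀ X → ∣ X ∣ ≤ t + 1 → ∃ λ F → F ∈ 𝓕 × ∣ F ∩ X ∣ < t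
    noCover𝓕 X h =
      let F , i , ¬c = find (¬All⇒Any¬ (λ F → t ≤? ∣ X ∩ F ∣) 𝓕 (λ c → (impossible (linear (X ∷ [])
            (t ∷ []) 0 (lit 1 ≼ lit 0) (x0 ⊕ lit 2 ≼ ∥ s0 ∵ large-covers X c ∙
            ∥ s0 ≼ x0 ⊕ lit 1 ∵ h ∙ [])))))
      in F , i , (linear (F ∷ X ∷ []) (t ∷ []) 0 (lit 1 ⊕ ∥ s0 ⋒ s1 ≼ x0)
          (lit 1 ⊕ ∥ s1 ⋒ s0 ≼ x0 ∵ ≰⇒> ¬c ∙ []))

    open Extension {n₀} t k

    private
      start : Uniform-Intersecting
      start = record
        { 𝔽 = _∈ 𝓕 ; 𝔽? = _∈? 𝓕 ; size = λ F i → All.lookup uniform i ; meet = λ F G i j →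
          intersecting i j }

    module _ (ℋ : Uniform-Intersecting) (𝓕⊆ : ∀ F → F ∈ 𝓕 → Uniform-Intersecting.𝔽 ℋ F)
             (maximal : ∀ X → ∣ X ∣ ≡ k → Compatible ℋ X → Uniform-Intersecting.𝔽 ℋ X) where

      open Uniform-Intersecting ℋ renaming (size to size𝔽; meet to meet𝔽)

      noCover : ∀ X → ∣ X ∣ ≤ t + 1 → ∃ λ F → 𝔽 F × ∣ F ∩ X ∣ < t
      noCover X h = let F , i , d = noCover𝓕 X h in F , 𝓕⊆ F i , d

      open Classification t (3 + l) 1≤t (m≤m+n 3 l) room 𝔽? size𝔽 meet𝔽 maximal noCover
        using (𝒮; 𝒮?; Covers; covers?; classify; StructureI; StructureII; StructureIII; no-cover≤;
          level≤; level-step; no-small-cover; module WithCover)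

      -- `𝔽` is smaller than one of the three values, where f₁ is `P₁` minus `Q₁`, f₂ is `P₂` minus
      -- `Q₂` and f₃ is `P₃`.
      data Below : Set where
        first  : # 𝔽? + Q₁ < P₁ → Below
        second : # 𝔽? + Q₂ < P₂ → Below
        third  : # 𝔽? < P₃ → Below

      without-cover : ¬ ∃ 𝒮 → # 𝔽? < P₃
      without-cover ¬w = no-cover-below (≤-trans
          (no-cover≤ (λ i j m e e′ → level-step i j m {q} refl
            (Descent.descend t l w 1≤t big i j m e e′)) 3 l (4 + 2 * l + w) refl
            (equation {n = 0} [] (t ∷ l ∷ w ∷ []) (x0 ⊕ (lit 7 ⊕ 2 ⊛ x1 ⊕ x2))
                (x0 ⊕ lit 3 ⊕ (lit 4 ⊕ 2 ⊛ x1 ⊕ x2)) 0 [] 0 []) (linear {n = 0} [] (l ∷ w ∷ []) 0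
                (x0 ≼ lit 4 ⊕ 2 ⊛ x0 ⊕ x1) []) (no-small-cover ¬w))
          (level≤ 3 l (4 + 2 * l + w) {(t + 3) C 3} {q} {b₃} ≤-refl ≤-refl ≤-refl))

      upper : ∃ 𝒮 → # 𝔽? ≤ # 𝒮? * b₂ + error
      upper (H , s) = WithCover.upper≤ l (4 + 2 * l + w) refl (equation {n = 0} [] (t ∷ l ∷ w ∷ [])
          (x0 ⊕ (lit 7 ⊕ 2 ⊛ x1 ⊕ x2)) (x0 ⊕ lit 3 ⊕ (lit 4 ⊕ 2 ⊛ x1 ⊕ x2)) 0 [] 0 []) H s
        {b₂} {b₃} {c} {q} ≤-refl ≤-refl ≤-refl ≤-refl

      with-cover : ∃ 𝒮 → Small (# 𝒮?) → Below
      with-cover s (below₁ h) = first (below {N₁} {# 𝒮?} {# 𝔽?} {P₁} {Q₁} h gap₁ lower₁ (upper s))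
      with-cover s (below₂ h) = second (below {N₂} {# 𝒮?} {# 𝔽?} {P₂} {Q₂} h gap₂ lower₂ (upper s))
      with-cover s (below₃ h) = third (subst (_< P₃) (+-identityʳ (# 𝔽?))
        (below {N₃} {# 𝒮?} {# 𝔽?} {P₃} {0} h gap₃ (subst (_≤ P₃ + N₃ * ((5 + 2 * l) * b₃))
          (sym (+-identityʳ (N₃ * b₂))) lower₃) (upper s)))

      outcome : Dec (∃ 𝒮) → Below ⊎ StructureI ⊎ StructureII ⊎ StructureIII
      outcome (no ¬w) = inj₁ (third (without-cover ¬w))
      outcome (yes s) = [ (λ h → inj₁ (with-cover s h)) , inj₂ ]′ classify

      length≤𝔽 : length 𝓕 ≤ # 𝔽?
      length≤𝔽 = ≤-trans (length≤ 𝓕 unique) (#-mono (_∈? 𝓕) 𝔽? 𝓕⊆)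

      Claim : Set
      Claim = (+ length 𝓕 ℤ.≤ bound) × (+ length 𝓕 ≡ bound → TypeI k t 𝓕 ⊎ TypeII k t 𝓕
        ⊎ TypeIII k t 𝓕)

      strict : ∀ {f} → f ℤ.≤ bound → + # 𝔽? ℤ.< f → Claim
      strict f≤ h = ℤ.<⇒≤ lt , λ e → contradiction (sym e) (ℤ.<⇒≢ lt ∘ sym)
        where
        lt : + length 𝓕 ℤ.< bound
        lt = ℤ.≤-<-trans (ℤ.+≤+ length≤𝔽) (ℤ.<-≤-trans h f≤)

      -- `𝓕` lies in `𝔽` and hence in `Fam`, whose size is at most the bound. If `𝓕` attains the
      -- bound, a set of `Fam` outside `𝓕` would make `Fam` too large, so the two families coincide.
      tight : ∀ {f} {Fam : Subset n₀ → Set} (Fam? : Decidable Fam) → f ℤ.≤ bound → + # Fam? ℤ.≤ f →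
        (∀ F → 𝔽 F → Fam F) →
              ((∀ F → F ∈ 𝓕 → Fam F) → (∀ F → Fam F → F ∈ 𝓕) → TypeI k t 𝓕 ⊎ TypeII k t 𝓕
                ⊎ TypeIII k t 𝓕) → Claim
      tight {f} {Fam} Fam? f≤ h sub done = ℤ.≤-trans (ℤ.+≤+ length≤Fam) (ℤ.≤-trans h f≤) ,
        λ e → done 𝓕⊆Fam (λ F p → decidable-stable (F ∈? 𝓕) (λ ¬i → <⇒≱
          (≤-trans (s≤s (length≤ 𝓕 unique)) (#-strict (_∈? 𝓕) Fam? 𝓕⊆Fam F p ¬i))
          (ℤ.drop‿+≤+ (ℤ.≤-trans h (ℤ.≤-trans f≤ (ℤ.≤-reflexive (sym e)))))))
        where
        𝓕⊆Fam : ∀ F → F ∈ 𝓕 → Fam F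
        𝓕⊆Fam F i = sub F (𝓕⊆ F i)
        length≤Fam : length 𝓕 ≤ # Fam?
        length≤Fam = ≤-trans (length≤ 𝓕 unique) (#-mono (_∈? 𝓕) Fam? 𝓕⊆Fam)

      private
        module N = Counts t l w refl
        module T = Translation {n₀} t (3 + l) 𝓕

      conclude : Below ⊎ StructureI ⊎ StructureII ⊎ StructureIII → Claim
      conclude (inj₁ (first h)) = strict F₁≤ (subst (+ # 𝔽? ℤ.<_) (sym f₁≡) (<-difference h))
      conclude (inj₁ (second h)) = strict F₂≤ (subst (+ # 𝔽? ℤ.<_) (sym f₂≡) (<-difference h))
      conclude (inj₁ (third h)) = strict F₃≤ (subst (+ # 𝔽? ℤ.<_) (sym f₃≡) (ℤ.+<+ h))
      conclude (inj₂ (inj₁ (T , ∣T∣ , A , B , C′ , u , (∣A∣ , ∣B∣ , ∣C′∣ , ∣u∣ , T∩A) ,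
        (T-BC , A-B , A-C , B-C , u⊑C) , sub))) =
        tight Fam.Family? F₁≤ (subst (+ # Fam.Family? ℤ.≤_) (sym f₁≡) (≤-difference Fam.count)) sub
          (λ to from → inj₁ (T.typeI T A B C′ u ∣T∣ (∣A∣ , ∣B∣ , ∣C′∣ , ∣u∣ , T∩A)
            (T-BC , A-B , A-C , B-C , u⊑C) to from))
        where module Fam = N.I T A B C′ u ∣T∣ ∣A∣ ∣B∣ ∣C′∣ ∣u∣ T∩A T-BC A-B A-C B-C u⊑C
      conclude (inj₂ (inj₂ (inj₁ (M , W , ∣M∣ , W⊑M , ∣W∣ , sub)))) =
        tight Fam.Family? F₂≤ (subst (+ # Fam.Family? ℤ.≤_) (sym f₂≡) (≤-difference Fam.count)) sub
          (λ to from → inj₂ (inj₁ (T.typeII M W ∣M∣ W⊑M ∣W∣ to from)))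
        where module Fam = N.II M W ∣M∣ W⊑M ∣W∣
      conclude (inj₂ (inj₂ (inj₂ (Z , ∣Z∣ , sub)))) =
        tight Fam.Family? F₃≤ (subst (+ # Fam.Family? ℤ.≤_) (sym f₃≡) (ℤ.+≤+ Fam.count)) sub
          (λ to from → inj₂ (inj₂ (T.typeIII Z ∣Z∣ to from)))
        where module Fam = N.III Z ∣Z∣

      claim : Claim
      claim = conclude (outcome (∃? 𝒮?))

    main : (+ length 𝓕 ℤ.≤ bound) × (+ length 𝓕 ≡ bound → TypeI k t 𝓕 ⊎ TypeII k t 𝓕
      ⊎ TypeIII k t 𝓕)
    main = let ℋ , sub , max = extend (m≤m+n t (3 + l)) (subsets n₀) start
           in claim ℋ sub (λ X → max X (∈-subsets X))

-- Makes the subtraction that defines `w` exact.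
room-for-w : ∀ {n} t l → ((t + 3) C 2) * (4 + l) ^ 4 ≤ n → t + (7 + 2 * l) ≤ n
room-for-w {n} t l big = linear {n = 0} [] (t ∷ l ∷ n ∷ ((t + 2) * Q) ∷ (t * Q) ∷ Q ∷ []) 3
    (x0 ⊕ (lit 7 ⊕ 2 ⊛ x1) ≼ x2) (x3 ≼ x2 ∵ lower ∙ x3 ≅˘ x4 ⊕ 2 ⊛ x5 ∵ *-distribʳ-+ Q t 2 ∙
    4 ⊛ x0 ≼ x4 ∵ 4*≤ t 4≤Q ∙ 2 ⟪ 4 ⊛ (lit 4 ⊕ x1) ≼ x5 ∵ 4*≤ q 4≤r ⟫ [])
  where
  open Polynomials l
  lower : (t + 2) * Q ≤ n
  lower = begin
    (t + 2) * Q                    ≤⟨ *-monoˡ-≤ Q (m≤m+n (t + 2) ((t + 2) C 2)) ⟩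
    (t + 2 + (t + 2) C 2) * Q      ≡⟨ cong₂ _*_ (sym (trans (cong (_C 2) (+-suc t 2))
      (C2-suc (t + 2)))) (sym q⁴) ⟩
    ((t + 3) C 2) * (4 + l) ^ 4    ≤⟨ big ⟩
    n                              ∎
    where open ≤-Reasoning

-- Here `n` and `k` are still variables, so the two equations can be matched with `refl`; from then
-- on both are sums in `t`, `l` and `w`.
reparametrised : ∀ {n k} t l w → k ≡ t + (3 + l) → n ≡ t + (7 + 2 * l + w) → 1 ≤ t →
  ((t + 3) C 2) * (4 + l) ^ 4 ≤ n →
  (𝓕 : Family n) → Unique 𝓕 → Uniform k 𝓕 →
  Intersecting t 𝓕 →
  τ t 𝓕 ≥ t + 2 →
  let bound = f₁ (+ n) (+ k) (+ t) ⊔ f₂ (+ n) (+ k) (+ t) ⊔ f₃ (+ n) (+ k) (+ t) in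
  (+ length 𝓕 ≤ℤ bound) ×
  (+ length 𝓕 ≡ bound → TypeI k t 𝓕 ⊎ TypeII k t 𝓕 ⊎ TypeIII k t 𝓕)
reparametrised t l w refl refl 1≤t big = Main.main t l w 1≤t big

theorem1p1 : ∀ (n k t : ℕ) → 1 ≤ n → 1 ≤ k → 1 ≤ t →
    k ≥ t + 3 →
    n ≥ ((t + 3) C 2) * (k ∸ t + 1) ^ 4 →
    (𝓕 : Family n) → Unique 𝓕 → Uniform k 𝓕 →
    Intersecting t 𝓕 →
    τ t 𝓕 ≥ t + 2 →
    let bound = f₁ (+ n) (+ k) (+ t) ⊔ f₂ (+ n) (+ k) (+ t) ⊔ f₃ (+ n) (+ k) (+ t) in
    (+ length 𝓕 ≤ℤ bound) ×
    (+ length 𝓕 ≡ bound → TypeI k t 𝓕 ⊎ TypeII k t 𝓕 ⊎ TypeIII k t 𝓕)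
theorem1p1 n k t _ _ 1≤t k≥t+3 n≥ = reparametrised t l w k≡ n≡ 1≤t big
  where
  l w : ℕ
  -- Both differences are exact: the first by `k≥t+3`, the second by `room-for-w`.
  l = k ∸ (t + 3)
  w = n ∸ (t + (7 + 2 * l))
  k≡ : k ≡ t + (3 + l)
  k≡ = trans (sym (m+[n∸m]≡n k≥t+3)) (+-assoc t 3 l)
  k∸t+1 : k ∸ t + 1 ≡ 4 + l
  k∸t+1 = trans (cong (λ k → k ∸ t + 1) k≡) (trans (cong (_+ 1) (m+n∸m≡n t (3 + l)))
    (+-comm (3 + l) 1))
  big : ((t + 3) C 2) * (4 + l) ^ 4 ≤ n
  big = ≤-trans (≤-reflexive (cong (λ q → ((t + 3) C 2) * q ^ 4) (sym k∸t+1))) n≥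
  n≡ : n ≡ t + (7 + 2 * l + w)
  n≡ = trans (sym (m+[n∸m]≡n (room-for-w t l big))) (+-assoc t (7 + 2 * l) w)
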